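{- Let $(G,\mathcal{B},\mathcal{L},\mathcal{F})$ be a quasi-biased graph such that $|V(G)|>6$ and every connected component of $G$ has at least two vertices, and suppose the quasi-graphic matroid $M=M(G,\mathcal{B},\mathcal{L},\mathcal{F})$ is $3$-connected and unbreakable. Then either $\mathrm{si}(G)$ is a cycle and $M$ is lifted-graphic, or $\mathrm{si}(G)$ can be obtained from a complete graph by deleting the edges of a path of length at most two.
   Context: Graphs are finite and may have loops and parallel edges; a cycle may be a loop (1-cycle) or a 2-cycle. A theta graph consists of two vertices joined by three internally vertex-disjoint paths. A quasi-biased graph $(G,\mathcal{B},\mathcal{L},\mathcal{F})$ consists of a graph $G$ and a partition $(\mathcal{B},\mathcal{L},\mathcal{F})$ of the set of cycles of $G$ such that no theta subgraph of $G$ contains exactly two cycles of $\mathcal{B}$, and every cycle in $\mathcal{L}$ shares a vertex with every cycle in $\mathcal{F}$. Cycles in $\mathcal{B}$ are balanced, others unbalanced. A tight handcuff is two edge-disjoint cycles sharing exactly one vertex; a loose handcuff is two vertex-disjoint cycles together with a minimal path joining them. $M(G,\mathcal{B},\mathcal{L},\mathcal{F})$ is the matroid on $E(G)$ whose circuits are: cycles in $\mathcal{B}$; theta subgraphs containing no cycle of $\mathcal{B}$; tight handcuffs with neither cycle in $\mathcal{B}$; unions of two vertex-disjoint cycles of $\mathcal{L}$; loose handcuffs with both cycles in $\mathcal{F}$. For a biased graph $(G,\mathcal{B})$ (i.e. $\mathcal{B}$ a set of cycles satisfying the theta condition above), its lift matroid is $M(G,\mathcal{B},\mathcal{C}\setminus\mathcal{B},\varnothing)$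 where $\mathcal{C}$ is the set of all cycles; a matroid is lifted-graphic if it is isomorphic to the lift matroid of some biased graph. A matroid $M$ is unbreakable if it is connected and $M/F$ is connected for every flat $F$ of $M$. $\mathrm{si}(G)$ denotes the simplification of $G$ (delete all loops and all but one edge of each parallel class). -}

module Defs where

open import Level using (0ℓ)
open import Data.Nat using (ℕ; zero; suc; _+_; _<_; _≤_)
open import Data.Nat.DivMod using (_%_; m%n<n)
open import Data.Fin using (Fin; zero; suc; toℕ; fromℕ<; fromℕ; inject₁)
open import Data.Fin.Subset using (Subset; _∈_; _∉_; _⊆_; _∪_; _∩_; ∁; ⁅_⁆; Nonempty; ∣_∣; ⊤)
open import Data.Vec using (tabulate; lookup)
open import Data.Product using (Σ; ∃; ∃-syntax; _×_; _,_; proj₁; proj₂)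
open import Data.Sum using (_⊎_)
open import Data.Empty using (⊥)
open import Relation.Nullary using (¬_)
open import Relation.Binary.PropositionalEquality using (_≡_; _≢_)
open import Function.Bundles using (_⇔_; _↔_; Inverse)
open import Function.Definitions using (Injective)

-- Graphs: vertices Fin n, edges Fin m, each edge has two (unordered)
-- ends; loops (equal ends) and parallel edges are allowed.

Graph : ℕ → ℕ → Set
Graph n m = Fin m → Fin n × Fin n

next : ∀ {k} → Fin (suc k) → Fin (suc k)
next {k} i = fromℕ< (m%n<n (suc (toℕ i)) (suc k))

Disjoint : ∀ {m} → Subset m → Subset m → Set
Disjoint X Y = ∀ e → e ∈ X → e ∈ Y → ⊥

ExactlyTwo : Set → Set → Set → Set
ExactlyTwo P Q R = (P × Q × ¬ R) ⊎ (P × ¬ Q × R) ⊎ (¬ P × Q × R)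

PairEq : ∀ {n} → Fin n → Fin n → Fin n → Fin n → Set
PairEq u v a b = (u ≡ a × v ≡ b) ⊎ (u ≡ b × v ≡ a)

module _ {n m : ℕ} (G : Graph n m) where

  Joins : Fin m → Fin n → Fin n → Set
  Joins e x y = (G e ≡ (x , y)) ⊎ (G e ≡ (y , x))

  IncidentTo : Fin m → Fin n → Set
  IncidentTo e v = (proj₁ (G e) ≡ v) ⊎ (proj₂ (G e) ≡ v)

  VertexOf : Subset m → Fin n → Set
  VertexOf X v = ∃[ e ] (e ∈ X × IncidentTo e v)

  -- C is (the edge set of) a cycle: a closed walk v₀ e₀ v₁ … vₖ eₖ v₀ with
  -- distinct vertices and distinct edges (k = 0: loop, k = 1: 2-cycle)
  IsCycle : Subset m → Set
  IsCycle C = ∃[ k ] Σ (Fin (suc k) → Fin n) λ v → Σ (Fin (suc k) → Fin m) λ e →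
    Injective _≡_ _≡_ v × Injective _≡_ _≡_ e ×
    (∀ i → Joins (e i) (v i) (v (next i))) ×
    (∀ x → (x ∈ C) ⇔ (∃[ i ] e i ≡ x))

  -- a path of length suc len from x to y
  record Path (x y : Fin n) : Set where
    field
      len : ℕ
      vtx : Fin (suc (suc len)) → Fin n
      edg : Fin (suc len) → Fin m
      vtx-inj : Injective _≡_ _≡_ vtx
      start : vtx zero ≡ x
      end : vtx (fromℕ (suc len)) ≡ y
      joins : ∀ i → Joins (edg i) (vtx (inject₁ i)) (vtx (suc i))

  EdgesOf : ∀ {x y} → Path x y → Subset m → Set
  EdgesOf p X = ∀ e → (e ∈ X) ⇔ (∃[ i ] Path.edg p i ≡ e)

  InternalVertex : ∀ {x y} → Path x y → Fin n → Set
  InternalVertex p z = ∃[ j ] (Path.vtx p j ≡ z × j ≢ zero × j ≢ fromℕ (suc (Path.len p)))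

  InternallyDisjoint : ∀ {x y} → Path x y → Path x y → Set
  InternallyDisjoint p q = ∀ z → InternalVertex p z → InternalVertex q z → ⊥

  -- P1, P2, P3 are the edge sets of three internally vertex-disjoint
  -- (and edge-disjoint) paths joining two distinct vertices; the theta
  -- subgraph is P1 ∪ P2 ∪ P3 and its cycles are P1∪P2, P1∪P3, P2∪P3.
  ThetaRep : Subset m → Subset m → Subset m → Set
  ThetaRep P1 P2 P3 = ∃[ x ] ∃[ y ] (x ≢ y ×
    Σ (Path x y) λ p1 → Σ (Path x y) λ p2 → Σ (Path x y) λ p3 →
    EdgesOf p1 P1 × EdgesOf p2 P2 × EdgesOf p3 P3 ×
    InternallyDisjoint p1 p2 × InternallyDisjoint p1 p3 × InternallyDisjoint p2 p3 ×
    Disjoint P1 P2 × Disjoint P1 P3 × Disjoint P2 P3)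

  ThetaProperty : (Subset m → Set) → Set
  ThetaProperty B = ∀ P1 P2 P3 → ThetaRep P1 P2 P3 →
    ¬ ExactlyTwo (B (P1 ∪ P2)) (B (P1 ∪ P3)) (B (P2 ∪ P3))

  VertexDisjoint : Subset m → Subset m → Set
  VertexDisjoint X Y = ∀ v → VertexOf X v → VertexOf Y v → ⊥

  record IsBiased (B : Subset m → Set) : Set where
    field
      B-cycles : ∀ X → B X → IsCycle X
      theta : ThetaProperty B

  record IsQuasiBiased (B L F : Subset m → Set) : Set where
    field
      only-cycles : ∀ X → (B X ⊎ L X ⊎ F X) → IsCycle X
      cover : ∀ C → IsCycle C → B C ⊎ L C ⊎ F C
      BL-disj : ∀ C → B C → L C → ⊥
      BF-disj : ∀ C → B C → F C → ⊥
      LF-disj : ∀ C → L C → F C → ⊥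
      theta : ThetaProperty B
      LF-meet : ∀ C D → L C → F D → ∃[ v ] (VertexOf C v × VertexOf D v)

  MCircuit : (B L F : Subset m → Set) → Subset m → Set
  MCircuit B L F X =
    B X
    ⊎ (∃[ P1 ] ∃[ P2 ] ∃[ P3 ] (ThetaRep P1 P2 P3 × X ≡ (P1 ∪ P2) ∪ P3 ×
         ¬ B (P1 ∪ P2) × ¬ B (P1 ∪ P3) × ¬ B (P2 ∪ P3)))
    ⊎ (∃[ C1 ] ∃[ C2 ] (IsCycle C1 × IsCycle C2 × Disjoint C1 C2 ×
         (∃[ u ] (VertexOf C1 u × VertexOf C2 u ×
                  (∀ w → VertexOf C1 w → VertexOf C2 w → w ≡ u))) ×
         ¬ B C1 × ¬ B C2 × X ≡ C1 ∪ C2))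
    ⊎ (∃[ C1 ] ∃[ C2 ] (L C1 × L C2 × VertexDisjoint C1 C2 × X ≡ C1 ∪ C2))
    ⊎ (∃[ C1 ] ∃[ C2 ] ∃[ x ] ∃[ y ] Σ (Path x y) λ p → ∃[ P ] (
         F C1 × F C2 × VertexDisjoint C1 C2 × EdgesOf p P ×
         VertexOf C1 x × VertexOf C2 y ×
         (∀ j → VertexOf C1 (Path.vtx p j) → j ≡ zero) ×
         (∀ j → VertexOf C2 (Path.vtx p j) → j ≡ fromℕ (suc (Path.len p))) ×
         X ≡ (C1 ∪ C2) ∪ P))

  LiftCircuit : (B : Subset m → Set) → Subset m → Set
  LiftCircuit B = MCircuit B (λ X → IsCycle X × ¬ B X) (λ _ → ⊥)

  SiAdj : Fin n → Fin n → Set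
  SiAdj u v = u ≢ v × ∃[ e ] Joins e u v

  SiIsCycle : Set
  SiIsCycle = ∃[ k ] Σ (Fin (suc k) → Fin n) λ c →
    Injective _≡_ _≡_ c × (∀ v → ∃[ i ] c i ≡ v) ×
    (∀ i j → SiAdj (c i) (c j) ⇔ ((j ≡ next i) ⊎ (i ≡ next j)))

  SiCompleteMinusShortPath : Set
  SiCompleteMinusShortPath = ∃[ k ] (k ≤ 2 × Σ (Fin (suc k) → Fin n) λ p →
    Injective _≡_ _≡_ p ×
    (∀ u v → SiAdj u v ⇔ (u ≢ v × ¬ (∃[ i ] PairEq u v (p (inject₁ i)) (p (suc i))))))

-- Matroid notions for a matroid on ground set Fin m given by its
-- circuit predicate.

module _ {m : ℕ} (Circ : Subset m → Set) where

  Indep : Subset m → Set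
  Indep I = ∀ C → Circ C → C ⊆ I → ⊥

  IsRank : Subset m → ℕ → Set
  IsRank X r = (∃[ I ] (I ⊆ X × Indep I × ∣ I ∣ ≡ r)) ×
               (∀ I → I ⊆ X → Indep I → ∣ I ∣ ≤ r)

  -- (X, E − X) is a k-separation: |X|,|E−X| ≥ k, r(X)+r(E−X)−r(M) ≤ k−1
  Separation : ℕ → Set
  Separation k = ∃[ X ] (k ≤ ∣ X ∣ × k ≤ ∣ ∁ X ∣ ×
    ∃[ a ] ∃[ b ] ∃[ c ] (IsRank X a × IsRank (∁ X) b × IsRank ⊤ c × a + b < k + c))

  ThreeConnected : Set
  ThreeConnected = ¬ Separation 1 × ¬ Separation 2

  ConnectedOn : Subset m → Set
  ConnectedOn S = ∀ e f → e ∈ S → f ∈ S → e ≢ f → ∃[ C ] (Circ C × e ∈ C × f ∈ C)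

  Connected : Set
  Connected = ConnectedOn ⊤

  IsFlat : Subset m → Set
  IsFlat Fl = ∀ e C → e ∉ Fl → Circ C → e ∈ C → C ⊆ Fl ∪ ⁅ e ⁆ → ⊥

  ContractCandidate : Subset m → Subset m → Set
  ContractCandidate Fl D = Nonempty D × ∃[ C ] (Circ C × D ≡ C ∩ ∁ Fl)

  ContractCircuit : Subset m → Subset m → Set
  ContractCircuit Fl D = ContractCandidate Fl D ×
    (∀ D' → ContractCandidate Fl D' → D' ⊆ D → D' ≡ D)

  Unbreakable : Set
  Unbreakable = Connected × (∀ Fl → IsFlat Fl → ConnectedOn' Fl)
    where
    ConnectedOn' : Subset m → Set
    ConnectedOn' Fl = ∀ e f → e ∈ ∁ Fl → f ∈ ∁ Fl → e ≢ f →
      ∃[ D ] (ContractCircuit Fl D × e ∈ D × f ∈ D)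

preimage : ∀ {m m'} → (Fin m → Fin m') → Subset m' → Subset m
preimage f D = tabulate (λ i → lookup D (f i))

Isomorphic : ∀ {m m'} → (Subset m → Set) → (Subset m' → Set) → Set
Isomorphic {m} {m'} Circ Circ' = Σ (Fin m ↔ Fin m') λ φ →
  ∀ D → Circ' D ⇔ Circ (preimage (Inverse.to φ) D)

LiftedGraphic : ∀ {m} → (Subset m → Set) → Set₁
LiftedGraphic {m} Circ = ∃[ n' ] ∃[ m' ] Σ (Graph n' m') λ G' →
  Σ (Subset m' → Set) λ B' → IsBiased G' B' × Isomorphic Circ (LiftCircuit G' B')

{-# OPTIONS --safe #-}
module Submission where

-- Contracting a suitable flat must not split off a parallel class of edges at one vertex.
-- Applied to the edge set of G − {a,b} for non-adjacent a and b with G − {a,b} connected, this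
-- shows that G − {a,b} is balanced while G − a and G − b are not; applied to the balanced
-- closure of G − {a,b,x} plus one edge at a and one at b, it shows that the edges at a further
-- vertex x cannot all agree with that closure.
--
-- 3-connectivity makes G 2-connected and both sides of every 2-vertex cut unbalanced.  If G has a
-- 2-vertex cut {u,v}, these facts force every other vertex to separate u from v on its own side, so
-- both sides are paths and si(G) is a cycle.  In that case two disjoint cycles of F would leave,
-- after deleting two vertices, two arcs that both contain cycles of F, which breaks M; hence M is
-- the lift matroid of (G,B).
--
-- If there is no 2-vertex cut, every unbalanced cycle meets every non-edge of si(G).  A smallest
-- unbalanced cycle C has no chords and its complement is a clique.  Length at least four is
-- impossible because n > 6, and for length at most three two disjoint non-edges, three non-edges
-- forming a triangle, or three non-edges at one vertex all contradict the facts above.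

open import Defs
open import Data.Nat using (ℕ; zero; suc; _+_; _^_; _<_; _≤_; s≤s; z≤n)
import Data.Nat.Properties as ℕₚ
open import Data.Nat.DivMod using (_%_; m<n⇒m%n≡m; n%n≡0)
open import Data.Fin using (Fin; zero; suc; toℕ; fromℕ; fromℕ<; inject₁; finToFun; funToFin)
import Data.Fin.Properties as Finₚ
open import Data.Fin.Induction using (<-weakInduction; <-weakInduction-startingFrom)
open import Data.Fin.Relation.Unary.Top using (view; ‵fromℕ; ‵inj₁)
open import Data.Fin.Subset using (Subset; inside; outside; _∈_; _∉_; _⊆_; _∪_; _∩_; ∁; ∣_∣; ⁅_⁆) renaming (⊥ to ∅)
open import Data.Fin.Subset.Properties using (_∈?_; ∉⊥; ∈⊤; x∈⁅x⁆; x∈⁅y⁆⇒x≡y; x∈p∪q⁻; x∈p∪q⁺; ∪-comm; x∈p∩q⁻; x∈p∩q⁺; x∈∁p⇒x∉p; x∉p⇒x∈∁p; p⊂q⇒∣p∣<∣q∣; p⊆q⇒∣p∣≤∣q∣; ∣⁅x⁆∣≡1; ∣⊥∣≡0; ∣p∣≤n; ⊆⊤; ⊆-antisym)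
open import Data.List using (List; []; _∷_; length; lookup)
open import Data.List.Membership.Propositional using () renaming (_∈_ to _∈ˡ_; _∉_ to _∉ˡ_)
import Data.List.Membership.DecPropositional as DecMem
open import Data.List.Relation.Unary.Any using (here; there; index)
open import Data.List.Relation.Unary.Any.Properties using (lookup-index)
open import Data.Vec using ([]; _∷_; tabulate)
open import Data.Vec.Properties using (lookup∘tabulate; tabulate∘lookup; lookup⇒[]=; []=⇒lookup)
open import Data.Product using (Σ; ∃-syntax; _×_; _,_; proj₁; proj₂)
open import Data.Product.Properties using (≡-dec)
open import Data.Sum using (_⊎_; inj₁; inj₂; swap; [_,_]′) renaming (map to ⊎-map)
open import Data.Unit using (⊤; tt)
open import Data.Empty using (⊥; ⊥-elim)
open import Relation.Nullary using (¬_; Dec; yes; no)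
open import Relation.Nullary.Decidable using (_⊎-dec_; _×-dec_; _→-dec_; map′; ¬?; does; dec-true; decidable-stable)
open import Relation.Binary.PropositionalEquality using (_≡_; _≢_; refl; sym; trans; cong; subst; subst₂)
open import Function.Bundles using (_⇔_; mk⇔; Equivalence)
open import Function.Construct.Identity using (↔-id)
open import Function using (_∘_)

open Equivalence using (to; from)

-- A parallel class is fatal for this reason: some circuit of the contraction would pass through a
-- member `e` of the class and an element `f` outside it; that circuit contains a second member
-- `e'`, and the dependent pair of `e` and `e'` contradicts its minimality. The obstacle is that M
-- treats L and F differently: two disjoint cycles of L are dependent by themselves, two of F only
-- together with a path. Hence contracting G - {a,b} splits according to whether a cycle of L lies
-- in it. Once G - {a,b} is known to be balanced, the later contractions need only balanced cycles
-- as witnesses. The bound n > 6 is room for one vertex besides six named ones. In the cut case the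
-- count leaves exactly seven vertices, and the last arc argument needs two vertices carrying a
-- cycle, two deleted ones and three more. Ranks, flats and components exist only under double
-- negation, while the conclusion is a disjunction that has to be decided. This works because the
-- partition decides whether a cycle is in `B`, and because the final split is on finite
-- configurations of non-edges, not on the existence of a cut.

next-inject₁ : ∀ {k} (i : Fin k) → next (inject₁ i) ≡ suc i
next-inject₁ {k} i = Finₚ.toℕ-injective
  (trans (Finₚ.toℕ-fromℕ< _)
  (trans (cong (λ t → suc t % suc k) (Finₚ.toℕ-inject₁ i))
         (m<n⇒m%n≡m (s≤s (Finₚ.toℕ<n i)))))

next-fromℕ : ∀ k → next (fromℕ k) ≡ zero
next-fromℕ k = Finₚ.toℕ-injective
  (trans (Finₚ.toℕ-fromℕ< _)
  (trans (cong (λ t → suc t % suc k) (Finₚ.toℕ-fromℕ k)) (n%n≡0 (suc k))))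

prev : ∀ {k} → Fin (suc k) → Fin (suc k)
prev zero = fromℕ _
prev (suc i) = inject₁ i

next-prev : ∀ {k} (i : Fin (suc k)) → next (prev i) ≡ i
next-prev zero = next-fromℕ _
next-prev (suc i) = next-inject₁ i

prev-next : ∀ {k} (i : Fin (suc k)) → prev (next i) ≡ i
prev-next i with view i
... | ‵fromℕ {k} = cong prev (next-fromℕ k)
... | ‵inj₁ {i = j} _ = cong prev (next-inject₁ j)

next-injective : ∀ {k} {i j : Fin (suc k)} → next i ≡ next j → i ≡ j
next-injective {i = i} {j} eq = trans (sym (prev-next i)) (trans (cong prev eq) (prev-next j))

⊆-or-witness : ∀ {m} (X Y : Subset m) → X ⊆ Y ⊎ ∃[ g ] (g ∈ X × g ∉ Y)
⊆-or-witness X Y with Finₚ.any? (λ g → (g ∈? X) ×-dec ¬? (g ∈? Y))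
... | yes w = inj₂ w
... | no ¬w = inj₁ λ {g} g∈ → decidable-stable (g ∈? Y) (λ g∉ → ¬w (g , g∈ , g∉))

-- Finite sets and classical logic

-- All intermediate goals are ⊥ or decidable, so classical arguments can be run in the
-- double-negation monad.
Cl : Set → Set
Cl A = ¬ ¬ A

pure : ∀ {A} → A → Cl A
pure a k = k a

_>>=_ : ∀ {A B} → Cl A → (A → Cl B) → Cl B
(c >>= f) k = c (λ a → f a k)

run : Cl ⊥ → ⊥
run c = c (λ x → x)

em : ∀ {A} → Cl (Dec A)
em k = k (no (λ a → k (yes a)))

fin-choice : ∀ {k} {P : Fin k → Set} → (∀ i → Cl (P i)) → Cl (∀ i → P i)
fin-choice {zero} c = pure λ ()
fin-choice {suc k} c = do
  p ← c zero
  ps ← fin-choice (λ i → c (suc i))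
  pure λ { zero → p ; (suc i) → ps i }

fromDec : ∀ {k} {P : Fin k → Set} → (∀ i → Dec (P i)) → Subset k
fromDec P? = tabulate (λ i → does (P? i))

∈-fromDec⁺ : ∀ {k} {P : Fin k → Set} (P? : ∀ i → Dec (P i)) {i} → P i → i ∈ fromDec P?
∈-fromDec⁺ P? {i} p = lookup⇒[]= i _ (trans (lookup∘tabulate _ i) (dec-true (P? i) p))

∈-fromDec⁻ : ∀ {k} {P : Fin k → Set} (P? : ∀ i → Dec (P i)) {i} → i ∈ fromDec P? → P i
∈-fromDec⁻ P? {i} i∈ with P? i | trans (sym (lookup∘tabulate (λ i → does (P? i)) i)) ([]=⇒lookup i∈)
... | yes p | _ = p

-- Flats and components have to be given as a `Subset`, but balance of an edge set and reachability
-- are not decided here, so such a subset is available only under `Cl`.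
record Comprehension {k} (P : Fin k → Set) : Set where
  constructor ⟦_,_,_⟧
  field
    set : Subset k
    out : ∀ {i} → i ∈ set → P i
    into : ∀ {i} → P i → i ∈ set

comprehension : ∀ {k} (P : Fin k → Set) → Cl (Comprehension P)
comprehension P = do
  d ← fin-choice {P = λ i → Dec (P i)} (λ i → em)
  pure ⟦ fromDec d , ∈-fromDec⁻ d , ∈-fromDec⁺ d ⟧

abstract
  -- Otherwise every vertex has a position in the shorter list; two distinct vertices share a
  -- position by the pigeonhole principle, and there they coincide.
  fresh : ∀ {k} (l : List (Fin k)) → length l < k → ∃[ v ] v ∉ˡ l
  fresh {k} l lt with Finₚ.any? (λ v → ¬? (DecMem._∈?_ Finₚ._≟_ v l))
  ... | yes w = w
  ... | no none with Finₚ.pigeonhole lt (λ v → index (mem v))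
    where
    mem : ∀ v → v ∈ˡ l
    mem v = decidable-stable (DecMem._∈?_ Finₚ._≟_ v l) (λ ¬p → none (v , ¬p))
  ... | i , j , i<j , eq = ⊥-elim (ℕₚ.<⇒≢ i<j (cong toℕ (trans (lookup-index (mem i)) (trans (cong (lookup l) eq) (sym (lookup-index (mem j)))))))
    where
    mem : ∀ v → v ∈ˡ l
    mem v = decidable-stable (DecMem._∈?_ Finₚ._≟_ v l) (λ ¬p → none (v , ¬p))

∣∪∣-disjoint : ∀ {k} (X Y : Subset k) → (∀ {g} → g ∈ X → g ∈ Y → ⊥) → ∣ X ∣ + ∣ Y ∣ ≤ ∣ X ∪ Y ∣
∣∪∣-disjoint [] [] d = z≤n
∣∪∣-disjoint (outside ∷ X) (outside ∷ Y) d = ∣∪∣-disjoint X Y λ a b → d (Data.Vec.there a) (Data.Vec.there b)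
∣∪∣-disjoint (outside ∷ X) (inside ∷ Y) d rewrite ℕₚ.+-suc ∣ X ∣ ∣ Y ∣ =
  s≤s (∣∪∣-disjoint X Y λ a b → d (Data.Vec.there a) (Data.Vec.there b))
∣∪∣-disjoint (inside ∷ X) (outside ∷ Y) d = s≤s (∣∪∣-disjoint X Y λ a b → d (Data.Vec.there a) (Data.Vec.there b))
∣∪∣-disjoint (inside ∷ X) (inside ∷ Y) d = ⊥-elim (d Data.Vec.here Data.Vec.here)

∣p∣≤∣p∩∁q∣+∣q∣ : ∀ {k} (p q : Subset k) → ∣ p ∣ ≤ ∣ p ∩ ∁ q ∣ + ∣ q ∣
∣p∣≤∣p∩∁q∣+∣q∣ [] [] = z≤n
∣p∣≤∣p∩∁q∣+∣q∣ (outside ∷ p) (outside ∷ q) = ∣p∣≤∣p∩∁q∣+∣q∣ p q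
∣p∣≤∣p∩∁q∣+∣q∣ (outside ∷ p) (inside ∷ q) rewrite ℕₚ.+-suc ∣ p ∩ ∁ q ∣ ∣ q ∣ = ℕₚ.m≤n⇒m≤1+n (∣p∣≤∣p∩∁q∣+∣q∣ p q)
∣p∣≤∣p∩∁q∣+∣q∣ (inside ∷ p) (outside ∷ q) = s≤s (∣p∣≤∣p∩∁q∣+∣q∣ p q)
∣p∣≤∣p∩∁q∣+∣q∣ (inside ∷ p) (inside ∷ q) rewrite ℕₚ.+-suc ∣ p ∩ ∁ q ∣ ∣ q ∣ = s≤s (∣p∣≤∣p∩∁q∣+∣q∣ p q)

∣p∣≤1+∣p∖x∣ : ∀ {k} (p : Subset k) x → ∣ p ∣ ≤ suc ∣ p ∩ ∁ ⁅ x ⁆ ∣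
∣p∣≤1+∣p∖x∣ p x = ℕₚ.≤-trans (∣p∣≤∣p∩∁q∣+∣q∣ p ⁅ x ⁆)
  (ℕₚ.≤-reflexive (trans (cong (∣ p ∩ ∁ ⁅ x ⁆ ∣ +_) (∣⁅x⁆∣≡1 x)) (ℕₚ.+-comm _ 1)))

two≤ : ∀ {k} {X : Subset k} {a b} → a ∈ X → b ∈ X → a ≢ b → 2 ≤ ∣ X ∣
two≤ {X = X} {a} {b} a∈ b∈ ne = subst (λ t → suc t ≤ ∣ X ∣) (∣⁅x⁆∣≡1 a)
  (p⊂q⇒∣p∣<∣q∣ ((λ q → subst (_∈ X) (sym (x∈⁅y⁆⇒x≡y a q)) a∈) , b , b∈ , λ q → ne (sym (x∈⁅y⁆⇒x≡y a q))))

one≤ : ∀ {k} {X : Subset k} {a} → a ∈ X → 1 ≤ ∣ X ∣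
one≤ {X = X} {a} a∈ = subst (_≤ ∣ X ∣) (∣⁅x⁆∣≡1 a)
  (p⊆q⇒∣p∣≤∣q∣ (λ q → subst (_∈ X) (sym (x∈⁅y⁆⇒x≡y a q)) a∈))

-- Ranks, separations and contractions of a circuit system

module _ {m : ℕ} (Circ : Subset m → Set) (nonempty : ∀ {X} → Circ X → ∃[ g ] g ∈ X) where

  -- Descends from the trivial bound m to the largest size attained, settling each size by `em`. The
  -- descent ends at the empty set, which is independent because circuits are nonempty.
  rank-exists : ∀ X → Cl (∃[ r ] IsRank Circ X r)
  rank-exists X = go m (λ I _ _ → ∣p∣≤n I)
    where
    Has : ℕ → Set
    Has t = ∃[ I ] (I ⊆ X × Indep Circ I × ∣ I ∣ ≡ t)
    go : ∀ t → (∀ I → I ⊆ X → Indep Circ I → ∣ I ∣ ≤ t) → Cl (∃[ r ] IsRank Circ X r)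
    go t bound = em {Has t} >>= λ where
        (yes h) → pure (t , h , bound)
        (no ¬h) → lower t bound ¬h
      where
      lower : ∀ t → (∀ I → I ⊆ X → Indep Circ I → ∣ I ∣ ≤ t) → ¬ Has t → Cl (∃[ r ] IsRank Circ X r)
      lower zero bound ¬h = λ _ → ¬h (∅ , (λ q → ⊥-elim (∉⊥ q)) ,
        (λ C c sub → ∉⊥ (sub (proj₂ (nonempty c)))) , ∣⊥∣≡0 m)
      lower (suc t) bound ¬h = go t λ I sub ind →
        ℕₚ.≤-pred (ℕₚ.≤∧≢⇒< (bound I sub ind) (λ eq → ¬h (I , sub , ind , eq)))

  -- The ranks of the two sides are attained by independent sets, and any independent `K` bounds the
  -- rank of M from below. So it is enough to merge `I` and `J` into one independent set at a loss
  -- of at most k - 1 elements; no rank has to be computed.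
  separation : ∀ k X → k ≤ ∣ X ∣ → k ≤ ∣ ∁ X ∣ →
    (∀ I J → I ⊆ X → J ⊆ ∁ X → Indep Circ I → Indep Circ J →
      Cl (∃[ K ] (Indep Circ K × ∣ I ∣ + ∣ J ∣ < k + ∣ K ∣))) →
    Cl (Separation Circ k)
  separation k X k≤ k≤' H = do
    (a , ra@((I , I⊆ , Ii , refl) , _)) ← rank-exists X
    (b , rb@((J , J⊆ , Ji , refl) , _)) ← rank-exists (∁ X)
    (c , rc@(_ , c-max)) ← rank-exists Data.Fin.Subset.⊤
    (K , Ki , lt) ← H I J I⊆ J⊆ Ii Ji
    pure (X , k≤ , k≤' , ∣ I ∣ , ∣ J ∣ , c , ra , rb , rc , ℕₚ.≤-trans lt (ℕₚ.+-monoʳ-≤ k (c-max K ⊆⊤ Ki)))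

  -- Modulo the flat the circuit shrinks to a dependent subset of the pair; `leaves` keeps that
  -- subset from being empty.
  record Parallel (Fl : Subset m) (e e' : Fin m) : Set where
    constructor parallel
    field
      {set} : Subset m
      circuit : Circ set
      leaves : ∃[ g ] (g ∈ set × g ∉ Fl)
      only : ∀ {g} → g ∈ set → g ∉ Fl → g ≡ e ⊎ g ≡ e'

  -- The elements of Sₐ outside the flat form a parallel class of the contraction that misses f.
  break : Unbreakable Circ → ∀ {Fl e f} (Sₐ : Fin m → Set) → IsFlat Circ Fl → e ∉ Fl → f ∉ Fl →
    Sₐ e → ¬ Sₐ f →
    (∀ {C} → Circ C → e ∈ C → ∃[ e' ] (e' ≢ e × e' ∈ C × e' ∉ Fl × Sₐ e')) →
    (∀ {e'} → e' ≢ e → e' ∉ Fl → Sₐ e' → Cl (Parallel Fl e e')) →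
    ⊥
  break (_ , ub) {Fl} {e} {f} Sₐ flat e∉ f∉ Se Sf H₁ H₂
    with ub Fl flat e f (x∉p⇒x∈∁p e∉) (x∉p⇒x∈∁p f∉) (λ { refl → Sf Se })
  ... | D , ((_ , C , circ , refl) , minimal) , e∈ , f∈ with H₁ circ (proj₁ (x∈p∩q⁻ C (∁ Fl) e∈))
  ... | e' , ne , e'∈C , e'∉ , Se' = run do
    (parallel {C'} circ' (g , g∈ , g∉) only) ← H₂ ne e'∉ Se'
    -- Both `e` and `e'` lie in `D`, so the trace `D'` of the new circuit is a candidate inside `D`.
    -- Minimality gives `D' = D`, which would put `f` into the pair.
    let D' = C' ∩ ∁ Fl
        sub : D' ⊆ C ∩ ∁ Fl
        sub {h} h∈ = let (h∈' , h∉) = x∈p∩q⁻ C' (∁ Fl) h∈ in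
          [ (λ { refl → e∈ }) , (λ { refl → x∈p∩q⁺ (e'∈C , x∉p⇒x∈∁p e'∉) }) ]′ (only h∈' (x∈∁p⇒x∉p h∉))
        eq = minimal D' ((g , x∈p∩q⁺ (g∈ , x∉p⇒x∈∁p g∉)) , C' , circ' , refl) sub
        (f∈' , _) = x∈p∩q⁻ C' (∁ Fl) (subst (f ∈_) (sym eq) f∈)
    pure ([ (λ { refl → Sf Se }) , (λ { refl → Sf Se' }) ]′ (only f∈' f∉))

-- Lists of vertices as subsets

fromList : ∀ {k} → List (Fin k) → Subset k
fromList [] = ∅
fromList (x ∷ l) = ⁅ x ⁆ ∪ fromList l

∈-fromList⁺ : ∀ {k} {v : Fin k} {l} → v ∈ˡ l → v ∈ fromList l
∈-fromList⁺ {l = x ∷ l} (here refl) = x∈p∪q⁺ (inj₁ (x∈⁅x⁆ x))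
∈-fromList⁺ {l = x ∷ l} (there q) = x∈p∪q⁺ (inj₂ (∈-fromList⁺ q))

∣fromList∣≤ : ∀ {k} (l : List (Fin k)) → ∣ fromList l ∣ ≤ length l
∣fromList∣≤ {k} [] = ℕₚ.≤-reflexive (∣⊥∣≡0 k)
∣fromList∣≤ (x ∷ l) = ℕₚ.≤-trans (∣p∣≤1+∣p∖x∣ (⁅ x ⁆ ∪ fromList l) x)
  (s≤s (ℕₚ.≤-trans (p⊆q⇒∣p∣≤∣q∣ λ {g} q → aux q) (∣fromList∣≤ l)))
  where
  aux : ∀ {g} → g ∈ (⁅ x ⁆ ∪ fromList l) ∩ ∁ ⁅ x ⁆ → g ∈ fromList l
  aux q with x∈p∩q⁻ (⁅ x ⁆ ∪ fromList l) _ q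
  ... | a , b with x∈p∪q⁻ ⁅ x ⁆ (fromList l) a
  ...   | inj₁ c = ⊥-elim (x∈∁p⇒x∉p b c)
  ...   | inj₂ c = c

NoDup : ∀ {k} → List (Fin k) → Set
NoDup [] = ⊤
NoDup (x ∷ l) = x ∉ˡ l × NoDup l

∈-fromList⁻ : ∀ {k} {v : Fin k} l → v ∈ fromList l → v ∈ˡ l
∈-fromList⁻ [] q = ⊥-elim (∉⊥ q)
∈-fromList⁻ (x ∷ l) q = [ (λ r → here (x∈⁅y⁆⇒x≡y x r)) , (λ r → there (∈-fromList⁻ l r)) ]′ (x∈p∪q⁻ ⁅ x ⁆ (fromList l) q)

∣fromList∣≥ : ∀ {k} (l : List (Fin k)) → NoDup l → length l ≤ ∣ fromList l ∣
∣fromList∣≥ [] _ = z≤n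
∣fromList∣≥ (x ∷ l) (x∉ , d) = ℕₚ.≤-trans (s≤s (∣fromList∣≥ l d))
  (ℕₚ.≤-trans (ℕₚ.≤-reflexive (cong (_+ ∣ fromList l ∣) (sym (∣⁅x⁆∣≡1 x))))
    (∣∪∣-disjoint ⁅ x ⁆ (fromList l) λ a b → x∉ (subst (_∈ˡ l) (x∈⁅y⁆⇒x≡y x a) (∈-fromList⁻ l b))))

pattern 0th x = here x
pattern 1st x = there (here x)
pattern 2nd x = there (there (here x))
pattern 3rd x = there (there (there (here x)))
pattern 4th x = there (there (there (there (here x))))
pattern 5th x = there (there (there (there (there (here x)))))

one-of-three : ∀ {k} {z a b c : Fin k} → z ∈ˡ (a ∷ b ∷ c ∷ []) → z ≡ a ⊎ z ≡ b ⊎ z ≡ c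
one-of-three (0th e) = inj₁ e
one-of-three (1st e) = inj₂ (inj₁ e)
one-of-three (2nd e) = inj₂ (inj₂ e)

one-of-four : ∀ {k} {z a b c d : Fin k} → z ∈ˡ (a ∷ b ∷ c ∷ d ∷ []) → z ≡ a ⊎ z ≡ b ⊎ z ≡ c ⊎ z ≡ d
one-of-four (0th e) = inj₁ e
one-of-four (there q) = inj₂ (one-of-three q)

record Hypotheses {n m : ℕ} (G : Graph n m) (B L F : Subset m → Set) : Set where
  field
    quasiBiased : IsQuasiBiased G B L F
    6<n : 6 < n
    component : ∀ v → ∃[ w ] (w ≢ v × Path G v w)
    three : ThreeConnected (MCircuit G B L F)
    unbreakable : Unbreakable (MCircuit G B L F)

module Graphs {n m : ℕ} (G : Graph n m) where

  -- Walks

  V = Fin n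
  E = Fin m

  J : E → V → V → Set
  J = Joins G

  Inc : E → V → Set
  Inc = IncidentTo G

  J-sym : ∀ {e x y} → J e x y → J e y x
  J-sym = swap

  J-incˡ : ∀ {e x y} → J e x y → Inc e x
  J-incˡ (inj₁ p) = inj₁ (cong proj₁ p)
  J-incˡ (inj₂ p) = inj₂ (cong proj₂ p)

  J-incʳ : ∀ {e x y} → J e x y → Inc e y
  J-incʳ = J-incˡ ∘ J-sym

  J-ends : ∀ {e x y p} → J e x y → Inc e p → p ≡ x ⊎ p ≡ y
  J-ends (inj₁ p) (inj₁ q) = inj₁ (trans (sym q) (cong proj₁ p))
  J-ends (inj₁ p) (inj₂ q) = inj₂ (trans (sym q) (cong proj₂ p))
  J-ends (inj₂ p) (inj₁ q) = inj₂ (trans (sym q) (cong proj₁ p))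
  J-ends (inj₂ p) (inj₂ q) = inj₁ (trans (sym q) (cong proj₂ p))

  inc-J : ∀ {e p} → Inc e p → ∃[ q ] J e p q
  inc-J {e} (inj₁ refl) = proj₂ (G e) , inj₁ refl
  inc-J {e} (inj₂ refl) = proj₁ (G e) , inj₂ refl

  J-unique : ∀ {e x y z} → J e x y → J e x z → y ≡ z
  J-unique (inj₁ p) (inj₁ q) = cong proj₂ (trans (sym p) q)
  J-unique (inj₁ p) (inj₂ q) = trans (cong proj₂ (trans (sym p) q)) (cong proj₁ (trans (sym p) q))
  J-unique (inj₂ p) (inj₁ q) = trans (cong proj₁ (trans (sym p) q)) (cong proj₂ (trans (sym p) q))
  J-unique (inj₂ p) (inj₂ q) = cong proj₁ (trans (sym p) q)

  data Walk : V → V → Set where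
    nil  : ∀ {x} → Walk x x
    cons : ∀ {x y z} (e : E) → J e x y → Walk y z → Walk x z

  infix 4 _∈ᵛ_ _∈ᵉ_
  _∈ᵛ_ : ∀ {x y} → V → Walk x y → Set
  p ∈ᵛ nil {x} = p ≡ x
  p ∈ᵛ cons {x} e j w = p ≡ x ⊎ p ∈ᵛ w

  _∈ᵉ_ : ∀ {x y} → E → Walk x y → Set
  g ∈ᵉ nil = ⊥
  g ∈ᵉ cons e j w = g ≡ e ⊎ g ∈ᵉ w

  Simple : ∀ {x y} → Walk x y → Set
  Simple nil = ⊤
  Simple (cons {x} e j w) = (¬ x ∈ᵛ w) × Simple w

  _∈ᵛ?_ : ∀ {x y} p (w : Walk x y) → Dec (p ∈ᵛ w)
  p ∈ᵛ? nil {x} = p Finₚ.≟ x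
  p ∈ᵛ? cons {x} e j w = (p Finₚ.≟ x) ⊎-dec (p ∈ᵛ? w)

  start∈ : ∀ {x y} (w : Walk x y) → x ∈ᵛ w
  start∈ nil = refl
  start∈ (cons e j w) = inj₁ refl

  end∈ : ∀ {x y} (w : Walk x y) → y ∈ᵛ w
  end∈ nil = refl
  end∈ (cons e j w) = inj₂ (end∈ w)

  es : ∀ {x y} → Walk x y → Subset m
  es nil = ∅
  es (cons e j w) = ⁅ e ⁆ ∪ es w

  ∈es⁻ : ∀ {x y g} (w : Walk x y) → g ∈ es w → g ∈ᵉ w
  ∈es⁻ nil g∈ = ⊥-elim (∉⊥ g∈)
  ∈es⁻ (cons e j w) g∈ = ⊎-map (x∈⁅y⁆⇒x≡y e) (∈es⁻ w) (x∈p∪q⁻ ⁅ e ⁆ (es w) g∈)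

  ∈es⁺ : ∀ {x y g} (w : Walk x y) → g ∈ᵉ w → g ∈ es w
  ∈es⁺ (cons e j w) (inj₁ refl) = x∈p∪q⁺ (inj₁ (x∈⁅x⁆ e))
  ∈es⁺ (cons e j w) (inj₂ g∈) = x∈p∪q⁺ (inj₂ (∈es⁺ w g∈))

  ∈ᵉ-ends : ∀ {x y g p} (w : Walk x y) → g ∈ᵉ w → Inc g p → p ∈ᵛ w
  ∈ᵉ-ends (cons e j w) (inj₁ refl) inc with J-ends j inc
  ... | inj₁ refl = inj₁ refl
  ... | inj₂ refl = inj₂ (start∈ w)
  ∈ᵉ-ends (cons e j w) (inj₂ g∈) inc = inj₂ (∈ᵉ-ends w g∈ inc)

  ∈ᵉ-joins : ∀ {x y g} (w : Walk x y) → Simple w → g ∈ᵉ w →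
    ∃[ r ] ∃[ s ] (J g r s × r ∈ᵛ w × s ∈ᵛ w × r ≢ s)
  ∈ᵉ-joins (cons {x} {y} e j w) (x∉ , sw) (inj₁ refl) =
    x , y , j , inj₁ refl , inj₂ (start∈ w) , λ { refl → x∉ (start∈ w) }
  ∈ᵉ-joins (cons e j w) (x∉ , sw) (inj₂ g∈) with ∈ᵉ-joins w sw g∈
  ... | r , s , jj , r∈ , s∈ , ne = r , s , jj , inj₂ r∈ , inj₂ s∈ , ne

  cons-vertex-edge : ∀ {x y z p} e (j : J e x y) (w : Walk y z) →
    p ∈ᵛ cons e j w → ∃[ g ] (g ∈ᵉ cons e j w × Inc g p)
  cons-vertex-edge e j w (inj₁ refl) = e , inj₁ refl , J-incˡ j
  cons-vertex-edge e j nil (inj₂ refl) = e , inj₁ refl , J-incʳ j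
  cons-vertex-edge e j (cons e' j' w) (inj₂ p∈) with cons-vertex-edge e' j' w p∈
  ... | g , g∈ , i = g , inj₂ g∈ , i

  vertex-edge : ∀ {x y p} (w : Walk x y) → x ≢ y → p ∈ᵛ w → ∃[ g ] (g ∈ᵉ w × Inc g p)
  vertex-edge nil ne p∈ = ⊥-elim (ne refl)
  vertex-edge (cons e j w) ne p∈ = cons-vertex-edge e j w p∈

  infixr 5 _⊕_
  _⊕_ : ∀ {x y z} → Walk x y → Walk y z → Walk x z
  nil ⊕ v = v
  cons e j w ⊕ v = cons e j (w ⊕ v)

  ∈ᵛ-⊕⁻ : ∀ {x y z p} (w : Walk x y) (v : Walk y z) → p ∈ᵛ w ⊕ v → p ∈ᵛ w ⊎ p ∈ᵛ v
  ∈ᵛ-⊕⁻ nil v p∈ = inj₂ p∈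
  ∈ᵛ-⊕⁻ (cons e j w) v (inj₁ eq) = inj₁ (inj₁ eq)
  ∈ᵛ-⊕⁻ (cons e j w) v (inj₂ p∈) = ⊎-map inj₂ (λ q → q) (∈ᵛ-⊕⁻ w v p∈)

  ∈ᵛ-⊕ʳ : ∀ {x y z p} (w : Walk x y) (v : Walk y z) → p ∈ᵛ v → p ∈ᵛ w ⊕ v
  ∈ᵛ-⊕ʳ nil v p∈ = p∈
  ∈ᵛ-⊕ʳ (cons e j w) v p∈ = inj₂ (∈ᵛ-⊕ʳ w v p∈)

  ∈ᵛ-⊕ˡ : ∀ {x y z p} (w : Walk x y) (v : Walk y z) → p ∈ᵛ w → p ∈ᵛ w ⊕ v
  ∈ᵛ-⊕ˡ nil v refl = start∈ v
  ∈ᵛ-⊕ˡ (cons e j w) v (inj₁ eq) = inj₁ eq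
  ∈ᵛ-⊕ˡ (cons e j w) v (inj₂ p∈) = inj₂ (∈ᵛ-⊕ˡ w v p∈)

  ∈ᵉ-⊕⁻ : ∀ {x y z g} (w : Walk x y) (v : Walk y z) → g ∈ᵉ w ⊕ v → g ∈ᵉ w ⊎ g ∈ᵉ v
  ∈ᵉ-⊕⁻ nil v g∈ = inj₂ g∈
  ∈ᵉ-⊕⁻ (cons e j w) v (inj₁ eq) = inj₁ (inj₁ eq)
  ∈ᵉ-⊕⁻ (cons e j w) v (inj₂ g∈) = ⊎-map inj₂ (λ q → q) (∈ᵉ-⊕⁻ w v g∈)

  ∈ᵉ-⊕ˡ : ∀ {x y z g} (w : Walk x y) (v : Walk y z) → g ∈ᵉ w → g ∈ᵉ w ⊕ v
  ∈ᵉ-⊕ˡ (cons e j w) v (inj₁ eq) = inj₁ eq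
  ∈ᵉ-⊕ˡ (cons e j w) v (inj₂ g∈) = inj₂ (∈ᵉ-⊕ˡ w v g∈)

  ∈ᵉ-⊕ʳ : ∀ {x y z g} (w : Walk x y) (v : Walk y z) → g ∈ᵉ v → g ∈ᵉ w ⊕ v
  ∈ᵉ-⊕ʳ nil v g∈ = g∈
  ∈ᵉ-⊕ʳ (cons e j w) v g∈ = inj₂ (∈ᵉ-⊕ʳ w v g∈)

  simple-⊕⁻ : ∀ {x y z} (w : Walk x y) (v : Walk y z) → Simple (w ⊕ v) →
    Simple w × Simple v × (∀ {p} → p ∈ᵛ w → p ∈ᵛ v → p ≡ y)
  simple-⊕⁻ nil v s = tt , s , λ p∈ _ → p∈
  simple-⊕⁻ (cons e j w) v (x∉ , s) with simple-⊕⁻ w v s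
  ... | sw , sv , meet = ((λ x∈ → x∉ (∈ᵛ-⊕ˡ w v x∈)) , sw) , sv ,
    λ { (inj₁ refl) p∈ → ⊥-elim (x∉ (∈ᵛ-⊕ʳ w v p∈)) ; (inj₂ p∈w) p∈ → meet p∈w p∈ }

  simple-⊕⁺ : ∀ {x y z} (w : Walk x y) (v : Walk y z) → Simple w → Simple v →
    (∀ {p} → p ∈ᵛ w → p ∈ᵛ v → p ≡ y) → Simple (w ⊕ v)
  simple-⊕⁺ nil v sw sv meet = sv
  simple-⊕⁺ (cons e j w) v (x∉ , sw) sv meet =
    (λ x∈ → [ x∉ , (λ x∈v → x∉ (subst (_∈ᵛ w) (sym (meet (inj₁ refl) x∈v)) (end∈ w))) ]′ (∈ᵛ-⊕⁻ w v x∈)) ,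
    simple-⊕⁺ w v sw sv (λ p∈ → meet (inj₂ p∈))

  rev : ∀ {x y} → Walk x y → Walk y x
  rev nil = nil
  rev (cons e j w) = rev w ⊕ cons e (J-sym j) nil

  ∈ᵛ-rev⁻ : ∀ {x y p} (w : Walk x y) → p ∈ᵛ rev w → p ∈ᵛ w
  ∈ᵛ-rev⁻ nil p∈ = p∈
  ∈ᵛ-rev⁻ (cons e j w) p∈ with ∈ᵛ-⊕⁻ (rev w) (cons e (J-sym j) nil) p∈
  ... | inj₁ q = inj₂ (∈ᵛ-rev⁻ w q)
  ... | inj₂ (inj₁ refl) = inj₂ (start∈ w)
  ... | inj₂ (inj₂ refl) = inj₁ refl

  ∈ᵛ-rev⁺ : ∀ {x y p} (w : Walk x y) → p ∈ᵛ w → p ∈ᵛ rev w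
  ∈ᵛ-rev⁺ nil p∈ = p∈
  ∈ᵛ-rev⁺ (cons e j w) (inj₁ refl) = end∈ (rev w ⊕ cons e (J-sym j) nil)
  ∈ᵛ-rev⁺ (cons e j w) (inj₂ p∈) = ∈ᵛ-⊕ˡ (rev w) _ (∈ᵛ-rev⁺ w p∈)

  ∈ᵉ-rev⁻ : ∀ {x y g} (w : Walk x y) → g ∈ᵉ rev w → g ∈ᵉ w
  ∈ᵉ-rev⁻ (cons e j w) g∈ with ∈ᵉ-⊕⁻ (rev w) (cons e (J-sym j) nil) g∈
  ... | inj₁ q = inj₂ (∈ᵉ-rev⁻ w q)
  ... | inj₂ (inj₁ refl) = inj₁ refl

  ∈ᵉ-rev⁺ : ∀ {x y g} (w : Walk x y) → g ∈ᵉ w → g ∈ᵉ rev w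
  ∈ᵉ-rev⁺ (cons e j w) (inj₁ refl) = ∈ᵉ-⊕ʳ (rev w) _ (inj₁ refl)
  ∈ᵉ-rev⁺ (cons e j w) (inj₂ g∈) = ∈ᵉ-⊕ˡ (rev w) _ (∈ᵉ-rev⁺ w g∈)

  simple-rev : ∀ {x y} (w : Walk x y) → Simple w → Simple (rev w)
  simple-rev nil s = tt
  simple-rev (cons {x} {y} e j w) (x∉ , s) =
    simple-⊕⁺ (rev w) (cons e (J-sym j) nil) (simple-rev w s) ((λ { refl → x∉ (start∈ w) }) , tt) meet
    where
    meet : ∀ {p} → p ∈ᵛ rev w → p ≡ y ⊎ p ≡ x → p ≡ y
    meet p∈ (inj₁ eq) = eq
    meet p∈ (inj₂ refl) = ⊥-elim (x∉ (∈ᵛ-rev⁻ w p∈))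

  record Split {x y} (w : Walk x y) (p : V) : Set where
    constructor mkSplit
    field
      pre : Walk x p
      suf : Walk p y
      eq : w ≡ pre ⊕ suf

  split : ∀ {x y p} (w : Walk x y) → p ∈ᵛ w → Split w p
  split nil refl = mkSplit nil nil refl
  split w@(cons e j _) (inj₁ refl) = mkSplit nil w refl
  split (cons e j w) (inj₂ p∈) with split w p∈
  ... | mkSplit a b eq = mkSplit (cons e j a) b (cong (cons e j) eq)

  simplify : ∀ {x y} (w : Walk x y) → Σ (Walk x y) λ v →
    Simple v × (∀ {p} → p ∈ᵛ v → p ∈ᵛ w) × (∀ {g} → g ∈ᵉ v → g ∈ᵉ w)
  simplify nil = nil , tt , (λ q → q) , λ q → q
  simplify (cons {x} e j w) with simplify w
  ... | v , sv , vv , ve with x ∈ᵛ? v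
  ...   | no x∉ = cons e j v , (x∉ , sv) , ⊎-map (λ q → q) vv , ⊎-map (λ q → q) ve
  ...   | yes x∈ with split v x∈
  ...     | mkSplit a b refl = b , proj₁ (proj₂ (simple-⊕⁻ a b sv)) ,
              (λ q → inj₂ (vv (∈ᵛ-⊕ʳ a b q))) , (λ q → inj₂ (ve (∈ᵉ-⊕ʳ a b q)))

  simple-closed : ∀ {x} (w : Walk x x) → Simple w → w ≡ nil
  simple-closed nil s = refl
  simple-closed (cons e j w) (x∉ , _) = ⊥-elim (x∉ (end∈ w))

  module _ {P : V → Set} (P? : ∀ p → Dec (P p)) where

    first : ∀ {x y} (w : Walk x y) → (∀ {p} → p ∈ᵛ w → ¬ P p) ⊎
      (∃[ s ] Σ (Split w s) λ sp → P s × (∀ {p} → p ∈ᵛ Split.pre sp → P p → p ≡ s))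
    first {x} w with P? x
    first w | yes px = inj₂ (_ , mkSplit nil w refl , px , λ p∈ _ → p∈)
    first nil | no ¬px = inj₁ λ { refl → ¬px }
    first (cons e j w) | no ¬px with first w
    ... | inj₁ none = inj₁ λ { (inj₁ refl) → ¬px ; (inj₂ q) → none q }
    ... | inj₂ (s , mkSplit a b eq , ps , f) = inj₂ (s , mkSplit (cons e j a) b (cong (cons e j) eq) , ps ,
      λ { (inj₁ refl) pp → ⊥-elim (¬px pp) ; (inj₂ q) pp → f q pp })

    last : ∀ {x y} (w : Walk x y) → (∀ {p} → p ∈ᵛ w → ¬ P p) ⊎
      (∃[ s ] Σ (Split w s) λ sp → P s × (∀ {p} → p ∈ᵛ Split.suf sp → P p → p ≡ s))
    last (nil {x}) with P? x
    ... | yes px = inj₂ (x , mkSplit nil nil refl , px , λ p∈ _ → p∈)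
    ... | no ¬px = inj₁ λ { refl → ¬px }
    last (cons {x} e j w) with last w
    ... | inj₂ (s , mkSplit a b eq , ps , f) = inj₂ (s , mkSplit (cons e j a) b (cong (cons e j) eq) , ps , f)
    ... | inj₁ none with P? x
    ...   | no ¬px = inj₁ λ { (inj₁ refl) → ¬px ; (inj₂ q) → none q }
    ...   | yes px = inj₂ (x , mkSplit nil (cons e j w) refl , px ,
              λ { (inj₁ eq) _ → eq ; (inj₂ q) pp → ⊥-elim (none q pp) })

  len : ∀ {x y} → Walk x y → ℕ
  len nil = 0
  len (cons e j w) = suc (len w)

  vt : ∀ {x y} (w : Walk x y) → Fin (suc (len w)) → V
  vt (nil {x}) _ = x
  vt (cons {x} e j w) zero = x
  vt (cons e j w) (suc i) = vt w i

  ed : ∀ {x y} (w : Walk x y) → Fin (len w) → E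
  ed (cons e j w) zero = e
  ed (cons e j w) (suc i) = ed w i

  vt-zero : ∀ {x y} (w : Walk x y) → vt w zero ≡ x
  vt-zero nil = refl
  vt-zero (cons e j w) = refl

  vt-last : ∀ {x y} (w : Walk x y) → vt w (fromℕ (len w)) ≡ y
  vt-last nil = refl
  vt-last (cons e j w) = vt-last w

  vt∈ : ∀ {x y} (w : Walk x y) i → vt w i ∈ᵛ w
  vt∈ nil i = refl
  vt∈ (cons e j w) zero = inj₁ refl
  vt∈ (cons e j w) (suc i) = inj₂ (vt∈ w i)

  vt-injective : ∀ {x y} (w : Walk x y) → Simple w → ∀ {i k} → vt w i ≡ vt w k → i ≡ k
  vt-injective nil s {zero} {zero} eq = refl
  vt-injective (cons e j w) s {zero} {zero} eq = refl
  vt-injective (cons e j w) (x∉ , s) {zero} {suc k} refl = ⊥-elim (x∉ (vt∈ w k))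
  vt-injective (cons e j w) (x∉ , s) {suc i} {zero} refl = ⊥-elim (x∉ (vt∈ w i))
  vt-injective (cons e j w) (x∉ , s) {suc i} {suc k} eq = cong suc (vt-injective w s eq)

  ed-surj : ∀ {x y g} (w : Walk x y) → g ∈ᵉ w → ∃[ i ] ed w i ≡ g
  ed-surj (cons e j w) (inj₁ refl) = zero , refl
  ed-surj (cons e j w) (inj₂ g∈) with ed-surj w g∈
  ... | i , eq = suc i , eq

  ed∈ : ∀ {x y} (w : Walk x y) i → ed w i ∈ᵉ w
  ed∈ (cons e j w) zero = inj₁ refl
  ed∈ (cons e j w) (suc i) = inj₂ (ed∈ w i)

  ed-joins : ∀ {x y} (w : Walk x y) i → J (ed w i) (vt w (inject₁ i)) (vt w (suc i))
  ed-joins (cons e j w) zero = subst (J e _) (sym (vt-zero w)) j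
  ed-joins (cons e j w) (suc i) = ed-joins w i

  ed-injective : ∀ {x y} (w : Walk x y) → Simple w → ∀ {i k} → ed w i ≡ ed w k → i ≡ k
  ed-injective (cons e j w) s {zero} {zero} eq = refl
  ed-injective (cons e j w) (x∉ , s) {zero} {suc k} refl = ⊥-elim (x∉ (∈ᵉ-ends w (ed∈ w k) (J-incˡ j)))
  ed-injective (cons e j w) (x∉ , s) {suc i} {zero} refl = ⊥-elim (x∉ (∈ᵉ-ends w (ed∈ w i) (J-incˡ j)))
  ed-injective (cons e j w) (x∉ , s) {suc i} {suc k} eq = cong suc (ed-injective w s eq)

  fromFun : ∀ k (v : Fin (suc k) → V) (e : Fin k → E) →
    (∀ i → J (e i) (v (inject₁ i)) (v (suc i))) → Walk (v zero) (v (fromℕ k))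
  fromFun zero v e j = nil
  fromFun (suc k) v e j = cons (e zero) (j zero) (fromFun k (v ∘ suc) (e ∘ suc) (j ∘ suc))

  ∈ᵛ-fromFun⁻ : ∀ {p} k v e j → p ∈ᵛ fromFun k v e j → ∃[ i ] v i ≡ p
  ∈ᵛ-fromFun⁻ zero v e j refl = zero , refl
  ∈ᵛ-fromFun⁻ (suc k) v e j (inj₁ refl) = zero , refl
  ∈ᵛ-fromFun⁻ (suc k) v e j (inj₂ p∈) with ∈ᵛ-fromFun⁻ k (v ∘ suc) (e ∘ suc) (j ∘ suc) p∈
  ... | i , eq = suc i , eq

  ∈ᵉ-fromFun⁻ : ∀ {g} k v e j → g ∈ᵉ fromFun k v e j → ∃[ i ] e i ≡ g
  ∈ᵉ-fromFun⁻ (suc k) v e j (inj₁ refl) = zero , refl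
  ∈ᵉ-fromFun⁻ (suc k) v e j (inj₂ g∈) with ∈ᵉ-fromFun⁻ k (v ∘ suc) (e ∘ suc) (j ∘ suc) g∈
  ... | i , eq = suc i , eq

  ∈ᵉ-fromFun⁺ : ∀ k v e j i → e i ∈ᵉ fromFun k v e j
  ∈ᵉ-fromFun⁺ (suc k) v e j zero = inj₁ refl
  ∈ᵉ-fromFun⁺ (suc k) v e j (suc i) = inj₂ (∈ᵉ-fromFun⁺ k (v ∘ suc) (e ∘ suc) (j ∘ suc) i)

  ∈ᵛ-fromFun⁺ : ∀ k v e j i → v i ∈ᵛ fromFun k v e j
  ∈ᵛ-fromFun⁺ zero v e j zero = refl
  ∈ᵛ-fromFun⁺ (suc k) v e j zero = inj₁ refl
  ∈ᵛ-fromFun⁺ (suc k) v e j (suc i) = inj₂ (∈ᵛ-fromFun⁺ k (v ∘ suc) (e ∘ suc) (j ∘ suc) i)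

  simple-fromFun : ∀ k v e j → (∀ {i l} → v i ≡ v l → i ≡ l) → Simple (fromFun k v e j)
  simple-fromFun zero v e j inj = tt
  simple-fromFun (suc k) v e j inj =
    (λ p∈ → case (∈ᵛ-fromFun⁻ k (v ∘ suc) (e ∘ suc) (j ∘ suc) p∈)) ,
    simple-fromFun k (v ∘ suc) (e ∘ suc) (j ∘ suc) (λ eq → Finₚ.suc-injective (inj eq))
    where
    case : ¬ (∃[ i ] v (suc i) ≡ v zero)
    case (i , eq) with inj eq
    ... | ()

  -- Opening and closing cycles

  snoc : ∀ k → (Fin k → E) → E → Fin (suc k) → E
  snoc zero f e zero = e
  snoc (suc k) f e zero = f zero
  snoc (suc k) f e (suc i) = snoc k (f ∘ suc) e i

  snoc-inject₁ : ∀ k f e i → snoc k f e (inject₁ i) ≡ f i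
  snoc-inject₁ (suc k) f e zero = refl
  snoc-inject₁ (suc k) f e (suc i) = snoc-inject₁ k (f ∘ suc) e i

  snoc-fromℕ : ∀ k f e → snoc k f e (fromℕ k) ≡ e
  snoc-fromℕ zero f e = refl
  snoc-fromℕ (suc k) f e = snoc-fromℕ k (f ∘ suc) e

  -- A cycle opened at its edge e = xy.
  record Cyc (C : Subset m) (e : E) (x y : V) : Set where
    constructor mkCyc
    field
      joins : J e x y
      w : Walk y x
      simple : Simple w
      e∉w : ¬ e ∈ᵉ w
      edges⁻ : ∀ {g} → g ∈ C → g ≡ e ⊎ g ∈ᵉ w
      edges⁺ : ∀ {g} → g ≡ e ⊎ g ∈ᵉ w → g ∈ C

  cyc⇒isCycle : ∀ {C e x y} → Cyc C e x y → IsCycle G C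
  cyc⇒isCycle {C} {e} {x} {y} (mkCyc joins w sw e∉ e⁻ e⁺) =
    len w , vt w , e' , vt-injective w sw , e'-inj , e'-joins , λ g → mk⇔ (c⁻ ∘ e⁻) c⁺
    where
    k = len w
    e' = snoc k (ed w) e
    e'-inj : ∀ {i l} → e' i ≡ e' l → i ≡ l
    e'-inj {i} {l} eq with view i | view l
    ... | ‵fromℕ | ‵fromℕ = refl
    ... | ‵fromℕ | ‵inj₁ {i = l'} _ = ⊥-elim (e∉ (subst (_∈ᵉ w)
      (trans (sym (snoc-inject₁ k (ed w) e l')) (trans (sym eq) (snoc-fromℕ k (ed w) e))) (ed∈ w l')))
    ... | ‵inj₁ {i = i'} _ | ‵fromℕ = ⊥-elim (e∉ (subst (_∈ᵉ w)
      (trans (sym (snoc-inject₁ k (ed w) e i')) (trans eq (snoc-fromℕ k (ed w) e))) (ed∈ w i')))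
    ... | ‵inj₁ {i = i'} _ | ‵inj₁ {i = l'} _ = cong inject₁ (ed-injective w sw
      (trans (sym (snoc-inject₁ k (ed w) e i')) (trans eq (snoc-inject₁ k (ed w) e l'))))
    e'-joins : ∀ i → J (e' i) (vt w i) (vt w (next i))
    e'-joins i with view i
    ... | ‵fromℕ rewrite snoc-fromℕ k (ed w) e | next-fromℕ k | vt-zero w | vt-last w = joins
    ... | ‵inj₁ {i = i'} _ rewrite snoc-inject₁ k (ed w) e i' | next-inject₁ i' = ed-joins w i'
    c⁻ : ∀ {g} → g ≡ e ⊎ g ∈ᵉ w → ∃[ i ] e' i ≡ g
    c⁻ (inj₁ refl) = fromℕ k , snoc-fromℕ k (ed w) e
    c⁻ (inj₂ g∈) with ed-surj w g∈
    ... | i , eq = inject₁ i , trans (snoc-inject₁ k (ed w) e i) eq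
    c⁺ : ∀ {g} → ∃[ i ] e' i ≡ g → g ∈ C
    c⁺ (i , eq) with view i
    c⁺ (_ , refl) | ‵fromℕ = e⁺ (inj₁ (snoc-fromℕ k (ed w) e))
    c⁺ (_ , refl) | ‵inj₁ {i = i'} _ = e⁺ (inj₂ (subst (_∈ᵉ w) (sym (snoc-inject₁ k (ed w) e i')) (ed∈ w i')))

  -- Reindexing by `next` lowers the index of the chosen edge by one. From index zero one more turn
  -- makes it the last edge, and removing the last edge leaves a walk along the remaining indices.
  rotate : ∀ {C} (c : IsCycle G C) (i : Fin (suc (proj₁ c))) →
    ∃[ x ] ∃[ y ] Cyc C (proj₁ (proj₂ (proj₂ c)) i) x y
  rotate {C} (k , v , e , vi , ei , je , ce) i = go (toℕ i) v e vi ei je ce i refl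
    where
    open-at-top : (v : Fin (suc k) → V) (e : Fin (suc k) → E) →
      (∀ {i l} → v i ≡ v l → i ≡ l) → (∀ {i l} → e i ≡ e l → i ≡ l) →
      (∀ i → J (e i) (v i) (v (next i))) → (∀ x → (x ∈ C) ⇔ (∃[ i ] e i ≡ x)) →
      ∃[ x ] ∃[ y ] Cyc C (e (fromℕ k)) x y
    open-at-top v e vi ei je ce = v (fromℕ k) , v zero ,
      mkCyc (subst (λ t → J (e (fromℕ k)) (v (fromℕ k)) (v t)) (next-fromℕ k) (je (fromℕ k)))
        w (simple-fromFun k v (e ∘ inject₁) js vi) e∉ c⁻ c⁺
      where
      js = λ l → subst (λ t → J (e (inject₁ l)) (v (inject₁ l)) (v t)) (next-inject₁ l) (je (inject₁ l))
      w = fromFun k v (e ∘ inject₁) js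
      e∉ : ¬ e (fromℕ k) ∈ᵉ w
      e∉ q with ∈ᵉ-fromFun⁻ k v (e ∘ inject₁) js q
      ... | l , eq = Finₚ.fromℕ≢inject₁ (sym (ei eq))
      c⁻ : ∀ {g} → g ∈ C → g ≡ e (fromℕ k) ⊎ g ∈ᵉ w
      c⁻ {g} g∈ with to (ce g) g∈
      ... | l , refl with view l
      ...   | ‵fromℕ = inj₁ refl
      ...   | ‵inj₁ {i = l'} _ = inj₂ (∈ᵉ-fromFun⁺ k v (e ∘ inject₁) js l')
      c⁺ : ∀ {g} → g ≡ e (fromℕ k) ⊎ g ∈ᵉ w → g ∈ C
      c⁺ {g} (inj₁ refl) = from (ce g) (_ , refl)
      c⁺ {g} (inj₂ q) with ∈ᵉ-fromFun⁻ k v (e ∘ inject₁) js q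
      ... | l , eq = from (ce g) (inject₁ l , eq)
    go : ∀ t (v : Fin (suc k) → V) (e : Fin (suc k) → E) →
      (∀ {i l} → v i ≡ v l → i ≡ l) → (∀ {i l} → e i ≡ e l → i ≡ l) →
      (∀ i → J (e i) (v i) (v (next i))) → (∀ x → (x ∈ C) ⇔ (∃[ i ] e i ≡ x)) →
      ∀ i → toℕ i ≡ t → ∃[ x ] ∃[ y ] Cyc C (e i) x y
    step : ∀ t (v : Fin (suc k) → V) (e : Fin (suc k) → E) →
      (∀ {i l} → v i ≡ v l → i ≡ l) → (∀ {i l} → e i ≡ e l → i ≡ l) →
      (∀ i → J (e i) (v i) (v (next i))) → (∀ x → (x ∈ C) ⇔ (∃[ i ] e i ≡ x)) →
      ∀ i → toℕ (prev i) ≡ t → ∃[ x ] ∃[ y ] Cyc C (e i) x y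
    step t v e vi ei je ce i eq with go t (v ∘ next) (e ∘ next)
        (λ q → next-injective (vi q)) (λ q → next-injective (ei q)) (λ l → je (next l))
        (λ x → mk⇔ (λ x∈ → let (l , q) = to (ce x) x∈ in prev l , trans (cong e (next-prev l)) q)
                   (λ (l , q) → from (ce x) (next l , q)))
        (prev i) eq
    ... | x , y , c = x , y , subst (λ z → Cyc C (e z) x y) (next-prev i) c
    go zero v e vi ei je ce zero eq with open-at-top (v ∘ next) (e ∘ next)
        (λ q → next-injective (vi q)) (λ q → next-injective (ei q)) (λ l → je (next l))
        (λ x → mk⇔ (λ x∈ → let (l , q) = to (ce x) x∈ in prev l , trans (cong e (next-prev l)) q)
                   (λ (l , q) → from (ce x) (next l , q)))
    ... | x , y , c = x , y , subst (λ z → Cyc C (e z) x y) (next-prev zero) c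
    go (suc t) v e vi ei je ce (suc i) eq =
      step t v e vi ei je ce (suc i) (trans (Finₚ.toℕ-inject₁ i) (ℕₚ.suc-injective eq))

  cyc-flip : ∀ {C e x y} → Cyc C e x y → Cyc C e y x
  cyc-flip (mkCyc j w s e∉ e⁻ e⁺) = mkCyc (J-sym j) (rev w) (simple-rev w s) (e∉ ∘ ∈ᵉ-rev⁻ w)
    (⊎-map (λ q → q) (∈ᵉ-rev⁺ w) ∘ e⁻) (e⁺ ∘ ⊎-map (λ q → q) (∈ᵉ-rev⁻ w))

  open-cycle : ∀ {C e x} → IsCycle G C → e ∈ C → Inc e x → ∃[ y ] Cyc C e x y
  open-cycle {C} {e} cyc@(_ , _ , _ , _ , _ , _ , ce) e∈ inc with to (ce e) e∈
  ... | i , refl with rotate cyc i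
  ...   | a , b , c with J-ends (Cyc.joins c) inc
  ...     | inj₁ refl = b , c
  ...     | inj₂ refl = a , cyc-flip c

  -- Cycles and ears

  VO : Subset m → V → Set
  VO = VertexOf G

  inc? : ∀ e p → Dec (Inc e p)
  inc? e p = (proj₁ (G e) Finₚ.≟ p) ⊎-dec (proj₂ (G e) Finₚ.≟ p)

  vo? : ∀ C p → Dec (VO C p)
  vo? C p = Finₚ.any? (λ e → (e ∈? C) ×-dec inc? e p)

  cyc-vertex⁻ : ∀ {C e x y p} (c : Cyc C e x y) → VO C p → p ∈ᵛ Cyc.w c
  cyc-vertex⁻ c (g , g∈ , inc) with Cyc.edges⁻ c g∈
  ... | inj₂ q = ∈ᵉ-ends (Cyc.w c) q inc
  ... | inj₁ refl with J-ends (Cyc.joins c) inc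
  ...   | inj₁ refl = end∈ (Cyc.w c)
  ...   | inj₂ refl = start∈ (Cyc.w c)

  cyc-vertex⁺ : ∀ {C e x y p} (c : Cyc C e x y) → p ∈ᵛ Cyc.w c → VO C p
  cyc-vertex⁺ {e = e} (mkCyc j nil _ _ _ e⁺) refl = e , e⁺ (inj₁ refl) , J-incˡ j
  cyc-vertex⁺ (mkCyc j (cons g k w) _ _ _ e⁺) p∈ with cons-vertex-edge g k w p∈
  ... | h , h∈ , inc = h , e⁺ (inj₂ h∈) , inc

  isCycle-nonempty : ∀ {C} → IsCycle G C → ∃[ e ] e ∈ C
  isCycle-nonempty (k , v , e , _ , _ , _ , ce) = e zero , from (ce (e zero)) (zero , refl)

  cyc-degree≥2 : ∀ {C e x y} → Cyc C e x y → x ≢ y → ∃[ e' ] (e' ≢ e × e' ∈ C × Inc e' x)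
  cyc-degree≥2 c ne with vertex-edge (Cyc.w c) (ne ∘ sym) (end∈ (Cyc.w c))
  ... | g , g∈ , inc = g , (λ { refl → Cyc.e∉w c g∈ }) , Cyc.edges⁺ c (inj₂ g∈) , inc

  cyc-degree≤2 : ∀ {C e x y} → Cyc C e x y → ∃[ e' ] (∀ {g} → g ∈ C → Inc g x → g ≡ e ⊎ g ≡ e')
  cyc-degree≤2 {C} {e} {x} c = go (rev w) (simple-rev w (Cyc.simple c))
      (⊎-map (λ q → q) (∈ᵉ-rev⁺ w) ∘ Cyc.edges⁻ c)
    where
    w = Cyc.w c
    go : ∀ {y} (v : Walk x y) → Simple v → (∀ {g} → g ∈ C → g ≡ e ⊎ g ∈ᵉ v) →
      ∃[ e' ] (∀ {g} → g ∈ C → Inc g x → g ≡ e ⊎ g ≡ e')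
    go nil s e⁻ = e , λ g∈ _ → ⊎-map (λ q → q) ⊥-elim (e⁻ g∈)
    go (cons e' j v) (x∉ , s) e⁻ = e' , λ {g} g∈ inc → aux inc (e⁻ g∈)
      where
      aux : ∀ {g} → Inc g x → g ≡ e ⊎ (g ≡ e' ⊎ g ∈ᵉ v) → g ≡ e ⊎ g ≡ e'
      aux inc (inj₁ q) = inj₁ q
      aux inc (inj₂ (inj₁ q)) = inj₂ q
      aux inc (inj₂ (inj₂ q)) = ⊥-elim (x∉ (∈ᵉ-ends v q inc))

  -- The cycles with one, with two and with at least three vertices, as seen from `p`.
  data LocalShape (C : Subset m) (p : V) : Set where
    loop : (∀ {q} → VO C q → q ≡ p) → LocalShape C p
    digon : ∀ y e → p ≢ y → e ∈ C → J e p y → (∀ {q} → VO C q → q ≡ p ⊎ q ≡ y) → LocalShape C p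
    bend : ∀ y y' e e' → p ≢ y → p ≢ y' → y ≢ y' → e ∈ C → J e p y → e' ∈ C → J e' p y' → LocalShape C p

  abstract
    local-shape : ∀ {C p} → IsCycle G C → VO C p → LocalShape C p
    local-shape {C} {p} cyc (e , e∈ , inc) with open-cycle cyc e∈ inc
    ... | y , c with rev (Cyc.w c) | simple-rev (Cyc.w c) (Cyc.simple c)
          | (λ {q} → ∈ᵛ-rev⁺ {p = q} (Cyc.w c)) | (λ {g} → ∈ᵉ-rev⁻ {g = g} (Cyc.w c))
    ... | nil | s | v⁺ | _ = loop (λ q → v⁺ (cyc-vertex⁻ c q))
    ... | cons e' j nil | x∉ , s | v⁺ | _ = digon y e x∉ e∈ (Cyc.joins c) (λ q → v⁺ (cyc-vertex⁻ c q))
    ... | cons {y = y'} e' j v@(cons _ _ v') | x∉ , y'∉ , s | v⁺ | e⁻ =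
      bend y y' e e' (λ { refl → x∉ (end∈ v) }) (λ { refl → x∉ (start∈ v) })
        (λ { refl → y'∉ (end∈ v') }) e∈ (Cyc.joins c) (Cyc.edges⁺ c (inj₂ (e⁻ (inj₁ refl)))) j

  -- If the first edge of the walk is in the cycle, the cycle needs a second edge at the starting
  -- vertex, and a simple walk has none; otherwise the cycle lies in the shorter walk.
  simple-acyclic : ∀ {C x y} (w : Walk x y) → Simple w → IsCycle G C → ¬ (∀ {g} → g ∈ C → g ∈ᵉ w)
  simple-acyclic nil s cyc sub = sub (proj₂ (isCycle-nonempty cyc))
  simple-acyclic {C} (cons {x} {z} e j w) (x∉ , s) cyc sub with e ∈? C
  ... | no e∉ = simple-acyclic w s cyc λ {g} g∈ → aux g∈ (sub g∈)
    where
    aux : ∀ {g} → g ∈ C → g ≡ e ⊎ g ∈ᵉ w → g ∈ᵉ w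
    aux g∈ (inj₁ refl) = ⊥-elim (e∉ g∈)
    aux g∈ (inj₂ q) = q
  ... | yes e∈ with open-cycle cyc e∈ (J-incˡ j)
  ...   | y , c with cyc-degree≥2 c (λ { refl → x∉ (subst (_∈ᵛ w) (J-unique j (Cyc.joins c)) (start∈ w)) })
  ...     | g , g≢ , g∈ , inc with sub g∈
  ...       | inj₁ eq = g≢ eq
  ...       | inj₂ q = x∉ (∈ᵉ-ends w q inc)

  -- If an edge of `C'` were missing from `C`, then `C` would lie in the simple walk obtained by
  -- opening `C'` at that edge.
  cycle⊆cycle : ∀ {C C'} → IsCycle G C → IsCycle G C' → C ⊆ C' → C' ⊆ C
  cycle⊆cycle {C} {C'} cyc cyc' sub with ⊆-or-witness C' C
  ... | inj₁ s = s
  ... | inj₂ (g , g∈ , g∉) with open-cycle cyc' g∈ (inj₁ refl)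
  ...   | y , c = ⊥-elim (simple-acyclic (Cyc.w c) (Cyc.simple c) cyc λ {h} h∈ → aux h∈ (Cyc.edges⁻ c (sub h∈)))
    where
    aux : ∀ {h} → h ∈ C → h ≡ g ⊎ h ∈ᵉ Cyc.w c → h ∈ᵉ Cyc.w c
    aux h∈ (inj₁ refl) = ⊥-elim (g∉ h∈)
    aux h∈ (inj₂ q) = q

  abstract
    close-walk : ∀ {g x y} → J g x y → (w : Walk y x) → ¬ g ∈ᵉ w →
      ∃[ C ] (IsCycle G C × g ∈ C × (∀ {h} → h ∈ C → h ≡ g ⊎ h ∈ᵉ w))
    close-walk {g} j w g∉ with simplify w
    ... | v , sv , vv , ve = ⁅ g ⁆ ∪ es v ,
        cyc⇒isCycle (mkCyc j v sv (g∉ ∘ ve) C⁻ C⁺) , C⁺ (inj₁ refl) , ⊎-map (λ q → q) ve ∘ C⁻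
      where
      C⁻ : ∀ {h} → h ∈ ⁅ g ⁆ ∪ es v → h ≡ g ⊎ h ∈ᵉ v
      C⁻ h∈ = ⊎-map (x∈⁅y⁆⇒x≡y g) (∈es⁻ v) (x∈p∪q⁻ ⁅ g ⁆ (es v) h∈)
      C⁺ : ∀ {h} → h ≡ g ⊎ h ∈ᵉ v → h ∈ ⁅ g ⁆ ∪ es v
      C⁺ (inj₁ refl) = x∈p∪q⁺ (inj₁ (x∈⁅x⁆ g))
      C⁺ (inj₂ q) = x∈p∪q⁺ (inj₂ (∈es⁺ v q))

  loop-cycle : ∀ {g x} → J g x x → IsCycle G ⁅ g ⁆
  loop-cycle {g} j = cyc⇒isCycle (mkCyc j nil tt (λ ()) (λ h → inj₁ (x∈⁅y⁆⇒x≡y g h))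
    λ { (inj₁ refl) → x∈⁅x⁆ g })

  cycle-loop : ∀ {C g x} → IsCycle G C → g ∈ C → J g x x → ∀ {h} → h ∈ C → h ≡ g
  cycle-loop cyc g∈ j {h} h∈ with open-cycle cyc g∈ (J-incˡ j)
  ... | y , c with J-unique (Cyc.joins c) j
  ...   | refl with Cyc.w c | simple-closed (Cyc.w c) (Cyc.simple c) | Cyc.edges⁻ c h∈
  ...     | _ | refl | inj₁ eq = eq

  abstract
    -- The three edges already form a cycle inside `C`, and a cycle contains no smaller one.
    cycle-of-triangle : ∀ {C p q r g₁ g₂ g₃} → IsCycle G C → g₁ ∈ C → g₂ ∈ C → g₃ ∈ C →
      J g₁ p q → J g₂ q r → J g₃ p r → p ≢ q → q ≢ r → ∀ {z} → VO C z → z ≡ p ⊎ z ≡ q ⊎ z ≡ r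
    cycle-of-triangle {C} {p} {q} {r} {g₁} {g₂} {g₃} cyc g₁∈ g₂∈ g₃∈ j₁ j₂ j₃ p≢q q≢r {z} (h , h∈ , i)
      with close-walk (J-sym j₃) (cons g₁ j₁ (cons g₂ j₂ nil)) g₃∉
      where
      g₃∉ : ¬ (g₃ ≡ g₁ ⊎ g₃ ≡ g₂ ⊎ ⊥)
      g₃∉ (inj₁ refl) = q≢r (J-unique j₁ j₃)
      g₃∉ (inj₂ (inj₁ refl)) = p≢q (sym (J-unique (J-sym j₂) (J-sym j₃)))
    ... | C' , cyc' , _ , C'⁻ = fin (C'⁻ (cycle⊆cycle cyc' cyc (λ k∈ → in-C (C'⁻ k∈)) h∈))
      where
      in-C : ∀ {k} → k ≡ g₃ ⊎ k ≡ g₁ ⊎ k ≡ g₂ ⊎ ⊥ → k ∈ C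
      in-C (inj₁ refl) = g₃∈
      in-C (inj₂ (inj₁ refl)) = g₁∈
      in-C (inj₂ (inj₂ (inj₁ refl))) = g₂∈
      fin : h ≡ g₃ ⊎ h ≡ g₁ ⊎ h ≡ g₂ ⊎ ⊥ → z ≡ p ⊎ z ≡ q ⊎ z ≡ r
      fin (inj₁ refl) = ⊎-map (λ x → x) inj₂ (J-ends j₃ i)
      fin (inj₂ (inj₁ refl)) = ⊎-map (λ x → x) inj₁ (J-ends j₁ i)
      fin (inj₂ (inj₂ (inj₁ refl))) = inj₂ (J-ends j₂ i)

  two-walks-cycle : ∀ {C x y} (w v : Walk x y) → x ≢ y → Simple w → Simple v →
    (∀ {p} → p ∈ᵛ w → p ∈ᵛ v → p ≡ x ⊎ p ≡ y) → (∀ {g} → g ∈ᵉ w → g ∈ᵉ v → ⊥) →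
    (∀ {g} → g ∈ C → g ∈ᵉ w ⊎ g ∈ᵉ v) → (∀ {g} → g ∈ᵉ w ⊎ g ∈ᵉ v → g ∈ C) → IsCycle G C
  two-walks-cycle nil v ne = ⊥-elim (ne refl)
  two-walks-cycle {C} {x} {y} (cons {y = z} e j w) v ne (x∉ , sw) sv meet dis C⁻ C⁺ =
    cyc⇒isCycle (mkCyc j (w ⊕ rev v) (simple-⊕⁺ w (rev v) sw (simple-rev v sv) meet')
      (λ q → [ (λ q → x∉ (∈ᵉ-ends w q (J-incˡ j))) , (λ q → dis (inj₁ refl) (∈ᵉ-rev⁻ v q)) ]′ (∈ᵉ-⊕⁻ w (rev v) q))
      (λ g∈ → aux⁻ (C⁻ g∈)) aux⁺)
    where
    meet' : ∀ {p} → p ∈ᵛ w → p ∈ᵛ rev v → p ≡ y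
    meet' p∈ q∈ with meet (inj₂ p∈) (∈ᵛ-rev⁻ v q∈)
    ... | inj₁ refl = ⊥-elim (x∉ p∈)
    ... | inj₂ eq = eq
    aux⁻ : ∀ {g} → (g ≡ e ⊎ g ∈ᵉ w) ⊎ g ∈ᵉ v → g ≡ e ⊎ g ∈ᵉ w ⊕ rev v
    aux⁻ (inj₁ (inj₁ q)) = inj₁ q
    aux⁻ (inj₁ (inj₂ q)) = inj₂ (∈ᵉ-⊕ˡ w _ q)
    aux⁻ (inj₂ q) = inj₂ (∈ᵉ-⊕ʳ w _ (∈ᵉ-rev⁺ v q))
    aux⁺ : ∀ {g} → g ≡ e ⊎ g ∈ᵉ w ⊕ rev v → g ∈ C
    aux⁺ (inj₁ q) = C⁺ (inj₁ (inj₁ q))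
    aux⁺ (inj₂ q) with ∈ᵉ-⊕⁻ w (rev v) q
    ... | inj₁ q' = C⁺ (inj₁ (inj₂ q'))
    ... | inj₂ q' = C⁺ (inj₂ (∈ᵉ-rev⁻ v q'))

  toPath : ∀ {x y} (w : Walk x y) → x ≢ y → Simple w → Σ (Path G x y) λ p → EdgesOf G p (es w) ×
    (∀ {z} → InternalVertex G p z → z ∈ᵛ w × z ≢ x × z ≢ y) ×
    (∀ i → Path.vtx p i ∈ᵛ w) × (∀ i → Path.vtx p i ≡ x → i ≡ zero) ×
    (∀ i → Path.vtx p i ≡ y → i ≡ fromℕ (suc (Path.len p)))
  toPath nil ne = ⊥-elim (ne refl)
  toPath {x} {y} w@(cons e j w') ne s = path ,
      (λ g → mk⇔ (λ g∈ → ed-surj w (∈es⁻ w g∈)) (λ { (i , refl) → ∈es⁺ w (ed∈ w i) })) ,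
      (λ { (i , refl , i≢0 , i≢l) → vt∈ w i , i≢0 ∘ isStart i , i≢l ∘ isEnd i }) , vt∈ w , isStart , isEnd
    where
    isStart : ∀ i → vt w i ≡ x → i ≡ zero
    isStart i q = vt-injective w s q
    isEnd : ∀ i → vt w i ≡ y → i ≡ fromℕ (suc (len w'))
    isEnd i q = vt-injective w s (trans q (sym (vt-last w)))
    path : Path G x y
    path = record { len = len w' ; vtx = vt w ; edg = ed w ; vtx-inj = vt-injective w s
                  ; start = refl ; end = vt-last w ; joins = ed-joins w }

  fromPath : ∀ {x y} (p : Path G x y) → Σ (Walk x y) λ w → Simple w ×
    (∀ {g} → g ∈ᵉ w → ∃[ i ] Path.edg p i ≡ g) × (∀ i → Path.edg p i ∈ᵉ w) ×
    (∀ {z} → z ∈ᵛ w → z ≡ x ⊎ z ≡ y ⊎ InternalVertex G p z) × (∀ i → Path.vtx p i ∈ᵛ w)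
  fromPath record { len = l ; vtx = v ; edg = e ; vtx-inj = inj ; start = refl ; end = refl ; joins = j } =
    fromFun (suc l) v e j , simple-fromFun (suc l) v e j inj , ∈ᵉ-fromFun⁻ (suc l) v e j , ∈ᵉ-fromFun⁺ (suc l) v e j ,
    (λ z∈ → aux (∈ᵛ-fromFun⁻ (suc l) v e j z∈)) , ∈ᵛ-fromFun⁺ (suc l) v e j
    where
    aux : ∀ {z} → ∃[ i ] v i ≡ z → z ≡ v zero ⊎ z ≡ v (fromℕ (suc l)) ⊎
      (∃[ i ] (v i ≡ z × i ≢ zero × i ≢ fromℕ (suc l)))
    aux (i , refl) with i Finₚ.≟ zero | i Finₚ.≟ fromℕ (suc l)
    ... | yes refl | _ = inj₁ refl
    ... | no _ | yes refl = inj₂ (inj₁ refl)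
    ... | no a | no b = inj₂ (inj₂ (i , refl , a , b))

  -- Theta subgraphs and ears

  record Separated {x y} (w v : Walk x y) : Set where
    field
      meet : ∀ {p} → p ∈ᵛ w → p ∈ᵛ v → p ≡ x ⊎ p ≡ y
      dis : ∀ {g} → g ∈ᵉ w → g ∈ᵉ v → ⊥

  sep-sym : ∀ {x y} {w v : Walk x y} → Separated w v → Separated v w
  sep-sym s = record { meet = λ a b → Separated.meet s b a ; dis = λ a b → Separated.dis s b a }

  record Theta (P₁ P₂ P₃ : Subset m) : Set where
    field
      {x y} : V
      x≢y : x ≢ y
      w₁ w₂ w₃ : Walk x y
      s₁ : Simple w₁
      s₂ : Simple w₂
      s₃ : Simple w₃
      e₁⁻ : ∀ {g} → g ∈ P₁ → g ∈ᵉ w₁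
      e₁⁺ : ∀ {g} → g ∈ᵉ w₁ → g ∈ P₁
      e₂⁻ : ∀ {g} → g ∈ P₂ → g ∈ᵉ w₂
      e₂⁺ : ∀ {g} → g ∈ᵉ w₂ → g ∈ P₂
      e₃⁻ : ∀ {g} → g ∈ P₃ → g ∈ᵉ w₃
      e₃⁺ : ∀ {g} → g ∈ᵉ w₃ → g ∈ P₃
      sep₁₂ : Separated w₁ w₂
      sep₁₃ : Separated w₁ w₃
      sep₂₃ : Separated w₂ w₃

  theta-walks : ∀ {P₁ P₂ P₃} → ThetaRep G P₁ P₂ P₃ → Theta P₁ P₂ P₃
  theta-walks {P₁} {P₂} {P₃} (x , y , ne , p1 , p2 , p3 , E1 , E2 , E3 , I12 , I13 , I23 , D12 , D13 , D23)
    with fromPath p1 | fromPath p2 | fromPath p3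
  ... | w1 , s1 , a1 , b1 , c1 , _ | w2 , s2 , a2 , b2 , c2 , _ | w3 , s3 , a3 , b3 , c3 , _ = record
    { x≢y = ne ; w₁ = w1 ; w₂ = w2 ; w₃ = w3 ; s₁ = s1 ; s₂ = s2 ; s₃ = s3
    ; e₁⁻ = E⁻ p1 w1 E1 b1 ; e₁⁺ = E⁺ p1 w1 E1 a1
    ; e₂⁻ = E⁻ p2 w2 E2 b2 ; e₂⁺ = E⁺ p2 w2 E2 a2
    ; e₃⁻ = E⁻ p3 w3 E3 b3 ; e₃⁺ = E⁺ p3 w3 E3 a3
    ; sep₁₂ = record { meet = λ a b → mt p1 p2 I12 (c1 a) (c2 b) ; dis = λ a b → D12 _ (E⁺ p1 w1 E1 a1 a) (E⁺ p2 w2 E2 a2 b) }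
    ; sep₁₃ = record { meet = λ a b → mt p1 p3 I13 (c1 a) (c3 b) ; dis = λ a b → D13 _ (E⁺ p1 w1 E1 a1 a) (E⁺ p3 w3 E3 a3 b) }
    ; sep₂₃ = record { meet = λ a b → mt p2 p3 I23 (c2 a) (c3 b) ; dis = λ a b → D23 _ (E⁺ p2 w2 E2 a2 a) (E⁺ p3 w3 E3 a3 b) } }
    where
    mt : ∀ (p q : Path G x y) {z} → InternallyDisjoint G p q →
      z ≡ x ⊎ z ≡ y ⊎ InternalVertex G p z → z ≡ x ⊎ z ≡ y ⊎ InternalVertex G q z → z ≡ x ⊎ z ≡ y
    mt _ _ I (inj₁ a) _ = inj₁ a
    mt _ _ I (inj₂ (inj₁ a)) _ = inj₂ a
    mt _ _ I (inj₂ (inj₂ _)) (inj₁ a) = inj₁ a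
    mt _ _ I (inj₂ (inj₂ _)) (inj₂ (inj₁ a)) = inj₂ a
    mt _ _ I (inj₂ (inj₂ a)) (inj₂ (inj₂ b)) = ⊥-elim (I _ a b)
    E⁻ : (p : Path G x y) (w : Walk x y) {P : Subset m} → EdgesOf G p P → (∀ i → Path.edg p i ∈ᵉ w) →
      ∀ {g} → g ∈ P → g ∈ᵉ w
    E⁻ p w E b {g} g∈ with to (E g) g∈
    ... | i , refl = b i
    E⁺ : (p : Path G x y) (w : Walk x y) {P : Subset m} → EdgesOf G p P →
      (∀ {g} → g ∈ᵉ w → ∃[ i ] Path.edg p i ≡ g) → ∀ {g} → g ∈ᵉ w → g ∈ P
    E⁺ p w E a {g} g∈ = from (E g) (a g∈)

  theta-perm : ∀ {P₁ P₂ P₃} → Theta P₁ P₂ P₃ → Theta P₂ P₃ P₁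
  theta-perm t = record { x≢y = x≢y ; w₁ = w₂ ; w₂ = w₃ ; w₃ = w₁ ; s₁ = s₂ ; s₂ = s₃ ; s₃ = s₁
    ; e₁⁻ = e₂⁻ ; e₁⁺ = e₂⁺ ; e₂⁻ = e₃⁻ ; e₂⁺ = e₃⁺ ; e₃⁻ = e₁⁻ ; e₃⁺ = e₁⁺
    ; sep₁₂ = sep₂₃ ; sep₁₃ = sep-sym sep₁₂ ; sep₂₃ = sep-sym sep₁₃ }
    where open Theta t

  theta-flip : ∀ {P₁ P₂ P₃} → Theta P₁ P₂ P₃ → Theta P₂ P₁ P₃
  theta-flip t = record { x≢y = x≢y ; w₁ = w₂ ; w₂ = w₁ ; w₃ = w₃ ; s₁ = s₂ ; s₂ = s₁ ; s₃ = s₃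
    ; e₁⁻ = e₂⁻ ; e₁⁺ = e₂⁺ ; e₂⁻ = e₁⁻ ; e₂⁺ = e₁⁺ ; e₃⁻ = e₃⁻ ; e₃⁺ = e₃⁺
    ; sep₁₂ = sep-sym sep₁₂ ; sep₁₃ = sep₂₃ ; sep₂₃ = sep₁₃ }
    where open Theta t

  theta-cycle₁₂ : ∀ {P₁ P₂ P₃} → Theta P₁ P₂ P₃ → IsCycle G (P₁ ∪ P₂)
  theta-cycle₁₂ {P₁} {P₂} t = two-walks-cycle w₁ w₂ x≢y s₁ s₂ (Separated.meet sep₁₂) (Separated.dis sep₁₂)
    (λ g∈ → ⊎-map e₁⁻ e₂⁻ (x∈p∪q⁻ P₁ P₂ g∈)) (λ q → x∈p∪q⁺ (⊎-map e₁⁺ e₂⁺ q))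
    where open Theta t

  theta-cycle₁₃ : ∀ {P₁ P₂ P₃} → Theta P₁ P₂ P₃ → IsCycle G (P₁ ∪ P₃)
  theta-cycle₁₃ = theta-cycle₁₂ ∘ theta-flip ∘ theta-perm ∘ theta-perm

  theta-cycle₂₃ : ∀ {P₁ P₂ P₃} → Theta P₁ P₂ P₃ → IsCycle G (P₂ ∪ P₃)
  theta-cycle₂₃ = theta-cycle₁₂ ∘ theta-perm

  theta-rep : ∀ {P₁ P₂ P₃} → Theta P₁ P₂ P₃ → ThetaRep G P₁ P₂ P₃
  theta-rep t with toPath w₁ x≢y s₁ | toPath w₂ x≢y s₂ | toPath w₃ x≢y s₃
    where open Theta t
  ... | p1 , E1 , i1 , _ | p2 , E2 , i2 , _ | p3 , E3 , i3 , _ =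
    x , y , x≢y , p1 , p2 , p3 ,
    tr p1 w₁ e₁⁻ e₁⁺ E1 , tr p2 w₂ e₂⁻ e₂⁺ E2 , tr p3 w₃ e₃⁻ e₃⁺ E3 ,
    (λ z a b → no-meet sep₁₂ (i1 a) (i2 b)) , (λ z a b → no-meet sep₁₃ (i1 a) (i3 b)) ,
    (λ z a b → no-meet sep₂₃ (i2 a) (i3 b)) ,
    (λ g a b → Separated.dis sep₁₂ (e₁⁻ a) (e₂⁻ b)) , (λ g a b → Separated.dis sep₁₃ (e₁⁻ a) (e₃⁻ b)) ,
    (λ g a b → Separated.dis sep₂₃ (e₂⁻ a) (e₃⁻ b))
    where
    open Theta t
    tr : ∀ {P} (p : Path G x y) (w : Walk x y) → (∀ {g} → g ∈ P → g ∈ᵉ w) → (∀ {g} → g ∈ᵉ w → g ∈ P) →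
      EdgesOf G p (es w) → EdgesOf G p P
    tr p w e⁻ e⁺ E g = mk⇔ (λ g∈ → to (E g) (∈es⁺ w (e⁻ g∈))) (λ q → e⁺ (∈es⁻ w (from (E g) q)))
    no-meet : ∀ {w v : Walk x y} {z} → Separated w v →
      z ∈ᵛ w × z ≢ x × z ≢ y → z ∈ᵛ v × z ≢ x × z ≢ y → ⊥
    no-meet s (a , b , c) (a' , _) = [ b , c ]′ (Separated.meet s a a')

  abstract
    split-cycle : ∀ {C s t} → IsCycle G C → VO C s → VO C t → s ≢ t →
      Σ (Walk s t) λ w → Σ (Walk s t) λ v → Simple w × Simple v × Separated w v ×
        (∀ {g} → g ∈ C → g ∈ᵉ w ⊎ g ∈ᵉ v) × (∀ {g} → g ∈ᵉ w ⊎ g ∈ᵉ v → g ∈ C)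
    split-cycle {C} {s} {t} cyc (e , e∈ , inc) t∈ ne with open-cycle cyc e∈ inc
    ... | y , c with Cyc.w c | Cyc.simple c | cyc-vertex⁻ c t∈ | Cyc.e∉w c
          | (λ {g} → Cyc.edges⁻ c {g}) | (λ {g} → Cyc.edges⁺ c {g})
    ... | w | sw | t∈w | e∉ | e⁻ | e⁺ with split w t∈w
    ... | mkSplit a b refl with simple-⊕⁻ a b sw
    ... | sa , sb , meet = cons e (Cyc.joins c) a , rev b ,
          ((λ s∈ → ne (meet s∈ (end∈ b))) , sa) , simple-rev b sb ,
          record { meet = λ { (inj₁ q) _ → inj₁ q ; (inj₂ q) r → inj₂ (meet q (∈ᵛ-rev⁻ b r)) }
                 ; dis = λ { (inj₁ refl) r → e∉ (∈ᵉ-⊕ʳ a b (∈ᵉ-rev⁻ b r)) ; (inj₂ q) r → no-common q (∈ᵉ-rev⁻ b r) } } ,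
          (λ g∈ → aux⁻ (e⁻ g∈)) , aux⁺
      where
      no-common : ∀ {g} → g ∈ᵉ a → g ∈ᵉ b → ⊥
      no-common g∈a g∈b with ∈ᵉ-joins a sa g∈a
      ... | r , r' , j , r∈ , r'∈ , r≢ =
        r≢ (trans (meet r∈ (∈ᵉ-ends b g∈b (J-incˡ j))) (sym (meet r'∈ (∈ᵉ-ends b g∈b (J-incʳ j)))))
      aux⁻ : ∀ {g} → g ≡ e ⊎ g ∈ᵉ a ⊕ b → (g ≡ e ⊎ g ∈ᵉ a) ⊎ g ∈ᵉ rev b
      aux⁻ (inj₁ q) = inj₁ (inj₁ q)
      aux⁻ (inj₂ q) = ⊎-map inj₂ (∈ᵉ-rev⁺ b) (∈ᵉ-⊕⁻ a b q)
      aux⁺ : ∀ {g} → (g ≡ e ⊎ g ∈ᵉ a) ⊎ g ∈ᵉ rev b → g ∈ C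
      aux⁺ (inj₁ (inj₁ q)) = e⁺ (inj₁ q)
      aux⁺ (inj₁ (inj₂ q)) = e⁺ (inj₂ (∈ᵉ-⊕ˡ a b q))
      aux⁺ (inj₂ q) = e⁺ (inj₂ (∈ᵉ-⊕ʳ a b (∈ᵉ-rev⁻ b q)))

  abstract
    ear-theta : ∀ {C s t} → IsCycle G C → VO C s → VO C t → s ≢ t → (v : Walk s t) → Simple v →
      (∀ {p} → p ∈ᵛ v → VO C p → p ≡ s ⊎ p ≡ t) → (∀ {g} → g ∈ᵉ v → g ∉ C) →
      ∃[ P₁ ] ∃[ P₂ ] Σ (Theta P₁ P₂ (es v)) λ th → C ≡ P₁ ∪ P₂ × Theta.x th ≡ s × Theta.y th ≡ t
    ear-theta {C} {s} {t} cyc s∈ t∈ ne v sv meet dis with split-cycle cyc s∈ t∈ ne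
    ... | w , w' , sw , sw' , sep , e⁻ , e⁺ = es w , es w' , record
      { x≢y = ne ; w₁ = w ; w₂ = w' ; w₃ = v ; s₁ = sw ; s₂ = sw' ; s₃ = sv
      ; e₁⁻ = ∈es⁻ w ; e₁⁺ = ∈es⁺ w ; e₂⁻ = ∈es⁻ w' ; e₂⁺ = ∈es⁺ w' ; e₃⁻ = ∈es⁻ v ; e₃⁺ = ∈es⁺ v
      ; sep₁₂ = sep ; sep₁₃ = mk w (λ q → e⁺ (inj₁ q)) ; sep₂₃ = mk w' (λ q → e⁺ (inj₂ q)) } ,
      ⊆-antisym (λ g∈ → x∈p∪q⁺ (⊎-map (∈es⁺ w) (∈es⁺ w') (e⁻ g∈)))
                (λ g∈ → e⁺ (⊎-map (∈es⁻ w) (∈es⁻ w') (x∈p∪q⁻ (es w) (es w') g∈))) , refl , refl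
      where
      mk : (u : Walk s t) → (∀ {g} → g ∈ᵉ u → g ∈ C) → Separated u v
      mk u inC = record
        { meet = λ p∈ q∈ → let (g , g∈ , inc) = vertex-edge u ne p∈ in meet q∈ (g , inC g∈ , inc)
        ; dis = λ a b → dis b (inC a) }

  data Ear (C C' : Subset m) (f : E) : Set where
    disjoint : VertexDisjoint G C C' → Ear C C' f
    tight : ∀ z → VO C z → VO C' z → (∀ p → VO C p → VO C' p → p ≡ z) → Disjoint C C' → Ear C C' f
    theta : ∀ P₁ P₂ S → Theta P₁ P₂ S → C ≡ P₁ ∪ P₂ → f ∈ S → S ⊆ C' → Ear C C' f

  abstract
    -- An edge f of C' outside C extends along C' in both directions until C is met.
    ear : ∀ {C C' f} → IsCycle G C → IsCycle G C' → f ∈ C' → f ∉ C → Ear C C' f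
    ear {C} {C'} {f} cyc cyc' f∈ f∉ with open-cycle cyc' f∈ (inj₁ refl)
    ... | y , c with first (vo? C) (Cyc.w c)
    ... | inj₁ none = disjoint λ p a b → none (cyc-vertex⁻ c b) a
    ... | inj₂ (s , mkSplit a rest eq , s∈C , fa) with last (vo? C) rest
    ... | inj₁ none = ⊥-elim (none (start∈ rest) s∈C)
    -- Along the opened walk `s` is the first and `t` the last meeting with `C`. The ear runs from
    -- `t` along `b`, across `f` and along `a` to `s`; the stretch `mid` between the meetings is
    -- discarded, and if `s = t` the two cycles are tight.
    ... | inj₂ (t , mkSplit mid b refl , t∈C , lb) = go s a mid b eq s∈C fa lb (s Finₚ.≟ t)
      where
      sw : Simple (Cyc.w c)
      sw = Cyc.simple c
      w∈C' : ∀ {g} → g ∈ᵉ Cyc.w c → g ∈ C'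
      w∈C' q = Cyc.edges⁺ c (inj₂ q)
      no-edge : ∀ {r q s} (w : Walk r q) → Simple w → (∀ {p} → p ∈ᵛ w → VO C p → p ≡ s) → ∀ {g} → g ∈ᵉ w → g ∉ C
      no-edge w sw only {g} g∈ g∈C with ∈ᵉ-joins w sw g∈
      ... | r , r' , j , r∈ , r'∈ , ne = ne (trans (only r∈ (g , g∈C , J-incˡ j)) (sym (only r'∈ (g , g∈C , J-incʳ j))))
      go : ∀ s (a : Walk y s) (mid : Walk s t) (b : Walk t (proj₁ (G f))) → Cyc.w c ≡ a ⊕ (mid ⊕ b) → VO C s →
        (∀ {p} → p ∈ᵛ a → VO C p → p ≡ s) → (∀ {p} → p ∈ᵛ b → VO C p → p ≡ t) → Dec (s ≡ t) → Ear C C' f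
      go s a mid b eq s∈C fa lb dec with simple-⊕⁻ a (mid ⊕ b) (subst Simple eq sw)
      ... | sa , smb , mt with simple-⊕⁻ mid b smb
      go s a mid b eq s∈C fa lb (yes refl) | sa , smb , mt | sm , sb , mt' with simple-closed mid sm
      ... | refl = tight s s∈C (cyc-vertex⁺ c (subst (s ∈ᵛ_) (sym eq) (∈ᵛ-⊕ˡ a b (end∈ a)))) only
              (λ g g∈ g∈' → dis g g∈ (Cyc.edges⁻ c g∈'))
        where
        only : ∀ p → VO C p → VO C' p → p ≡ s
        only p p∈ p∈' with ∈ᵛ-⊕⁻ a b (subst (p ∈ᵛ_) eq (cyc-vertex⁻ c p∈'))
        ... | inj₁ q = fa q p∈
        ... | inj₂ q = lb q p∈
        dis : ∀ g → g ∈ C → g ≡ f ⊎ g ∈ᵉ Cyc.w c → ⊥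
        dis g g∈ (inj₁ refl) = f∉ g∈
        dis g g∈ (inj₂ q) with ∈ᵉ-⊕⁻ a b (subst (g ∈ᵉ_) eq q)
        ... | inj₁ r = no-edge a sa fa r g∈
        ... | inj₂ r = no-edge b sb lb r g∈
      go s a mid b eq s∈C fa lb (no ne) | sa , smb , mt | sm , sb , mt' =
          let (P₁ , P₂ , th , ceq , _) = ear-theta cyc t∈C s∈C (ne ∘ sym) v sv only noC in
          theta P₁ P₂ (es v) th ceq (∈es⁺ v (∈ᵉ-⊕ʳ b (cons f (Cyc.joins c) a) (inj₁ refl))) sub
        where
        v : Walk t s
        v = b ⊕ cons f (Cyc.joins c) a
        ab : ∀ {p} → p ∈ᵛ a → p ∈ᵛ b → ⊥
        ab p∈a p∈b with mt p∈a (∈ᵛ-⊕ʳ mid b p∈b)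
        ... | refl = ne (mt' (start∈ mid) p∈b)
        sv : Simple v
        sv = simple-⊕⁺ b (cons f (Cyc.joins c) a) sb ((λ x∈a → ab x∈a (end∈ b)) , sa)
               λ { _ (inj₁ q) → q ; p∈b (inj₂ p∈a) → ⊥-elim (ab p∈a p∈b) }
        only : ∀ {p} → p ∈ᵛ v → VO C p → p ≡ t ⊎ p ≡ s
        only p∈ p∈C with ∈ᵛ-⊕⁻ b (cons f (Cyc.joins c) a) p∈
        ... | inj₁ q = inj₁ (lb q p∈C)
        ... | inj₂ (inj₁ refl) = inj₁ (lb (end∈ b) p∈C)
        ... | inj₂ (inj₂ q) = inj₂ (fa q p∈C)
        noC : ∀ {g} → g ∈ᵉ v → g ∉ C
        noC g∈ with ∈ᵉ-⊕⁻ b (cons f (Cyc.joins c) a) g∈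
        ... | inj₁ q = no-edge b sb lb q
        ... | inj₂ (inj₁ refl) = f∉
        ... | inj₂ (inj₂ q) = no-edge a sa fa q
        sub : es v ⊆ C'
        sub g∈ with ∈ᵉ-⊕⁻ b (cons f (Cyc.joins c) a) (∈es⁻ v g∈)
        ... | inj₁ q = w∈C' (subst (_ ∈ᵉ_) (sym eq) (∈ᵉ-⊕ʳ a (mid ⊕ b) (∈ᵉ-⊕ʳ mid b q)))
        ... | inj₂ (inj₁ refl) = f∈
        ... | inj₂ (inj₂ q) = w∈C' (subst (_ ∈ᵉ_) (sym eq) (∈ᵉ-⊕ˡ a (mid ⊕ b) q))

  -- Cycles and paths forced by minimum degree two

  module _ (A : E → Set) (u v : V)
    (deg : ∀ {g p z} → A g → J g p z → p ≢ z → p ≢ u → p ≢ v → ∃[ g' ] (g' ≢ g × A g' × Inc g' p)) where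

    private
      CycleIn : Set
      CycleIn = ∃[ C ] (IsCycle G C × (∀ {g} → g ∈ C → A g))

      Grown : V → Set
      Grown t = ∃[ s ] ((s ≡ u ⊎ s ≡ v) × s ≢ t × Σ (Walk s t) λ w → Simple w × (∀ {g} → g ∈ᵉ w → A g))

      -- The walk is prolonged at its start: unless the start is `u` or `v`, `deg` supplies a
      -- further edge, whose other end is either new or closes a cycle. The fuel runs out no earlier
      -- than the vertices, since a simple walk has at most n of them.
      grow : ∀ fuel {s y t} e (j : J e s y) (w : Walk y t) → Simple (cons e j w) → (∀ {g} → g ∈ᵉ cons e j w → A g) →
        n ≤ fuel + len w → CycleIn ⊎ Grown t
      grow zero e j w s a lt = ⊥-elim (ℕₚ.<⇒≱ (Finₚ.injective⇒≤ (vt-injective (cons e j w) s)) (ℕₚ.m≤n⇒m≤1+n lt))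
      grow (suc fuel) {s} {y} e j w (s∉ , sw) a lt with s Finₚ.≟ u | s Finₚ.≟ v
      ... | yes eq | _ = inj₂ (s , inj₁ eq , (λ { refl → s∉ (end∈ w) }) , cons e j w , (s∉ , sw) , a)
      ... | no _ | yes eq = inj₂ (s , inj₂ eq , (λ { refl → s∉ (end∈ w) }) , cons e j w , (s∉ , sw) , a)
      ... | no s≢u | no s≢v with deg (a (inj₁ refl)) j (λ { refl → s∉ (start∈ w) }) s≢u s≢v
      ...   | g , g≢e , Ag , inc with inc-J inc
      ...     | r , k with r ∈ᵛ? cons e j w
      ...       | no r∉ = grow fuel g (J-sym k) (cons e j w) (r∉ , s∉ , sw)
                    (λ { (inj₁ refl) → Ag ; (inj₂ q) → a q }) (subst (n ≤_) (sym (ℕₚ.+-suc fuel (len w))) lt)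
      ...       | yes r∈ with split (cons e j w) r∈
      ...         | mkSplit p q eq with close-walk (J-sym k) p g∉p
        where
        g∉p : ¬ g ∈ᵉ p
        g∉p g∈ with subst (g ∈ᵉ_) (sym eq) (∈ᵉ-⊕ˡ p q g∈)
        ... | inj₁ q = g≢e q
        ... | inj₂ g∈w = s∉ (∈ᵉ-ends w g∈w inc)
      ...           | C , cyc , _ , C⁻ = inj₁ (C , cyc , λ h∈ → aux (C⁻ h∈))
        where
        aux : ∀ {h} → h ≡ g ⊎ h ∈ᵉ p → A h
        aux (inj₁ refl) = Ag
        aux (inj₂ h∈) = a (subst (_ ∈ᵉ_) (sym eq) (∈ᵉ-⊕ˡ p q h∈))

    -- Growing the single edge `g` at both ends, without closing a cycle, stops only at `u` and `v`;
    -- the two stops differ because the walk is simple.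
    cycle-or-path : ∀ {g} → A g → (∃[ C ] (IsCycle G C × (∀ {g} → g ∈ C → A g))) ⊎
      (u ≢ v × Σ (Walk u v) λ w → ∀ {g} → g ∈ᵉ w → A g)
    cycle-or-path {g} Ag with proj₁ (G g) Finₚ.≟ proj₂ (G g)
    ... | yes eq = inj₁ (⁅ g ⁆ , loop-cycle {x = proj₁ (G g)} (inj₁ (cong (proj₁ (G g) ,_) (sym eq))) ,
            λ q → subst A (sym (x∈⁅y⁆⇒x≡y g q)) Ag)
    ... | no ne with grow n g (inj₁ refl) nil (ne , tt) (λ { (inj₁ refl) → Ag }) (ℕₚ.≤-reflexive (sym (ℕₚ.+-identityʳ n)))
    ...   | inj₁ c = inj₁ c
    ...   | inj₂ (s , s∈ , s≢ , w , sw , a) with rev w | simple-rev w sw | (λ {g} → ∈ᵉ-rev⁻ {g = g} w)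
    ...     | nil | _ | _ = ⊥-elim (s≢ refl)
    ...     | cons e j w' | sw' | r with grow n e j w' sw' (λ q → a (r q)) (ℕₚ.m≤m+n n _)
    ...       | inj₁ c = inj₁ c
    ...       | inj₂ (t , t∈ , t≢ , w'' , _ , a') = fin s∈ t∈ t≢
      where
      fin : s ≡ u ⊎ s ≡ v → t ≡ u ⊎ t ≡ v → t ≢ s → (∃[ C ] (IsCycle G C × (∀ {g} → g ∈ C → A g))) ⊎
        (u ≢ v × Σ (Walk u v) λ w → ∀ {g} → g ∈ᵉ w → A g)
      fin (inj₁ refl) (inj₁ refl) ne = ⊥-elim (ne refl)
      fin (inj₂ refl) (inj₂ refl) ne = ⊥-elim (ne refl)
      fin (inj₁ refl) (inj₂ refl) ne = inj₂ (ne ∘ sym , rev w'' , λ q → a' (∈ᵉ-rev⁻ w'' q))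
      fin (inj₂ refl) (inj₁ refl) ne = inj₂ (ne , w'' , a')

  module Matroid (B L F : Subset m → Set) (H : Hypotheses G B L F) where
    open Hypotheses H

    -- Balanced sets and circuits

    open IsQuasiBiased quasiBiased using (only-cycles; cover; BL-disj; BF-disj; LF-disj; LF-meet)
    private module Q = IsQuasiBiased quasiBiased

    Circ : Subset m → Set
    Circ = MCircuit G B L F

    B-cycle : ∀ {C} → B C → IsCycle G C
    B-cycle b = only-cycles _ (inj₁ b)

    L-cycle : ∀ {C} → L C → IsCycle G C
    L-cycle l = only-cycles _ (inj₂ (inj₁ l))

    F-cycle : ∀ {C} → F C → IsCycle G C
    F-cycle f = only-cycles _ (inj₂ (inj₂ f))

    L⇒¬B : ∀ {C} → L C → ¬ B C
    L⇒¬B l b = BL-disj _ b l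

    F⇒¬B : ∀ {C} → F C → ¬ B C
    F⇒¬B f b = BF-disj _ b f

    balanced? : ∀ {C} → IsCycle G C → Dec (B C)
    balanced? {C} cyc with cover C cyc
    ... | inj₁ b = yes b
    ... | inj₂ (inj₁ l) = no (L⇒¬B l)
    ... | inj₂ (inj₂ f) = no (F⇒¬B f)

    theta-third : ∀ {P₁ P₂ P₃} → Theta P₁ P₂ P₃ → B (P₁ ∪ P₂) → B (P₁ ∪ P₃) → B (P₂ ∪ P₃)
    theta-third t b₁₂ b₁₃ = decidable-stable (balanced? (theta-cycle₂₃ t))
      λ ¬b → Q.theta _ _ _ (theta-rep t) (inj₁ (b₁₂ , b₁₃ , ¬b))

    theta-third' : ∀ {P₁ P₂ P₃} → Theta P₁ P₂ P₃ → B (P₁ ∪ P₃) → B (P₂ ∪ P₃) → B (P₁ ∪ P₂)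
    theta-third' t b₁₃ b₂₃ = decidable-stable (balanced? (theta-cycle₁₂ t))
      λ ¬b → Q.theta _ _ _ (theta-rep t) (inj₂ (inj₂ (¬b , b₁₃ , b₂₃)))

    BalE : (E → Set) → Set
    BalE X = ∀ {C} → IsCycle G C → (∀ {g} → g ∈ C → X g) → B C

    _+ᵉ_ : (E → Set) → E → E → Set
    (X +ᵉ e) g = X g ⊎ g ≡ e

    private
      -- The arc P₁ avoiding e is not contained in C', for otherwise P₁ ∪ S would be a cycle
      -- properly inside C'; so exchanging it for the ear S brings C closer to C'.
      exchange : ∀ {X e C'} → BalE X → IsCycle G C' → e ∈ C' → (∀ {g} → g ∈ C' → (X +ᵉ e) g) →
        ∀ {P₁ P₂ S} → Theta P₁ P₂ S → S ⊆ C' → e ∉ P₁ → e ∈ P₂ →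
        B (P₁ ∪ P₂) → (∀ {g} → g ∈ P₁ ∪ P₂ → (X +ᵉ e) g) →
        B (P₂ ∪ S) × e ∈ P₂ ∪ S × (∀ {g} → g ∈ P₂ ∪ S → (X +ᵉ e) g) ×
          ∣ (P₂ ∪ S) ∩ ∁ C' ∣ < ∣ (P₁ ∪ P₂) ∩ ∁ C' ∣
      exchange {X} {e} {C'} bal cyc' e∈' sub' {P₁} {P₂} {S} t S⊆ e∉P₁ e∈P₂ b sub =
        theta-third t b (bal (theta-cycle₁₃ t) in-X) , x∈p∪q⁺ (inj₁ e∈P₂) ,
        (λ g∈ → [ (λ q → sub (x∈p∪q⁺ (inj₂ q))) , (λ q → sub' (S⊆ q)) ]′ (x∈p∪q⁻ P₂ S g∈)) ,
        p⊂q⇒∣p∣<∣q∣ (smaller , witness)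
        where
        open Theta t
        e∉S : e ∉ S
        e∉S q = Separated.dis sep₂₃ (e₂⁻ e∈P₂) (e₃⁻ q)
        X⊎ : ∀ {g} → g ≢ e → (X +ᵉ e) g → X g
        X⊎ ne (inj₁ q) = q
        X⊎ ne (inj₂ q) = ⊥-elim (ne q)
        in-X : ∀ {g} → g ∈ P₁ ∪ S → X g
        in-X g∈ with x∈p∪q⁻ P₁ S g∈
        ... | inj₁ q = X⊎ (λ { refl → e∉P₁ q }) (sub (x∈p∪q⁺ (inj₁ q)))
        ... | inj₂ q = X⊎ (λ { refl → e∉S q }) (sub' (S⊆ q))
        smaller : ∀ {g} → g ∈ (P₂ ∪ S) ∩ ∁ C' → g ∈ (P₁ ∪ P₂) ∩ ∁ C'
        smaller g∈ with x∈p∩q⁻ (P₂ ∪ S) (∁ C') g∈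
        ... | g∈' , g∉ with x∈p∪q⁻ P₂ S g∈'
        ...   | inj₁ q = x∈p∩q⁺ (x∈p∪q⁺ (inj₂ q) , g∉)
        ...   | inj₂ q = ⊥-elim (x∈∁p⇒x∉p g∉ (S⊆ q))
        witness : ∃[ g ] (g ∈ (P₁ ∪ P₂) ∩ ∁ C' × g ∉ (P₂ ∪ S) ∩ ∁ C')
        witness with ⊆-or-witness P₁ C'
        ... | inj₁ P₁⊆ = ⊥-elim ([ e∉P₁ , e∉S ]′ (x∈p∪q⁻ P₁ S
                (cycle⊆cycle (theta-cycle₁₃ t) cyc' (λ g∈ → [ P₁⊆ , S⊆ ]′ (x∈p∪q⁻ P₁ S g∈)) e∈')))
        ... | inj₂ (g , g∈ , g∉) = g , x∈p∩q⁺ (x∈p∪q⁺ (inj₁ g∈) , x∉p⇒x∈∁p g∉) ,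
                λ q → [ (λ r → Separated.dis sep₁₂ (e₁⁻ g∈) (e₂⁻ r)) , (λ r → Separated.dis sep₁₃ (e₁⁻ g∈) (e₃⁻ r)) ]′
                  (x∈p∪q⁻ P₂ S (proj₁ (x∈p∩q⁻ (P₂ ∪ S) (∁ C') q)))

    -- One balanced cycle through `e` puts `e` into the balanced closure of `X`: exchanging arcs for
    -- ears moves that cycle to any other cycle `C'` through `e`, and the number of its edges
    -- outside `C'` drops at each exchange.
    bal-extend : ∀ {X e C} → BalE X → B C → e ∈ C → (∀ {g} → g ∈ C → (X +ᵉ e) g) → BalE (X +ᵉ e)
    bal-extend {X} {e} {C} bal b e∈ sub {C'} cyc' sub' with e ∈? C'
    ... | no e∉ = bal cyc' (λ g∈ → aux g∈ (sub' g∈))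
      where
      aux : ∀ {g} → g ∈ C' → (X +ᵉ e) g → X g
      aux g∈ (inj₁ q) = q
      aux g∈ (inj₂ refl) = ⊥-elim (e∉ g∈)
    ... | yes e∈' = go (suc ∣ C ∩ ∁ C' ∣) C b e∈ sub ℕₚ.≤-refl
      where
      go : ∀ t C → B C → e ∈ C → (∀ {g} → g ∈ C → (X +ᵉ e) g) → ∣ C ∩ ∁ C' ∣ < t → B C'
      go (suc t) C b e∈ sub (s≤s lt) with ⊆-or-witness C' C
      ... | inj₁ C'⊆ = subst B (⊆-antisym (cycle⊆cycle cyc' (B-cycle b) C'⊆) C'⊆) b
      ... | inj₂ (f , f∈ , f∉) with ear (B-cycle b) cyc' f∈ f∉
      ... | disjoint d = ⊥-elim (d _ (e , e∈ , inj₁ refl) (e , e∈' , inj₁ refl))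
      ... | tight _ _ _ _ d = ⊥-elim (d e e∈ e∈')
      ... | theta P₁ P₂ S th refl f∈S S⊆ with e ∈? P₁
      ...   | no e∉₁ =
        let (b' , e'∈ , sub'' , lt') = exchange bal cyc' e∈' sub' th S⊆ e∉₁
              ([ (λ q → ⊥-elim (e∉₁ q)) , (λ q → q) ]′ (x∈p∪q⁻ P₁ P₂ e∈)) b sub
        in go t (P₂ ∪ S) b' e'∈ sub'' (ℕₚ.≤-trans lt' lt)
      ...   | yes e∈₁ =
        let eq = ∪-comm P₁ P₂
            (b' , e'∈ , sub'' , lt') = exchange bal cyc' e∈' sub' (theta-flip th) S⊆
              (λ q → Separated.dis (Theta.sep₁₂ th) (Theta.e₁⁻ th e∈₁) (Theta.e₂⁻ th q)) e∈₁
              (subst B eq b) (λ q → sub (subst (_ ∈_) (sym eq) q))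
        in go t (P₁ ∪ S) b' e'∈ sub'' (ℕₚ.≤-trans lt' (subst (λ Z → ∣ Z ∩ ∁ C' ∣ ≤ t) eq lt))

    Connects : (E → Set) → V → V → Set
    Connects Y p q = Σ (Walk p q) λ w → ∀ {g} → g ∈ᵉ w → Y g

    connects-refl : ∀ {Y p} → Connects Y p p
    connects-refl = nil , λ ()

    connects-trans : ∀ {Y p q r} → Connects Y p q → Connects Y q r → Connects Y p r
    connects-trans (w , a) (v , b) = w ⊕ v , λ g∈ → [ a , b ]′ (∈ᵉ-⊕⁻ w v g∈)

    connects-sym : ∀ {Y p q} → Connects Y p q → Connects Y q p
    connects-sym (w , a) = rev w , λ g∈ → a (∈ᵉ-rev⁻ w g∈)

    connects-mono : ∀ {Y Z : E → Set} {p q} → (∀ {g} → Y g → Z g) → Connects Y p q → Connects Z p q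
    connects-mono f (w , a) = w , λ g∈ → f (a g∈)

    connects-edge : ∀ {Y : E → Set} {g p q} → J g p q → Y g → Connects Y p q
    connects-edge {g = g} j y = cons g j nil , λ { (inj₁ refl) → y }

    walk-connects : ∀ {Y : E → Set} {x y p} (w : Walk x y) → (∀ {g} → g ∈ᵉ w → Y g) → p ∈ᵛ w → Connects Y p y
    walk-connects w a p∈ with split w p∈
    ... | mkSplit u v refl = v , λ g∈ → a (∈ᵉ-⊕ʳ u v g∈)

    abstract
      cycle-connects : ∀ {C p q} → IsCycle G C → VO C p → VO C q → Connects (_∈ C) p q
      cycle-connects cyc (e , e∈ , inc) q∈ with open-cycle cyc e∈ inc
      ... | y , c = connects-sym (walk-connects (Cyc.w c) (λ g∈ → Cyc.edges⁺ c (inj₂ g∈)) (cyc-vertex⁻ c q∈))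

    abstract
      -- Any connection can be trimmed to a minimal one: from the last vertex on `C₁` to the first
      -- later vertex on `C₂`.
      loose-handcuff : ∀ {C₁ C₂ p q} {Y : E → Set} → F C₁ → F C₂ → VertexDisjoint G C₁ C₂ → VO C₁ p → VO C₂ q → Connects Y p q →
        ∃[ x ] ∃[ y ] Σ (Walk x y) λ v → VO C₁ x × VO C₂ y × (∀ {g} → g ∈ᵉ v → Y g) × Circ ((C₁ ∪ C₂) ∪ es v)
      loose-handcuff {C₁} {C₂} {p} {q} f₁ f₂ d p∈ q∈ (w , a) with simplify w
      ... | w' , sw , _ , we with last (vo? C₁) w'
      ... | inj₁ none = ⊥-elim (none (start∈ w') p∈)
      ... | inj₂ (x , mkSplit u v refl , x∈ , lx) with first (vo? C₂) v
      ... | inj₁ none = ⊥-elim (none (end∈ v) q∈)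
      ... | inj₂ (y , mkSplit r s refl , y∈ , fy) =
        let (_ , srs , _) = simple-⊕⁻ u (r ⊕ s) sw
            (sr , _ , _) = simple-⊕⁻ r s srs
            (P , E' , _ , in-w , isS , isE) = toPath r (λ { refl → d x x∈ y∈ }) sr
        in x , y , r , x∈ , y∈ , (λ g∈ → a (we (∈ᵉ-⊕ʳ u (r ⊕ s) (∈ᵉ-⊕ˡ r s g∈)))) ,
          inj₂ (inj₂ (inj₂ (inj₂ (C₁ , C₂ , x , y , P , es r , f₁ , f₂ , d , E' , x∈ , y∈ ,
            (λ j c → isS j (lx (∈ᵛ-⊕ˡ r s (in-w j)) c)) , (λ j c → isE j (fy (in-w j) c)) , refl))))

    abstract
      -- If `C₀` is unbalanced it extends `C₁` by an ear containing `e`. A theta gives a balanced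
      -- cycle through the ear or is a circuit itself; cycles that meet in one vertex give a tight
      -- handcuff. Disjoint cycles lie both in L or both in F by `LF-meet`, and in the second case
      -- `conn` supplies the path.
      circuit-through : ∀ {C₁ C₀ e} {Y : E → Set} → IsCycle G C₁ → ¬ B C₁ → IsCycle G C₀ → e ∈ C₀ → e ∉ C₁ →
        (∀ {g} → g ∈ C₁ → Y g) → (∀ {g} → g ∈ C₀ → Y g) →
        (L C₁ ⊎ ∃[ p ] ∃[ q ] (VO C₀ p × VO C₁ q × Connects Y p q)) →
        ∃[ X ] (Circ X × e ∈ X × (∀ {g} → g ∈ X → Y g))
      circuit-through {C₁} {C₀} {e} {Y} cyc₁ ¬b₁ cyc₀ e∈ e∉ Y₁ Y₀ conn with cover C₀ cyc₀
      ... | inj₁ b = C₀ , inj₁ b , e∈ , Y₀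
      ... | inj₂ LF with ear cyc₁ cyc₀ e∈ e∉
      ... | tight z z₁ z₀ only d = C₁ ∪ C₀ ,
          inj₂ (inj₂ (inj₁ (C₁ , C₀ , cyc₁ , cyc₀ , d , (z , z₁ , z₀ , only) , ¬b₁ , [ L⇒¬B , F⇒¬B ]′ LF , refl))) ,
          x∈p∪q⁺ (inj₂ e∈) , λ q → [ Y₁ , Y₀ ]′ (x∈p∪q⁻ C₁ C₀ q)
      ... | theta P₁ P₂ S th refl e∈S S⊆ with balanced? (theta-cycle₁₃ th) | balanced? (theta-cycle₂₃ th)
      ...   | yes b | _ = P₁ ∪ S , inj₁ b , x∈p∪q⁺ (inj₂ e∈S) ,
            λ q → [ (λ r → Y₁ (x∈p∪q⁺ (inj₁ r))) , (λ r → Y₀ (S⊆ r)) ]′ (x∈p∪q⁻ P₁ S q)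
      ...   | no _ | yes b = P₂ ∪ S , inj₁ b , x∈p∪q⁺ (inj₂ e∈S) ,
            λ q → [ (λ r → Y₁ (x∈p∪q⁺ (inj₂ r))) , (λ r → Y₀ (S⊆ r)) ]′ (x∈p∪q⁻ P₂ S q)
      ...   | no b₁₃ | no b₂₃ = (P₁ ∪ P₂) ∪ S ,
            inj₂ (inj₁ (P₁ , P₂ , S , theta-rep th , refl , ¬b₁ , b₁₃ , b₂₃)) , x∈p∪q⁺ (inj₂ e∈S) ,
            λ q → [ Y₁ , (λ r → Y₀ (S⊆ r)) ]′ (x∈p∪q⁻ (P₁ ∪ P₂) S q)
      circuit-through {C₁} {C₀} {e} {Y} cyc₁ ¬b₁ cyc₀ e∈ e∉ Y₁ Y₀ conn | inj₂ LF | disjoint d = go LF (cover C₁ cyc₁) conn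
        where
        go : L C₀ ⊎ F C₀ → B C₁ ⊎ L C₁ ⊎ F C₁ → (L C₁ ⊎ ∃[ p ] ∃[ q ] (VO C₀ p × VO C₁ q × Connects Y p q)) → ∃[ X ] (Circ X × e ∈ X × (∀ {g} → g ∈ X → Y g))
        go _ (inj₁ b) _ = ⊥-elim (¬b₁ b)
        go (inj₁ l₀) (inj₂ (inj₁ l₁)) _ = C₁ ∪ C₀ , inj₂ (inj₂ (inj₂ (inj₁ (C₁ , C₀ , l₁ , l₀ , d , refl)))) ,
          x∈p∪q⁺ (inj₂ e∈) , λ q → [ Y₁ , Y₀ ]′ (x∈p∪q⁻ C₁ C₀ q)
        go (inj₁ l₀) (inj₂ (inj₂ f₁)) _ with LF-meet _ _ l₀ f₁
        ... | v , a , b = ⊥-elim (d v b a)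
        go (inj₂ f₀) (inj₂ (inj₁ l₁)) _ with LF-meet _ _ l₁ f₀
        ... | v , a , b = ⊥-elim (d v a b)
        go (inj₂ f₀) (inj₂ (inj₂ f₁)) conn with conn
        ... | inj₁ l = ⊥-elim (LF-disj _ l f₁)
        ... | inj₂ (p , q , p∈ , q∈ , cn) with loose-handcuff f₀ f₁ (λ v a b → d v b a) p∈ q∈ cn
        ...   | x , y , v , _ , _ , vY , circ = (C₀ ∪ C₁) ∪ es v , circ , x∈p∪q⁺ (inj₁ (x∈p∪q⁺ (inj₁ e∈))) ,
          λ r → [ (λ r → [ Y₀ , Y₁ ]′ (x∈p∪q⁻ C₀ C₁ r)) , (λ r → vY (∈es⁻ v r)) ]′ (x∈p∪q⁻ (C₀ ∪ C₁) (es v) r)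

    -- By `circuit-through` the two cycles would span a circuit inside `I`.
    indep-two-cycles : ∀ {I C C'} → Indep Circ I → IsCycle G C → IsCycle G C' → C ⊆ I → C' ⊆ I → ¬ C' ⊆ C →
      ¬ (L C ⊎ ∃[ p ] ∃[ q ] (VO C' p × VO C q × Connects (_∈ I) p q))
    indep-two-cycles {I} {C} {C'} ind cyc cyc' C⊆ C'⊆ ¬sub conn with ⊆-or-witness C' C
    ... | inj₁ sub = ¬sub sub
    ... | inj₂ (e , e∈ , e∉) with circuit-through {Y = _∈ I} cyc (λ b → ind C (inj₁ b) C⊆) cyc' e∈ e∉ C⊆ C'⊆ conn
    ...   | X , circ , _ , X⊆ = ind X circ X⊆

    -- Local structure of circuits

    Link : E → V → Set
    Link g v = ∃[ z ] (J g v z × v ≢ z)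

    inc-cases : ∀ {g v} → Inc g v → J g v v ⊎ Link g v
    inc-cases {g} {v} inc with inc-J inc
    ... | z , j with v Finₚ.≟ z
    ...   | yes refl = inj₁ j
    ...   | no ne = inj₂ (z , j , ne)

    loop-not-link : ∀ {g v x y} → J g v v → J g x y → x ≡ y
    loop-not-link j k with J-ends j (J-incˡ k) | J-ends j (J-incʳ k)
    ... | inj₁ refl | inj₁ refl = refl
    ... | inj₁ refl | inj₂ refl = refl
    ... | inj₂ refl | inj₁ refl = refl
    ... | inj₂ refl | inj₂ refl = refl

    singleton-cycle : ∀ {C g v} → IsCycle G C → g ∈ C → J g v v → C ≡ ⁅ g ⁆
    singleton-cycle {g = g} cyc g∈ j = ⊆-antisym (λ h∈ → subst (_∈ ⁅ g ⁆) (sym (cycle-loop cyc g∈ j h∈)) (x∈⁅x⁆ g))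
      (λ h∈ → subst (_∈ _) (sym (x∈⁅y⁆⇒x≡y g h∈)) g∈)

    abstract
      cycle-links : ∀ {C g v} → IsCycle G C → g ∈ C → Link g v → ∃[ g' ] (g' ≢ g × g' ∈ C × Link g' v)
      cycle-links cyc g∈ (z , j , ne) with open-cycle cyc g∈ (J-incˡ j)
      ... | y , c with J-unique j (Cyc.joins c)
      ...   | refl with cyc-degree≥2 c ne
      ...     | g' , g'≢ , g'∈ , inc with inc-cases inc
      ...       | inj₁ lp = ⊥-elim (g'≢ (sym (cycle-loop cyc g'∈ lp g∈)))
      ...       | inj₂ lk = g' , g'≢ , g'∈ , lk

    simple-edge-link : ∀ {x y g v} (w : Walk x y) → Simple w → g ∈ᵉ w → Inc g v → Link g v
    simple-edge-link w s g∈ inc with inc-cases inc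
    ... | inj₂ lk = lk
    ... | inj₁ lp with ∈ᵉ-joins w s g∈
    ...   | r , r' , j , _ , _ , ne = ⊥-elim (ne (loop-not-link lp j))

    walk-degree : ∀ {x y g v} (w : Walk x y) → Simple w → g ∈ᵉ w → Inc g v → v ≢ x → v ≢ y →
      ∃[ g' ] (g' ≢ g × g' ∈ᵉ w × Inc g' v)
    walk-degree {g = g} {v} w s g∈ inc v≢x v≢y with split w (∈ᵉ-ends w g∈ inc)
    ... | mkSplit a b refl with simple-⊕⁻ a b s | vertex-edge a (v≢x ∘ sym) (end∈ a) | vertex-edge b v≢y (start∈ b)
    ... | sa , sb , meet | g₁ , g₁∈ , i₁ | g₂ , g₂∈ , i₂ with g Finₚ.≟ g₁
    ... | no ne = g₁ , ne ∘ sym , ∈ᵉ-⊕ˡ a b g₁∈ , i₁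
    ... | yes refl = g₂ , (λ q → no-common (subst (_∈ᵉ a) (sym q) g₁∈)) , ∈ᵉ-⊕ʳ a b g₂∈ , i₂
      where
      no-common : ¬ g₂ ∈ᵉ a
      no-common q with ∈ᵉ-joins a sa q
      ... | r , r' , j , r∈ , r'∈ , ne =
        ne (trans (meet r∈ (∈ᵉ-ends b g₂∈ (J-incˡ j))) (sym (meet r'∈ (∈ᵉ-ends b g₂∈ (J-incʳ j)))))

    data CircuitView : Subset m → Set where
      balanced : ∀ {X} → B X → CircuitView X
      thetaᶜ : ∀ {P₁ P₂ P₃} → Theta P₁ P₂ P₃ → ¬ B (P₁ ∪ P₂) → ¬ B (P₁ ∪ P₃) → ¬ B (P₂ ∪ P₃) →
        CircuitView ((P₁ ∪ P₂) ∪ P₃)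
      tightᶜ : ∀ {C₁ C₂} u → IsCycle G C₁ → IsCycle G C₂ → Disjoint C₁ C₂ → VO C₁ u → VO C₂ u →
        (∀ w → VO C₁ w → VO C₂ w → w ≡ u) → ¬ B C₁ → ¬ B C₂ → CircuitView (C₁ ∪ C₂)
      bracelet : ∀ {C₁ C₂} → L C₁ → L C₂ → VertexDisjoint G C₁ C₂ → CircuitView (C₁ ∪ C₂)
      looseᶜ : ∀ {C₁ C₂ P x y} (w : Walk x y) → Simple w → x ≢ y → F C₁ → F C₂ → VertexDisjoint G C₁ C₂ →
        VO C₁ x → VO C₂ y → (∀ {g} → g ∈ P → g ∈ᵉ w) → (∀ {g} → g ∈ᵉ w → g ∈ P) → CircuitView ((C₁ ∪ C₂) ∪ P)

    circuit-view : ∀ {X} → Circ X → CircuitView X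
    circuit-view (inj₁ b) = balanced b
    circuit-view (inj₂ (inj₁ (_ , _ , _ , t , refl , a , b , c))) = thetaᶜ (theta-walks t) a b c
    circuit-view (inj₂ (inj₂ (inj₁ (_ , _ , c₁ , c₂ , d , (u , u₁ , u₂ , o) , b₁ , b₂ , refl)))) =
      tightᶜ u c₁ c₂ d u₁ u₂ o b₁ b₂
    circuit-view (inj₂ (inj₂ (inj₂ (inj₁ (_ , _ , l₁ , l₂ , d , refl))))) = bracelet l₁ l₂ d
    circuit-view (inj₂ (inj₂ (inj₂ (inj₂ (_ , _ , x , y , p , P , f₁ , f₂ , d , E' , x∈ , y∈ , _ , _ , refl)))))
      with fromPath p
    ... | w , s , e⁻ , e⁺ , _ = looseᶜ w s (λ { refl → d x x∈ y∈ }) f₁ f₂ d x∈ y∈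
      (λ {g} g∈ → let (i , q) = to (E' g) g∈ in subst (_∈ᵉ w) q (e⁺ i)) (λ {g} g∈ → from (E' g) (e⁻ g∈))

    private
      ∪ˡ : ∀ {X Y : Subset m} {g} → g ∈ X → g ∈ X ∪ Y
      ∪ˡ q = x∈p∪q⁺ (inj₁ q)
      ∪ʳ : ∀ {X Y : Subset m} {g} → g ∈ Y → g ∈ X ∪ Y
      ∪ʳ q = x∈p∪q⁺ (inj₂ q)

    FLoopAt : Subset m → V → Set
    FLoopAt X v = ∃[ ℓ ] (ℓ ∈ X × J ℓ v v × F ⁅ ℓ ⁆)

    -- The exceptional case is the foot of a loose handcuff whose cycle at that end is a single
    -- loop; this loop is then in F.
    circuit-links : ∀ {X g v} → Circ X → g ∈ X → Link g v →
      (∃[ g' ] (g' ≢ g × g' ∈ X × Link g' v)) ⊎ FLoopAt X v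
    circuit-links {X} {g} {v} circ = go (circuit-view circ)
      where
      Goal : Subset m → Set
      Goal X = (∃[ g' ] (g' ≢ g × g' ∈ X × Link g' v)) ⊎ FLoopAt X v
      cyc : ∀ {C X} → IsCycle G C → C ⊆ X → g ∈ C → Link g v → Goal X
      cyc c sub g∈ lk with cycle-links c g∈ lk
      ... | g' , ne , g'∈ , lk' = inj₁ (g' , ne , sub g'∈ , lk')
      atEnd : ∀ {C X} → F C → C ⊆ X → g ∉ C → VO C v → Goal X
      atEnd f sub g∉ (h , h∈ , inc) with inc-cases inc
      ... | inj₂ lk = inj₁ (h , (λ { refl → g∉ h∈ }) , sub h∈ , lk)
      ... | inj₁ lp = inj₂ (h , sub h∈ , lp , subst F (singleton-cycle (F-cycle f) h∈ lp) f)
      go : ∀ {X} → CircuitView X → g ∈ X → Link g v → Goal X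
      go (balanced b) g∈ lk = cyc (B-cycle b) (λ q → q) g∈ lk
      go (thetaᶜ {P₁} {P₂} {P₃} t _ _ _) g∈ lk with x∈p∪q⁻ (P₁ ∪ P₂) P₃ g∈
      ... | inj₁ q = cyc (theta-cycle₁₂ t) ∪ˡ q lk
      ... | inj₂ q = cyc (theta-cycle₁₃ t) (λ r → [ ∪ˡ ∘ ∪ˡ , ∪ʳ ]′ (x∈p∪q⁻ P₁ P₃ r)) (∪ʳ q) lk
      go (tightᶜ {C₁} {C₂} u c₁ c₂ _ _ _ _ _ _) g∈ lk with x∈p∪q⁻ C₁ C₂ g∈
      ... | inj₁ q = cyc c₁ ∪ˡ q lk
      ... | inj₂ q = cyc c₂ ∪ʳ q lk
      go (bracelet {C₁} {C₂} l₁ l₂ _) g∈ lk with x∈p∪q⁻ C₁ C₂ g∈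
      ... | inj₁ q = cyc (L-cycle l₁) ∪ˡ q lk
      ... | inj₂ q = cyc (L-cycle l₂) ∪ʳ q lk
      go (looseᶜ {C₁} {C₂} {P} {x} {y} w s x≢y f₁ f₂ d x∈ y∈ e⁻ e⁺) g∈ lk with g ∈? C₁ | g ∈? C₂
      ... | yes q | _ = cyc (F-cycle f₁) (∪ˡ ∘ ∪ˡ) q lk
      ... | no _ | yes q = cyc (F-cycle f₂) (∪ˡ ∘ ∪ʳ) q lk
      ... | no g∉₁ | no g∉₂ with v Finₚ.≟ x | v Finₚ.≟ y
      ...   | yes refl | _ = atEnd f₁ (∪ˡ ∘ ∪ˡ) g∉₁ x∈
      ...   | no _ | yes refl = atEnd f₂ (∪ˡ ∘ ∪ʳ) g∉₂ y∈
      ...   | no a | no b with x∈p∪q⁻ (C₁ ∪ C₂) P g∈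
      ...     | inj₁ q = ⊥-elim ([ g∉₁ , g∉₂ ]′ (x∈p∪q⁻ C₁ C₂ q))
      ...     | inj₂ q with walk-degree w s (e⁻ q) (J-incˡ (proj₁ (proj₂ lk))) a b
      ...       | g' , ne , g'∈ , inc = inj₁ (g' , ne , ∪ʳ (e⁺ g'∈) , simple-edge-link w s g'∈ inc)

    -- A loop lies in no theta and on no path. In a handcuff it is one of the two cycles, and the
    -- other cycle or the path provides a further edge at `v`; the last alternative comes from two
    -- disjoint cycles of L.
    circuit-loops : ∀ {X g v} → Circ X → g ∈ X → J g v v →
      B ⁅ g ⁆ ⊎ (∃[ g' ] (g' ≢ g × g' ∈ X × Inc g' v)) ⊎ (L ⁅ g ⁆ × ∃[ C ] (L C × C ⊆ X × g ∉ C))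
    circuit-loops {X} {g} {v} circ g∈X lp = go (circuit-view circ) g∈X
      where
      Goal : Subset m → Set
      Goal X = B ⁅ g ⁆ ⊎ (∃[ g' ] (g' ≢ g × g' ∈ X × Inc g' v)) ⊎ (L ⁅ g ⁆ × ∃[ C ] (L C × C ⊆ X × g ∉ C))
      no-loop : ∀ {x y} (w : Walk x y) → Simple w → ¬ g ∈ᵉ w
      no-loop w s g∈ with ∈ᵉ-joins w s g∈
      ... | r , r' , j , _ , _ , ne = ne (loop-not-link lp j)
      at : ∀ {C u} → IsCycle G C → g ∈ C → VO C u → u ≡ v
      at c g∈ (h , h∈ , inc) with cycle-loop c g∈ lp h∈
      ... | refl = [ (λ q → q) , (λ q → q) ]′ (J-ends lp inc)
      go : ∀ {X} → CircuitView X → g ∈ X → Goal X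
      go (balanced b) g∈ = inj₁ (subst B (singleton-cycle (B-cycle b) g∈ lp) b)
      go (thetaᶜ {P₁} {P₂} {P₃} t _ _ _) g∈ with x∈p∪q⁻ (P₁ ∪ P₂) P₃ g∈
      ... | inj₂ q = ⊥-elim (no-loop (Theta.w₃ t) (Theta.s₃ t) (Theta.e₃⁻ t q))
      ... | inj₁ r with x∈p∪q⁻ P₁ P₂ r
      ...   | inj₁ q = ⊥-elim (no-loop (Theta.w₁ t) (Theta.s₁ t) (Theta.e₁⁻ t q))
      ...   | inj₂ q = ⊥-elim (no-loop (Theta.w₂ t) (Theta.s₂ t) (Theta.e₂⁻ t q))
      go (tightᶜ {C₁} {C₂} u c₁ c₂ d u₁ u₂ _ _ _) g∈ with x∈p∪q⁻ C₁ C₂ g∈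
      ... | inj₁ q with at c₁ q u₁ | u₂
      ...   | refl | h , h∈ , inc = inj₂ (inj₁ (h , (λ { refl → d g q h∈ }) , ∪ʳ h∈ , inc))
      go (tightᶜ {C₁} {C₂} u c₁ c₂ d u₁ u₂ _ _ _) g∈ | inj₂ q with at c₂ q u₂ | u₁
      ...   | refl | h , h∈ , inc = inj₂ (inj₁ (h , (λ { refl → d g h∈ q }) , ∪ˡ h∈ , inc))
      go (bracelet {C₁} {C₂} l₁ l₂ d) g∈ with x∈p∪q⁻ C₁ C₂ g∈
      ... | inj₁ q = inj₂ (inj₂ (subst L (singleton-cycle (L-cycle l₁) q lp) l₁ , C₂ , l₂ , ∪ʳ ,
              λ r → d _ (g , q , inj₁ refl) (g , r , inj₁ refl)))
      ... | inj₂ q = inj₂ (inj₂ (subst L (singleton-cycle (L-cycle l₂) q lp) l₂ , C₁ , l₁ , ∪ˡ ,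
              λ r → d _ (g , r , inj₁ refl) (g , q , inj₁ refl)))
      go (looseᶜ {C₁} {C₂} {P} {x} {y} w s x≢y f₁ f₂ d x∈ y∈ e⁻ e⁺) g∈ with x∈p∪q⁻ (C₁ ∪ C₂) P g∈
      ... | inj₂ q = ⊥-elim (no-loop w s (e⁻ q))
      ... | inj₁ r with x∈p∪q⁻ C₁ C₂ r
      ...   | inj₁ q with at (F-cycle f₁) q x∈ | vertex-edge w x≢y (start∈ w)
      ...     | refl | h , h∈ , inc = inj₂ (inj₁ (h , (λ { refl → no-loop w s h∈ }) , ∪ʳ (e⁺ h∈) , inc))
      go (looseᶜ {C₁} {C₂} {P} {x} {y} w s x≢y f₁ f₂ d x∈ y∈ e⁻ e⁺) g∈ | inj₁ r | inj₂ q
        with at (F-cycle f₂) q y∈ | vertex-edge w x≢y (end∈ w)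
      ...     | refl | h , h∈ , inc = inj₂ (inj₁ (h , (λ { refl → no-loop w s h∈ }) , ∪ʳ (e⁺ h∈) , inc))

    -- Meant for flats with balanced edge set: if all of the circuit except `g` lies in such a set,
    -- the second alternative fails and the circuit is a balanced cycle through `g`.
    circuit-unbalanced-cycle : ∀ {X g} → Circ X → g ∈ X → B X ⊎ ∃[ K ] (IsCycle G K × ¬ B K × K ⊆ X × g ∉ K)
    circuit-unbalanced-cycle {X} {g} circ = go (circuit-view circ)
      where
      Goal : Subset m → Set
      Goal X = B X ⊎ ∃[ K ] (IsCycle G K × ¬ B K × K ⊆ X × g ∉ K)
      vd : ∀ {C C'} → VertexDisjoint G C C' → g ∈ C → g ∉ C'
      vd d a b = d _ (g , a , inj₁ refl) (g , b , inj₁ refl)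
      go : ∀ {X} → CircuitView X → g ∈ X → Goal X
      go (balanced b) g∈ = inj₁ b
      go (thetaᶜ {P₁} {P₂} {P₃} t b₁₂ b₁₃ b₂₃) g∈ with x∈p∪q⁻ (P₁ ∪ P₂) P₃ g∈
      ... | inj₂ q = inj₂ (_ , theta-cycle₁₂ t , b₁₂ , ∪ˡ ,
            λ r → [ (λ r → Separated.dis sep₁₃ (e₁⁻ r) (e₃⁻ q)) , (λ r → Separated.dis sep₂₃ (e₂⁻ r) (e₃⁻ q)) ]′ (x∈p∪q⁻ P₁ P₂ r))
        where open Theta t
      ... | inj₁ q' with x∈p∪q⁻ P₁ P₂ q'
      ...   | inj₁ q = inj₂ (_ , theta-cycle₂₃ t , b₂₃ , (λ r → [ ∪ˡ ∘ ∪ʳ , ∪ʳ ]′ (x∈p∪q⁻ P₂ P₃ r)) ,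
            λ r → [ (λ r → Separated.dis sep₁₂ (e₁⁻ q) (e₂⁻ r)) , (λ r → Separated.dis sep₁₃ (e₁⁻ q) (e₃⁻ r)) ]′ (x∈p∪q⁻ P₂ P₃ r))
        where open Theta t
      ...   | inj₂ q = inj₂ (_ , theta-cycle₁₃ t , b₁₃ , (λ r → [ ∪ˡ ∘ ∪ˡ , ∪ʳ ]′ (x∈p∪q⁻ P₁ P₃ r)) ,
            λ r → [ (λ r → Separated.dis sep₁₂ (e₁⁻ r) (e₂⁻ q)) , (λ r → Separated.dis sep₂₃ (e₂⁻ q) (e₃⁻ r)) ]′ (x∈p∪q⁻ P₁ P₃ r))
        where open Theta t
      go (tightᶜ {C₁} {C₂} u c₁ c₂ d _ _ _ b₁ b₂) g∈ with x∈p∪q⁻ C₁ C₂ g∈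
      ... | inj₁ q = inj₂ (C₂ , c₂ , b₂ , ∪ʳ , λ r → d g q r)
      ... | inj₂ q = inj₂ (C₁ , c₁ , b₁ , ∪ˡ , λ r → d g r q)
      go (bracelet {C₁} {C₂} l₁ l₂ d) g∈ with g ∈? C₁
      ... | yes q = inj₂ (C₂ , L-cycle l₂ , L⇒¬B l₂ , ∪ʳ , vd d q)
      ... | no q = inj₂ (C₁ , L-cycle l₁ , L⇒¬B l₁ , ∪ˡ , q)
      go (looseᶜ {C₁} {C₂} w s x≢y f₁ f₂ d x∈ y∈ e⁻ e⁺) g∈ with g ∈? C₁
      ... | yes q = inj₂ (C₂ , F-cycle f₂ , F⇒¬B f₂ , ∪ˡ ∘ ∪ʳ , vd d q)
      ... | no q = inj₂ (C₁ , F-cycle f₁ , F⇒¬B f₁ , ∪ˡ ∘ ∪ˡ , q)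

    -- Two disjoint cycles of L form the only kind of circuit that need not be connected as a
    -- subgraph.
    circuit-connected : ∀ {X} → Circ X →
      (∃[ C₁ ] ∃[ C₂ ] (L C₁ × L C₂ × X ≡ C₁ ∪ C₂)) ⊎ (∀ {p q} → VO X p → VO X q → Connects (_∈ X) p q)
    circuit-connected circ = go (circuit-view circ)
      where
      to-root : ∀ {X} r → (∀ {p} → VO X p → Connects (_∈ X) p r) → ∀ {p q} → VO X p → VO X q → Connects (_∈ X) p q
      to-root r c p∈ q∈ = connects-trans (c p∈) (connects-sym (c q∈))
      go : ∀ {X} → CircuitView X →
        (∃[ C₁ ] ∃[ C₂ ] (L C₁ × L C₂ × X ≡ C₁ ∪ C₂)) ⊎ (∀ {p q} → VO X p → VO X q → Connects (_∈ X) p q)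
      go (balanced b) = inj₂ (cycle-connects (B-cycle b))
      go (bracelet {C₁} {C₂} l₁ l₂ _) = inj₁ (C₁ , C₂ , l₁ , l₂ , refl)
      go (tightᶜ {C₁} {C₂} u c₁ c₂ _ u₁ u₂ _ _ _) = inj₂ (to-root u c)
        where
        c : ∀ {p} → VO (C₁ ∪ C₂) p → Connects (_∈ C₁ ∪ C₂) p u
        c (g , g∈ , inc) with x∈p∪q⁻ C₁ C₂ g∈
        ... | inj₁ q = connects-mono ∪ˡ (cycle-connects c₁ (g , q , inc) u₁)
        ... | inj₂ q = connects-mono ∪ʳ (cycle-connects c₂ (g , q , inc) u₂)
      go (thetaᶜ {P₁} {P₂} {P₃} t _ _ _) = inj₂ (to-root y c)
        where
        open Theta t
        c : ∀ {p} → VO ((P₁ ∪ P₂) ∪ P₃) p → Connects (_∈ (P₁ ∪ P₂) ∪ P₃) p y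
        c (g , g∈ , inc) with x∈p∪q⁻ (P₁ ∪ P₂) P₃ g∈
        ... | inj₂ q = walk-connects w₃ (∪ʳ ∘ e₃⁺) (∈ᵉ-ends w₃ (e₃⁻ q) inc)
        ... | inj₁ r with x∈p∪q⁻ P₁ P₂ r
        ...   | inj₁ q = walk-connects w₁ (∪ˡ ∘ ∪ˡ ∘ e₁⁺) (∈ᵉ-ends w₁ (e₁⁻ q) inc)
        ...   | inj₂ q = walk-connects w₂ (∪ˡ ∘ ∪ʳ ∘ e₂⁺) (∈ᵉ-ends w₂ (e₂⁻ q) inc)
      go (looseᶜ {C₁} {C₂} {P} {x} {y} w s _ f₁ f₂ _ x∈ y∈ e⁻ e⁺) = inj₂ (to-root y c)
        where
        c : ∀ {p} → VO ((C₁ ∪ C₂) ∪ P) p → Connects (_∈ (C₁ ∪ C₂) ∪ P) p y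
        c (g , g∈ , inc) with x∈p∪q⁻ (C₁ ∪ C₂) P g∈
        ... | inj₂ q = walk-connects w (∪ʳ ∘ e⁺) (∈ᵉ-ends w (e⁻ q) inc)
        ... | inj₁ r with x∈p∪q⁻ C₁ C₂ r
        ...   | inj₁ q = connects-trans (connects-mono (∪ˡ ∘ ∪ˡ) (cycle-connects (F-cycle f₁) (g , q , inc) x∈)) (w , ∪ʳ ∘ e⁺)
        ...   | inj₂ q = connects-mono (∪ˡ ∘ ∪ʳ) (cycle-connects (F-cycle f₂) (g , q , inc) y∈)

    -- 3-connectivity

    circuit-nonempty : ∀ {X} → Circ X → ∃[ g ] g ∈ X
    circuit-nonempty circ = go (circuit-view circ)
      where
      left : ∀ {X Y : Subset m} → ∃[ g ] g ∈ X → ∃[ g ] g ∈ X ∪ Y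
      left (g , q) = g , x∈p∪q⁺ (inj₁ q)
      go : ∀ {X} → CircuitView X → ∃[ g ] g ∈ X
      go (balanced b) = isCycle-nonempty (B-cycle b)
      go (thetaᶜ t _ _ _) = left (isCycle-nonempty (theta-cycle₁₂ t))
      go (tightᶜ _ c _ _ _ _ _ _ _) = left (isCycle-nonempty c)
      go (bracelet l _ _) = left (isCycle-nonempty (L-cycle l))
      go (looseᶜ _ _ _ f _ _ _ _ _ _) = left (left (isCycle-nonempty (F-cycle f)))

    abstract
      link-at : ∀ v → ∃[ g ] Link g v
      link-at v with component v
      ... | w , w≢v , p with fromPath p
      ...   | nil , _ = ⊥-elim (w≢v refl)
      ...   | cons {y = y} e j w' , (v∉ , _) , _ = e , y , j , λ { refl → v∉ (start∈ w') }

    endsOf : List E → List V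
    endsOf [] = []
    endsOf (g ∷ gs) = proj₁ (G g) ∷ proj₂ (G g) ∷ endsOf gs

    endsOf-inc : ∀ {g v} gs → g ∈ˡ gs → Inc g v → v ∈ˡ endsOf gs
    endsOf-inc (g ∷ gs) (here refl) (inj₁ refl) = here refl
    endsOf-inc (g ∷ gs) (here refl) (inj₂ refl) = there (here refl)
    endsOf-inc (g ∷ gs) (there q) inc = there (there (endsOf-inc gs q inc))

    private
      5≤n : 5 ≤ n
      5≤n = ℕₚ.≤-trans (ℕₚ.m≤n+m 5 2) 6<n

    another-edge : ∀ g h → ∃[ e ] (e ≢ g × e ≢ h)
    another-edge g h with fresh (endsOf (g ∷ h ∷ [])) 5≤n
    ... | v , v∉ with link-at v
    ...   | e , z , j , _ = e , (λ { refl → v∉ (endsOf-inc _ (here refl) (J-incˡ j)) }) ,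
              (λ { refl → v∉ (endsOf-inc _ (there (here refl)) (J-incˡ j)) })

    -- Three edges have at most six ends, so by `6 < n` a vertex is left, and the edge found there
    -- is different from all three.
    two-more-edges : ∀ g h → ∃[ e ] ∃[ e' ] (e ≢ e' × e ≢ g × e ≢ h × e' ≢ g × e' ≢ h)
    two-more-edges g h with another-edge g h
    ... | e , e≢g , e≢h with fresh (endsOf (e ∷ g ∷ h ∷ [])) 6<n
    ...   | v , v∉ with link-at v
    ...     | e' , z , j , _ = e , e' , out (here refl) , e≢g , e≢h ,
                out (there (here refl)) ∘ sym , out (there (there (here refl))) ∘ sym
      where
      out : ∀ {f} → f ∈ˡ (e ∷ g ∷ h ∷ []) → f ≢ e'
      out f∈ refl = v∉ (endsOf-inc _ f∈ (J-incˡ j))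

    -- It would be a loop of M, a set of rank zero, and hence one side of a 1-separation.
    no-balanced-loop : ∀ {g v} → J g v v → ¬ B ⁅ g ⁆
    no-balanced-loop {g} {v} lp b with another-edge g g
    ... | e , e≢g , _ = separation Circ circuit-nonempty 1 ⁅ g ⁆ (one≤ (x∈⁅x⁆ g))
      (one≤ {a = e} (x∉p⇒x∈∁p (λ q → e≢g (x∈⁅y⁆⇒x≡y g q))))
      (λ I J I⊆ J⊆ Ii Ji → pure (J , Ji , s≤s (ℕₚ.≤-reflexive (cong (_+ ∣ J ∣) (empty I I⊆ Ii)))))
      (proj₁ three)
      where
      empty : ∀ I → I ⊆ ⁅ g ⁆ → Indep Circ I → ∣ I ∣ ≡ 0
      empty I I⊆ Ii = ℕₚ.n≤0⇒n≡0 (ℕₚ.≤-pred (subst (suc ∣ I ∣ ≤_) (∣⁅x⁆∣≡1 g)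
        (p⊂q⇒∣p∣<∣q∣ (I⊆ , g , x∈⁅x⁆ g , λ g∈ →
          Ii ⁅ g ⁆ (inj₁ b) (λ q → subst (_∈ I) (sym (x∈⁅y⁆⇒x≡y g q)) g∈)))))

    -- A parallel pair has rank one; with two more elements outside it is one side of a
    -- 2-separation.
    no-balanced-digon : ∀ {g h} → g ≢ h → ¬ B (⁅ g ⁆ ∪ ⁅ h ⁆)
    no-balanced-digon {g} {h} g≢h b with two-more-edges g h
    ... | e , e' , e≢e' , e≢g , e≢h , e'≢g , e'≢h =
      separation Circ circuit-nonempty 2 X (two≤ g∈ h∈ g≢h) (two≤ (out e≢g e≢h) (out e'≢g e'≢h) e≢e')
        (λ I J I⊆ J⊆ Ii Ji → pure (J , Ji , s≤s (ℕₚ.+-monoˡ-≤ ∣ J ∣ (small I I⊆ Ii)))) (proj₂ three)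
      where
      X = ⁅ g ⁆ ∪ ⁅ h ⁆
      g∈ : g ∈ X
      g∈ = x∈p∪q⁺ (inj₁ (x∈⁅x⁆ g))
      h∈ : h ∈ X
      h∈ = x∈p∪q⁺ (inj₂ (x∈⁅x⁆ h))
      X⁻ : ∀ {f} → f ∈ X → f ≡ g ⊎ f ≡ h
      X⁻ q = ⊎-map (x∈⁅y⁆⇒x≡y g) (x∈⁅y⁆⇒x≡y h) (x∈p∪q⁻ ⁅ g ⁆ ⁅ h ⁆ q)
      out : ∀ {f} → f ≢ g → f ≢ h → f ∈ ∁ X
      out a b = x∉p⇒x∈∁p (λ q → [ a , b ]′ (X⁻ q))
      small : ∀ I → I ⊆ X → Indep Circ I → ∣ I ∣ ≤ 1
      small I I⊆ Ii with ⊆-or-witness X I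
      ... | inj₁ X⊆ = ⊥-elim (Ii X (inj₁ b) X⊆)
      ... | inj₂ (x , x∈ , x∉) with X⁻ x∈
      ...   | inj₁ refl = subst (∣ I ∣ ≤_) (∣⁅x⁆∣≡1 h) (p⊆q⇒∣p∣≤∣q∣ λ {f} q → aux q (X⁻ (I⊆ q)))
        where
        aux : ∀ {f} → f ∈ I → f ≡ g ⊎ f ≡ h → f ∈ ⁅ h ⁆
        aux q (inj₁ refl) = ⊥-elim (x∉ q)
        aux q (inj₂ refl) = x∈⁅x⁆ h
      ...   | inj₂ refl = subst (∣ I ∣ ≤_) (∣⁅x⁆∣≡1 g) (p⊆q⇒∣p∣≤∣q∣ λ {f} q → aux q (X⁻ (I⊆ q)))
        where
        aux : ∀ {f} → f ∈ I → f ≡ g ⊎ f ≡ h → f ∈ ⁅ g ⁆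
        aux q (inj₂ refl) = ⊥-elim (x∉ q)
        aux q (inj₁ refl) = x∈⁅x⁆ g

    MinDegree2 : Subset m → Set
    MinDegree2 C = ∀ {g p} → g ∈ C → Link g p → ∃[ g' ] (g' ≢ g × g' ∈ C × Inc g' p)

    link-inc : ∀ {g p} → Link g p → Inc g p
    link-inc (_ , j , _) = J-incˡ j

    circuit-mindeg : ∀ {C} → Circ C → MinDegree2 C
    circuit-mindeg circ g∈ lk@(z , j , ne) with circuit-links circ g∈ lk
    ... | inj₁ (g' , g'≢ , g'∈ , lk') = g' , g'≢ , g'∈ , link-inc lk'
    ... | inj₂ (ℓ , ℓ∈ , lp , _) = ℓ , (λ { refl → ne (loop-not-link lp j) }) , ℓ∈ , J-incˡ lp

    cycle-mindeg : ∀ {C} → IsCycle G C → MinDegree2 C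
    cycle-mindeg cyc g∈ lk with cycle-links cyc g∈ lk
    ... | g' , g'≢ , g'∈ , lk' = g' , g'≢ , g'∈ , link-inc lk'

    -- A 2-separation tolerates a loss of one, so a single element of `I` may be sacrificed.
    drop-size : ∀ (I J : Subset m) j → (∀ {g} → g ∈ I → g ∈ J → ⊥) →
      ∣ I ∣ + ∣ J ∣ < 2 + ∣ (I ∩ ∁ ⁅ j ⁆) ∪ J ∣
    drop-size I J j dis = s≤s (ℕₚ.≤-trans (ℕₚ.+-monoˡ-≤ ∣ J ∣ (∣p∣≤1+∣p∖x∣ I j))
      (s≤s (∣∪∣-disjoint (I ∩ ∁ ⁅ j ⁆) J (λ a b → dis (proj₁ (x∈p∩q⁻ I _ a)) b))))

    keep-size : ∀ (I J : Subset m) → (∀ {g} → g ∈ I → g ∈ J → ⊥) → ∣ I ∣ + ∣ J ∣ < 2 + ∣ I ∪ J ∣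
    keep-size I J dis = s≤s (ℕₚ.m≤n⇒m≤1+n (∣∪∣-disjoint I J dis))

    private
      ∖⁻ : ∀ {I : Subset m} {j g} → g ∈ I ∩ ∁ ⁅ j ⁆ → g ∈ I × g ≢ j
      ∖⁻ {I} {j} q = let (a , b) = x∈p∩q⁻ I _ q in a , λ { refl → x∈∁p⇒x∉p b (x∈⁅x⁆ j) }

    -- Circuits have no vertex of degree one. A lone edge at `v` would be in no circuit, against
    -- connectedness; two edges would be in series, so that deleting one of them disables the other
    -- and the pair is one side of a 2-separation.
    three-edges : ∀ v e e' → ¬ (∀ {g} → Inc g v → g ≡ e ⊎ g ≡ e')
    three-edges v e e' all with link-at v
    ... | ℓ , lk = [ (λ { refl → go e' all }) , (λ { refl → go e (swap ∘ all) }) ]′ (all (link-inc lk))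
      where
      go : ∀ o → (∀ {g} → Inc g v → g ≡ ℓ ⊎ g ≡ o) → ⊥
      go o all with (ℓ Finₚ.≟ o) ⊎-dec ¬? (inc? o v)
      ... | yes only with another-edge ℓ ℓ
      ...   | f , f≢ℓ , _ with proj₁ unbreakable ℓ f Data.Fin.Subset.Properties.∈⊤ Data.Fin.Subset.Properties.∈⊤ (f≢ℓ ∘ sym)
      ...     | C , circ , ℓ∈ , _ with circuit-mindeg circ ℓ∈ lk
      ...       | g' , g'≢ , _ , inc with all inc | only
      ...         | inj₁ q | _ = g'≢ q
      ...         | inj₂ refl | inj₁ refl = g'≢ refl
      ...         | inj₂ refl | inj₂ ¬inc = ¬inc inc
      go o all | no ¬only with two-more-edges ℓ o
      ... | f , f' , f≢f' , f≢ℓ , f≢o , f'≢ℓ , f'≢o =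
        separation Circ circuit-nonempty 2 X (two≤ (x∈p∪q⁺ (inj₁ (x∈⁅x⁆ ℓ))) (x∈p∪q⁺ (inj₂ (x∈⁅x⁆ o))) (λ q → ¬only (inj₁ q)))
          (two≤ (out f≢ℓ f≢o) (out f'≢ℓ f'≢o) f≢f') sep (proj₂ three)
        where
        X = ⁅ ℓ ⁆ ∪ ⁅ o ⁆
        X⁻ : ∀ {f} → f ∈ X → f ≡ ℓ ⊎ f ≡ o
        X⁻ q = ⊎-map (x∈⁅y⁆⇒x≡y ℓ) (x∈⁅y⁆⇒x≡y o) (x∈p∪q⁻ ⁅ ℓ ⁆ ⁅ o ⁆ q)
        X⁺ : ∀ {f} → f ≡ ℓ ⊎ f ≡ o → f ∈ X
        X⁺ q = x∈p∪q⁺ (⊎-map (λ { refl → x∈⁅x⁆ ℓ }) (λ { refl → x∈⁅x⁆ o }) q)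
        out : ∀ {f} → f ≢ ℓ → f ≢ o → f ∈ ∁ X
        out a b = x∉p⇒x∈∁p (λ q → [ a , b ]′ (X⁻ q))
        sep : ∀ I J → I ⊆ X → J ⊆ ∁ X → Indep Circ I → Indep Circ J →
          Cl (∃[ K ] (Indep Circ K × ∣ I ∣ + ∣ J ∣ < 2 + ∣ K ∣))
        sep I J I⊆ J⊆ Ii Ji = pure (K , Ki , drop-size I J o (λ a b → x∈∁p⇒x∉p (J⊆ b) (I⊆ a)))
          where
          K = (I ∩ ∁ ⁅ o ⁆) ∪ J
          o∉K : o ∉ K
          o∉K q = [ (λ r → proj₂ (∖⁻ {I} r) refl) , (λ r → x∈∁p⇒x∉p (J⊆ r) (X⁺ (inj₂ refl))) ]′ (x∈p∪q⁻ (I ∩ ∁ ⁅ o ⁆) J q)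
          Ki : Indep Circ K
          Ki C circ C⊆ with ℓ ∈? C
          ... | yes ℓ∈ with circuit-mindeg circ ℓ∈ lk
          ...   | g' , g'≢ , g'∈ , inc with all inc
          ...     | inj₁ q = g'≢ q
          ...     | inj₂ refl = o∉K (C⊆ g'∈)
          Ki C circ C⊆ | no ℓ∉ = Ji C circ λ {g} g∈ → aux g∈ (x∈p∪q⁻ (I ∩ ∁ ⁅ o ⁆) J (C⊆ g∈))
            where
            aux : ∀ {g} → g ∈ C → g ∈ I ∩ ∁ ⁅ o ⁆ ⊎ g ∈ J → g ∈ J
            aux g∈ (inj₂ q) = q
            aux g∈ (inj₁ q) with ∖⁻ {I} q
            ... | g∈I , g≢o with X⁻ (I⊆ g∈I)
            ...   | inj₁ refl = ⊥-elim (ℓ∉ g∈)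
            ...   | inj₂ eq = ⊥-elim (g≢o eq)

    abstract
      second-edge : ∀ v g → ∃[ h ] (h ≢ g × Inc h v)
      second-edge v g with Finₚ.any? (λ h → ¬? (h Finₚ.≟ g) ×-dec inc? h v)
      ... | yes w = w
      ... | no none = ⊥-elim (three-edges v g g λ {h} inc → inj₁ (decidable-stable (h Finₚ.≟ g) λ ne → none (h , ne , inc)))

    -- `W` is a union of components of G - {u,v}, and `X` consists of the edges meeting it, so edges
    -- between `u` and `v` are counted on the other side. The case `u = v` is that of a cut vertex.
    module Side (W : Subset n) (u v : V)
      (closed : ∀ {g p q} → J g p q → p ∈ W → q ∈ W ⊎ q ≡ u ⊎ q ≡ v) where

      Meets : E → Set
      Meets g = proj₁ (G g) ∈ W ⊎ proj₂ (G g) ∈ W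

      meets : ∀ {g p} → Inc g p → p ∈ W → Meets g
      meets (inj₁ refl) p∈ = inj₁ p∈
      meets (inj₂ refl) p∈ = inj₂ p∈

      meets⁻ : ∀ {g} → Meets g → ∃[ p ] (p ∈ W × Inc g p)
      meets⁻ (inj₁ q) = _ , q , inj₁ refl
      meets⁻ (inj₂ q) = _ , q , inj₂ refl

      meets? : ∀ g → Dec (Meets g)
      meets? g = (proj₁ (G g) ∈? W) ⊎-dec (proj₂ (G g) ∈? W)

      X : Subset m
      X = fromDec meets?

      X⁺ : ∀ {g p} → Inc g p → p ∈ W → g ∈ X
      X⁺ inc p∈ = ∈-fromDec⁺ meets? (meets inc p∈)

      X⁻ : ∀ {g} → g ∈ X → ∃[ p ] (p ∈ W × Inc g p)
      X⁻ q = meets⁻ (∈-fromDec⁻ meets? q)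

      X-end : ∀ {g p} → g ∈ X → Inc g p → p ∈ W ⊎ p ≡ u ⊎ p ≡ v
      X-end {g} {p} g∈ inc with X⁻ g∈
      ... | r , r∈ , i with inc-J i
      ...   | s , j with J-ends j inc
      ...     | inj₁ refl = inj₁ r∈
      ...     | inj₂ refl = closed j r∈

      -- At a vertex of `W` all edges of `C` belong to `X`, so the part of `C` in `X` can lose
      -- degree only at `u` and `v`.
      side-in : ∀ {C g} → MinDegree2 C → g ∈ C → g ∈ X →
        (∃[ K ] (IsCycle G K × (∀ {h} → h ∈ K → h ∈ C × h ∈ X))) ⊎
        (u ≢ v × Σ (Walk u v) λ w → ∀ {h} → h ∈ᵉ w → h ∈ C × h ∈ X)
      side-in {C} deg g∈C g∈X = cycle-or-path (λ h → h ∈ C × h ∈ X) u v deg' (g∈C , g∈X)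
        where
        deg' : ∀ {g p z} → g ∈ C × g ∈ X → J g p z → p ≢ z → p ≢ u → p ≢ v → ∃[ g' ] (g' ≢ g × (g' ∈ C × g' ∈ X) × Inc g' p)
        deg' (g∈C , g∈X) j ne p≢u p≢v with deg g∈C (_ , j , ne) | X-end g∈X (J-incˡ j)
        ... | g' , g'≢ , g'∈ , inc | inj₁ p∈ = g' , g'≢ , (g'∈ , X⁺ inc p∈) , inc
        ... | _ | inj₂ (inj₁ q) = ⊥-elim (p≢u q)
        ... | _ | inj₂ (inj₂ q) = ⊥-elim (p≢v q)

      two-edges-in : ∀ {a} → a ∈ W → 2 ≤ ∣ X ∣
      two-edges-in {a} a∈ with link-at a
      ... | ℓ , lk with second-edge a ℓ
      ...   | h , h≢ , inc = two≤ (X⁺ inc a∈) (X⁺ (link-inc lk) a∈) h≢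

      two-edges-out : ∀ {b} → b ∉ W → b ≢ u → b ≢ v → 2 ≤ ∣ ∁ X ∣
      two-edges-out {b} b∉ b≢u b≢v with link-at b
      ... | ℓ , lk with second-edge b ℓ
      ...   | h , h≢ , inc = two≤ (out inc) (out (link-inc lk)) h≢
        where
        out : ∀ {g} → Inc g b → g ∈ ∁ X
        out inc = x∉p⇒x∈∁p (λ q → [ b∉ , [ b≢u , b≢v ]′ ]′ (X-end q inc))

      -- If u and v are joined in I, deleting an edge j of the joining path makes I ∪ J independent.
      unbalanced-side : ∀ {a b} → u ≢ v → a ∈ W → b ∉ W → b ≢ u → b ≢ v → ¬ BalE (_∈ X)
      unbalanced-side u≢v a∈ b∉ b≢u b≢v bal =
        separation Circ circuit-nonempty 2 X (two-edges-in a∈) (two-edges-out b∉ b≢u b≢v) sep (proj₂ three)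
        where
        acyclic : ∀ {I C} → I ⊆ X → Indep Circ I → IsCycle G C → ¬ C ⊆ I
        acyclic I⊆ Ii cyc C⊆ = Ii _ (inj₁ (bal cyc (λ q → I⊆ (C⊆ q)))) C⊆
        in-I : ∀ {I J C h} → J ⊆ ∁ X → C ⊆ I ∪ J → h ∈ C × h ∈ X → h ∈ I
        in-I {I} {J} J⊆ C⊆ (a , b) = [ (λ q → q) , (λ q → ⊥-elim (x∈∁p⇒x∉p (J⊆ q) b)) ]′ (x∈p∪q⁻ I J (C⊆ a))
        -- A circuit with an edge in `I` would leave in `I` either a cycle, which is balanced and
        -- thus itself a circuit, or a walk from `u` to `v`.
        indep-∪ : ∀ I J → I ⊆ X → J ⊆ ∁ X → Indep Circ I → Indep Circ J → ¬ Connects (_∈ I) u v → Indep Circ (I ∪ J)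
        indep-∪ I J I⊆ J⊆ Ii Ji ¬conn C circ C⊆ with ⊆-or-witness C J
        ... | inj₁ C⊆J = Ji C circ C⊆J
        ... | inj₂ (g , g∈ , g∉) with side-in (circuit-mindeg circ) g∈ (I⊆ ([ (λ q → q) , (λ q → ⊥-elim (g∉ q)) ]′ (x∈p∪q⁻ I J (C⊆ g∈))))
        ...   | inj₁ (K , cyc , K⊆) = acyclic I⊆ Ii cyc (λ q → in-I J⊆ C⊆ (K⊆ q))
        ...   | inj₂ (_ , w , w⊆) = ¬conn (w , λ q → in-I J⊆ C⊆ (w⊆ q))
        sep : ∀ I J → I ⊆ X → J ⊆ ∁ X → Indep Circ I → Indep Circ J →
          Cl (∃[ K ] (Indep Circ K × ∣ I ∣ + ∣ J ∣ < 2 + ∣ K ∣))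
        sep I J I⊆ J⊆ Ii Ji = em {Connects (_∈ I) u v} >>= λ where
            (no ¬conn) → pure (I ∪ J , indep-∪ I J I⊆ J⊆ Ii Ji ¬conn , keep-size I J dis)
            (yes (w , w⊆)) → cut w w⊆
          where
          dis : ∀ {g} → g ∈ I → g ∈ J → ⊥
          dis a b = x∈∁p⇒x∉p (J⊆ b) (I⊆ a)
          cut : (w : Walk u v) → (∀ {g} → g ∈ᵉ w → g ∈ I) → Cl (∃[ K ] (Indep Circ K × ∣ I ∣ + ∣ J ∣ < 2 + ∣ K ∣))
          cut w w⊆ with simplify w
          ... | nil , _ , _ , _ = ⊥-elim (u≢v refl)
          ... | cons j jn w' , (u∉w' , sw') , _ , we =
            pure ((I ∩ ∁ ⁅ j ⁆) ∪ J , indep-∪ (I ∩ ∁ ⁅ j ⁆) J (λ q → I⊆ (proj₁ (∖⁻ {I} q))) J⊆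
                    (λ C c sub → Ii C c (λ q → proj₁ (∖⁻ {I} (sub q)))) Ji ¬conn , drop-size I J j dis)
            where
            ¬conn : ¬ Connects (_∈ I ∩ ∁ ⁅ j ⁆) u v
            ¬conn (r , r⊆) with close-walk jn (w' ⊕ rev r) j∉
              where
              j∉ : ¬ j ∈ᵉ w' ⊕ rev r
              j∉ q with ∈ᵉ-⊕⁻ w' (rev r) q
              ... | inj₁ a = u∉w' (∈ᵉ-ends w' a (J-incˡ jn))
              ... | inj₂ a = proj₂ (∖⁻ {I} (r⊆ (∈ᵉ-rev⁻ r a))) refl
            ... | C , cyc , _ , C⁻ = acyclic I⊆ Ii cyc (λ q → aux (C⁻ q))
              where
              aux : ∀ {h} → h ≡ j ⊎ h ∈ᵉ w' ⊕ rev r → h ∈ I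
              aux (inj₁ refl) = w⊆ (we (inj₁ refl))
              aux (inj₂ q) with ∈ᵉ-⊕⁻ w' (rev r) q
              ... | inj₁ a = w⊆ (we (inj₂ a))
              ... | inj₂ a = proj₁ (∖⁻ {I} (r⊆ (∈ᵉ-rev⁻ r a)))

    -- Cut vertices

    module _ (W : Subset n) (w : V) (closed : ∀ {g p q} → J g p q → p ∈ W → q ∈ W ⊎ q ≡ w) where
      open Side W w w (λ j p∈ → ⊎-map (λ q → q) inj₁ (closed j p∈))

      private
        reach : ∀ {C : Subset m} {p q} (r : Walk p q) → (∀ {g} → g ∈ᵉ r → g ∈ C) → p ∈ W ⊎ p ≡ w → q ∉ W →
          Connects (λ g → g ∈ C × g ∈ X) p w
        reach r r⊆ (inj₂ refl) q∉ = connects-refl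
        reach nil r⊆ (inj₁ p∈) q∉ = ⊥-elim (q∉ p∈)
        reach (cons e j r) r⊆ (inj₁ p∈) q∉ = connects-trans
          (connects-edge j (r⊆ (inj₁ refl) , X⁺ (J-incˡ j) p∈)) (reach r (r⊆ ∘ inj₂) (closed j p∈) q∉)

        module _ {I J : Subset m} (I⊆ : I ⊆ X) (J⊆ : J ⊆ ∁ X) (Ii : Indep Circ I) (Ji : Indep Circ J) where

          dis : ∀ {g} → g ∈ I → g ∈ J → ⊥
          dis a b = x∈∁p⇒x∉p (J⊆ b) (I⊆ a)

          in-I : ∀ {C h} → C ⊆ I ∪ J → h ∈ C × h ∈ X → h ∈ I
          in-I C⊆ (a , b) = [ (λ q → q) , (λ q → ⊥-elim (x∈∁p⇒x∉p (J⊆ q) b)) ]′ (x∈p∪q⁻ I J (C⊆ a))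

          edge-in : ∀ {C} → Circ C → C ⊆ I ∪ J → ∃[ g ] (g ∈ C × g ∈ X)
          edge-in {C} circ C⊆ with ⊆-or-witness C J
          ... | inj₁ sub = ⊥-elim (Ji C circ sub)
          ... | inj₂ (g , g∈ , g∉) = g , g∈ , I⊆ ([ (λ q → q) , (λ q → ⊥-elim (g∉ q)) ]′ (x∈p∪q⁻ I J (C⊆ g∈)))

          side-cycle : ∀ {C g} → MinDegree2 C → C ⊆ I ∪ J → g ∈ C → g ∈ X →
            ∃[ K ] (IsCycle G K × (∀ {h} → h ∈ K → h ∈ C × h ∈ X))
          side-cycle deg C⊆ g∈ g∈X with side-in deg g∈ g∈X
          ... | inj₁ r = r
          ... | inj₂ (ne , _) = ⊥-elim (ne refl)

          -- A connected circuit that uses both sides links its cycle in `I` to `w`. A disconnected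
          -- one consists of two cycles of L; as a cycle cannot cross a cut vertex, one of them
          -- would lie wholly in `I`, which is excluded.
          crossing : ∀ {C} → Circ C → C ⊆ I ∪ J → ¬ (∃[ D ] (L D × D ⊆ I)) →
            ∃[ K ] ∃[ p ] (IsCycle G K × (∀ {h} → h ∈ K → h ∈ C × h ∈ I) × VO K p × Connects (_∈ I) p w)
          crossing {C} circ C⊆ ¬L with edge-in circ C⊆ | ⊆-or-witness C I
          ... | _ | inj₁ sub = ⊥-elim (Ii C circ sub)
          ... | g₀ , g₀∈ , g₀∈X | inj₂ (g₁ , g₁∈ , g₁∉) with circuit-connected circ
          ...   | inj₁ (C₁ , C₂ , l₁ , l₂ , refl) = ⊥-elim ([ (λ q → aux l₁ q (x∈p∪q⁺ ∘ inj₁)) , (λ q → aux l₂ q (x∈p∪q⁺ ∘ inj₂)) ]′ (x∈p∪q⁻ C₁ C₂ g₀∈))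
            where
            aux : ∀ {D} → L D → g₀ ∈ D → D ⊆ C₁ ∪ C₂ → ⊥
            aux {D} l g∈ D⊆ with side-cycle (cycle-mindeg (L-cycle l)) (λ q → C⊆ (D⊆ q)) g∈ g₀∈X
            ... | K , cyc , K⊆ = ¬L (D , l , λ q → in-I {D} (λ q → C⊆ (D⊆ q)) (K⊆ (cycle⊆cycle cyc (L-cycle l) (λ r → proj₁ (K⊆ r)) q)))
          ...   | inj₂ conn with side-cycle (circuit-mindeg circ) C⊆ g₀∈ g₀∈X
          ...     | K , cyc , K⊆ with isCycle-nonempty cyc
          ...       | h , h∈ = K , proj₁ (G h) , cyc , (λ q → proj₁ (K⊆ q) , in-I C⊆ (K⊆ q)) , (h , h∈ , inj₁ refl) ,
                        connects-mono (in-I C⊆) (reach r r⊆ p∈ q∉)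
            where
            cn = conn (h , proj₁ (K⊆ h∈) , inj₁ refl) (g₁ , g₁∈ , inj₁ refl)
            r = proj₁ cn
            r⊆ : ∀ {g} → g ∈ᵉ r → g ∈ C
            r⊆ = proj₂ cn
            p∈ : proj₁ (G h) ∈ W ⊎ proj₁ (G h) ≡ w
            p∈ = ⊎-map (λ q → q) [ (λ q → q) , (λ q → q) ]′ (X-end (proj₂ (K⊆ h∈)) (inj₁ refl))
            q∉ : proj₁ (G g₁) ∉ W
            q∉ q = g₁∉ (in-I C⊆ (g₁∈ , X⁺ (inj₁ refl) q))

        minus⊆ : ∀ {I : Subset m} {j g} → g ∈ I ∩ ∁ ⁅ j ⁆ → g ∈ I
        minus⊆ {I} q = proj₁ (x∈p∩q⁻ I _ q)

        j∉minus : ∀ {I : Subset m} {j} → j ∉ I ∩ ∁ ⁅ j ⁆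
        j∉minus {I} {j} q = x∈∁p⇒x∉p (proj₂ (x∈p∩q⁻ I _ q)) (x∈⁅x⁆ j)

      -- A circuit crossing w uses a cycle of I that is in L or is joined to w in I; an independent I
      -- has at most one such cycle, so deleting one of its edges makes I ∪ J independent.
      no-cut-vertex : ∀ {a b} → a ∈ W → b ∉ W → b ≢ w → ⊥
      no-cut-vertex a∈ b∉ b≢ =
        separation Circ circuit-nonempty 2 X (two-edges-in a∈) (two-edges-out b∉ b≢ b≢) sep (proj₂ (three))
        where
        module _ I J (I⊆ : I ⊆ X) (J⊆ : J ⊆ ∁ X) (Ii : Indep Circ I) (Ji : Indep Circ J) where
          Goal = ∃[ K ] (Indep Circ K × ∣ I ∣ + ∣ J ∣ < 2 + ∣ K ∣)
          module _ (j : E) where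
            I' = I ∩ ∁ ⁅ j ⁆
            I'⊆ : I' ⊆ X
            I'⊆ q = I⊆ (minus⊆ {I} q)
            I'i : Indep Circ I'
            I'i C c sub = Ii C c (λ q → minus⊆ {I} (sub q))
          module _ {C₁ j} (cyc₁ : IsCycle G C₁) (C₁⊆ : C₁ ⊆ I) (j∈ : j ∈ C₁) where
            other : ∀ {K} → IsCycle G K → K ⊆ I' j → ¬ K ⊆ C₁
            other cyc K⊆ sub = j∉minus {I} (K⊆ (cycle⊆cycle cyc cyc₁ sub j∈))
          caseL : ∀ {C₁} → L C₁ → C₁ ⊆ I → Goal
          caseL {C₁} l C₁⊆ with isCycle-nonempty (L-cycle l)
          ... | j , j∈ = I' j ∪ J , ind , drop-size I J j (dis I⊆ J⊆ Ii Ji)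
            where
            ind : Indep Circ (I' j ∪ J)
            ind C circ C⊆ with edge-in (I'⊆ j) J⊆ (I'i j) Ji circ C⊆
            ... | g , g∈ , g∈X with side-cycle (I'⊆ j) J⊆ (I'i j) Ji (circuit-mindeg circ) C⊆ g∈ g∈X
            ...   | K , cyc , K⊆ = indep-two-cycles Ii (L-cycle l) cyc C₁⊆ (λ q → minus⊆ {I} (K⊆I' q))
                      (other (L-cycle l) C₁⊆ j∈ cyc K⊆I') (inj₁ l)
              where
              K⊆I' : K ⊆ I' j
              K⊆I' q = in-I (I'⊆ j) J⊆ (I'i j) Ji C⊆ (K⊆ q)
          Joined : Set
          Joined = ∃[ C₁ ] ∃[ p ] (IsCycle G C₁ × C₁ ⊆ I × VO C₁ p × Connects (_∈ I) p w)
          caseJoined : ¬ (∃[ D ] (L D × D ⊆ I)) → Joined → Goal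
          caseJoined ¬L (C₁ , p , cyc₁ , C₁⊆ , p∈ , conn) with isCycle-nonempty cyc₁
          ... | j , j∈ = I' j ∪ J , ind , drop-size I J j (dis I⊆ J⊆ Ii Ji)
            where
            ind : Indep Circ (I' j ∪ J)
            ind C circ C⊆ with crossing (I'⊆ j) J⊆ (I'i j) Ji circ C⊆ (λ { (D , l , sub) → ¬L (D , l , λ q → minus⊆ {I} (sub q)) })
            ... | K , q , cyc , K⊆ , q∈ , conn' = indep-two-cycles Ii cyc₁ cyc C₁⊆ (λ r → minus⊆ {I} (proj₂ (K⊆ r)))
                    (other cyc₁ C₁⊆ j∈ cyc (λ r → proj₂ (K⊆ r)))
                    (inj₂ (q , p , q∈ , p∈ , connects-trans (connects-mono (minus⊆ {I}) conn') (connects-sym conn)))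
          caseNone : ¬ (∃[ D ] (L D × D ⊆ I)) → ¬ Joined → Goal
          caseNone ¬L ¬J = I ∪ J , ind , keep-size I J (dis I⊆ J⊆ Ii Ji)
            where
            ind : Indep Circ (I ∪ J)
            ind C circ C⊆ with crossing I⊆ J⊆ Ii Ji circ C⊆ ¬L
            ... | K , q , cyc , K⊆ , q∈ , conn' = ¬J (K , q , cyc , (λ r → proj₂ (K⊆ r)) , q∈ , conn')
          sep : Cl Goal
          sep = em {∃[ D ] (L D × D ⊆ I)} >>= λ where
            (yes (D , l , sub)) → pure (caseL l sub)
            (no ¬L) → em {Joined} >>= λ where
              (yes jn) → pure (caseJoined ¬L jn)
              (no ¬J) → pure (caseNone ¬L ¬J)

    -- Contracting G − {a,b}

    VSet : Set₁
    VSet = V → Set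

    record InV (S : VSet) (g : E) : Set where
      constructor _,_
      field
        end₁ : S (proj₁ (G g))
        end₂ : S (proj₂ (G g))

    inV : ∀ {S : VSet} {g p q} → J g p q → S p → S q → InV S g
    inV {S} j p∈ q∈ = at (inj₁ refl) , at (inj₂ refl)
      where
      at : ∀ {r} → Inc _ r → S r
      at inc = [ (λ { refl → p∈ }) , (λ { refl → q∈ }) ]′ (J-ends j inc)

    inV-end : ∀ {S : VSet} {g p} → InV S g → Inc g p → S p
    inV-end (a , b) (inj₁ refl) = a
    inV-end (a , b) (inj₂ refl) = b

    BalV : VSet → Set
    BalV S = BalE (InV S)

    balV-mono : ∀ {S T : VSet} → (∀ {p} → S p → T p) → BalV T → BalV S
    balV-mono f bal cyc sub = bal cyc (λ g∈ → let (a , b) = sub g∈ in f a , f b)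

    Adj : V → V → Set
    Adj = SiAdj G

    adj-sym : ∀ {p q} → Adj p q → Adj q p
    adj-sym (ne , e , j) = ne ∘ sym , e , J-sym j

    ConnV : VSet → V → V → Set
    ConnV S p q = Σ (Walk p q) λ w → ∀ {r} → r ∈ᵛ w → S r

    connV-edges : ∀ {S : VSet} {p q} → ConnV S p q → Connects (InV S) p q
    connV-edges (w , a) = w , λ g∈ → a (∈ᵉ-ends w g∈ (inj₁ refl)) , a (∈ᵉ-ends w g∈ (inj₂ refl))

    infixl 6 _∪ᵛ_
    _∪ᵛ_ : VSet → V → VSet
    (S ∪ᵛ a) p = S p ⊎ p ≡ a

    -- `e` is the only edge at `a`, and no cycle passes through a vertex of degree one.
    pendant : ∀ {X e a} → BalE X → Link e a → (∀ {g} → X g → ¬ Inc g a) → BalE (X +ᵉ e)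
    pendant {X} {e} {a} bal lk off {C} cyc sub = bal cyc λ g∈ → aux g∈ (sub g∈)
      where
      aux : ∀ {g} → g ∈ C → (X +ᵉ e) g → X g
      aux g∈ (inj₁ q) = q
      aux g∈ (inj₂ refl) with cycle-links cyc g∈ lk
      ... | g' , g'≢ , g'∈ , lk' with sub g'∈
      ...   | inj₁ q = ⊥-elim (off q (link-inc lk'))
      ...   | inj₂ q = ⊥-elim (g'≢ q)

    -- The edges of `P` are added one at a time by index. The order does not matter, since the
    -- balanced cycle certifying an edge uses only `X` besides that edge.
    bal-extend-all : ∀ {X P : E → Set} → BalE X →
      (∀ {g} → P g → X g ⊎ ∃[ C ] (B C × g ∈ C × (∀ {h} → h ∈ C → (X +ᵉ g) h))) → BalE (λ g → X g ⊎ P g)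
    bal-extend-all {X} {P} bal ext cyc sub = go m cyc λ g∈ → ⊎-map (λ q → q) (λ q → q , Finₚ.toℕ<n _) (sub g∈)
      where
      Upto : ℕ → E → Set
      Upto k g = X g ⊎ (P g × toℕ g < k)
      go : ∀ k → BalE (Upto k)
      go zero cyc sub = bal cyc λ g∈ → [ (λ q → q) , (λ { (_ , ()) }) ]′ (sub g∈)
      go (suc k) {C} cyc sub with Finₚ.any? (λ g → (g ∈? C) ×-dec (toℕ g ℕₚ.≟ k))
      ... | no none = go k cyc λ {g} g∈ → lower g∈ (sub g∈)
        where
        lower : ∀ {g} → g ∈ C → Upto (suc k) g → Upto k g
        lower g∈ (inj₁ q) = inj₁ q
        lower g∈ (inj₂ (p , s≤s le)) = inj₂ (p , ℕₚ.≤∧≢⇒< le (λ eq → none (_ , g∈ , eq)))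
      ... | yes (e , e∈ , eqk) = fin (sub e∈)
        where
        lower : ∀ {g} → Upto (suc k) g → (Upto k +ᵉ e) g
        lower (inj₁ q) = inj₁ (inj₁ q)
        lower {g} (inj₂ (p , s≤s le)) with g Finₚ.≟ e
        ... | yes q = inj₂ q
        ... | no ne = inj₁ (inj₂ (p , ℕₚ.≤∧≢⇒< le (λ eq → ne (Finₚ.toℕ-injective (trans eq (sym eqk))))))
        inX : X e → B C
        inX x = go k cyc λ g∈ → [ (λ q → q) , (λ { refl → inj₁ x }) ]′ (lower (sub g∈))
        fin : Upto (suc k) e → B C
        fin (inj₁ x) = inX x
        fin (inj₂ (p , _)) with ext p
        ... | inj₁ x = inX x
        ... | inj₂ (D , b , e∈D , D⊆) =
          bal-extend (go k) b e∈D (λ h∈ → ⊎-map inj₁ (λ q → q) (D⊆ h∈)) cyc (λ g∈ → lower (sub g∈))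

    close-at : ∀ {S : VSet} {c z p e₀ f} → J e₀ z c → J f p c → f ≢ e₀ → ¬ S c → ConnV S z p →
      ∃[ C ] (IsCycle G C × f ∈ C × (∀ {h} → h ∈ C → (InV S h ⊎ h ≡ e₀) ⊎ h ≡ f) × (∀ {h} → h ∈ C → InV (S ∪ᵛ c) h))
    close-at {S} {c} {z} {p} {e₀} {f} j₀ j ne c∉ (w , a) with close-walk j w' f∉
      where
      w' : Walk c p
      w' = cons e₀ (J-sym j₀) w
      f∉ : ¬ f ∈ᵉ w'
      f∉ (inj₁ q) = ne q
      f∉ (inj₂ q) = c∉ (a (∈ᵉ-ends w q (J-incʳ j)))
    ... | C , cyc , f∈ , C⁻ = C , cyc , f∈ , (λ q → e1 (C⁻ q)) , λ q → e2 (C⁻ q)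
      where
      wE = proj₂ (connV-edges {S} (w , a))
      e1 : ∀ {h} → h ≡ f ⊎ (h ≡ e₀ ⊎ h ∈ᵉ w) → (InV S h ⊎ h ≡ e₀) ⊎ h ≡ f
      e1 (inj₁ q) = inj₂ q
      e1 (inj₂ (inj₁ q)) = inj₁ (inj₂ q)
      e1 (inj₂ (inj₂ q)) = inj₁ (inj₁ (wE q))
      e2 : ∀ {h} → h ≡ f ⊎ (h ≡ e₀ ⊎ h ∈ᵉ w) → InV (S ∪ᵛ c) h
      e2 (inj₁ refl) = inV j (inj₁ (a (end∈ w))) (inj₂ refl)
      e2 (inj₂ (inj₁ refl)) = inV j₀ (inj₁ (a (start∈ w))) (inj₂ refl)
      e2 (inj₂ (inj₂ q)) = let (x , y) = wE q in inj₁ x , inj₁ y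

    -- One edge from `z` to `a` is pendant and hence harmless. Every other edge from `T` to `a`
    -- closes a cycle with it through some `S`, and that cycle is balanced because `S` together with
    -- `a` is; a loop at `a` is covered by the same sets.
    bal-add-vertex : ∀ {T : VSet} {a z} → BalV T → ¬ T a → T z → Adj z a →
      (∀ {p} → T p → Adj p a → Σ VSet λ S → (∀ {q} → S q → T q) × ConnV S z p × BalV (S ∪ᵛ a)) → BalV (T ∪ᵛ a)
    bal-add-vertex {T} {a} {z} bal a∉ z∈ za@(z≢a , e₀ , j₀) ext cyc sub =
      bal-extend-all (pendant bal (z , J-sym j₀ , z≢a ∘ sym) (λ q i → a∉ (inV-end q i))) ext' cyc (λ q → inj₂ (sub q))
      where
      Closes : E → Set
      Closes g = (InV T +ᵉ e₀) g ⊎ ∃[ C ] (B C × g ∈ C × (∀ {h} → h ∈ C → ((InV T +ᵉ e₀) +ᵉ g) h))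
      at : ∀ {g p} → J g p a → T p → Closes g
      at {g} j p∈ with g Finₚ.≟ e₀
      ... | yes eq = inj₁ (inj₂ eq)
      ... | no ne with ext p∈ ((λ { refl → a∉ p∈ }) , g , j)
      ...   | S , S⊆ , conn , balS with close-at {S} j₀ j ne (λ s → a∉ (S⊆ s)) conn
      ...     | C , cyc , g∈ , C⊆ , CV = inj₂ (C , balS cyc CV , g∈ , λ q → ⊎-map (⊎-map (λ (x , y) → S⊆ x , S⊆ y) (λ r → r)) (λ r → r) (C⊆ q))
      ext' : ∀ {g} → InV (T ∪ᵛ a) g → Closes g
      ext' {g} (inj₁ p , inj₁ q) = inj₁ (inj₁ (p , q))
      ext' {g} (inj₁ p∈ , inj₂ eq) = at (inj₁ (cong (_ ,_) eq)) p∈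
      ext' {g} (inj₂ eq , inj₁ p∈) = at (inj₂ (cong (_, _) eq)) p∈
      ext' {g} (inj₂ eq , inj₂ eq') with ext z∈ za
      ... | S , _ , _ , balS = inj₂ (⁅ g ⁆ , balS (loop-cycle lp) (λ h∈ → subst (InV (S ∪ᵛ a)) (sym (x∈⁅y⁆⇒x≡y g h∈)) (inj₂ eq , inj₂ eq')) ,
              x∈⁅x⁆ g , λ h∈ → inj₂ (x∈⁅y⁆⇒x≡y g h∈))
        where
        lp : J g a a
        lp = inj₁ (trans (cong (_, _) eq) (cong (_ ,_) eq'))

    module NonAdjacent {a b : V} (a≢b : a ≢ b) (¬ab : ¬ Adj a b) where

      Off : VSet
      Off p = p ≢ a × p ≢ b

      off? : ∀ p → Dec (Off p)
      off? p = ¬? (p Finₚ.≟ a) ×-dec ¬? (p Finₚ.≟ b)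

      EH : E → Set
      EH = InV Off

      EH? : ∀ g → Dec (EH g)
      EH? g = map′ (λ (p , q) → p , q) (λ (p , q) → p , q) (off? (proj₁ (G g)) ×-dec off? (proj₂ (G g)))

      not-EH : ∀ {g} → ¬ EH g → ∃[ c ] ((c ≡ a ⊎ c ≡ b) × Inc g c)
      not-EH {g} ¬eh with inc? g a | inc? g b
      ... | yes i | _ = a , inj₁ refl , i
      ... | no _ | yes i = b , inj₂ refl , i
      ... | no i | no k = ⊥-elim (¬eh (((i ∘ inj₁) , (k ∘ inj₁)) , ((i ∘ inj₂) , (k ∘ inj₂))))

      EH-off-a : ∀ {g} → EH g → ¬ Inc g a
      EH-off-a eh i = proj₁ (inV-end eh i) refl

      EH-off : ∀ {g c} → c ≡ a ⊎ c ≡ b → EH g → ¬ Inc g c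
      EH-off (inj₁ refl) eh i = proj₁ (inV-end eh i) refl
      EH-off (inj₂ refl) eh i = proj₂ (inV-end eh i) refl

      other-end : ∀ {g q} → J g a q → a ≢ q → Off q
      other-end j a≢q = (a≢q ∘ sym) , λ { refl → ¬ab (a≢b , _ , j) }

      Fl₀ : Subset m
      Fl₀ = fromDec EH?

      Fl₀⁺ : ∀ {g} → EH g → g ∈ Fl₀
      Fl₀⁺ = ∈-fromDec⁺ EH?

      Fl₀⁻ : ∀ {g} → g ∈ Fl₀ → EH g
      Fl₀⁻ = ∈-fromDec⁻ EH?

      NoL : Set
      NoL = ∀ {C} → L C → ¬ (∀ {g} → g ∈ C → EH g)

      -- An edge outside `EH` ends at `a` or `b`, where a circuit must have a second edge. The one
      -- escape is a loop paired with a disjoint cycle of L inside `EH`, which `NoL` forbids.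
      flat₀ : NoL → IsFlat Circ Fl₀
      flat₀ noL g C g∉ circ g∈ C⊆ with not-EH (g∉ ∘ Fl₀⁺)
      ... | c , c∈ , inc = go (inc-cases inc)
        where
        rest : ∀ {h} → h ∈ C → h ≢ g → EH h
        rest h∈ ne = [ Fl₀⁻ , (λ q → ⊥-elim (ne (x∈⁅y⁆⇒x≡y g q))) ]′ (x∈p∪q⁻ Fl₀ ⁅ g ⁆ (C⊆ h∈))
        go : J g c c ⊎ Link g c → ⊥
        go (inj₂ lk) with circuit-mindeg circ g∈ lk
        ... | g' , ne , g'∈ , i = EH-off c∈ (rest g'∈ ne) i
        go (inj₁ lp) with circuit-loops circ g∈ lp
        ... | inj₁ bal = no-balanced-loop lp bal
        ... | inj₂ (inj₁ (g' , ne , g'∈ , i)) = EH-off c∈ (rest g'∈ ne) i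
        ... | inj₂ (inj₂ (_ , D , l , D⊆ , g∉D)) = noL l (λ h∈ → rest (D⊆ h∈) (λ { refl → g∉D h∈ }))

      private
        e = proj₁ (link-at a)
        lke : Link e a
        lke = proj₂ (link-at a)
        p = proj₁ lke
        je : J e a p
        je = proj₁ (proj₂ lke)
        offp : Off p
        offp = other-end je (proj₂ (proj₂ lke))
        f = proj₁ (link-at b)
        lkf : Link f b
        lkf = proj₂ (link-at b)

        ¬inc-f : ¬ Inc f a
        ¬inc-f i with lkf
        ... | z , j , ne with J-ends j i
        ...   | inj₁ q = a≢b q
        ...   | inj₂ refl = ¬ab (a≢b , f , J-sym j)

        Y : E → E → Set
        Y e' g = EH g ⊎ g ≡ e ⊎ g ≡ e'

        only : ∀ {Fl : Subset m} {e'} → (∀ {g} → EH g → g ∈ Fl) → ∀ {g} → Y e' g → g ∉ Fl → g ≡ e ⊎ g ≡ e'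
        only EH⊆ (inj₁ q) g∉ = ⊥-elim (g∉ (EH⊆ q))
        only EH⊆ (inj₂ q) g∉ = q

        cycle-through : ∀ {e' q} → e' ≢ e → J e' a q → a ≢ q → Connects EH p q → ∃[ C ] (IsCycle G C × e' ∈ C × (∀ {g} → g ∈ C → Y e' g))
        cycle-through {e'} {q} ne j a≢q (w , w⊆) with close-walk (J-sym j) (cons e je w) e'∉
          where
          e'∉ : ¬ e' ∈ᵉ cons e je w
          e'∉ (inj₁ r) = ne r
          e'∉ (inj₂ r) = EH-off-a (w⊆ r) (J-incˡ j)
        ... | C , cyc , e'∈ , C⁻ = C , cyc , e'∈ , λ g∈ → aux (C⁻ g∈)
          where
          aux : ∀ {g} → g ≡ e' ⊎ (g ≡ e ⊎ g ∈ᵉ w) → Y e' g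
          aux (inj₁ r) = inj₂ (inj₂ r)
          aux (inj₂ (inj₁ r)) = inj₂ (inj₁ r)
          aux (inj₂ (inj₂ r)) = inj₁ (w⊆ r)

      -- If G - b were balanced, any two edges at `a` would close up through the connected graph G -
      -- {a,b} to a balanced cycle. They would form a parallel class after contraction, away from
      -- the edge `f` at `b`.
      one-more-unbalanced : (∀ {p q} → Off p → Off q → Cl (Connects EH p q)) → ¬ BalV (_≢ b)
      one-more-unbalanced conn bal = break Circ circuit-nonempty unbreakable (λ g → Inc g a) (flat₀ noL)
        (λ q → EH-off-a (Fl₀⁻ q) (link-inc lke)) (λ q → EH-off (inj₂ refl) (Fl₀⁻ q) (link-inc lkf))
        (link-inc lke) ¬inc-f H₁ H₂
        where
        EH⊆ : ∀ {g} → EH g → InV (_≢ b) g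
        EH⊆ ((_ , x) , (_ , y)) = x , y
        noL : NoL
        noL l sub = L⇒¬B l (bal (L-cycle l) (λ g∈ → EH⊆ (sub g∈)))
        at-a : ∀ {g} → Inc g a → InV (_≢ b) g
        at-a {g} i with inc-J i
        ... | z , j = inV j a≢b (λ { refl → ¬ab (a≢b , g , j) })
        loop-bal : ∀ {ℓ} → J ℓ a a → B ⁅ ℓ ⁆
        loop-bal {ℓ} lp = bal (loop-cycle lp) (λ q → subst (InV (_≢ b)) (sym (x∈⁅y⁆⇒x≡y ℓ q)) (at-a (J-incˡ lp)))
        H₁ : ∀ {C} → Circ C → e ∈ C → ∃[ e' ] (e' ≢ e × e' ∈ C × e' ∉ Fl₀ × Inc e' a)
        H₁ circ e∈ with circuit-mindeg circ e∈ lke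
        ... | e' , ne , e'∈ , i = e' , ne , e'∈ , (λ q → EH-off-a (Fl₀⁻ q) i) , i
        H₂ : ∀ {e'} → e' ≢ e → e' ∉ Fl₀ → Inc e' a → Cl (Parallel Circ circuit-nonempty Fl₀ e e')
        H₂ {e'} ne e'∉ i with inc-cases i
        ... | inj₁ lp = ⊥-elim (no-balanced-loop lp (loop-bal lp))
        ... | inj₂ (q , j , a≢q) = do
          cn ← conn offp (other-end j a≢q)
          let (C , cyc , e'∈ , C⊆) = cycle-through ne j a≢q cn
          pure (parallel (inj₁ (bal cyc (λ g∈ → [ EH⊆ , [ (λ { refl → at-a (link-inc lke) }) , (λ { refl → at-a i }) ]′ ]′ (C⊆ g∈))))
            (e' , e'∈ , e'∉) λ g∈ → only {Fl₀} Fl₀⁺ (C⊆ g∈))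

      module _ (spread : ∀ {p} → Off p → Cl (∃[ C ] ∃[ q ] (IsCycle G C × ¬ B C × (∀ {g} → g ∈ C → EH g) × VO C q × Connects EH p q)))
        where
        private
          -- `e` and `e'` lead into the same component of G - {a,b}, so they lie on a common cycle.
          -- An unbalanced cycle of that component, which avoids `a`, turns it into a circuit
          -- through `e'` by `circuit-through`.
          same-component : ∀ {Fl : Subset m} → (∀ {g} → EH g → g ∈ Fl) → ∀ {e' q} → e' ≢ e → e' ∉ Fl → J e' a q → a ≢ q →
            Connects EH p q → Cl (Parallel Circ circuit-nonempty Fl e e')
          same-component {Fl} EH⊆ {e'} {q} ne e'∉ j a≢q cn = do
            (D , r , cycD , ¬b , D⊆ , r∈ , cn') ← spread offp
            let (C₀ , cyc₀ , e'∈ , C₀⊆) = cycle-through ne j a≢q cn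
                (X , circ , e'∈X , X⊆) = circuit-through {Y = Y e'} cycD ¬b cyc₀ e'∈ (λ h → EH-off-a (D⊆ h) (J-incˡ j))
                  (λ h → inj₁ (D⊆ h)) C₀⊆
                  (inj₂ (a , r , (e' , e'∈ , J-incˡ j) , r∈ , connects-trans (connects-edge je (inj₂ (inj₁ refl))) (connects-mono inj₁ cn')))
            pure (parallel circ (e' , e'∈X , e'∉) λ g∈ → only {Fl} EH⊆ (X⊆ g∈))

        -- With every component of G − {a,b} unbalanced, the edges at a form a parallel class
        -- after contracting G − {a,b}.
        all-connected : (∀ {p q} → Off p → Off q → Cl (Connects EH p q)) → (∃[ D ] (L D × (∀ {g} → g ∈ D → EH g))) → ⊥
        all-connected conn (D₀ , l₀ , D₀⊆) =
          break Circ circuit-nonempty unbreakable (λ g → Inc g a) flat e∉ f∉ (link-inc lke) ¬inc-f H₁ H₂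
          where
          -- A loop at `a` or `b` is disjoint from the cycle `D₀` of L, so it is not in F; balanced
          -- loops do not exist. It is thus in L and forms a circuit with `D₀`, so a flat containing
          -- `EH` must contain all loops.
          Loopy : E → Set
          Loopy g = EH g ⊎ (proj₁ (G g) ≡ proj₂ (G g))
          Loopy? : ∀ g → Dec (Loopy g)
          Loopy? g = EH? g ⊎-dec (proj₁ (G g) Finₚ.≟ proj₂ (G g))
          Fl : Subset m
          Fl = fromDec Loopy?
          link-out : ∀ {g c} → c ≡ a ⊎ c ≡ b → Link g c → g ∉ Fl
          link-out {g} c∈ (z , j , ne) q with ∈-fromDec⁻ Loopy? q
          ... | inj₁ eh = EH-off c∈ eh (J-incˡ j)
          ... | inj₂ eq = ne (loop-not-link {v = proj₁ (G g)} (inj₁ (cong (λ t → proj₁ (G g) , t) (sym eq))) j)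
          e∉ : e ∉ Fl
          e∉ = link-out (inj₁ refl) lke
          f∉ : f ∉ Fl
          f∉ = link-out (inj₂ refl) lkf
          not-loop : ∀ {g c} → g ∉ Fl → Inc g c → Link g c
          not-loop {g} g∉ i with inc-cases i
          ... | inj₂ lk = lk
          ... | inj₁ lp = ⊥-elim (g∉ (∈-fromDec⁺ Loopy? (inj₂ (loop-not-link lp (inj₁ refl)))))
          no-F-loop : ∀ {ℓ c} → c ≡ a ⊎ c ≡ b → J ℓ c c → ¬ F ⁅ ℓ ⁆
          no-F-loop {ℓ} c∈ lp fl with LF-meet _ _ l₀ fl
          ... | v , (h , h∈ , i) , (h' , h'∈ , i') with x∈⁅y⁆⇒x≡y ℓ h'∈
          ...   | refl with J-ends lp i'
          ...     | inj₁ refl = EH-off c∈ (D₀⊆ h∈) i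
          ...     | inj₂ refl = EH-off c∈ (D₀⊆ h∈) i
          flat : IsFlat Circ Fl
          flat g C g∉ circ g∈ C⊆ with not-EH (λ q → g∉ (∈-fromDec⁺ Loopy? (inj₁ q)))
          ... | c , c∈ , inc with circuit-links circ g∈ (not-loop g∉ inc)
          ...   | inj₁ (g' , ne , g'∈ , lk) = [ link-out c∈ lk , (λ q → ne (x∈⁅y⁆⇒x≡y g q)) ]′ (x∈p∪q⁻ Fl ⁅ g ⁆ (C⊆ g'∈))
          ...   | inj₂ (ℓ , ℓ∈ , lp , fl) = no-F-loop c∈ lp fl
          H₁ : ∀ {C} → Circ C → e ∈ C → ∃[ e' ] (e' ≢ e × e' ∈ C × e' ∉ Fl × Inc e' a)
          H₁ circ e∈ with circuit-links circ e∈ lke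
          ... | inj₁ (e' , ne , e'∈ , lk) = e' , ne , e'∈ , link-out (inj₁ refl) lk , link-inc lk
          ... | inj₂ (ℓ , ℓ∈ , lp , fl) = ⊥-elim (no-F-loop (inj₁ refl) lp fl)
          H₂ : ∀ {e'} → e' ≢ e → e' ∉ Fl → Inc e' a → Cl (Parallel Circ circuit-nonempty Fl e e')
          H₂ ne e'∉ i with not-loop e'∉ i
          ... | q , j , a≢q = do
            cn ← conn offp (other-end j a≢q)
            same-component {Fl} (λ q → ∈-fromDec⁺ Loopy? (inj₁ q)) ne e'∉ j a≢q cn

        -- Without cycles of L in G - {a,b} the unbalanced ones there are all in F. Hence two edges
        -- at `a` into different components join two of them to a loose handcuff, and the edges at
        -- `a` are parallel even when G - {a,b} is disconnected.
        all-F : NoL → ⊥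
        all-F noL = break Circ circuit-nonempty unbreakable (λ g → Inc g a) (flat₀ noL)
            (λ q → EH-off-a (Fl₀⁻ q) (link-inc lke)) (λ q → EH-off (inj₂ refl) (Fl₀⁻ q) (link-inc lkf))
            (link-inc lke) ¬inc-f H₁ H₂
          where
          H₁ : ∀ {C} → Circ C → e ∈ C → ∃[ e' ] (e' ≢ e × e' ∈ C × e' ∉ Fl₀ × Inc e' a)
          H₁ circ e∈ with circuit-mindeg circ e∈ lke
          ... | e' , ne , e'∈ , i = e' , ne , e'∈ , (λ q → EH-off-a (Fl₀⁻ q) i) , i
          isF : ∀ {C} → IsCycle G C → ¬ B C → (∀ {g} → g ∈ C → EH g) → F C
          isF {C} cyc ¬b sub with cover C cyc
          ... | inj₁ b = ⊥-elim (¬b b)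
          ... | inj₂ (inj₁ l) = ⊥-elim (noL l sub)
          ... | inj₂ (inj₂ f) = f
          H₂ : ∀ {e'} → e' ≢ e → e' ∉ Fl₀ → Inc e' a → Cl (Parallel Circ circuit-nonempty Fl₀ e e')
          H₂ {e'} ne e'∉ i with inc-cases i
          ... | inj₁ lp = do
            (D , r , cycD , ¬b , D⊆ , r∈ , cn') ← spread offp
            let (X , circ , e'∈X , X⊆) = circuit-through {Y = Y e'} cycD ¬b (loop-cycle lp) (x∈⁅x⁆ e') (λ h → EH-off-a (D⊆ h) i)
                  (λ h → inj₁ (D⊆ h)) (λ h → inj₂ (inj₂ (x∈⁅y⁆⇒x≡y e' h)))
                  (inj₂ (a , r , (e' , x∈⁅x⁆ e' , i) , r∈ , connects-trans (connects-edge je (inj₂ (inj₁ refl))) (connects-mono inj₁ cn')))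
            pure (parallel circ (e' , e'∈X , e'∉) λ g∈ → only {Fl₀} Fl₀⁺ (X⊆ g∈))
          ... | inj₂ (q , j , a≢q) = em {Connects EH p q} >>= λ where
            (yes cn) → same-component {Fl₀} Fl₀⁺ ne e'∉ j a≢q cn
            (no ¬cn) → do
              (D , r , cycD , ¬b , D⊆ , r∈ , cn) ← spread offp
              (D' , r' , cycD' , ¬b' , D'⊆ , r'∈ , cn') ← spread (other-end j a≢q)
              let disj : VertexDisjoint G D D'
                  disj v v∈ v∈' = ¬cn (connects-trans cn (connects-trans (connects-mono D⊆ (cycle-connects cycD r∈ v∈))
                    (connects-trans (connects-mono D'⊆ (cycle-connects cycD' v∈' r'∈)) (connects-sym cn'))))
                  (x , y , v , x∈ , y∈ , vY , circ) = loose-handcuff {Y = Y e'} (isF cycD ¬b D⊆) (isF cycD' ¬b' D'⊆) disj r∈ r'∈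
                    (connects-trans (connects-mono inj₁ (connects-sym cn)) (connects-trans (connects-edge (J-sym je) (inj₂ (inj₁ refl)))
                      (connects-trans (connects-edge j (inj₂ (inj₂ refl))) (connects-mono inj₁ cn'))))
                  in-Y : ∀ {g} → g ∈ (D ∪ D') ∪ es v → Y e' g
                  in-Y g∈ = [ (λ q → [ inj₁ ∘ D⊆ , inj₁ ∘ D'⊆ ]′ (x∈p∪q⁻ D D' q)) , (λ q → vY (∈es⁻ v q)) ]′ (x∈p∪q⁻ (D ∪ D') (es v) g∈)
                  -- The path of the handcuff joins different components of G - {a,b}, so it cannot
                  -- stay in the flat.
                  leave : ∃[ g ] (g ∈ es v × g ∉ Fl₀)
                  leave = [ (λ sub → ⊥-elim (¬cn (connects-trans cn (connects-trans (connects-mono D⊆ (cycle-connects cycD r∈ x∈))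
                              (connects-trans (v , λ q → Fl₀⁻ (sub (∈es⁺ v q))) (connects-trans (connects-mono D'⊆ (cycle-connects cycD' y∈ r'∈)) (connects-sym cn')))))))
                          , (λ w → w) ]′ (⊆-or-witness (es v) Fl₀)
                  (g , g∈ , g∉) = leave
              pure (parallel circ (g , x∈p∪q⁺ (inj₂ g∈) , g∉) λ g∈ → only {Fl₀} Fl₀⁺ (in-Y g∈))

      -- As G - {a,b} is connected, a single unbalanced cycle is reached from all of its vertices;
      -- then either some cycle of L lies in G - {a,b} or none does.
      balanced-off : (∀ {p q} → Off p → Off q → Cl (Connects EH p q)) → Cl (BalV Off)
      balanced-off conn ¬bal = run do
        let spread : ∀ {p} → Off p → Cl (∃[ C ] ∃[ q ] (IsCycle G C × ¬ B C × (∀ {g} → g ∈ C → EH g) × VO C q × Connects EH p q))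
            spread {p} offp k = ¬bal λ {C} cyc sub → decidable-stable (balanced? cyc) λ ¬b →
              let (g , g∈) = isCycle-nonempty cyc in
              conn {p} {proj₁ (G g)} offp (InV.end₁ (sub g∈)) λ cn → k (C , proj₁ (G g) , cyc , ¬b , (λ h∈ → sub h∈) , (g , g∈ , inj₁ refl) , cn)
        (yes D) ← em {∃[ D ] (L D × (∀ {g} → g ∈ D → EH g))}
          where (no ¬D) → λ k → k (all-F spread λ {C} l sub → ¬D (C , l , λ h∈ → sub h∈))
        λ k → k (all-connected spread conn D)

    -- Contracting around a third vertex

    -- The ways to attach `c`, which is `a` or `b`, by an edge `yc` compatible with `x`: there is no
    -- edge `xc`, or every edge `xc` closes with `yc` through `S` a cycle known to be balanced.
    data Choice (a b x c : V) : Set₁ where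
      nonadjacent : ∀ y → y ≢ x → Adj y c → ¬ Adj x c → Choice a b x c
      via : ∀ y → y ≢ x → Adj y c → (S : VSet) → (∀ {q} → S q → q ≢ a × q ≢ b) → ConnV S y x →
        BalV (S ∪ᵛ c) → Choice a b x c

    module _ {a b x : V} (a≢b : a ≢ b) (¬ab : ¬ Adj a b) (x≢a : x ≢ a) (x≢b : x ≢ b) where
      open NonAdjacent a≢b ¬ab

      Off₃ : VSet
      Off₃ p = Off p × p ≢ x

      private
        record Spoke (c : V) : Set where
          field
            y : V
            e : E
            j : J e y c
            y≢x : y ≢ x
            y≢c : y ≢ c
            ext : ∀ {g} → J g x c → ∃[ C ] (B C × g ∈ C × (∀ {h} → h ∈ C → (EH h ⊎ h ≡ e) ⊎ h ≡ g))

        spoke : ∀ {c} → c ≡ a ⊎ c ≡ b → Choice a b x c → Spoke c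
        spoke {c} c∈ (nonadjacent y y≢x (y≢c , e , j) ¬xc) = record { y = y ; e = e ; j = j ; y≢x = y≢x ; y≢c = y≢c
          ; ext = λ k → ⊥-elim (¬xc ([ (λ { refl → x≢a }) , (λ { refl → x≢b }) ]′ c∈ , _ , k)) }
        spoke {c} c∈ (via y y≢x (y≢c , e , j) S S⊆ conn bal) = record { y = y ; e = e ; j = j ; y≢x = y≢x ; y≢c = y≢c ; ext = ext }
          where
          c∉ : ¬ S c
          c∉ s = [ (λ { refl → proj₁ (S⊆ s) refl }) , (λ { refl → proj₂ (S⊆ s) refl }) ]′ c∈
          ext : ∀ {g} → J g x c → ∃[ C ] (B C × g ∈ C × (∀ {h} → h ∈ C → (EH h ⊎ h ≡ e) ⊎ h ≡ g))
          ext {g} k with close-at {S} j k (λ { refl → y≢x (J-unique (J-sym j) (J-sym k)) }) c∉ conn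
          ... | C , cyc , g∈ , C⊆ , CV = C , bal cyc CV , g∈ , λ h∈ → ⊎-map (⊎-map (λ (p , q) → S⊆ p , S⊆ q) (λ r → r)) (λ r → r) (C⊆ h∈)

      -- The edges at x form a parallel class after contracting the balanced closure of
      -- G − {a,b,x} together with the spokes at a and b.
      third-vertex : BalV Off → (∀ {p q} → Off₃ p → Off₃ q → Cl (ConnV Off₃ p q)) → ¬ BalV (_≢ x) →
        Choice a b x a → Choice a b x b → ⊥
      third-vertex bal conn unb chₐ ch_b = run do
          cx ← fin-choice {P = λ p → ∀ q → p ≢ x → q ≢ x → Connects Z₀ p q} (λ p → fin-choice (λ q → connect p q))
          fl ← comprehension (λ g → InV (_≢ x) g × BalE (Z₂ +ᵉ g))
          λ k → k (contract cx fl)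
        where
        module A = Spoke (spoke (inj₁ refl) chₐ)
        module Bb = Spoke (spoke (inj₂ refl) ch_b)
        Ay-off : Off A.y
        Ay-off = A.y≢c , λ eq → ¬ab (a≢b , A.e , J-sym (subst (λ t → J A.e t a) eq A.j))
        By-off : Off Bb.y
        By-off = (λ eq → ¬ab (a≢b , Bb.e , subst (λ t → J Bb.e t b) eq Bb.j)) , Bb.y≢c
        -- Each spoke is pendant over the balanced graph G - {a,b}, so adding both keeps it
        -- balanced.
        Z₁ : E → Set
        Z₁ = (EH +ᵉ A.e) +ᵉ Bb.e
        balZ₁ : BalE Z₁
        balZ₁ = pendant (pendant bal (A.y , J-sym A.j , A.y≢c ∘ sym) (λ q → EH-off (inj₁ refl) q))
          (Bb.y , J-sym Bb.j , Bb.y≢c ∘ sym)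
          λ { (inj₁ q) → EH-off (inj₂ refl) q
            ; (inj₂ refl) i → [ (λ q → proj₂ Ay-off (sym q)) , (λ q → a≢b (sym q)) ]′ (J-ends A.j i) }
        -- All edges at `x` can be added as well: those into G - {a,b} are there already, and those
        -- to `a` or `b` are certified by the two choices.
        Z₂ : E → Set
        Z₂ g = Z₁ g ⊎ Inc g x
        balZ₂ : BalE Z₂
        balZ₂ = bal-extend-all balZ₁ ext
          where
          ext : ∀ {g} → Inc g x → Z₁ g ⊎ ∃[ C ] (B C × g ∈ C × (∀ {h} → h ∈ C → (Z₁ +ᵉ g) h))
          ext {g} i with inc-J i
          ... | z , j with z Finₚ.≟ a | z Finₚ.≟ b
          ...   | no z≢a | no z≢b = inj₁ (inj₁ (inj₁ (inV j (x≢a , x≢b) (z≢a , z≢b))))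
          ...   | yes refl | _ = let (C , bC , g∈ , C⊆) = A.ext j in inj₂ (C , bC , g∈ , λ h∈ → ⊎-map inj₁ (λ q → q) (C⊆ h∈))
          ...   | no _ | yes refl = let (C , bC , g∈ , C⊆) = Bb.ext j in
                    inj₂ (C , bC , g∈ , λ h∈ → ⊎-map (⊎-map inj₁ (λ q → q)) (λ q → q) (C⊆ h∈))
        -- The part of `Z₁` off `x` connects all vertices of G - x, so it closes every further edge
        -- off `x` to a cycle.
        Z₀ : E → Set
        Z₀ g = Z₁ g × InV (_≢ x) g
        Z₁? : ∀ g → Dec (Z₁ g)
        Z₁? g = (EH? g ⊎-dec (g Finₚ.≟ A.e)) ⊎-dec (g Finₚ.≟ Bb.e)
        anchor : ∀ p → p ≢ x → ∃[ q ] (Off₃ q × Connects Z₀ p q)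
        anchor p p≢x with p Finₚ.≟ a | p Finₚ.≟ b
        ... | no p≢a | no p≢b = p , ((p≢a , p≢b) , p≢x) , connects-refl
        ... | yes refl | _ = A.y , (Ay-off , A.y≢x) , connects-edge (J-sym A.j) (inj₁ (inj₂ refl) , inV A.j A.y≢x p≢x)
        ... | no _ | yes refl = Bb.y , (By-off , Bb.y≢x) , connects-edge (J-sym Bb.j) (inj₂ refl , inV Bb.j Bb.y≢x p≢x)
        connect : ∀ p q → Cl (p ≢ x → q ≢ x → Connects Z₀ p q)
        connect p q with p Finₚ.≟ x | q Finₚ.≟ x
        ... | yes eq | _ = pure λ p≢x → ⊥-elim (p≢x eq)
        ... | no _ | yes eq = pure λ _ q≢x → ⊥-elim (q≢x eq)
        ... | no p≢x | no q≢x with anchor p p≢x | anchor q q≢x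
        ...   | p' , offp , cp | q' , offq , cq = do
          cn ← conn offp offq
          pure λ _ _ → connects-trans cp (connects-trans (connects-mono
            (λ (u , v) → inj₁ (inj₁ (proj₁ u , proj₁ v)) , (proj₂ u , proj₂ v)) (connV-edges cn)) (connects-sym cq))

        module _ (cx : ∀ p q → p ≢ x → q ≢ x → Connects Z₀ p q) (fl : Comprehension (λ g → InV (_≢ x) g × BalE (Z₂ +ᵉ g))) where
          open Comprehension fl renaming (set to Fl; out to Fl⁻; into to Fl⁺)
          -- `Fl` is the balanced closure of `Z₂` cut down to the edges off `x`. Membership speaks
          -- of one edge at a time; the cycles closed through `Z₀` make the edges compatible with
          -- each other.
          Z₃ : E → Set
          Z₃ g = Z₂ g ⊎ g ∈ Fl
          balZ₃ : BalE Z₃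
          balZ₃ = bal-extend-all balZ₂ ext
            where
            ext : ∀ {g} → g ∈ Fl → Z₂ g ⊎ ∃[ C ] (B C × g ∈ C × (∀ {h} → h ∈ C → (Z₂ +ᵉ g) h))
            ext {g} g∈ with Fl⁻ g∈ | Z₁? g
            ... | _ | yes z = inj₁ (inj₁ z)
            ... | (p≢x , q≢x) , bal' | no ¬z with cx (proj₂ (G g)) (proj₁ (G g)) q≢x p≢x
            ...   | w , w⊆ with close-walk {g = g} (inj₁ refl) w (λ q → ¬z (proj₁ (w⊆ q)))
            ...     | C , cyc , g∈C , C⁻ = inj₂ (C , bal' cyc C⊆ , g∈C , C⊆)
              where
              C⊆ : ∀ {h} → h ∈ C → (Z₂ +ᵉ g) h
              C⊆ h∈ = [ inj₂ , (λ q → inj₁ (inj₁ (proj₁ (w⊆ q)))) ]′ (C⁻ h∈)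
          Fl-off : ∀ {g} → g ∈ Fl → ¬ Inc g x
          Fl-off g∈ i = inV-end (proj₁ (Fl⁻ g∈)) i refl
          loop-bal : ∀ {ℓ} → J ℓ x x → B ⁅ ℓ ⁆
          loop-bal {ℓ} lp = balZ₂ (loop-cycle lp) (λ q → inj₂ (subst (λ t → Inc t x) (sym (x∈⁅y⁆⇒x≡y ℓ q)) (J-incˡ lp)))
          flat : IsFlat Circ Fl
          flat g C g∉ circ g∈ C⊆ = go (inc? g x)
            where
            rest : ∀ {h} → h ∈ C → h ≢ g → h ∈ Fl
            rest h∈ ne = [ (λ q → q) , (λ q → ⊥-elim (ne (x∈⁅y⁆⇒x≡y g q))) ]′ (x∈p∪q⁻ Fl ⁅ g ⁆ (C⊆ h∈))
            go : Dec (Inc g x) → ⊥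
            go (yes i) with inc-cases i
            ... | inj₁ lp = no-balanced-loop lp (loop-bal lp)
            ... | inj₂ lk with circuit-mindeg circ g∈ lk
            ...   | g' , ne , g'∈ , i' = Fl-off (rest g'∈ ne) i'
            go (no ¬i) with circuit-unbalanced-cycle circ g∈
            ... | inj₂ (K , cyc , ¬b , K⊆ , g∉K) = ¬b (balZ₃ cyc λ h∈ → inj₂ (rest (K⊆ h∈) λ { refl → g∉K h∈ }))
            ... | inj₁ b' = g∉ (Fl⁺ (((λ q → ¬i (inj₁ q)) , (λ q → ¬i (inj₂ q))) , λ cyc sub →
                    bal-extend balZ₃ b' g∈ (λ {h} h∈ → add h∈) cyc (λ h∈ → ⊎-map inj₁ (λ q → q) (sub h∈))))
              where
              add : ∀ {h} → h ∈ C → (Z₃ +ᵉ g) h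
              add {h} h∈ with h Finₚ.≟ g
              ... | yes eq = inj₂ eq
              ... | no ne = inj₁ (inj₂ (rest h∈ ne))
          e = proj₁ (link-at x)
          lke : Link e x
          lke = proj₂ (link-at x)
          H₁ : ∀ {C} → Circ C → e ∈ C → ∃[ e' ] (e' ≢ e × e' ∈ C × e' ∉ Fl × Inc e' x)
          H₁ circ e∈ with circuit-mindeg circ e∈ lke
          ... | e' , ne , e'∈ , i = e' , ne , e'∈ , (λ q → Fl-off q i) , i
          H₂ : ∀ {e'} → e' ≢ e → e' ∉ Fl → Inc e' x → Cl (Parallel Circ circuit-nonempty Fl e e')
          H₂ {e'} ne e'∉ i with inc-cases i
          ... | inj₁ lp = ⊥-elim (no-balanced-loop lp (loop-bal lp))
          ... | inj₂ (q , j , x≢q) with cx (proj₁ lke) q (proj₂ (proj₂ lke) ∘ sym) (x≢q ∘ sym)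
          ...   | w , w⊆ with close-walk (J-sym j) (cons e (proj₁ (proj₂ lke)) w) e'∉w
            where
            e'∉w : ¬ e' ∈ᵉ cons e (proj₁ (proj₂ lke)) w
            e'∉w (inj₁ r) = ne r
            e'∉w (inj₂ r) = inV-end (proj₂ (w⊆ r)) i refl
          ...     | C , cyc , e'∈ , C⁻ = pure (parallel (inj₁ (balZ₂ cyc λ h∈ → in-Z (C⁻ h∈))) (e' , e'∈ , e'∉) λ h∈ h∉ → only h∉ (C⁻ h∈))
            where
            in-Z : ∀ {h} → h ≡ e' ⊎ (h ≡ e ⊎ h ∈ᵉ w) → Z₂ h
            in-Z (inj₁ refl) = inj₂ i
            in-Z (inj₂ (inj₁ refl)) = inj₂ (link-inc lke)
            in-Z (inj₂ (inj₂ r)) = inj₁ (proj₁ (w⊆ r))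
            only : ∀ {h} → h ∉ Fl → h ≡ e' ⊎ (h ≡ e ⊎ h ∈ᵉ w) → h ≡ e ⊎ h ≡ e'
            only h∉ (inj₁ r) = inj₂ r
            only h∉ (inj₂ (inj₁ r)) = inj₁ r
            only {h} h∉ (inj₂ (inj₂ r)) = ⊥-elim (h∉ (Fl⁺ (proj₂ (w⊆ r) , λ cyc sub →
              balZ₂ cyc λ k∈ → [ (λ q → q) , (λ { refl → inj₁ (proj₁ (w⊆ r)) }) ]′ (sub k∈))))
          contract : ⊥
          contract with Finₚ.any? (λ g → ¬? (inc? g x) ×-dec ¬? (g ∈? Fl))
          -- If the flat contained every edge off `x`, then G - x would be balanced. An edge off `x`
          -- outside the flat is the element that the parallel class at `x` misses.
          ... | no none = unb λ cyc sub → balZ₃ cyc λ {g} g∈ → inj₂ (decidable-stable (g ∈? Fl)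
                  λ g∉ → none (g , (λ i → inV-end (sub g∈) i refl) , g∉))
          ... | yes (f , ¬i , f∉) = break Circ circuit-nonempty unbreakable (λ g → Inc g x) flat
                  (λ q → Fl-off q (link-inc lke)) f∉ (link-inc lke) ¬i H₁ H₂

    -- Minimal unbalanced cycles

    adj? : ∀ p q → Dec (Adj p q)
    adj? p q = ¬? (p Finₚ.≟ q) ×-dec Finₚ.any? (λ e → J? e)
      where
      _≟²_ = ≡-dec Finₚ._≟_ Finₚ._≟_
      J? : ∀ e → Dec (J e p q)
      J? e = (G e ≟² (p , q)) ⊎-dec (G e ≟² (q , p))

    balV-stable : ∀ {S} → Cl (BalV S) → BalV S
    balV-stable c cyc sub = decidable-stable (balanced? cyc) λ ¬b → c λ bal → ¬b (bal cyc sub)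

    cycle-inV : ∀ {C} {S : VSet} → (∀ {p} → VO C p → S p) → ∀ {g} → g ∈ C → InV S g
    cycle-inV sub g∈ = sub (_ , g∈ , inj₁ refl) , sub (_ , g∈ , inj₂ refl)

    VS : Subset m → Subset n
    VS C = fromDec (vo? C)

    record MinCycle (T : VSet) : Set where
      field
        C : Subset m
        cyc : IsCycle G C
        unbal : ¬ B C
        inT : ∀ {p} → VO C p → T p
        minimal : ∀ {C'} → IsCycle G C' → ¬ B C' → (∀ {p} → VO C' p → T p) → ∣ VS C ∣ ≤ ∣ VS C' ∣

    min-cycle : ∀ {T} → ¬ BalV T → Cl (MinCycle T)
    min-cycle {T} unb k = unb λ {C} cyc sub → decidable-stable (balanced? cyc) λ ¬b →
      go (suc ∣ VS C ∣) C cyc ¬b (λ { (g , g∈ , i) → inV-end (sub g∈) i }) ℕₚ.≤-refl k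
      where
      go : ∀ t C → IsCycle G C → ¬ B C → (∀ {p} → VO C p → T p) → ∣ VS C ∣ < t → Cl (MinCycle T)
      go (suc t) C cyc ¬b inT (s≤s lt) = em {∃[ C' ] (IsCycle G C' × ¬ B C' × (∀ p → VO C' p → T p) × ∣ VS C' ∣ < ∣ VS C ∣)} >>= λ where
        (yes (C' , cyc' , ¬b' , inT' , lt')) → go t C' cyc' ¬b' (λ {p} → inT' p) (ℕₚ.≤-trans lt' lt)
        (no none) → pure record { C = C ; cyc = cyc ; unbal = ¬b ; inT = inT ;
          minimal = λ cyc' ¬b' inT' → ℕₚ.≮⇒≥ λ lt → none (_ , cyc' , ¬b' , (λ p → inT' {p}) , lt) }

    one-edge : ∀ {x y} (w : Walk x y) → x ≢ y → Simple w → (∀ {z} → z ∈ᵛ w → z ≡ x ⊎ z ≡ y) → ∃[ g ] (g ∈ᵉ w × J g x y)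
    one-edge nil ne _ _ = ⊥-elim (ne refl)
    one-edge (cons g j nil) ne _ _ = g , inj₁ refl , j
    one-edge (cons g j w@(cons _ _ w')) ne (x∉ , z∉ , _) inner with inner (inj₂ (start∈ w))
    ... | inj₁ refl = ⊥-elim (x∉ (start∈ w))
    ... | inj₂ refl = ⊥-elim (z∉ (end∈ w'))

    module Minimal {T : VSet} (mc : MinCycle T) where
      open MinCycle mc public

      D : VSet
      D = VO C

      D? : ∀ p → Dec (D p)
      D? = vo? C

      size : ℕ
      size = ∣ VS C ∣

      bal-proper : ∀ {S : VSet} {z} → (∀ {p} → S p → D p) → D z → ¬ S z → BalV S
      bal-proper {S} {z} S⊆ z∈ z∉ {C'} cyc' sub = decidable-stable (balanced? cyc') λ ¬b →
        ℕₚ.<⇒≱ (p⊂q⇒∣p∣<∣q∣ ((λ q → ∈-fromDec⁺ D? (S⊆ (inS (∈-fromDec⁻ (vo? C') q)))) ,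
            z , ∈-fromDec⁺ D? z∈ , λ q → z∉ (inS (∈-fromDec⁻ (vo? C') q))))
          (minimal cyc' ¬b (λ q → inT (S⊆ (inS q))))
        where
        inS : ∀ {p} → VO C' p → S p
        inS (g , g∈ , i) = inV-end (sub g∈) i

      bal-small : ∀ {S : VSet} (l : List V) → (∀ {p} → S p → T p) → (∀ {p} → S p → p ∈ˡ l) → length l < size → BalV S
      bal-small {S} l S⊆ S⊆l lt {C'} cyc' sub = decidable-stable (balanced? cyc') λ ¬b →
        ℕₚ.<⇒≱ lt (ℕₚ.≤-trans (minimal cyc' ¬b (λ q → S⊆ (inS q)))
          (ℕₚ.≤-trans (p⊆q⇒∣p∣≤∣q∣ λ q → ∈-fromList⁺ (S⊆l (inS (∈-fromDec⁻ (vo? C') q)))) (∣fromList∣≤ l)))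
        where
        inS : ∀ {p} → VO C' p → S p
        inS (g , g∈ , i) = inV-end (sub g∈) i

      abstract
        D-outside : ∀ l → length l < size → ∃[ z ] (D z × z ∉ˡ l)
        D-outside l lt with Finₚ.any? (λ z → D? z ×-dec ¬? (DecMem._∈?_ Finₚ._≟_ z l))
        ... | yes w = w
        ... | no none = ⊥-elim (ℕₚ.<⇒≱ lt (ℕₚ.≤-trans (p⊆q⇒∣p∣≤∣q∣ λ {z} q → ∈-fromList⁺
                (decidable-stable (DecMem._∈?_ Finₚ._≟_ z l) λ ¬p → none (z , ∈-fromDec⁻ D? q , ¬p))) (∣fromList∣≤ l)))

      abstract
        exhausts : ∀ l → NoDup l → (∀ {z} → z ∈ˡ l → D z) → size ≤ length l → ∀ {z} → D z → z ∈ˡ l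
        exhausts l nd inD ≤l {z} z∈ = decidable-stable (DecMem._∈?_ Finₚ._≟_ z l) λ z∉ →
          ℕₚ.<⇒≱ (ℕₚ.≤-trans (∣fromList∣≥ (z ∷ l) (z∉ , nd)) (p⊆q⇒∣p∣≤∣q∣ λ q → ∈-fromDec⁺ D? (all z∉ (∈-fromList⁻ (z ∷ l) q)))) ≤l
          where
          all : z ∉ˡ l → ∀ {y} → y ∈ˡ (z ∷ l) → D y
          all _ (here refl) = z∈
          all _ (there q) = inD q

      D-nonempty : ∃[ p ] D p
      D-nonempty with isCycle-nonempty cyc
      ... | g , g∈ = proj₁ (G g) , g , g∈ , inj₁ refl

      private
        -- If the cycle P₁ ∪ S is unbalanced it must span D, so P₂ has no internal vertex.
        spanning-arc : ∀ {P₁ P₂ S} (th : Theta P₁ P₂ S) → C ≡ P₁ ∪ P₂ → ¬ B (P₁ ∪ S) → (∀ {z} → VO S z → D z) →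
          ∃[ g ] (g ∈ C × J g (Theta.x th) (Theta.y th))
        spanning-arc {P₁} {P₂} {S} th refl ¬b S⊆ with one-edge w₂ x≢y s₂ inner
          where
          open Theta th
          inner : ∀ {z} → z ∈ᵛ w₂ → z ≡ x ⊎ z ≡ y
          inner {z} z∈ with z Finₚ.≟ x | z Finₚ.≟ y
          ... | yes e | _ = inj₁ e
          ... | no _ | yes e = inj₂ e
          ... | no z≢x | no z≢y = ⊥-elim (¬b (bal-proper {S = λ p → D p × p ≢ z} proj₁
                  (let (g , g∈ , i) = vertex-edge w₂ x≢y z∈ in g , x∈p∪q⁺ (inj₂ (e₂⁺ g∈)) , i) (λ q → proj₂ q refl)
                  (theta-cycle₁₃ th) (cycle-inV away)))
            where
            away : ∀ {p} → VO (P₁ ∪ S) p → D p × p ≢ z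
            away (g , g∈ , i) with x∈p∪q⁻ P₁ S g∈
            ... | inj₁ q = (g , x∈p∪q⁺ (inj₁ q) , i) , λ { refl → [ z≢x , z≢y ]′ (Separated.meet sep₁₂ (∈ᵉ-ends w₁ (e₁⁻ q) i) z∈) }
            ... | inj₂ q = S⊆ (g , q , i) , λ { refl → [ z≢x , z≢y ]′ (Separated.meet sep₂₃ z∈ (∈ᵉ-ends w₃ (e₃⁻ q) i)) }
        ... | g , g∈ , j = g , x∈p∪q⁺ (inj₂ (Theta.e₂⁺ th g∈)) , j

      abstract
        -- An edge `f` outside `C` forms a theta with it, and not both cycles through `f` are
        -- balanced. An unbalanced one must have all vertices of `C` by minimality, so the arc that
        -- it skips is a single edge parallel to `f`.
        no-chord : ∀ {p q} → D p → D q → Adj p q → ∃[ g ] (g ∈ C × J g p q)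
        no-chord {p} {q} p∈ q∈ (p≢q , f , j) with f ∈? C
        ... | yes f∈ = f , f∈ , j
        ... | no f∉ with ear-theta cyc p∈ q∈ p≢q (cons f j nil) (p≢q , tt) (λ r _ → r) (λ { (inj₁ refl) → f∉ })
        ...   | P₁ , P₂ , th , eq , eqx , eqy = go (balanced? (theta-cycle₁₃ th)) (balanced? (theta-cycle₂₃ th))
          where
          S⊆ : ∀ {z} → VO (es (cons f j nil)) z → D z
          S⊆ (g , g∈ , i) with ∈es⁻ (cons f j nil) g∈
          ... | inj₁ refl = [ (λ { refl → p∈ }) , (λ { refl → q∈ }) ]′ (J-ends j i)
          go : Dec (B (P₁ ∪ es (cons f j nil))) → Dec (B (P₂ ∪ es (cons f j nil))) → ∃[ g ] (g ∈ C × J g p q)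
          go (yes b₁) (yes b₂) = ⊥-elim (unbal (subst B (sym eq) (theta-third' th b₁ b₂)))
          go (no ¬b) _ with spanning-arc th eq ¬b S⊆
          ... | g , g∈ , k = g , g∈ , subst₂ (J g) eqx eqy k
          go (yes _) (no ¬b) with spanning-arc (theta-flip th) (trans eq (∪-comm P₁ P₂)) ¬b S⊆
          ... | g , g∈ , k = g , g∈ , subst₂ (J g) eqx eqy k

      degree≤2 : ∀ {c q₁ q₂ q₃} → D c → D q₁ → D q₂ → D q₃ → q₁ ≢ q₂ → q₁ ≢ q₃ → q₂ ≢ q₃ →
        Adj c q₁ → Adj c q₂ → Adj c q₃ → ⊥
      degree≤2 c∈ d₁ d₂ d₃ n₁₂ n₁₃ n₂₃ a₁ a₂ a₃ with no-chord c∈ d₁ a₁ | no-chord c∈ d₂ a₂ | no-chord c∈ d₃ a₃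
      ... | g₁ , g₁∈ , j₁ | g₂ , g₂∈ , j₂ | g₃ , g₃∈ , j₃ with open-cycle cyc g₁∈ (J-incˡ j₁)
      ...   | y , cy with cyc-degree≤2 cy
      ...     | e' , only with only g₂∈ (J-incˡ j₂) | only g₃∈ (J-incˡ j₃)
      ...       | inj₁ refl | _ = n₁₂ (J-unique j₁ j₂)
      ...       | _ | inj₁ refl = n₁₃ (J-unique j₁ j₃)
      ...       | inj₂ refl | inj₂ refl = n₂₃ (J-unique j₂ j₃)

      abstract
        triangle : ∀ {p q r} → D p → D q → D r → Adj p q → Adj q r → Adj p r → ∀ {z} → D z → z ≡ p ⊎ z ≡ q ⊎ z ≡ r
        triangle p∈ q∈ r∈ pq qr pr = let (_ , g₁∈ , j₁) = no-chord p∈ q∈ pq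
                                         (_ , g₂∈ , j₂) = no-chord q∈ r∈ qr
                                         (_ , g₃∈ , j₃) = no-chord p∈ r∈ pr
          in cycle-of-triangle cyc g₁∈ g₂∈ g₃∈ j₁ j₂ j₃ (proj₁ pq) (proj₁ qr)

      abstract
        two-neighbours : ∀ {c d d'} → D c → D d → D d' → c ≢ d → c ≢ d' → d ≢ d' →
          ∃[ y ] ∃[ y' ] (D y × D y' × y ≢ y' × Adj c y × Adj c y')
        two-neighbours {c} {d} {d'} c∈ d∈ d'∈ n₁ n₂ n₃ with local-shape cyc c∈
        ... | loop only = ⊥-elim (n₁ (sym (only d∈)))
        ... | digon y e c≢y e∈ j only = ⊥-elim (aux (only d∈) (only d'∈))
          where
          aux : d ≡ c ⊎ d ≡ y → d' ≡ c ⊎ d' ≡ y → ⊥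
          aux (inj₁ q) _ = n₁ (sym q)
          aux _ (inj₁ q) = n₂ (sym q)
          aux (inj₂ q) (inj₂ r) = n₃ (trans q (sym r))
        ... | bend y y' e e' c≢y c≢y' y≢y' e∈ j e'∈ j' =
          y , y' , (e , e∈ , J-incʳ j) , (e' , e'∈ , J-incʳ j') , y≢y' , (c≢y , e , j) , (c≢y' , e' , j')

      small-clique : size ≤ 3 → ∀ {c d} → D c → D d → c ≢ d → Adj c d
      small-clique ≤3 {c} {d} c∈ d∈ c≢d with local-shape cyc c∈
      ... | loop only = ⊥-elim (c≢d (sym (only d∈)))
      ... | digon y e c≢y e∈ j only with only d∈
      ...   | inj₁ q = ⊥-elim (c≢d (sym q))
      ...   | inj₂ refl = c≢y , e , j
      small-clique ≤3 {c} {d} c∈ d∈ c≢d | bend y y' e e' c≢y c≢y' y≢y' e∈ j e'∈ j' with exhausts (c ∷ y ∷ y' ∷ [])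
        ((λ { (here q) → c≢y q ; (there (here q)) → c≢y' q }) , (λ { (here q) → y≢y' q }) , (λ ()) , tt)
        (λ { (here refl) → c∈ ; (there (here refl)) → e , e∈ , J-incʳ j ; (there (there (here refl))) → e' , e'∈ , J-incʳ j' }) ≤3 d∈
      ... | here q = ⊥-elim (c≢d (sym q))
      ... | there (here refl) = c≢y , e , j
      ... | there (there (here refl)) = c≢y' , e' , j'

    Off : V → V → VSet
    Off a b p = p ≢ a × p ≢ b

    Conn₂ : V → V → Set
    Conn₂ a b = ∀ {p q} → Off a b p → Off a b q → Cl (ConnV (Off a b) p q)

    nonedge-balanced : ∀ {a b} → a ≢ b → ¬ Adj a b → Conn₂ a b → BalV (Off a b)
    nonedge-balanced a≢b ¬ab conn = balV-stable (NonAdjacent.balanced-off a≢b ¬ab λ p q → do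
      c ← conn p q
      pure (connV-edges c))

    nonedge-unbalanced : ∀ {a b} → a ≢ b → ¬ Adj a b → Conn₂ a b → ¬ BalV (_≢ b)
    nonedge-unbalanced a≢b ¬ab conn = NonAdjacent.one-more-unbalanced a≢b ¬ab λ p q → do
      c ← conn p q
      pure (connV-edges c)

    connV-refl : ∀ {S : VSet} {p} → S p → ConnV S p p
    connV-refl s = nil , λ { refl → s }

    connV-trans : ∀ {S : VSet} {p q r} → ConnV S p q → ConnV S q r → ConnV S p r
    connV-trans (w , a) (v , b) = w ⊕ v , λ q → [ a , b ]′ (∈ᵛ-⊕⁻ w v q)

    connV-sym : ∀ {S : VSet} {p q} → ConnV S p q → ConnV S q p
    connV-sym (w , a) = rev w , λ q → a (∈ᵛ-rev⁻ w q)

    connV-mono : ∀ {S T : VSet} {p q} → (∀ {r} → S r → T r) → ConnV S p q → ConnV T p q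
    connV-mono f (w , a) = w , λ q → f (a q)

    connV-adj : ∀ {S : VSet} {p q} → S p → S q → Adj p q → ConnV S p q
    connV-adj sp sq (_ , e , j) = cons e j nil , λ { (inj₁ refl) → sp ; (inj₂ refl) → sq }

    connV-near : ∀ {S : VSet} {p q} → S p → S q → (p ≢ q → Adj p q) → ConnV S p q
    connV-near {p = p} {q} sp sq adj with p Finₚ.≟ q
    ... | yes refl = connV-refl sp
    ... | no ne = connV-adj sp sq (adj ne)

    -- Graphs without 2-vertex cuts

    module NoCut (conn₂ : ∀ {a b} → Conn₂ a b) where

      bal-miss : ∀ {a b} {S : VSet} → a ≢ b → ¬ Adj a b → ¬ S a → ¬ S b → BalV S
      bal-miss a≢b ¬ab a∉ b∉ = balV-mono (λ s → (λ { refl → a∉ s }) , λ { refl → b∉ s }) (nonedge-balanced a≢b ¬ab conn₂)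

      unb : ∀ {a b} → a ≢ b → ¬ Adj a b → ¬ BalV (_≢ a)
      unb a≢b ¬ab = nonedge-unbalanced (a≢b ∘ sym) (¬ab ∘ adj-sym) conn₂

      -- Otherwise deleting `p` and `q` would isolate `v` from a fourth vertex.
      neighbour : ∀ {v p q} → v ≢ p → v ≢ q → ∃[ r ] (Adj v r × r ≢ p × r ≢ q)
      neighbour {v} {p} {q} v≢p v≢q with Finₚ.any? (λ r → adj? v r ×-dec (¬? (r Finₚ.≟ p) ×-dec ¬? (r Finₚ.≟ q)))
      ... | yes w = w
      ... | no none with fresh (v ∷ p ∷ q ∷ []) (ℕₚ.≤-trans (ℕₚ.m≤n+m 4 3) 6<n)
      ...   | z , z∉ = ⊥-elim (conn₂ {p} {q} (v≢p , v≢q) ((λ e → z∉ (1st e)) , λ e → z∉ (2nd e)) λ (w , wv) → step (simplify w) wv)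
        where
        step : ∀ {w : Walk v z} → (Σ (Walk v z) λ u → Simple u × (∀ {p} → p ∈ᵛ u → p ∈ᵛ w) × (∀ {g} → g ∈ᵉ u → g ∈ᵉ w)) →
          (∀ {r} → r ∈ᵛ w → Off p q r) → ⊥
        step (nil , _) wv = z∉ (0th refl)
        step (cons {y = y} e j u , (v∉ , _) , uv , _) wv =
          none (y , ((λ { refl → v∉ (start∈ u) }) , e , j) , wv (uv (inj₂ (start∈ u))))

      three-neighbours : ∀ v → ∃[ r₁ ] ∃[ r₂ ] ∃[ r₃ ] (Adj v r₁ × Adj v r₂ × Adj v r₃ × r₁ ≢ r₂ × r₁ ≢ r₃ × r₂ ≢ r₃)
      three-neighbours v with link-at v
      ... | g , r₁ , j , v≢r₁ with neighbour v≢r₁ v≢r₁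
      ...   | r₂ , a₂ , r₂≢r₁ , _ with neighbour v≢r₁ (proj₁ a₂)
      ...     | r₃ , a₃ , r₃≢r₁ , r₃≢r₂ = r₁ , r₂ , r₃ , (v≢r₁ , g , j) , a₂ , a₃ , r₂≢r₁ ∘ sym , r₃≢r₁ ∘ sym , r₃≢r₂ ∘ sym

      module WithMinimal (mc : MinCycle (λ _ → ⊤)) where
        open Minimal mc

        unbal-D : ¬ BalV D
        unbal-D bal = unbal (bal cyc (cycle-inV (λ q → q)))

        Q-clique : ∀ {p q} → ¬ D p → ¬ D q → p ≢ q → Adj p q
        Q-clique {p} {q} p∉ q∉ ne = decidable-stable (adj? p q) λ ¬a → unbal-D (bal-miss ne ¬a p∉ q∉)

        hits : ∀ {p q} → p ≢ q → ¬ Adj p q → D p ⊎ D q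
        hits {p} {q} ne ¬a with D? p | D? q
        ... | yes a | _ = inj₁ a
        ... | no _ | yes b = inj₂ b
        ... | no a | no b = ⊥-elim (unbal-D (bal-miss ne ¬a a b))

        unb-Q : ∀ {x} → ¬ D x → ¬ BalV (_≢ x)
        unb-Q x∉ bal = unbal-D (balV-mono (λ { d refl → x∉ d }) bal)

        -- Shortest unbalanced cycles of length at least four

        module Large (4≤ : 4 ≤ size) where

          -- There are three neighbours in G, but at most two in the chordless cycle.
          Q-neighbour : ∀ {c} → D c → ∃[ q ] (¬ D q × Adj c q)
          Q-neighbour {c} c∈ with three-neighbours c
          ... | r₁ , r₂ , r₃ , a₁ , a₂ , a₃ , n₁ , n₂ , n₃ with D? r₁ | D? r₂ | D? r₃
          ...   | no d | _ | _ = r₁ , d , a₁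
          ...   | _ | no d | _ = r₂ , d , a₂
          ...   | _ | _ | no d = r₃ , d , a₃
          ...   | yes d₁ | yes d₂ | yes d₃ = ⊥-elim (degree≤2 c∈ d₁ d₂ d₃ n₁ n₂ n₃ a₁ a₂ a₃)

          non-neighbour : ∀ {c} → D c → ∃[ b ] (D b × c ≢ b × ¬ Adj c b)
          non-neighbour {c} c∈ with D-outside (c ∷ []) (ℕₚ.≤-trans (s≤s (s≤s z≤n)) 4≤)
          ... | z₁ , d₁ , z₁∉ with D-outside (c ∷ z₁ ∷ []) (ℕₚ.≤-trans (s≤s (s≤s (s≤s z≤n))) 4≤)
          ...   | z₂ , d₂ , z₂∉ with D-outside (c ∷ z₁ ∷ z₂ ∷ []) 4≤
          ...     | z₃ , d₃ , z₃∉ with adj? c z₁ | adj? c z₂ | adj? c z₃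
          ...       | no a | _ | _ = z₁ , d₁ , (λ e → z₁∉ (0th (sym e))) , a
          ...       | _ | no a | _ = z₂ , d₂ , (λ e → z₂∉ (0th (sym e))) , a
          ...       | _ | _ | no a = z₃ , d₃ , (λ e → z₃∉ (0th (sym e))) , a
          ...       | yes a₁ | yes a₂ | yes a₃ = ⊥-elim (degree≤2 c∈ d₁ d₂ d₃
                        (λ e → z₂∉ (1st (sym e))) (λ e → z₃∉ (1st (sym e))) (λ e → z₃∉ (2nd (sym e))) a₁ a₂ a₃)

          Quad : V → V → V → V → VSet
          Quad y q x c p = p ≡ y ⊎ p ≡ q ⊎ p ≡ x ⊎ p ≡ c

          -- No route from `c` over two vertices outside `D` to `x` is balanced together with its
          -- ends, so the choice `via` is blocked for this pair.
          Bad : V → V → Set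
          Bad c x = ∀ y q → ¬ D y → ¬ D q → Adj c y → Adj x q → ¬ BalV (Quad y q x c)

          bad-sym : ∀ {c x} → Bad c x → Bad x c
          bad-sym bad y q y∉ q∉ ay aq bal = bad q y q∉ y∉ aq ay (balV-mono
            (λ { (inj₁ e) → inj₂ (inj₁ e) ; (inj₂ (inj₁ e)) → inj₁ e ; (inj₂ (inj₂ (inj₁ e))) → inj₂ (inj₂ (inj₂ e)) ; (inj₂ (inj₂ (inj₂ e))) → inj₂ (inj₂ (inj₁ e)) }) bal)

          good : ∀ {c x} → ¬ Bad c x → Cl (∃[ y ] ∃[ q ] (¬ D y × ¬ D q × Adj c y × Adj x q × BalV (Quad y q x c)))
          good {c} {x} ¬bad k = ¬bad λ y q y∉ q∉ ay aq bal → k (y , q , y∉ , q∉ , ay , aq , λ {C} → bal {C})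

          choice : ∀ {a b x c} → D a → D b → D x → x ≢ a → x ≢ b →
            (∃[ y ] ∃[ q ] (¬ D y × ¬ D q × Adj c y × Adj x q × BalV (Quad y q x c))) → Choice a b x c
          choice {a} {b} {x} {c} a∈ b∈ x∈ x≢a x≢b (y , q , y∉ , q∉ , ay , aq , bal) =
            via y (λ { refl → y∉ x∈ }) (adj-sym ay) S S-off
              (connV-trans {q = q} (connV-near (inj₁ refl) (inj₂ (inj₁ refl)) (Q-clique y∉ q∉)) (connV-adj (inj₂ (inj₁ refl)) (inj₂ (inj₂ refl)) (adj-sym aq)))
              (balV-mono (λ { (inj₁ (inj₁ e)) → inj₁ e ; (inj₁ (inj₂ (inj₁ e))) → inj₂ (inj₁ e) ; (inj₁ (inj₂ (inj₂ e))) → inj₂ (inj₂ (inj₁ e)) ; (inj₂ e) → inj₂ (inj₂ (inj₂ e)) }) (λ {C} → bal {C}))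
            where
            S : VSet
            S p = p ≡ y ⊎ p ≡ q ⊎ p ≡ x
            S-off : ∀ {p} → S p → p ≢ a × p ≢ b
            S-off (inj₁ refl) = (λ { refl → y∉ a∈ }) , λ { refl → y∉ b∈ }
            S-off (inj₂ (inj₁ refl)) = (λ { refl → q∉ a∈ }) , λ { refl → q∉ b∈ }
            S-off (inj₂ (inj₂ refl)) = x≢a , x≢b

          -- The third-vertex argument inside D: x sees the pair a, b through a bad edge.
          bad-edge : ∀ {a b x} → D a → D b → D x → a ≢ b → ¬ Adj a b → x ≢ a → x ≢ b → Cl (Bad a x ⊎ Bad b x)
          bad-edge {a} {b} {x} a∈ b∈ x∈ a≢b ¬ab x≢a x≢b = em {Bad a x} >>= λ
            { (yes bad) → pure (inj₁ bad)
            ; (no ¬a) → em {Bad b x} >>= λ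
              { (yes bad) → pure (inj₂ bad)
              ; (no ¬b) → λ _ → run (good ¬a >>= λ ga → good ¬b >>= λ gb → λ k → k
                  (third-vertex a≢b ¬ab x≢a x≢b (nonedge-balanced a≢b ¬ab conn₂) conn₃
                  (let (b' , _ , ne , ¬adj) = non-neighbour x∈ in unb ne ¬adj)
                  (choice a∈ b∈ x∈ x≢a x≢b ga) (choice a∈ b∈ x∈ x≢a x≢b gb))) } }
            where
            Off₃' : VSet
            Off₃' p = Off a b p × p ≢ x
            Q-off : ∀ {q} → ¬ D q → Off₃' q
            Q-off q∉ = ((λ { refl → q∉ a∈ }) , λ { refl → q∉ b∈ }) , λ { refl → q∉ x∈ }
            to-Q : ∀ {p} → Off₃' p → ∃[ q ] (¬ D q × ConnV Off₃' p q)
            to-Q {p} off with D? p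
            ... | no p∉ = p , p∉ , connV-refl off
            ... | yes p∈ with Q-neighbour p∈
            ...   | q , q∉ , aq = q , q∉ , connV-adj off (Q-off q∉) aq
            conn₃ : ∀ {p q} → Off₃' p → Off₃' q → Cl (ConnV Off₃' p q)
            conn₃ offp offq with to-Q offp | to-Q offq
            ... | p' , p'∉ , cp | q' , q'∉ , cq = pure (connV-trans cp (connV-trans
                    (connV-near (Q-off p'∉) (Q-off q'∉) (Q-clique p'∉ q'∉)) (connV-sym cq)))

          -- The four vertices of a `Quad` cannot carry an unbalanced cycle if the shortest one has
          -- five, so no pair is bad.
          not-five : 5 ≤ size → ⊥
          not-five 5≤ with D-nonempty
          ... | a , a∈ with non-neighbour a∈
          ...   | b , b∈ , a≢b , ¬ab with D-outside (a ∷ b ∷ []) (ℕₚ.≤-trans (s≤s (s≤s (s≤s z≤n))) 4≤)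
          ...     | x , x∈ , x∉ = bad-edge a∈ b∈ x∈ a≢b ¬ab (λ e → x∉ (0th e)) (λ e → x∉ (1st e))
                      λ { (inj₁ bad) → no-bad a∈ x∈ bad ; (inj₂ bad) → no-bad b∈ x∈ bad }
            where
            no-bad : ∀ {c x} → D c → D x → ¬ Bad c x
            no-bad {c} {x} c∈ x∈ bad with Q-neighbour c∈ | Q-neighbour x∈
            ... | y , y∉ , ay | q , q∉ , aq = bad y q y∉ q∉ ay aq (bal-small (y ∷ q ∷ x ∷ c ∷ []) (λ _ → tt)
              (λ { (inj₁ e) → 0th e ; (inj₂ (inj₁ e)) → 1st e ; (inj₂ (inj₂ (inj₁ e))) → 2nd e ; (inj₂ (inj₂ (inj₂ e))) → 3rd e }) 5≤)

          module Four {a b x x' : V} (a∈ : D a) (b∈ : D b) (x∈ : D x) (x'∈ : D x') (a≢b : a ≢ b) (x≢x' : x ≢ x')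
            (only : ∀ {z} → D z → z ≡ a ⊎ z ≡ b ⊎ z ≡ x ⊎ z ≡ x') where

            -- A vertex outside D avoiding an unbalanced quadruple is adjacent to the rest of D.
            opposite : ∀ {c y d z} → D c → D y → D d → D z → c ≢ d → d ≢ y → z ≢ c → z ≢ y → Bad c y → Bad d z → ⊥
            opposite {c} {y} {d} {z} c∈ y∈ d∈ z∈ c≢d d≢y z≢c z≢y bad bad' with Q-neighbour c∈ | Q-neighbour y∈
            -- The four vertices of `D` and the two chosen neighbours make six, and n > 6 provides
            -- `t`.
            ... | r , r∉ , ar | q , q∉ , aq with fresh (a ∷ b ∷ x ∷ x' ∷ r ∷ q ∷ []) 6<n
            -- With `t` used as neighbour of both `d` and `z`, the quadruple has only three
            -- vertices. It is therefore balanced, against the badness of the second pair.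
            ...   | t , t∉ = bad' t t t∉D t∉D (adj-to d∈ (c≢d ∘ sym) d≢y) (adj-to z∈ z≢c z≢y)
                      (bal-small (t ∷ z ∷ d ∷ []) (λ _ → tt)
                        (λ { (inj₁ e) → 0th e ; (inj₂ (inj₁ e)) → 0th e ; (inj₂ (inj₂ (inj₁ e))) → 1st e ; (inj₂ (inj₂ (inj₂ e))) → 2nd e }) 4≤)
              where
              t∉D : ¬ D t
              t∉D t∈ with only t∈
              ... | inj₁ e = t∉ (0th e)
              ... | inj₂ (inj₁ e) = t∉ (1st e)
              ... | inj₂ (inj₂ (inj₁ e)) = t∉ (2nd e)
              ... | inj₂ (inj₂ (inj₂ e)) = t∉ (3rd e)
              adj-to : ∀ {w} → D w → w ≢ c → w ≢ y → Adj w t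
              adj-to {w} w∈ w≢c w≢y = decidable-stable (adj? w t) λ ¬a → bad r q r∉ q∉ ar aq (bal-miss
                (λ { refl → t∉D w∈ }) ¬a
                (λ { (inj₁ refl) → r∉ w∈ ; (inj₂ (inj₁ refl)) → q∉ w∈ ; (inj₂ (inj₂ (inj₁ e))) → w≢y e ; (inj₂ (inj₂ (inj₂ e))) → w≢c e })
                (λ { (inj₁ e) → t∉ (4th e) ; (inj₂ (inj₁ e)) → t∉ (5th e) ; (inj₂ (inj₂ (inj₁ refl))) → t∉D y∈ ; (inj₂ (inj₂ (inj₂ refl))) → t∉D c∈ }))

            -- The two neighbours of `a` on the cycle are `x` and `x'`; an edge between them would
            -- close a triangle, which would be the whole cycle.
            other-pair : ¬ Adj a b → x ≢ a → x ≢ b → x' ≢ b → ¬ Adj x x'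
            other-pair ¬ab x≢a x≢b x'≢b xx' = both (two-neighbours a∈ b∈ x∈ a≢b (x≢a ∘ sym) (x≢b ∘ sym))
              where
              nbr : ∀ {y} → D y → Adj a y → y ≡ x ⊎ y ≡ x'
              nbr y∈ ay with only y∈
              ... | inj₁ refl = ⊥-elim (proj₁ ay refl)
              ... | inj₂ (inj₁ refl) = ⊥-elim (¬ab ay)
              ... | inj₂ (inj₂ e) = e
              tri : Adj a x → Adj a x' → ⊥
              tri ax ax' = [ a≢b ∘ sym , [ x≢b ∘ sym , x'≢b ∘ sym ]′ ]′ (triangle a∈ x∈ x'∈ ax xx' ax' b∈)
              both : ∃[ y ] ∃[ y' ] (D y × D y' × y ≢ y' × Adj a y × Adj a y') → ⊥
              both (y , y' , y∈ , y'∈ , y≢y' , ay , ay') with nbr y∈ ay | nbr y'∈ ay'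
              ... | inj₁ refl | inj₁ refl = y≢y' refl
              ... | inj₂ refl | inj₂ refl = y≢y' refl
              ... | inj₁ refl | inj₂ refl = tri ay ay'
              ... | inj₂ refl | inj₁ refl = tri ay' ay

            -- By `bad-edge` the vertices `x` and `x'`, and where needed also `a` or `b`, each lie
            -- on a bad pair of the 4-cycle a x b x'. This always yields two bad pairs without
            -- common vertex, which `opposite` excludes.
            impossible : ¬ Adj a b → x ≢ a → x ≢ b → x' ≢ a → x' ≢ b → ⊥
            impossible ¬ab x≢a x≢b x'≢a x'≢b = run do
                inj₁ ax ← bad-edge a∈ b∈ x∈ a≢b ¬ab x≢a x≢b
                  where inj₂ bx → do
                          inj₂ bx' ← bad-edge a∈ b∈ x'∈ a≢b ¬ab x'≢a x'≢b
                            where inj₁ ax' → λ k → k (opp bx ax' b∈ x∈ a∈ x'∈ (a≢b ∘ sym) (x≢a ∘ sym) x'≢b (x≢x' ∘ sym))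
                          inj₁ xa ← bad-edge x∈ x'∈ a∈ x≢x' ¬xx' (x≢a ∘ sym) (x'≢a ∘ sym)
                            where inj₂ x'a → λ k → k (opp bx (bad-sym x'a) b∈ x∈ a∈ x'∈ (a≢b ∘ sym) (x≢a ∘ sym) x'≢b (x≢x' ∘ sym))
                          λ k → k (opp bx' (bad-sym xa) b∈ x'∈ a∈ x∈ (a≢b ∘ sym) (x'≢a ∘ sym) x≢b x≢x')
                inj₁ ax' ← bad-edge a∈ b∈ x'∈ a≢b ¬ab x'≢a x'≢b
                  where inj₂ bx' → λ k → k (opp ax bx' a∈ x∈ b∈ x'∈ a≢b (x≢b ∘ sym) x'≢a (x≢x' ∘ sym))
                inj₁ xb ← bad-edge x∈ x'∈ b∈ x≢x' ¬xx' (x≢b ∘ sym) (x'≢b ∘ sym)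
                  where inj₂ x'b → λ k → k (opp ax (bad-sym x'b) a∈ x∈ b∈ x'∈ a≢b (x≢b ∘ sym) x'≢a (x≢x' ∘ sym))
                λ k → k (opp ax' (bad-sym xb) a∈ x'∈ b∈ x∈ a≢b (x'≢b ∘ sym) x≢a x≢x')
              where
              ¬xx' : ¬ Adj x x'
              ¬xx' = other-pair ¬ab x≢a x≢b x'≢b
              opp : ∀ {c y d z} → Bad c y → Bad d z → D c → D y → D d → D z → c ≢ d → d ≢ y → z ≢ c → z ≢ y → ⊥
              opp b₁ b₂ d₁ d₂ d₃ d₄ n₁ n₂ n₃ n₄ = opposite d₁ d₂ d₃ d₄ n₁ n₂ n₃ n₄ b₁ b₂

          large-impossible : ⊥
          large-impossible with D-nonempty
          ... | a , a∈ with non-neighbour a∈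
          ... | b , b∈ , a≢b , ¬ab with D-outside (a ∷ b ∷ []) (ℕₚ.≤-trans (s≤s (s≤s (s≤s z≤n))) 4≤)
          ... | x , x∈ , x∉ with D-outside (a ∷ b ∷ x ∷ []) 4≤
          ... | x' , x'∈ , x'∉ = Four.impossible a∈ b∈ x∈ x'∈ a≢b x≢x' only ¬ab
                  (λ e → x∉ (0th e)) (λ e → x∉ (1st e)) (λ e → x'∉ (0th e)) (λ e → x'∉ (1st e))
            where
            x≢x' : x ≢ x'
            x≢x' e = x'∉ (2nd (sym e))
            only : ∀ {z} → D z → z ≡ a ⊎ z ≡ b ⊎ z ≡ x ⊎ z ≡ x'
            only z∈ = one-of-four (exhausts (a ∷ b ∷ x ∷ x' ∷ [])
              ((λ { (0th e) → a≢b e ; (1st e) → x∉ (0th (sym e)) ; (2nd e) → x'∉ (0th (sym e)) }) ,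
               (λ { (0th e) → x∉ (1st (sym e)) ; (1st e) → x'∉ (1st (sym e)) }) , (λ { (0th e) → x≢x' e }) , (λ ()) , tt)
              (λ { (0th refl) → a∈ ; (1st refl) → b∈ ; (2nd refl) → x∈ ; (3rd refl) → x'∈ }) (ℕₚ.≮⇒≥ not-five) z∈)

      -- Shortest unbalanced cycles of length at most three

      module SmallCycle (mc : MinCycle (λ _ → ⊤)) (≤3 : Minimal.size mc ≤ 3) where
        open WithMinimal mc
        open Minimal mc

        clique : ∀ {c d} → D c → D d → c ≢ d → Adj c d
        clique = small-clique ≤3

        -- `D` meets all three non-edges, so it contains two of the three vertices; but `D` is a
        -- clique.
        no-triangle : ∀ {a b c} → a ≢ b → a ≢ c → b ≢ c → ¬ Adj a b → ¬ Adj a c → ¬ Adj b c → ⊥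
        no-triangle {a} {b} {c} ab ac bc ¬ab ¬ac ¬bc with D? a
        ... | yes a∈ with hits bc ¬bc
        ...   | inj₁ b∈ = ¬ab (clique a∈ b∈ ab)
        ...   | inj₂ c∈ = ¬ac (clique a∈ c∈ ac)
        no-triangle ab ac bc ¬ab ¬ac ¬bc | no a∉ with hits ab ¬ab | hits ac ¬ac
        ...   | inj₁ a∈ | _ = a∉ a∈
        ...   | _ | inj₁ a∈ = a∉ a∈
        ...   | inj₂ b∈ | inj₂ c∈ = ¬bc (clique b∈ c∈ bc)

        -- `e` is allowed to coincide with `c` or `d`, so that cycles on two and on three vertices
        -- are treated together.
        record TwoNonEdges (c a d b e : V) : Set where
          constructor twoNonEdges
          field
            c∈ : D c
            a∉ : ¬ D a
            d∈ : D d
            b∉ : ¬ D b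
            c≢d : c ≢ d
            a≢b : a ≢ b
            ¬ca : ¬ Adj c a
            ¬db : ¬ Adj d b
            e∈ : D e
            only : ∀ {z} → D z → z ≡ c ⊎ z ≡ d ⊎ z ≡ e

        swap-nonedges : ∀ {c a d b e} → TwoNonEdges c a d b e → TwoNonEdges d b c a e
        swap-nonedges (twoNonEdges c∈ a∉ d∈ b∉ c≢d a≢b ¬ca ¬db e∈ only) =
          twoNonEdges d∈ b∉ c∈ a∉ (c≢d ∘ sym) (a≢b ∘ sym) ¬db ¬ca e∈
            λ z∈ → [ inj₂ ∘ inj₁ , [ inj₁ , inj₂ ∘ inj₂ ]′ ]′ (only z∈)

        module _ {c a d b e : V} (t : TwoNonEdges c a d b e) where
          open TwoNonEdges t

          c≢a : c ≢ a
          c≢a refl = a∉ c∈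

          Other : V → VSet
          Other x y = ¬ D y × y ≢ a × y ≢ b × y ≢ x

          off-list : ∀ {z} → z ∉ˡ (c ∷ d ∷ e ∷ []) → ¬ D z
          off-list z∉ z∈ with only z∈
          ... | inj₁ q = z∉ (0th q)
          ... | inj₂ (inj₁ q) = z∉ (1st q)
          ... | inj₂ (inj₂ q) = z∉ (2nd q)

          pick : ∀ x → ∃[ y ] Other x y
          pick x with fresh (c ∷ d ∷ e ∷ a ∷ b ∷ x ∷ []) 6<n
          ... | y , y∉ = y , off-list (λ { (0th q) → y∉ (0th q) ; (1st q) → y∉ (1st q) ; (2nd q) → y∉ (2nd q) }) ,
                  (λ q → y∉ (3rd q)) , (λ q → y∉ (4th q)) , (λ q → y∉ (5th q))

          OffCax : V → VSet
          OffCax x p = Off c a p × p ≢ x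

          -- The third-vertex argument for the non-edge `ca`, with `x` outside `D`. The small sets
          -- it needs avoid both `d` and `b`, and so are balanced by the other non-edge; everything
          -- outside `D` is adjacent to `b`, so connectivity has to be supplied only for vertices of
          -- `D`.
          remove : ∀ {x} → ¬ D x → x ≢ a → x ≢ b → (¬ Adj x c ⊎ ∃[ y ] (Other x y × Adj y c)) →
            (∀ {p} → D p → p ≢ c → ConnV (OffCax x) p b) → ⊥
          remove {x} x∉ x≢a x≢b near reach = third-vertex c≢a ¬ca (λ { refl → x∉ c∈ }) x≢a
              (nonedge-balanced c≢a ¬ca conn₂) (λ p q → pure (connV-trans (to-b p) (connV-sym (to-b q)))) (unb-Q x∉) (choice-c near) choice-a
            where
            off-b : OffCax x b
            off-b = ((λ { refl → b∉ c∈ }) , a≢b ∘ sym) , x≢b ∘ sym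
            to-b : ∀ {p} → OffCax x p → ConnV (OffCax x) p b
            to-b {p} off with D? p
            ... | yes p∈ = reach p∈ (proj₁ (proj₁ off))
            ... | no p∉ = connV-near off off-b (Q-clique p∉ b∉)
            pair : ∀ {y f} → Other x y → f ≢ d → f ≢ b → (Adj y f) → f ≡ c ⊎ f ≡ a → Choice c a x f
            pair {y} {f} (y∉ , y≢a , y≢b , y≢x) f≢d f≢b ay f∈ = via y y≢x ay (λ p → p ≡ y ⊎ p ≡ x)
              (λ { (inj₁ refl) → (λ { refl → y∉ c∈ }) , y≢a ; (inj₂ refl) → (λ { refl → x∉ c∈ }) , x≢a })
              (connV-adj (inj₁ refl) (inj₂ refl) (Q-clique y∉ x∉ y≢x))
              (bal-miss (λ { refl → b∉ d∈ }) ¬db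
                (λ { (inj₁ (inj₁ refl)) → y∉ d∈ ; (inj₁ (inj₂ refl)) → x∉ d∈ ; (inj₂ q) → f≢d (sym q) })
                (λ { (inj₁ (inj₁ q)) → y≢b (sym q) ; (inj₁ (inj₂ q)) → x≢b (sym q) ; (inj₂ q) → f≢b (sym q) }))
            choice-a : Choice c a x a
            choice-a with pick x
            ... | y , oth@(y∉ , y≢a , _) = pair oth (λ { refl → a∉ d∈ }) a≢b (Q-clique y∉ a∉ y≢a) (inj₂ refl)
            choice-c : ¬ Adj x c ⊎ ∃[ y ] (Other x y × Adj y c) → Choice c a x c
            choice-c (inj₁ ¬xc) = nonadjacent d (λ { refl → x∉ d∈ }) (clique d∈ c∈ (c≢d ∘ sym)) ¬xc
            choice-c (inj₂ (y , oth , yc)) = pair oth c≢d (λ { refl → b∉ c∈ }) yc (inj₁ refl)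

          NearC : V → Set
          NearC w = ¬ D w × w ≢ a × w ≢ b × Adj w c

          nearC? : Dec (∃[ w ] NearC w)
          nearC? = Finₚ.any? (λ w → ¬? (D? w) ×-dec (¬? (w Finₚ.≟ a) ×-dec (¬? (w Finₚ.≟ b) ×-dec adj? w c)))

          D-off : ∀ {x p} → ¬ D x → D p → p ≢ c → OffCax x p
          D-off x∉ p∈ p≢c = (p≢c , λ { refl → a∉ p∈ }) , λ { refl → x∉ p∈ }

          Q-off : ∀ {x p} → ¬ D p → p ≢ a → p ≢ x → OffCax x p
          Q-off p∉ p≢a p≢x = ((λ { refl → p∉ c∈ }) , p≢a) , p≢x

          reach-via : ∀ {f s x} → D f → f ≢ c → Adj f s → ¬ D s → s ≢ a → s ≢ x → ¬ D x → x ≢ b →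
            ∀ {p} → D p → p ≢ c → ConnV (OffCax x) p b
          reach-via f∈ f≢c fs s∉ s≢a s≢x x∉ x≢b p∈ p≢c = connV-trans (connV-near (D-off x∉ p∈ p≢c) (D-off x∉ f∈ f≢c) (clique p∈ f∈))
            (connV-trans (connV-adj (D-off x∉ f∈ f≢c) (Q-off s∉ s≢a s≢x) fs)
              (connV-near (Q-off s∉ s≢a s≢x) (Q-off b∉ (a≢b ∘ sym) (x≢b ∘ sym)) (Q-clique s∉ b∉)))

          -- `s` is the exit from `D` towards `b` and must survive the removal of `x`. A vertex near
          -- `c` serves as spoke end at `c`; if there is none, any suitable `x` is non-adjacent to
          -- `c`.
          remove-via : ∀ {f s} → D f → f ≢ c → Adj f s → ¬ D s → s ≢ a →
            (∀ {w} → NearC w → ∃[ x ] (Other w x × x ≢ s)) → ⊥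
          remove-via {f} {s} f∈ f≢c fs s∉ s≢a avoid with nearC?
          ... | no none with pick s
          ...   | x , x∉ , x≢a , x≢b , x≢s = remove x∉ x≢a x≢b (inj₁ λ xc → none (x , x∉ , x≢a , x≢b , xc))
                    (reach-via f∈ f≢c fs s∉ s≢a (x≢s ∘ sym) x∉ x≢b)
          remove-via {f} {s} f∈ f≢c fs s∉ s≢a avoid | yes (w , nw@(w∉ , w≢a , w≢b , wc)) with avoid nw
          ...   | x , (x∉ , x≢a , x≢b , x≢w) , x≢s = remove x∉ x≢a x≢b (inj₂ (w , (w∉ , w≢a , w≢b , x≢w ∘ sym) , wc))
                    (reach-via f∈ f≢c fs s∉ s≢a (x≢s ∘ sym) x∉ x≢b)

          -- Here D = {c,d}, so there is room to avoid one more vertex.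
          two-vertices : e ≡ d → ⊥
          two-vertices e≡d with neighbour {d} {c} {a} (c≢d ∘ sym) (λ { refl → a∉ d∈ })
          ... | s , ds , s≢c , s≢a = remove-via d∈ (c≢d ∘ sym) ds s∉ s≢a avoid
            where
            s∉ : ¬ D s
            s∉ s∈ with only s∈
            ... | inj₁ q = s≢c q
            ... | inj₂ (inj₁ q) = proj₁ ds (sym q)
            ... | inj₂ (inj₂ q) = proj₁ ds (sym (trans q e≡d))
            avoid : ∀ {w} → NearC w → ∃[ x ] (Other w x × x ≢ s)
            avoid {w} _ with fresh (c ∷ d ∷ a ∷ b ∷ w ∷ s ∷ []) 6<n
            ... | x , x∉ = x , (off-list (λ { (0th q) → x∉ (0th q) ; (1st q) → x∉ (1st q) ; (2nd q) → x∉ (1st (trans q e≡d)) }) ,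
                    (λ q → x∉ (2nd q)) , (λ q → x∉ (3rd q)) , (λ q → x∉ (4th q))) , λ q → x∉ (5th q)

          reach-b : e ≢ c → Adj e b → ⊥
          reach-b e≢c eb = remove-via e∈ e≢c eb b∉ (a≢b ∘ sym) λ {w} _ → let (x , oth@(_ , _ , x≢b , _)) = pick w in x , oth , x≢b

        no-two-nonedges : ∀ {c a d b e} → TwoNonEdges c a d b e → ⊥
        no-two-nonedges {c} {a} {d} {b} {e} t with e Finₚ.≟ c | e Finₚ.≟ d
        ... | _ | yes e≡d = two-vertices t e≡d
        ... | yes e≡c | no _ = two-vertices (swap-nonedges t) e≡c
        ... | no e≢c | no e≢d with adj? e b | adj? e a
        ... | yes eb | _ = reach-b t e≢c eb
        ... | no _ | yes ea = reach-b (swap-nonedges t) e≢d ea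
        ... | no ¬eb | no ¬ea with neighbour e≢c e≢d
        ... | s , es , s≢c , s≢d = go (nearC? t)
          where
          open TwoNonEdges t
          s∉ : ¬ D s
          s∉ s∈ with only s∈
          ... | inj₁ q = s≢c q
          ... | inj₂ (inj₁ q) = s≢d q
          ... | inj₂ (inj₂ q) = proj₁ es (sym q)
          s≢a : s ≢ a
          s≢a refl = ¬ea es
          s≢b : s ≢ b
          s≢b refl = ¬eb es
          go : Dec (∃[ w ] NearC t w) → ⊥
          go (no none) = remove-via t e∈ e≢c es s∉ s≢a λ nw → ⊥-elim (none (_ , nw))
          go (yes (w , nw@(w∉ , w≢a , w≢b , wc))) with w Finₚ.≟ s | adj? d w | adj? e w
          ... | yes refl | _ | _ with pick t s
          ...   | x , x∉ , x≢a , x≢b , x≢s = remove t x∉ x≢a x≢b (inj₂ (s , (s∉ , s≢a , s≢b , x≢s ∘ sym) , wc))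
                    (reach-via t e∈ e≢c es s∉ s≢a (x≢s ∘ sym) x∉ x≢b)
          -- Here `s` is removed, and `w` serves both as spoke end at `c` and as exit from `D`.
          go (yes (w , nw@(w∉ , w≢a , w≢b , wc))) | no w≢s | yes dw | _ =
            remove t s∉ s≢a s≢b (inj₂ (w , (w∉ , w≢a , w≢b , w≢s) , wc)) (reach-via t d∈ (c≢d ∘ sym) dw w∉ w≢a w≢s s∉ s≢b)
          go (yes (w , nw@(w∉ , w≢a , w≢b , wc))) | no w≢s | no _ | yes ew =
            remove t s∉ s≢a s≢b (inj₂ (w , (w∉ , w≢a , w≢b , w≢s) , wc)) (reach-via t e∈ e≢c ew w∉ w≢a w≢s s∉ s≢b)
          -- `w` is not adjacent to `d`, so after exchanging the two non-edges it can be removed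
          -- itself, with `s` as exit.
          go (yes (w , nw@(w∉ , w≢a , w≢b , wc))) | no w≢s | no ¬dw | no ¬ew =
            remove t' w∉ w≢b w≢a (inj₁ (¬dw ∘ adj-sym)) (reach-via t' e∈ e≢d es s∉ s≢b (w≢s ∘ sym) w∉ w≢a)
            where
            t' = swap-nonedges t

        enumerate : ∀ {c d} → D c → D d → c ≢ d → ∃[ e ] (D e × (∀ {z} → D z → z ≡ c ⊎ z ≡ d ⊎ z ≡ e))
        enumerate {c} {d} c∈ d∈ c≢d with Finₚ.any? (λ e → D? e ×-dec (¬? (e Finₚ.≟ c) ×-dec ¬? (e Finₚ.≟ d)))
        ... | no none = d , d∈ , λ {z} z∈ → aux z∈ (z Finₚ.≟ c) (z Finₚ.≟ d)
          where
          aux : ∀ {z} → D z → Dec (z ≡ c) → Dec (z ≡ d) → z ≡ c ⊎ z ≡ d ⊎ z ≡ d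
          aux z∈ (yes q) _ = inj₁ q
          aux z∈ (no _) (yes q) = inj₂ (inj₁ q)
          aux z∈ (no p) (no q) = ⊥-elim (none (_ , z∈ , p , q))
        ... | yes (e , e∈ , e≢c , e≢d) = e , e∈ , λ z∈ → one-of-three (exhausts (c ∷ d ∷ e ∷ [])
          ((λ { (0th x) → c≢d x ; (1st x) → e≢c (sym x) }) , (λ { (0th x) → e≢d (sym x) }) , (λ ()) , tt)
          (λ { (0th refl) → c∈ ; (1st refl) → d∈ ; (2nd refl) → e∈ }) ≤3 z∈)

        no-disjoint : ∀ {p q r s} → p ≢ q → r ≢ s → p ≢ r → p ≢ s → q ≢ r → q ≢ s → ¬ Adj p q → ¬ Adj r s → ⊥
        no-disjoint {p} {q} {r} {s} pq rs pr ps qr qs ¬pq ¬rs = go (hits pq ¬pq) (hits rs ¬rs)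
          where
          out : ∀ {c a} → D c → c ≢ a → ¬ Adj c a → ¬ D a
          out c∈ ne ¬a a∈ = ¬a (clique c∈ a∈ ne)
          fin : ∀ {c a d b} → D c → D d → c ≢ a → d ≢ b → c ≢ d → a ≢ b → ¬ Adj c a → ¬ Adj d b → ⊥
          fin c∈ d∈ ca db cd ab ¬ca ¬db = let (e , e∈ , only) = enumerate c∈ d∈ cd in
            no-two-nonedges (twoNonEdges c∈ (out c∈ ca ¬ca) d∈ (out d∈ db ¬db) cd ab ¬ca ¬db e∈ only)
          go : D p ⊎ D q → D r ⊎ D s → ⊥
          go (inj₁ a) (inj₁ b) = fin a b pq rs pr qs ¬pq ¬rs
          go (inj₁ a) (inj₂ b) = fin a b pq (rs ∘ sym) ps qr ¬pq (¬rs ∘ adj-sym)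
          go (inj₂ a) (inj₁ b) = fin a b (pq ∘ sym) rs qr ps (¬pq ∘ adj-sym) ¬rs
          go (inj₂ a) (inj₂ b) = fin a b (pq ∘ sym) (rs ∘ sym) qs pr (¬pq ∘ adj-sym) (¬rs ∘ adj-sym)

        module Claw {b a₁ a₂ a₃ : V} (n₁ : b ≢ a₁) (n₂ : b ≢ a₂) (n₃ : b ≢ a₃)
          (d₁₂ : a₁ ≢ a₂) (d₁₃ : a₁ ≢ a₃) (d₂₃ : a₂ ≢ a₃) (¬1 : ¬ Adj b a₁) (¬2 : ¬ Adj b a₂) (¬3 : ¬ Adj b a₃) where

          T : VSet
          T p = p ≢ a₁ × p ≢ b

          -- If the edges at the leaf a₁ all agree with the edge to z then G − b is balanced.
          contradiction-at : ∀ {z} → T z → Adj z a₁ →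
            (∀ {p} → T p → Adj p a₁ → Σ VSet λ S → (∀ {q} → S q → T q) × ConnV S z p × (¬ S a₂ ⊎ ¬ S a₃)) → ⊥
          contradiction-at {z} z∈ az ext = unb n₁ ¬1 (balV-mono cover-all
            (bal-add-vertex {T} {a₁} {z} (nonedge-balanced (n₁ ∘ sym) (¬1 ∘ adj-sym) conn₂) (λ q → proj₁ q refl) z∈ az
              λ p∈ ap → let (S , S⊆ , conn , miss) = ext p∈ ap in S , S⊆ , conn , bal S⊆ miss))
            where
            cover-all : ∀ {p} → p ≢ b → (T ∪ᵛ a₁) p
            cover-all {p} p≢b with p Finₚ.≟ a₁
            ... | yes q = inj₂ q
            ... | no q = inj₁ (q , p≢b)
            bal : ∀ {S : VSet} → (∀ {q} → S q → T q) → ¬ S a₂ ⊎ ¬ S a₃ → BalV (S ∪ᵛ a₁)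
            bal S⊆ (inj₁ m) = bal-miss n₂ ¬2 (λ { (inj₁ s) → proj₂ (S⊆ s) refl ; (inj₂ q) → n₁ q }) (λ { (inj₁ s) → m s ; (inj₂ q) → d₁₂ (sym q) })
            bal S⊆ (inj₂ m) = bal-miss n₃ ¬3 (λ { (inj₁ s) → proj₂ (S⊆ s) refl ; (inj₂ q) → n₁ q }) (λ { (inj₁ s) → m s ; (inj₂ q) → d₁₃ (sym q) })

          -- The leaves are outside the clique `D`. A walk to `z` is followed only up to its first
          -- vertex `y` outside `D`, from where an edge leads to `z`; the set used is part of `D`
          -- with `y` and `z`, and `y` can coincide with only one of the other two leaves.
          center-in : D b → ⊥
          center-in b∈ with three-list
            where
            three-list : ∃[ d ] ∃[ e ] (∀ {z} → D z → z ≡ b ⊎ z ≡ d ⊎ z ≡ e)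
            three-list with Finₚ.any? (λ d → D? d ×-dec ¬? (d Finₚ.≟ b))
            ... | no none = b , b , λ {z} z∈ → inj₁ (decidable-stable (z Finₚ.≟ b) λ ne → none (z , z∈ , ne))
            ... | yes (d , d∈ , d≢b) with enumerate b∈ d∈ (d≢b ∘ sym)
            ...   | e , _ , only = d , e , only
          ... | d , e , only with fresh (b ∷ d ∷ e ∷ a₁ ∷ a₂ ∷ a₃ ∷ []) 6<n
          ... | z , z∉ = run do
              w ← fin-choice {P = λ p → T p → ConnV T p z} (λ p → walk p)
              λ k → k (contradiction-at Tz (Q-clique z∉D a₁∉ (proj₁ Tz)) λ {p} p∈ _ → ext (w p p∈))
            where
            z∉D : ¬ D z
            z∉D z∈ with only z∈
            ... | inj₁ q = z∉ (0th q)
            ... | inj₂ (inj₁ q) = z∉ (1st q)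
            ... | inj₂ (inj₂ q) = z∉ (2nd q)
            a₁∉ : ¬ D a₁
            a₁∉ q = ¬1 (clique b∈ q n₁)
            a₂∉ : ¬ D a₂
            a₂∉ q = ¬2 (clique b∈ q n₂)
            a₃∉ : ¬ D a₃
            a₃∉ q = ¬3 (clique b∈ q n₃)
            Tz : T z
            Tz = (λ q → z∉ (3rd q)) , λ q → z∉ (0th q)
            walk : ∀ p → Cl (T p → ConnV T p z)
            walk p with p Finₚ.≟ a₁ | p Finₚ.≟ b
            ... | yes q | _ = pure λ t → ⊥-elim (proj₁ t q)
            ... | no _ | yes q = pure λ t → ⊥-elim (proj₂ t q)
            ... | no p₁ | no p₂ = conn₂ {a₁} {b} (p₁ , p₂) Tz >>= λ c → pure λ _ → c
            ext : ∀ {p} → ConnV T p z → Σ VSet λ S → (∀ {q} → S q → T q) × ConnV S z p × (¬ S a₂ ⊎ ¬ S a₃)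
            ext {p} (w , wT) with first (λ r → ¬? (D? r)) w
            ... | inj₁ none = ⊥-elim (none (end∈ w) z∉D)
            ... | inj₂ (y , mkSplit u v refl , y∉ , before) = S , S⊆ ,
                  connV-sym (connV-trans {q = y} (u , inS) (connV-near (inj₂ (inj₁ refl)) (inj₂ (inj₂ refl)) (Q-clique y∉ z∉D))) , miss (a₂ Finₚ.≟ y)
              where
              S : VSet
              S r = (D r × T r) ⊎ r ≡ y ⊎ r ≡ z
              S⊆ : ∀ {q} → S q → T q
              S⊆ (inj₁ (_ , t)) = t
              S⊆ (inj₂ (inj₁ refl)) = wT (∈ᵛ-⊕ˡ u v (end∈ u))
              S⊆ (inj₂ (inj₂ refl)) = Tz
              inS : ∀ {r} → r ∈ᵛ u → S r
              inS {r} r∈ with D? r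
              ... | yes d = inj₁ (d , wT (∈ᵛ-⊕ˡ u v r∈))
              ... | no ¬d = inj₂ (inj₁ (before r∈ ¬d))
              miss : Dec (a₂ ≡ y) → ¬ S a₂ ⊎ ¬ S a₃
              miss (no ne) = inj₁ λ { (inj₁ (d , _)) → a₂∉ d ; (inj₂ (inj₁ q)) → ne q ; (inj₂ (inj₂ q)) → z∉ (4th (sym q)) }
              miss (yes refl) = inj₂ λ { (inj₁ (d , _)) → a₃∉ d ; (inj₂ (inj₁ q)) → d₂₃ (sym q) ; (inj₂ (inj₂ q)) → z∉ (5th (sym q)) }

          -- Now `D` consists of the three leaves. From `z` a vertex `p` is reached directly, or
          -- over one vertex outside `D` when `p` is a leaf; such a route contains at most one of
          -- `a₂` and `a₃`.
          leaves-in : D a₁ → D a₂ → D a₃ → ⊥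
          leaves-in i₁ i₂ i₃ with neighbour d₁₂ d₁₃
          ... | z , az , z≢a₂ , z≢a₃ = contradiction-at Tz (adj-sym az) ext
            where
            b∉ : ¬ D b
            b∉ q = ¬1 (clique q i₁ n₁)
            only : ∀ {p} → D p → p ≡ a₁ ⊎ p ≡ a₂ ⊎ p ≡ a₃
            only {p} p∈ with enumerate i₁ i₂ d₁₂
            ... | e , _ , all with all i₃
            ...   | inj₁ q = ⊥-elim (d₁₃ (sym q))
            ...   | inj₂ (inj₁ q) = ⊥-elim (d₂₃ (sym q))
            ...   | inj₂ (inj₂ refl) = all p∈
            outD : ∀ {v r s t} → Adj v r → (∀ {p} → D p → p ≡ v ⊎ p ≡ s ⊎ p ≡ t) → r ≢ s → r ≢ t → ¬ D r
            outD vr all r≢s r≢t r∈ with all r∈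
            ... | inj₁ q = proj₁ vr (sym q)
            ... | inj₂ (inj₁ q) = r≢s q
            ... | inj₂ (inj₂ q) = r≢t q
            Tz : T z
            Tz = proj₁ az ∘ sym , λ { refl → ¬1 (adj-sym az) }
            z∉ : ¬ D z
            z∉ = outD az only z≢a₂ z≢a₃
            through : ∀ {p y} → D p → T p → Adj p y → ¬ D y → y ≢ b → p ≢ a₂ ⊎ p ≢ a₃ →
              Σ VSet λ S → (∀ {q} → S q → T q) × ConnV S z p × (¬ S a₂ ⊎ ¬ S a₃)
            through {p} {y} p∈ Tp py y∉ y≢b which = S , S⊆ ,
                connV-trans {q = y} (connV-near (inj₁ refl) (inj₂ (inj₁ refl)) (Q-clique z∉ y∉)) (connV-adj (inj₂ (inj₁ refl)) (inj₂ (inj₂ refl)) (adj-sym py)) ,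
                ⊎-map (λ ne → miss i₂ (ne ∘ sym)) (λ ne → miss i₃ (ne ∘ sym)) which
              where
              S : VSet
              S r = r ≡ z ⊎ r ≡ y ⊎ r ≡ p
              S⊆ : ∀ {q} → S q → T q
              S⊆ (inj₁ refl) = Tz
              S⊆ (inj₂ (inj₁ refl)) = (λ { refl → y∉ i₁ }) , y≢b
              S⊆ (inj₂ (inj₂ refl)) = Tp
              miss : ∀ {r} → D r → r ≢ p → ¬ S r
              miss r∈ ne (inj₁ refl) = z∉ r∈
              miss r∈ ne (inj₂ (inj₁ refl)) = y∉ r∈
              miss r∈ ne (inj₂ (inj₂ q)) = ne q
            ext : ∀ {p} → T p → Adj p a₁ → Σ VSet λ S → (∀ {q} → S q → T q) × ConnV S z p × (¬ S a₂ ⊎ ¬ S a₃)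
            ext {p} Tp _ with D? p
            ... | no p∉ = (λ r → r ≡ z ⊎ r ≡ p) , (λ { (inj₁ refl) → Tz ; (inj₂ refl) → Tp }) ,
                    connV-near (inj₁ refl) (inj₂ refl) (Q-clique z∉ p∉) , inj₁ λ { (inj₁ refl) → z∉ i₂ ; (inj₂ refl) → p∉ i₂ }
            ... | yes p∈ with only p∈
            ...   | inj₁ q = ⊥-elim (proj₁ Tp q)
            ...   | inj₂ (inj₁ refl) with neighbour (d₁₂ ∘ sym) d₂₃
            ...     | y , ay , y≢a₁ , y≢a₃ = through p∈ Tp ay (outD ay (λ q → [ inj₂ ∘ inj₁ , [ inj₁ , inj₂ ∘ inj₂ ]′ ]′ (only q)) y≢a₁ y≢a₃)
                        (λ { refl → ¬2 (adj-sym ay) }) (inj₂ d₂₃)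
            ext {p} Tp _ | yes p∈ | inj₂ (inj₂ refl) with neighbour (d₁₃ ∘ sym) (d₂₃ ∘ sym)
            ...     | y , ay , y≢a₁ , y≢a₂ = through p∈ Tp ay (outD ay (λ q → [ inj₂ ∘ inj₁ , [ inj₂ ∘ inj₂ , inj₁ ]′ ]′ (only q)) y≢a₁ y≢a₂)
                        (λ { refl → ¬3 (adj-sym ay) }) (inj₁ (d₂₃ ∘ sym))

          no-claw : ⊥
          no-claw with D? b
          ... | yes b∈ = center-in b∈
          ... | no b∉ = leaves-in (hit n₁ ¬1) (hit n₂ ¬2) (hit n₃ ¬3)
            where
            hit : ∀ {a} → b ≢ a → ¬ Adj b a → D a
            hit ne ¬a = [ (λ q → ⊥-elim (b∉ q)) , (λ q → q) ]′ (hits ne ¬a)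

    -- 2-vertex cuts

    conn₁ : ∀ {w p q} → p ≢ w → q ≢ w → Cl (ConnV (_≢ w) p q)
    conn₁ {w} {p} {q} p≢ q≢ ¬conn = run do
      ⟦ W , out , into ⟧ ← comprehension (ConnV (_≢ w) p)
      λ k → k (no-cut-vertex W w (λ {g} j p∈ → step (out p∈) j into) {p} {q} (into (connV-refl p≢)) (¬conn ∘ out) q≢)
      where
      step : ∀ {g r s} {W : Subset n} → ConnV (_≢ w) p r → J g r s → (∀ {i} → ConnV (_≢ w) p i → i ∈ W) → s ∈ W ⊎ s ≡ w
      step {g} {r} {s} c j into with s Finₚ.≟ w
      ... | yes e = inj₂ e
      ... | no ne = inj₁ (into (connV-trans c (cons g j nil , λ { (inj₁ refl) → proj₂ c (end∈ (proj₁ c)) ; (inj₂ refl) → ne })))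

    -- Balance of the pairs excludes loops and parallel edges at `w`, since balanced loops and
    -- 2-cycles do not occur. Three edges at `w` then require a third neighbour.
    neighbour-of : ∀ {w p q} → (∀ {r} → Adj w r → BalV (λ z → z ≡ w ⊎ z ≡ r)) → ∃[ r ] (Adj w r × r ≢ p × r ≢ q)
    neighbour-of {w} {p} {q} bal with Finₚ.any? (λ r → adj? w r ×-dec (¬? (r Finₚ.≟ p) ×-dec ¬? (r Finₚ.≟ q)))
    ... | yes x = x
    ... | no none with link-at w
    ...   | ℓ , z₀ , j₀ , w≢z₀ = ⊥-elim (three-edges w (rep p) (rep q) (λ {g} i → all i (inc-cases i)))
      where
      -- arbitrary if w and r are not adjacent
      rep : V → E
      rep r with adj? w r
      ... | yes (_ , e , _) = e
      ... | no _ = ℓ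
      rep-unique : ∀ {g r} → w ≢ r → J g w r → g ≡ rep r
      rep-unique {g} {r} ne j with adj? w r
      ... | no ¬a = ⊥-elim (¬a (ne , g , j))
      ... | yes (_ , e , k) with g Finₚ.≟ e
      ...   | yes eq = eq
      ...   | no g≢e with close-walk j (cons e (J-sym k) nil) (λ { (inj₁ q) → g≢e q })
      ...     | C , cyc , g∈ , C⁻ = ⊥-elim (no-balanced-digon g≢e (subst B C≡ (bal (ne , g , j) cyc λ h∈ → in-pair (C⁻ h∈))))
        where
        in-pair : ∀ {h} → h ≡ g ⊎ h ≡ e ⊎ ⊥ → InV (λ z → z ≡ w ⊎ z ≡ r) h
        in-pair (inj₁ refl) = inV j (inj₁ refl) (inj₂ refl)
        in-pair (inj₂ (inj₁ refl)) = inV k (inj₁ refl) (inj₂ refl)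
        e∈ : e ∈ C
        e∈ with cycle-links cyc g∈ (r , j , ne)
        ... | g' , g'≢ , g'∈ , _ with C⁻ g'∈
        ...   | inj₁ q = ⊥-elim (g'≢ q)
        ...   | inj₂ (inj₁ refl) = g'∈
        C≡ : C ≡ ⁅ g ⁆ ∪ ⁅ e ⁆
        C≡ = ⊆-antisym (λ h∈ → x∈p∪q⁺ ([ (λ { refl → inj₁ (x∈⁅x⁆ g) }) , (λ { (inj₁ refl) → inj₂ (x∈⁅x⁆ e) }) ]′ (C⁻ h∈)))
          (λ h∈ → [ (λ q → subst (_∈ C) (sym (x∈⁅y⁆⇒x≡y g q)) g∈) , (λ q → subst (_∈ C) (sym (x∈⁅y⁆⇒x≡y e q)) e∈) ]′ (x∈p∪q⁻ ⁅ g ⁆ ⁅ e ⁆ h∈))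
      all : ∀ {g} → Inc g w → J g w w ⊎ Link g w → g ≡ rep p ⊎ g ≡ rep q
      all {g} i (inj₁ lp) = ⊥-elim (no-balanced-loop lp (bal (w≢z₀ , ℓ , j₀) (loop-cycle lp)
        λ h∈ → subst (InV (λ z → z ≡ w ⊎ z ≡ z₀)) (sym (x∈⁅y⁆⇒x≡y g h∈)) (inV lp (inj₁ refl) (inj₁ refl))))
      all {g} i (inj₂ (z , j , ne)) with z Finₚ.≟ p | z Finₚ.≟ q
      ... | yes refl | _ = inj₁ (rep-unique ne j)
      ... | no _ | yes refl = inj₂ (rep-unique ne j)
      ... | no z≢p | no z≢q = ⊥-elim (none (z , (ne , g , j) , z≢p , z≢q))

    -- The sides are arbitrary unions of components of G - {u,v}; neither is assumed to be
    -- connected.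
    record Cut (u v : V) (W₁ W₂ : VSet) : Set where
      field
        u≢v : u ≢ v
        part : ∀ z → z ≡ u ⊎ z ≡ v ⊎ W₁ z ⊎ W₂ z
        disj : ∀ {z} → W₁ z → W₂ z → ⊥
        u∉₁ : ¬ W₁ u
        u∉₂ : ¬ W₂ u
        v∉₁ : ¬ W₁ v
        v∉₂ : ¬ W₂ v
        apart : ∀ {p q} → W₁ p → W₂ q → ¬ Adj p q
        some₁ : ∃[ a ] W₁ a
        some₂ : ∃[ b ] W₂ b

    swap-sides : ∀ {u v W₁ W₂} → Cut u v W₁ W₂ → Cut u v W₂ W₁
    swap-sides c = record { u≢v = u≢v ; part = λ z → ⊎-map (λ q → q) (⊎-map (λ q → q) swap) (part z)
      ; disj = λ a b → disj b a ; u∉₁ = u∉₂ ; u∉₂ = u∉₁ ; v∉₁ = v∉₂ ; v∉₂ = v∉₁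
      ; apart = λ a b adj → apart b a (adj-sym adj) ; some₁ = some₂ ; some₂ = some₁ }
      where open Cut c

    swap-ends : ∀ {u v W₁ W₂} → Cut u v W₁ W₂ → Cut v u W₁ W₂
    swap-ends c = record { u≢v = u≢v ∘ sym ; part = λ z → [ inj₂ ∘ inj₁ , [ inj₁ , inj₂ ∘ inj₂ ]′ ]′ (part z)
      ; disj = disj ; u∉₁ = v∉₁ ; u∉₂ = v∉₂ ; v∉₁ = u∉₁ ; v∉₂ = u∉₂ ; apart = apart ; some₁ = some₁ ; some₂ = some₂ }
      where open Cut c

    -- `a` does not separate `u` from `v` on its own side. The aim is that there is no such vertex.
    NonSep : ∀ {u v W₁ W₂} → Cut u v W₁ W₂ → V → Set
    NonSep {u} {v} {W₁} {W₂} c a = W₁ a × ConnV (λ z → ¬ W₂ z × z ≢ a) u v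

    module CutFacts {u v : V} {W₁ W₂ : VSet} (c : Cut u v W₁ W₂) where
      open Cut c public

      End : VSet
      End z = z ≡ u ⊎ z ≡ v

      end? : ∀ z → Dec (End z)
      end? z = (z Finₚ.≟ u) ⊎-dec (z Finₚ.≟ v)

      end∉₁ : ∀ {z} → End z → ¬ W₁ z
      end∉₁ (inj₁ refl) = u∉₁
      end∉₁ (inj₂ refl) = v∉₁

      end∉₂ : ∀ {z} → End z → ¬ W₂ z
      end∉₂ (inj₁ refl) = u∉₂
      end∉₂ (inj₂ refl) = v∉₂

      W₁? : ∀ z → Dec (W₁ z)
      W₁? z with part z
      ... | inj₁ refl = no u∉₁
      ... | inj₂ (inj₁ refl) = no v∉₁
      ... | inj₂ (inj₂ (inj₁ a)) = yes a
      ... | inj₂ (inj₂ (inj₂ b)) = no λ a → disj a b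

      not-2 : ∀ {z} → ¬ W₂ z → End z ⊎ W₁ z
      not-2 {z} ¬b with part z
      ... | inj₁ e = inj₁ (inj₁ e)
      ... | inj₂ (inj₁ e) = inj₁ (inj₂ e)
      ... | inj₂ (inj₂ (inj₁ a)) = inj₂ a
      ... | inj₂ (inj₂ (inj₂ b)) = ⊥-elim (¬b b)

      adj-1 : ∀ {p q} → W₁ p → Adj p q → ¬ W₂ q
      adj-1 p∈ pq q∈ = apart p∈ q∈ pq

      private
        stay : ∀ {p t} (w : Walk p t) → Simple w → (∀ {r} → r ∈ᵛ w → End r → r ≡ t) → W₁ p ⊎ p ≡ t → ∀ {r} → r ∈ᵛ w → W₁ r ⊎ r ≡ t
        stay w sw only (inj₂ refl) r∈ with w | simple-closed w sw | r∈
        ... | _ | refl | r≡ = inj₂ r≡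
        stay nil sw only (inj₁ p∈) refl = inj₁ p∈
        stay (cons e j w) sw only (inj₁ p∈) (inj₁ refl) = inj₁ p∈
        stay (cons {p} {y} e j w) (p∉ , sw) only (inj₁ p∈) (inj₂ r∈) = stay w sw (λ q → only (inj₂ q)) next-in r∈
          where
          next-in : W₁ y ⊎ y ≡ _
          next-in with not-2 (adj-1 p∈ ((λ { refl → p∉ (start∈ w) }) , e , j))
          ... | inj₁ en = inj₂ (only (inj₂ (start∈ w)) en)
          ... | inj₂ y∈ = inj₁ y∈

      -- As `a` is no cut vertex, some walk from `p` avoids it and reaches an end; up to the first
      -- end met it cannot leave `W₁`.
      attach : ∀ {p a} → W₁ p → p ≢ a → Cl (∃[ t ] (End t × t ≢ a × ConnV (λ z → (W₁ z ⊎ z ≡ t) × z ≢ a) p t))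
      attach {p} {a} p∈ p≢a with target
        where
        target : ∃[ t ] (End t × t ≢ a)
        target with u Finₚ.≟ a
        ... | yes refl = v , inj₂ refl , u≢v ∘ sym
        ... | no ne = u , inj₁ refl , ne
      ... | t₀ , en₀ , t₀≢ = do
          (w , wv) ← conn₁ p≢a t₀≢
          pure (go w wv)
        where
        go : (w : Walk p t₀) → (∀ {r} → r ∈ᵛ w → r ≢ a) → ∃[ t ] (End t × t ≢ a × ConnV (λ z → (W₁ z ⊎ z ≡ t) × z ≢ a) p t)
        go w wv with simplify w
        ... | w' , sw , sub , _ with first end? w'
        ...   | inj₁ none = ⊥-elim (none (end∈ w') en₀)
        ...   | inj₂ (t , mkSplit x y refl , en , only) = t , en , wv (sub (∈ᵛ-⊕ˡ x y (end∈ x))) , x ,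
                  λ r∈ → stay x (proj₁ (simple-⊕⁻ x y sw)) only (inj₁ p∈) r∈ , wv (sub (∈ᵛ-⊕ˡ x y r∈))

      end-other : ∀ {t} → End t → t ≢ u → t ≡ v
      end-other (inj₁ e) ne = ⊥-elim (ne e)
      end-other (inj₂ e) ne = e

      attach-v : ∀ {p} → W₁ p → Cl (ConnV (λ z → (W₁ z ⊎ z ≡ v) × z ≢ u) p v)
      attach-v p∈ = do
        (t , en , t≢u , conn) ← attach {a = u} p∈ (λ { refl → u∉₁ p∈ })
        pure (subst (λ t → ConnV (λ z → (W₁ z ⊎ z ≡ t) × z ≢ u) _ t) (end-other en t≢u) conn)

      private
        X₀ : Subset n
        X₀ = fromDec W₁?

      unbalanced : ¬ BalV (λ z → ¬ W₂ z)
      unbalanced bal with some₁ | some₂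
      ... | a , a∈ | b , b∈ = S.unbalanced-side {a} {b} u≢v (∈-fromDec⁺ W₁? a∈) (λ q → disj (∈-fromDec⁻ W₁? q) b∈)
            (λ { refl → u∉₂ b∈ }) (λ { refl → v∉₂ b∈ })
            λ cyc sub → bal cyc λ g∈ → at (sub g∈) (inj₁ refl) , at (sub g∈) (inj₂ refl)
        where
        closed : ∀ {g p q} → J g p q → p ∈ X₀ → q ∈ X₀ ⊎ q ≡ u ⊎ q ≡ v
        closed {g} {p} {q} j p∈ with p Finₚ.≟ q
        ... | yes refl = inj₁ p∈
        ... | no ne = [ inj₂ , inj₁ ∘ ∈-fromDec⁺ W₁? ]′ (not-2 (adj-1 (∈-fromDec⁻ W₁? p∈) (ne , g , j)))
        module S = Side X₀ u v closed
        at : ∀ {g p} → g ∈ S.X → Inc g p → ¬ W₂ p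
        at g∈ i q with S.X-end g∈ i
        ... | inj₁ p∈ = disj (∈-fromDec⁻ W₁? p∈) q
        ... | inj₂ en = end∉₂ en q

    -- Neither `u` nor `v` is a cut vertex, so a vertex of `W₁` reaches each of them on its own side
    -- without the other.
    link-sides : ∀ {u v W₁ W₂} (c : Cut u v W₁ W₂) → Cl (ConnV (λ z → ¬ W₂ z) u v)
    link-sides {u} {v} {W₁} {W₂} c = do
        x ← attach-v (proj₂ some₁)
        y ← CutFacts.attach-v (swap-ends c) (proj₂ some₁)
        pure (connV-trans (connV-sym (connV-mono (λ r → in-1 (inj₁ refl) (proj₁ r)) y)) (connV-mono (λ r → in-1 (inj₂ refl) (proj₁ r)) x))
      where
      open CutFacts c
      in-1 : ∀ {z t} → End t → W₁ z ⊎ z ≡ t → ¬ W₂ z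
      in-1 en (inj₁ a) b = disj a b
      in-1 en (inj₂ refl) b = end∉₂ en b

    module _ {u v W₁ W₂} (c : Cut u v W₁ W₂) where
      open CutFacts c

      -- After the deletion `u` and `v` are still joined through the first side, and every other
      -- vertex attaches to one of them.
      nonsep-conn₂ : ∀ {a b} → NonSep c a → W₂ b → Conn₂ a b
      nonsep-conn₂ {a} {b} (a∈ , uv) b∈ {p} {q} offp offq = do
          x ← to-u p offp
          y ← to-u q offq
          pure (connV-trans x (connV-sym y))
        where
        uv' : ConnV (Off a b) u v
        uv' = connV-mono (λ (¬2 , ne) → ne , λ { refl → ¬2 b∈ }) uv
        end-to-u : ∀ {t} → End t → ConnV (Off a b) t u
        end-to-u (inj₁ refl) = connV-refl (proj₂ uv' (start∈ (proj₁ uv')))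
        end-to-u (inj₂ refl) = connV-sym uv'
        to-u : ∀ p → Off a b p → Cl (ConnV (Off a b) p u)
        to-u p (p≢a , p≢b) with part p
        ... | inj₁ e = pure (end-to-u (inj₁ e))
        ... | inj₂ (inj₁ e) = pure (end-to-u (inj₂ e))
        ... | inj₂ (inj₂ (inj₁ p∈)) = do
          (t , en , _ , conn) ← attach p∈ p≢a
          pure (connV-trans (connV-mono (λ { (inj₁ x , ne) → ne , (λ { refl → disj x b∈ }) ; (inj₂ refl , ne) → ne , λ { refl → end∉₂ en b∈ } }) conn) (end-to-u en))
        ... | inj₂ (inj₂ (inj₂ p∈)) = do
          (t , en , _ , conn) ← CutFacts.attach (swap-sides c) p∈ p≢b
          pure (connV-trans (connV-mono (λ { (inj₁ x , ne) → (λ { refl → disj a∈ x }) , ne ; (inj₂ refl , ne) → (λ { refl → end∉₁ en a∈ }) , ne }) conn) (end-to-u en))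

      nonsep-balanced : ∀ {a b} → NonSep c a → W₂ b → BalV (Off a b)
      nonsep-balanced ns b∈ = nonedge-balanced (λ { refl → disj (proj₁ ns) b∈ }) (apart (proj₁ ns) b∈) (nonsep-conn₂ ns b∈)

    -- In other words, every unbalanced cycle avoiding `W₁` passes through all of `W₂`.
    Missing : VSet → VSet → Set₁
    Missing W₁ W₂ = ∀ {S : VSet} {b} → (∀ {z} → S z → ¬ W₁ z) → W₂ b → ¬ S b → BalV S

    record Three (W : VSet) (x y z : V) : Set where
      constructor mkThree
      field
        x∈ : W x
        y∈ : W y
        z∈ : W z
        x≢y : x ≢ y
        x≢z : x ≢ z
        y≢z : y ≢ z

    rotate₃ : ∀ {W x y z} → Three W x y z → Three W y z x
    rotate₃ (mkThree a b c p q r) = mkThree b c a r (p ∘ sym) (q ∘ sym)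

    -- A minimal unbalanced cycle of G − W₁ contains W₂; if it had length at least four it would
    -- have no chords, and two non-adjacent vertices of W₂ could be deleted without disconnecting G.
    module TriangleSide {u v W₁ W₂} (c : Cut u v W₁ W₂) (missing : Missing W₁ W₂)
      {w₁ w₂ w₃} (t : Three W₂ w₁ w₂ w₃) where
      open CutFacts c

      pick-other : ∀ p q → ∃[ b ] (W₂ b × b ≢ p × b ≢ q)
      pick-other p q with w₁ Finₚ.≟ p | w₁ Finₚ.≟ q | w₂ Finₚ.≟ p | w₂ Finₚ.≟ q
      ... | no a | no b | _ | _ = w₁ , Three.x∈ t , a , b
      ... | _ | _ | no a | no b = w₂ , Three.y∈ t , a , b
      ... | yes refl | _ | yes e | _ = ⊥-elim (Three.x≢y t (sym e))
      ... | _ | yes refl | _ | yes e = ⊥-elim (Three.x≢y t (sym e))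
      ... | yes refl | _ | _ | yes refl = w₃ , Three.z∈ t , Three.x≢z t ∘ sym , Three.y≢z t ∘ sym
      ... | _ | yes refl | yes refl | _ = w₃ , Three.z∈ t , Three.y≢z t ∘ sym , Three.x≢z t ∘ sym

      side-neighbour : ∀ {w} → W₂ w → ∀ p q → ∃[ r ] (Adj w r × r ≢ p × r ≢ q)
      side-neighbour {w} w∈ p q = neighbour-of λ {r} wr → let (b , b∈ , b≢w , b≢r) = pick-other w r in
        missing (λ { (inj₁ refl) z∈ → disj z∈ w∈ ; (inj₂ refl) z∈ → apart z∈ w∈ (adj-sym wr) }) b∈ λ { (inj₁ e) → b≢w e ; (inj₂ e) → b≢r e }

      module _ (mc : MinCycle (λ z → ¬ W₁ z)) where
        open Minimal mc

        W₂⊆D : ∀ {b} → W₂ b → D b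
        W₂⊆D {b} b∈ = decidable-stable (D? b) λ b∉ → unbal (missing {S = D} inT b∈ b∉ cyc (cycle-inV (λ q → q)))

        adj-end : 4 ≤ size → ∀ {w} → W₂ w → ∃[ e ] (End e × Adj w e)
        adj-end 4≤ {w} w∈ with adj? w u | adj? w v
        ... | yes a | _ = u , inj₁ refl , a
        ... | no _ | yes a = v , inj₂ refl , a
        ... | no ¬u | no ¬v with side-neighbour w∈ w w
        ...   | r₁ , a₁ , _ with side-neighbour w∈ r₁ r₁
        ...     | r₂ , a₂ , n₂ , _ with side-neighbour w∈ r₁ r₂
        ...       | r₃ , a₃ , n₃ , n₃' = ⊥-elim (degree≤2 (W₂⊆D w∈) (inD a₁) (inD a₂) (inD a₃) (n₂ ∘ sym) (n₃ ∘ sym) (n₃' ∘ sym) a₁ a₂ a₃)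
          where
          inD : ∀ {r} → Adj w r → D r
          inD {r} a with part r
          ... | inj₁ refl = ⊥-elim (¬u a)
          ... | inj₂ (inj₁ refl) = ⊥-elim (¬v a)
          ... | inj₂ (inj₂ (inj₁ r∈)) = ⊥-elim (apart r∈ w∈ (adj-sym a))
          ... | inj₂ (inj₂ (inj₂ r∈)) = W₂⊆D r∈

        clique-pair : 4 ≤ size → ∀ {w w'} → W₂ w → W₂ w' → w ≢ w' → Adj w w'
        clique-pair 4≤ {w} {w'} w∈ w'∈ ne = decidable-stable (adj? w w') λ ¬a →
          unbalanced (balV-mono (λ ¬2 → (λ { refl → ¬2 w∈ }) , λ { refl → ¬2 w'∈ }) (nonedge-balanced ne ¬a conn))
          where
          S = Off w w'
          not₂ : ∀ {z} → ¬ W₂ z → S z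
          not₂ ¬2 = (λ { refl → ¬2 w∈ }) , λ { refl → ¬2 w'∈ }
          end-to-u : ∀ {t} → End t → Cl (ConnV S t u)
          end-to-u (inj₁ refl) = pure (connV-refl (not₂ u∉₂))
          end-to-u (inj₂ refl) = do
            l ← link-sides c
            pure (connV-sym (connV-mono not₂ l))
          to-u : ∀ p → S p → Cl (ConnV S p u)
          to-u p off with part p
          ... | inj₁ e = end-to-u (inj₁ e)
          ... | inj₂ (inj₁ e) = end-to-u (inj₂ e)
          ... | inj₂ (inj₂ (inj₁ p∈)) = do
            (t , en , _ , cn) ← attach {a = w} p∈ (λ { refl → disj p∈ w∈ })
            y ← end-to-u en
            pure (connV-trans (connV-mono (λ { (inj₁ x , _) → not₂ (disj x) ; (inj₂ refl , _) → not₂ (end∉₂ en) }) cn) y)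
          ... | inj₂ (inj₂ (inj₂ p∈)) = do
            let (e , en , a) = adj-end 4≤ p∈
            y ← end-to-u en
            pure (connV-trans (connV-adj off (not₂ (end∉₂ en)) a) y)
          conn : Conn₂ w w'
          conn offp offq = do
            x ← to-u _ offp
            y ← to-u _ offq
            pure (connV-trans x (connV-sym y))

        not-large : ¬ 4 ≤ size
        not-large 4≤ = let (z , z∈ , z∉) = D-outside (w₁ ∷ w₂ ∷ w₃ ∷ []) 4≤ in
          [ (λ e → z∉ (0th e)) , [ (λ e → z∉ (1st e)) , (λ e → z∉ (2nd e)) ]′ ]′
            (triangle (W₂⊆D (Three.x∈ t)) (W₂⊆D (Three.y∈ t)) (W₂⊆D (Three.z∈ t))
              (clique-pair 4≤ (Three.x∈ t) (Three.y∈ t) (Three.x≢y t)) (clique-pair 4≤ (Three.y∈ t) (Three.z∈ t) (Three.y≢z t))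
              (clique-pair 4≤ (Three.x∈ t) (Three.z∈ t) (Three.x≢z t)) z∈)

        size≤3 : size ≤ 3
        size≤3 = ℕₚ.≮⇒≥ not-large

        only-three : ∀ {z} → W₂ z → z ≡ w₁ ⊎ z ≡ w₂ ⊎ z ≡ w₃
        only-three z∈ = one-of-three (exhausts (w₁ ∷ w₂ ∷ w₃ ∷ [])
          ((λ { (0th x) → Three.x≢y t x ; (1st x) → Three.x≢z t x }) , (λ { (0th x) → Three.y≢z t x }) , (λ ()) , tt)
          (λ { (0th refl) → W₂⊆D (Three.x∈ t) ; (1st refl) → W₂⊆D (Three.y∈ t) ; (2nd refl) → W₂⊆D (Three.z∈ t) }) size≤3 (W₂⊆D z∈))

      record Triangle : Set where
        field
          only : ∀ {z} → W₂ z → z ≡ w₁ ⊎ z ≡ w₂ ⊎ z ≡ w₃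
          cl : ∀ {p q} → W₂ p → W₂ q → p ≢ q → Adj p q

      is-triangle : Cl Triangle
      is-triangle = do
        mc ← min-cycle (CutFacts.unbalanced (swap-sides c))
        pure record { only = only-three mc ; cl = λ p∈ q∈ → Minimal.small-clique mc (size≤3 mc) (W₂⊆D mc p∈) (W₂⊆D mc q∈) }

    nonsep-missing : ∀ {u v W₁ W₂} (c : Cut u v W₁ W₂) {a} → NonSep c a → Missing W₁ W₂
    nonsep-missing c ns S⊆ b∈ b∉ = balV-mono (λ s → (λ { refl → S⊆ s (proj₁ ns) }) , λ { refl → b∉ s }) (nonsep-balanced c ns b∈)

    -- A third neighbour of `x` besides `y` and `z` cannot be in either side.
    end-neighbour : ∀ {u v W₁ W₂} (c : Cut u v W₁ W₂) (missing : Missing W₁ W₂) {x y z} (t : Three W₂ x y z) →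
      (∀ {p} → W₂ p → p ≡ x ⊎ p ≡ y ⊎ p ≡ z) → ∃[ e ] (CutFacts.End c e × Adj x e)
    end-neighbour {u} {v} {W₁} {W₂} c missing {x} {y} {z} t only = found (TriangleSide.side-neighbour c missing t (Three.x∈ t) y z)
      where
      found : ∃[ r ] (Adj x r × r ≢ y × r ≢ z) → ∃[ e ] (CutFacts.End c e × Adj x e)
      found (r , xr , r≢y , r≢z) = r , is-end (Cut.part c r) , xr
        where
        is-end : r ≡ u ⊎ r ≡ v ⊎ W₁ r ⊎ W₂ r → CutFacts.End c r
        is-end (inj₁ e) = inj₁ e
        is-end (inj₂ (inj₁ e)) = inj₂ e
        is-end (inj₂ (inj₂ (inj₁ r∈))) = ⊥-elim (Cut.apart c r∈ (Three.x∈ t) (adj-sym xr))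
        is-end (inj₂ (inj₂ (inj₂ r∈))) = ⊥-elim ([ proj₁ xr ∘ sym , [ r≢y , r≢z ]′ ]′ (only r∈))

    module _ {u v W₁ W₂} (c : Cut u v W₁ W₂) {a} (ns : NonSep c a) where
      open CutFacts c
      private
        a∈ : W₁ a
        a∈ = proj₁ ns

      -- The third-vertex argument for the non-edge `ab` and `x`: the spoke from `t` to `b` agrees
      -- with `x`, because `t`, `x` and `b` together miss `y`, and at `a` there is no edge to `x`.
      common-end : ∀ {b x y} → Three W₂ b x y → (∀ {p} → W₂ p → p ≡ b ⊎ p ≡ x ⊎ p ≡ y) →
        ∃[ e ] (End e × Adj y e) → ∀ {t} → End t → Adj b t → Adj x t → ⊥
      common-end {b} {x} {y} (mkThree b∈ x∈ y∈ b≢x b≢y x≢y) only (ey , ey-end , yey) {t} t-end bt xt =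
          third-vertex a≢b (apart a∈ b∈) (a≢x ∘ sym) (b≢x ∘ sym) (nonsep-balanced c ns b∈) conn₃
            (λ bal → unbalanced (balV-mono (λ { ¬2 refl → ¬2 x∈ }) bal)) choice-a choice-b
        where
        a≢b : a ≢ b
        a≢b refl = disj a∈ b∈
        a≢x : a ≢ x
        a≢x refl = disj a∈ x∈
        S : VSet
        S p = Off a b p × p ≢ x
        not₂ : ∀ {z} → ¬ W₂ z → z ≢ a → S z
        not₂ ¬2 ne = (ne , λ { refl → ¬2 b∈ }) , λ { refl → ¬2 x∈ }
        end-off : ∀ {e} → End e → S e
        end-off en = not₂ (end∉₂ en) (λ { refl → end∉₁ en a∈ })
        end-to-u : ∀ {e} → End e → ConnV S e u
        end-to-u (inj₁ refl) = connV-refl (end-off (inj₁ refl))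
        end-to-u (inj₂ refl) = connV-sym (connV-mono (λ (¬2 , ne) → not₂ ¬2 ne) (proj₂ ns))
        to-u : ∀ p → S p → Cl (ConnV S p u)
        to-u p ((p≢a , p≢b) , p≢x) with part p
        ... | inj₁ e = pure (end-to-u (inj₁ e))
        ... | inj₂ (inj₁ e) = pure (end-to-u (inj₂ e))
        ... | inj₂ (inj₂ (inj₁ p∈)) = do
          (t , en , _ , conn) ← attach p∈ p≢a
          pure (connV-trans (connV-mono (λ { (inj₁ z , ne) → not₂ (disj z) ne ; (inj₂ refl , ne) → not₂ (end∉₂ en) ne }) conn) (end-to-u en))
        ... | inj₂ (inj₂ (inj₂ p∈)) with only p∈
        ...   | inj₁ e = ⊥-elim (p≢b e)
        ...   | inj₂ (inj₁ e) = ⊥-elim (p≢x e)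
        ...   | inj₂ (inj₂ refl) = pure (connV-trans (connV-adj ((p≢a , p≢b) , p≢x) (end-off ey-end) yey) (end-to-u ey-end))
        conn₃ : ∀ {p q} → S p → S q → Cl (ConnV S p q)
        conn₃ offp offq = do
          p→u ← to-u _ offp
          q→u ← to-u _ offq
          pure (connV-trans p→u (connV-sym q→u))
        choice-a : Choice a b x a
        choice-a with link-at a
        ... | g , z , j , a≢z = nonadjacent z (λ { refl → apart a∈ x∈ (a≢z , g , j) }) (adj-sym (a≢z , g , j)) (λ xa → apart a∈ x∈ (adj-sym xa))
        t-off : Off a b t
        t-off = (λ { refl → end∉₁ t-end a∈ }) , λ { refl → end∉₂ t-end b∈ }
        choice-b : Choice a b x b
        choice-b = via t (λ { refl → end∉₂ t-end x∈ }) (adj-sym bt) (λ p → p ≡ t ⊎ p ≡ x)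
          (λ { (inj₁ refl) → t-off ; (inj₂ refl) → a≢x ∘ sym , b≢x ∘ sym })
          (connV-adj (inj₁ refl) (inj₂ refl) (adj-sym xt))
          (nonsep-missing c ns (λ { (inj₁ (inj₁ refl)) q → end∉₁ t-end q ; (inj₁ (inj₂ refl)) q → disj q x∈ ; (inj₂ refl) q → disj q b∈ }) y∈
            λ { (inj₁ (inj₁ refl)) → end∉₂ t-end y∈ ; (inj₁ (inj₂ e)) → x≢y (sym e) ; (inj₂ e) → b≢y (sym e) })

      -- `W₂` would be a triangle each of whose vertices has a neighbour among the two ends, so two
      -- of them share one.
      nonsep-three : ∀ {w₁ w₂ w₃} → Three W₂ w₁ w₂ w₃ → ⊥
      nonsep-three {w₁} {w₂} {w₃} t = run do
          tri ← TriangleSide.is-triangle c miss t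
          λ k → k (go (TriangleSide.Triangle.only tri))
        where
        miss : Missing W₁ W₂
        miss = nonsep-missing c ns
        go : (∀ {z} → W₂ z → z ≡ w₁ ⊎ z ≡ w₂ ⊎ z ≡ w₃) → ⊥
        go only = fin (end-neighbour c miss t only) (end-neighbour c miss t' only') (end-neighbour c miss t'' only'')
          where
          t' = rotate₃ t
          t'' = rotate₃ t'
          only' : ∀ {z} → W₂ z → z ≡ w₂ ⊎ z ≡ w₃ ⊎ z ≡ w₁
          only' z∈ = [ inj₂ ∘ inj₂ , [ inj₁ , inj₂ ∘ inj₁ ]′ ]′ (only z∈)
          only'' : ∀ {z} → W₂ z → z ≡ w₃ ⊎ z ≡ w₁ ⊎ z ≡ w₂
          only'' z∈ = [ inj₂ ∘ inj₂ , [ inj₁ , inj₂ ∘ inj₁ ]′ ]′ (only' z∈)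
          fin : ∃[ e ] (End e × Adj w₁ e) → ∃[ e ] (End e × Adj w₂ e) → ∃[ e ] (End e × Adj w₃ e) → ⊥
          fin (e₁ , en₁ , a₁) (e₂ , en₂ , a₂) (e₃ , en₃ , a₃) with e₁ Finₚ.≟ e₂ | e₂ Finₚ.≟ e₃ | e₃ Finₚ.≟ e₁
          ... | yes refl | _ | _ = common-end t only (e₃ , en₃ , a₃) en₁ a₁ a₂
          ... | _ | yes refl | _ = common-end t' only' (e₁ , en₁ , a₁) en₂ a₂ a₃
          ... | _ | _ | yes refl = common-end t'' only'' (e₂ , en₂ , a₂) en₃ a₃ a₁
          ... | no n₁ | no n₂ | no n₃ = two-ends en₁ en₂ en₃
            where
            two-ends : End e₁ → End e₂ → End e₃ → ⊥
            two-ends (inj₁ refl) (inj₁ refl) _ = n₁ refl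
            two-ends (inj₂ refl) (inj₂ refl) _ = n₁ refl
            two-ends _ (inj₁ refl) (inj₁ refl) = n₂ refl
            two-ends _ (inj₂ refl) (inj₂ refl) = n₂ refl
            two-ends (inj₁ refl) _ (inj₁ refl) = n₃ refl
            two-ends (inj₂ refl) _ (inj₂ refl) = n₃ refl

    last-vertex : ∀ {S : VSet} {p q} → p ≢ q → ConnV S p q → ∃[ r ] (S r × Adj r q)
    last-vertex ne (w , wv) = go ne w wv
      where
      go : ∀ {S : VSet} {p q} → p ≢ q → (w : Walk p q) → (∀ {r} → r ∈ᵛ w → S r) → ∃[ r ] (S r × Adj r q)
      go ne nil wv = ⊥-elim (ne refl)
      go {q = q} ne (cons {p} {y} e j w) wv with y Finₚ.≟ q
      ... | yes refl = p , wv (inj₁ refl) , ne , e , j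
      ... | no y≢ = go y≢ w (λ r → wv (inj₂ r))

    -- Serves the configuration that counting leaves over: the two ends, three vertices of `W₁` and
    -- two of `W₂`.
    module SevenVertices {u v W₁ W₂} (c : Cut u v W₁ W₂) (all-nonsep : ∀ {x} → W₁ x → NonSep c x)
      {w₁ w₂} (w₁∈ : W₂ w₁) (w₂∈ : W₂ w₂) (w₁≢w₂ : w₁ ≢ w₂) (only₂ : ∀ {z} → W₂ z → z ≡ w₁ ⊎ z ≡ w₂)
      (clique₁ : ∀ {p q} → W₁ p → W₁ q → p ≢ q → Adj p q)
      (¬uv : ¬ Adj u v) (¬uw₂ : ¬ Adj u w₂) where
      open CutFacts c

      missing₂ : Missing W₁ W₂
      missing₂ = nonsep-missing c (all-nonsep (proj₂ some₁))

      -- Otherwise a minimal unbalanced cycle of G − W₁ passes through u, w₁ and w₂,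
      -- but u has only one neighbour there.
      u-adjacent : ∀ {x} → W₁ x → Cl (Adj u x)
      u-adjacent {x} x∈ ¬ux = run do
          mc ← min-cycle (CutFacts.unbalanced (swap-sides c))
          λ k → k (through mc)
        where
        x≢u : x ≢ u
        x≢u refl = u∉₁ x∈
        S = Off u x
        v-off : S v
        v-off = u≢v ∘ sym , λ { refl → v∉₁ x∈ }
        v-neighbour : ∃[ y ] (W₁ y × y ≢ x × Adj y v)
        v-neighbour with last-vertex u≢v (proj₂ (all-nonsep x∈))
        ... | r , (¬2 , r≢x) , rv with not-2 ¬2
        ...   | inj₁ (inj₁ refl) = ⊥-elim (¬uv rv)
        ...   | inj₁ (inj₂ refl) = ⊥-elim (proj₁ rv refl)
        ...   | inj₂ r∈ = r , r∈ , r≢x , rv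
        off₁ : ∀ {p} → W₁ p → p ≢ x → S p
        off₁ p∈ ne = (λ { refl → u∉₁ p∈ }) , ne
        to-v : ∀ p → S p → Cl (ConnV S p v)
        to-v p (p≢u , p≢x) with part p
        ... | inj₁ e = ⊥-elim (p≢u e)
        ... | inj₂ (inj₁ refl) = pure (connV-refl v-off)
        ... | inj₂ (inj₂ (inj₁ p∈)) = let (y , y∈ , y≢x , yv) = v-neighbour in
                pure (connV-trans (connV-near (off₁ p∈ p≢x) (off₁ y∈ y≢x) (clique₁ p∈ y∈)) (connV-adj (off₁ y∈ y≢x) v-off yv))
        ... | inj₂ (inj₂ (inj₂ p∈)) = do
          cn ← CutFacts.attach-v (swap-sides c) p∈
          pure (connV-mono (λ { (inj₁ z , ne) → ne , (λ { refl → disj x∈ z }) ; (inj₂ refl , ne) → v-off }) cn)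
        bal : BalV S
        bal = nonedge-balanced (x≢u ∘ sym) ¬ux λ offp offq → do
          p→v ← to-v _ offp
          q→v ← to-v _ offq
          pure (connV-trans p→v (connV-sym q→v))
        through : MinCycle (λ z → ¬ W₁ z) → ⊥
        through mc = two (two-neighbours u∈D w₁∈D w₂∈D (λ { refl → u∉₂ w₁∈ }) (λ { refl → u∉₂ w₂∈ }) w₁≢w₂)
          where
          open Minimal mc
          unbal-D : ¬ BalV D
          unbal-D b = unbal (b cyc (cycle-inV (λ q → q)))
          u∈D : D u
          u∈D = decidable-stable (D? u) λ u∉ → unbal-D (balV-mono (λ d → (λ { refl → u∉ d }) , λ { refl → inT d x∈ }) bal)
          in-D : ∀ {w} → W₂ w → D w
          in-D {w} w∈ = decidable-stable (D? w) λ w∉ → unbal-D (missing₂ inT w∈ w∉)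
          w₁∈D = in-D w₁∈
          w₂∈D = in-D w₂∈
          is-w₁ : ∀ {y} → D y → Adj u y → y ≡ w₁
          is-w₁ {y} y∈ uy with part y
          ... | inj₁ refl = ⊥-elim (proj₁ uy refl)
          ... | inj₂ (inj₁ refl) = ⊥-elim (¬uv uy)
          ... | inj₂ (inj₂ (inj₁ q)) = ⊥-elim (inT y∈ q)
          ... | inj₂ (inj₂ (inj₂ q)) with only₂ q
          ...   | inj₁ e = e
          ...   | inj₂ refl = ⊥-elim (¬uw₂ uy)
          two : ∃[ y ] ∃[ y' ] (D y × D y' × y ≢ y' × Adj u y × Adj u y') → ⊥
          two (y , y' , y∈ , y'∈ , ne , uy , uy') = ne (trans (is-w₁ y∈ uy) (sym (is-w₁ y'∈ uy')))

    flip-nonsep : ∀ {u v W₁ W₂} (c : Cut u v W₁ W₂) {a} → NonSep c a → NonSep (swap-ends c) a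
    flip-nonsep c (a∈ , w) = a∈ , connV-sym w

    module _ {u v W₁ W₂} (c : Cut u v W₁ W₂) (all-nonsep : ∀ {x} → W₁ x → NonSep c x)
      {w₁ w₂} (w₁∈ : W₂ w₁) (w₂∈ : W₂ w₂) (w₁≢w₂ : w₁ ≢ w₂) (only₂ : ∀ {z} → W₂ z → z ≡ w₁ ⊎ z ≡ w₂)
      {x₁ x₂ x₃} (t : Three W₁ x₁ x₂ x₃) (only₁ : ∀ {z} → W₁ z → z ≡ x₁ ⊎ z ≡ x₂ ⊎ z ≡ x₃)
      (missing₁ : Missing W₂ W₁) (w₁u : Adj w₁ u) (w₂v : Adj w₂ v)
      (u-adj : ∀ {x} → W₁ x → Adj u x) (v-adj : ∀ {x} → W₁ x → Adj v x) where
      open CutFacts c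
      open Three t renaming (x∈ to x₁∈; y∈ to x₂∈; z∈ to x₃∈; x≢y to x₁≢x₂; x≢z to x₁≢x₃; y≢z to x₂≢x₃)

      -- The third-vertex argument for `x₁`, `w₁` and `x₂`. What remains is connected through the
      -- path v x₃ u, and both spokes start at `u`: `u`, `x₁` and `x₂` miss `x₃`, and `x₂` is not
      -- adjacent to `w₁`.
      seven-impossible : ⊥
      seven-impossible = third-vertex x₁≢w₁ (apart x₁∈ w₁∈) (x₁≢x₂ ∘ sym) (λ { refl → disj x₂∈ w₁∈ })
          (nonsep-balanced c (all-nonsep x₁∈) w₁∈) (λ p q → pure (connV-trans (to-u p) (connV-sym (to-u q))))
          (λ bal → CutFacts.unbalanced (swap-sides c) (balV-mono (λ { ¬1 refl → ¬1 x₂∈ }) bal)) choice-x choice-w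
        where
        x₁≢w₁ : x₁ ≢ w₁
        x₁≢w₁ refl = disj x₁∈ w₁∈
        S : VSet
        S p = Off x₁ w₁ p × p ≢ x₂
        off₂ : ∀ {z} → ¬ W₁ z → z ≢ w₁ → S z
        off₂ ¬1 ne = ((λ { refl → ¬1 x₁∈ }) , ne) , λ { refl → ¬1 x₂∈ }
        u-off : S u
        u-off = off₂ u∉₁ (λ { refl → u∉₂ w₁∈ })
        v-off : S v
        v-off = off₂ v∉₁ (λ { refl → v∉₂ w₁∈ })
        x₃-off : S x₃
        x₃-off = (x₁≢x₃ ∘ sym , λ { refl → disj x₃∈ w₁∈ }) , x₂≢x₃ ∘ sym
        v-to-u : ConnV S v u
        v-to-u = connV-trans (connV-adj v-off x₃-off (v-adj x₃∈)) (connV-adj x₃-off u-off (adj-sym (u-adj x₃∈)))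
        to-u : ∀ {p} → S p → ConnV S p u
        to-u {p} off@((p≢x₁ , p≢w₁) , p≢x₂) with part p
        ... | inj₁ refl = connV-refl u-off
        ... | inj₂ (inj₁ refl) = v-to-u
        ... | inj₂ (inj₂ (inj₁ p∈)) with only₁ p∈
        ...   | inj₁ e = ⊥-elim (p≢x₁ e)
        ...   | inj₂ (inj₁ e) = ⊥-elim (p≢x₂ e)
        ...   | inj₂ (inj₂ refl) = connV-adj x₃-off u-off (adj-sym (u-adj x₃∈))
        to-u {p} off@((p≢x₁ , p≢w₁) , p≢x₂) | inj₂ (inj₂ (inj₂ p∈)) with only₂ p∈
        ...   | inj₁ e = ⊥-elim (p≢w₁ e)
        ...   | inj₂ refl = connV-trans (connV-adj off v-off w₂v) v-to-u
        choice-x : Choice x₁ w₁ x₂ x₁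
        choice-x = via u (λ { refl → u∉₁ x₂∈ }) (u-adj x₁∈) (λ p → p ≡ u ⊎ p ≡ x₂)
          (λ { (inj₁ refl) → proj₁ u-off ; (inj₂ refl) → x₁≢x₂ ∘ sym , λ { refl → disj x₂∈ w₁∈ } })
          (connV-adj (inj₁ refl) (inj₂ refl) (u-adj x₂∈))
          (missing₁ (λ { (inj₁ (inj₁ refl)) → u∉₂ ; (inj₁ (inj₂ refl)) → disj x₂∈ ; (inj₂ refl) → disj x₁∈ }) x₃∈
            λ { (inj₁ (inj₁ refl)) → u∉₁ x₃∈ ; (inj₁ (inj₂ e)) → x₂≢x₃ (sym e) ; (inj₂ e) → x₁≢x₃ (sym e) })
        choice-w : Choice x₁ w₁ x₂ w₁
        choice-w = nonadjacent u (λ { refl → u∉₁ x₂∈ }) (adj-sym w₁u) (apart x₂∈ w₁∈)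

    module _ {u v W₁ W₂} (c : Cut u v W₁ W₂) (all-nonsep : ∀ {x} → W₁ x → NonSep c x) where
      open CutFacts c
      private
        c' = swap-sides c
        module C' = CutFacts c'

        few₂ : ∃[ w ] ∃[ w' ] (W₂ w × (∀ {z} → W₂ z → z ≡ w ⊎ z ≡ w'))
        few₂ with some₂
        ... | w , w∈ with Finₚ.any? (λ z → C'.W₁? z ×-dec ¬? (z Finₚ.≟ w))
        ...   | no none = w , w , w∈ , λ {z} z∈ → inj₁ (decidable-stable (z Finₚ.≟ w) λ ne → none (z , z∈ , ne))
        ...   | yes (w' , w'∈ , w'≢) = w , w' , w∈ , λ {z} z∈ → aux z∈ (z Finₚ.≟ w) (z Finₚ.≟ w')
          where
          aux : ∀ {z} → W₂ z → Dec (z ≡ w) → Dec (z ≡ w') → z ≡ w ⊎ z ≡ w'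
          aux z∈ (yes e) _ = inj₁ e
          aux z∈ (no _) (yes e) = inj₂ e
          aux z∈ (no p) (no q) = ⊥-elim (nonsep-three c (all-nonsep (proj₂ some₁)) (mkThree z∈ w∈ w'∈ p q (w'≢ ∘ sym)))

        -- The ends and the at most two vertices of `W₂` take up only four of at least seven
        -- vertices.
        three₁ : ∃[ x₁ ] ∃[ x₂ ] ∃[ x₃ ] Three W₁ x₁ x₂ x₃
        three₁ with few₂
        ... | w , w' , _ , only with fresh (u ∷ v ∷ w ∷ w' ∷ []) (ℕₚ.≤-trans (ℕₚ.m≤n+m 5 2) 6<n)
        ... | x₁ , n₁ with fresh (u ∷ v ∷ w ∷ w' ∷ x₁ ∷ []) (ℕₚ.≤-trans (ℕₚ.m≤n+m 6 1) 6<n)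
        ... | x₂ , n₂ with fresh (u ∷ v ∷ w ∷ w' ∷ x₁ ∷ x₂ ∷ []) 6<n
        ... | x₃ , n₃ = x₁ , x₂ , x₃ , mkThree
                (in₁ (λ e → n₁ (0th e)) (λ e → n₁ (1st e)) (λ e → n₁ (2nd e)) (λ e → n₁ (3rd e)))
                (in₁ (λ e → n₂ (0th e)) (λ e → n₂ (1st e)) (λ e → n₂ (2nd e)) (λ e → n₂ (3rd e)))
                (in₁ (λ e → n₃ (0th e)) (λ e → n₃ (1st e)) (λ e → n₃ (2nd e)) (λ e → n₃ (3rd e)))
                (λ e → n₂ (4th (sym e))) (λ e → n₃ (4th (sym e))) (λ e → n₃ (5th (sym e)))
          where
          in₁ : ∀ {x} → x ≢ u → x ≢ v → x ≢ w → x ≢ w' → W₁ x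
          in₁ {x} a b d e with part x
          ... | inj₁ q = ⊥-elim (a q)
          ... | inj₂ (inj₁ q) = ⊥-elim (b q)
          ... | inj₂ (inj₂ (inj₁ q)) = q
          ... | inj₂ (inj₂ (inj₂ q)) = ⊥-elim ([ d , e ]′ (only q))

        missing₁ : Missing W₂ W₁
        missing₁ S⊆ b∈ b∉ = balV-mono (λ s → (λ { refl → b∉ s }) , λ { refl → S⊆ s (proj₂ some₂) }) (nonsep-balanced c (all-nonsep b∈) (proj₂ some₂))

        module Pinned {x₁ x₂ x₃} (t : Three W₁ x₁ x₂ x₃) (only₁ : ∀ {z} → W₁ z → z ≡ x₁ ⊎ z ≡ x₂ ⊎ z ≡ x₃)
          (clique₁ : ∀ {p q} → W₁ p → W₁ q → p ≢ q → Adj p q) where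

          ¬nonsep₂ : ∀ {b} → ¬ NonSep c' b
          ¬nonsep₂ ns = nonsep-three c' ns t

          ¬uv : ¬ Adj u v
          ¬uv uv with some₂
          ... | b , b∈ = ¬nonsep₂ (b∈ , connV-adj (u∉₁ , λ { refl → u∉₂ b∈ }) (v∉₁ , λ { refl → v∉₂ b∈ }) uv)

          -- A vertex `w'` next to both ends would lead from `u` to `v` around `w`, and `W₂` has no
          -- non-separating vertex because `W₁` has three elements.
          not-both : ∀ {w w'} → W₂ w → W₂ w' → w ≢ w' → Adj w' u → ¬ Adj w' v
          not-both w∈ w'∈ ne wu wv = ¬nonsep₂ (w∈ , connV-trans
            (connV-adj (u∉₁ , λ { refl → u∉₂ w∈ }) (C'.disj w'∈ , ne ∘ sym) (adj-sym wu))
            (connV-adj (C'.disj w'∈ , ne ∘ sym) (v∉₁ , λ { refl → v∉₂ w∈ }) wv))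

          in₂ : ∀ {z} → z ≢ u → z ≢ v → ¬ W₁ z → W₂ z
          in₂ {z} a b d with part z
          ... | inj₁ q = ⊥-elim (a q)
          ... | inj₂ (inj₁ q) = ⊥-elim (b q)
          ... | inj₂ (inj₂ (inj₁ q)) = ⊥-elim (d q)
          ... | inj₂ (inj₂ (inj₂ q)) = q

          two₂ : ∃[ w ] ∃[ w' ] (W₂ w × W₂ w' × w ≢ w')
          two₂ with fresh (u ∷ v ∷ x₁ ∷ x₂ ∷ x₃ ∷ []) (ℕₚ.≤-trans (ℕₚ.m≤n+m 6 1) 6<n)
          ... | w , n₁ with fresh (u ∷ v ∷ x₁ ∷ x₂ ∷ x₃ ∷ w ∷ []) 6<n
          ... | w' , n₂ = w , w' , in₂ (λ e → n₁ (0th e)) (λ e → n₁ (1st e)) (λ q → no₁ (λ e → n₁ (2nd e)) (λ e → n₁ (3rd e)) (λ e → n₁ (4th e)) (only₁ q)) ,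
                  in₂ (λ e → n₂ (0th e)) (λ e → n₂ (1st e)) (λ q → no₁ (λ e → n₂ (2nd e)) (λ e → n₂ (3rd e)) (λ e → n₂ (4th e)) (only₁ q)) , λ e → n₂ (5th (sym e))
            where
            no₁ : ∀ {z} → z ≢ x₁ → z ≢ x₂ → z ≢ x₃ → ¬ (z ≡ x₁ ⊎ z ≡ x₂ ⊎ z ≡ x₃)
            no₁ a b d = [ a , [ b , d ]′ ]′

          another : ∀ {w} → W₂ w → ∃[ w' ] (W₂ w' × w' ≢ w)
          another {w} w∈ with two₂
          ... | a , b , a∈ , b∈ , a≢b with a Finₚ.≟ w
          ...   | yes refl = b , b∈ , a≢b ∘ sym
          ...   | no ne = a , a∈ , ne

          in-₂ : ∀ {r t} → ¬ W₁ r → Adj r t → End t → W₂ r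
          in-₂ {r} {t} ¬1 rt en with CutFacts.not-2 c' ¬1
          ... | inj₂ q = q
          ... | inj₁ en' = ⊥-elim (ends en' en)
            where
            ends : End r → End t → ⊥
            ends (inj₁ refl) (inj₁ refl) = proj₁ rt refl
            ends (inj₁ refl) (inj₂ refl) = ¬uv rt
            ends (inj₂ refl) (inj₁ refl) = ¬uv (adj-sym rt)
            ends (inj₂ refl) (inj₂ refl) = proj₁ rt refl

          -- No vertex of `W₂` is adjacent to both ends, so the last vertices before `u` and before
          -- `v` on this side are distinct, and they exhaust `W₂`.
          finish : ConnV (λ z → ¬ W₁ z) u v → ⊥
          finish uv with last-vertex (u≢v ∘ sym) (connV-sym uv) | last-vertex u≢v uv
          ... | w₁ , ¬1 , w₁u | w₂ , ¬1' , w₂v = run do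
              ua ← fin-choice {P = λ x → W₁ x → Adj u x} (λ x → lift x (SevenVertices.u-adjacent c all-nonsep w₁∈ w₂∈ w₁≢w₂ only₂ clique₁ ¬uv (¬uw₂ ∘ adj-sym)))
              va ← fin-choice {P = λ x → W₁ x → Adj v x} (λ x → lift x (SevenVertices.u-adjacent (swap-ends c) (λ q → flip-nonsep c (all-nonsep q))
                     w₂∈ w₁∈ (w₁≢w₂ ∘ sym) (λ q → swap (only₂ q)) clique₁ (¬uv ∘ adj-sym) (¬vw₁ ∘ adj-sym)))
              λ k → k (seven-impossible c all-nonsep w₁∈ w₂∈ w₁≢w₂ only₂ t only₁ missing₁ w₁u w₂v (λ {x} → ua x) (λ {x} → va x))
            where
            w₁∈ = in-₂ ¬1 w₁u (inj₁ refl)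
            w₂∈ = in-₂ ¬1' w₂v (inj₂ refl)
            only-one : ∀ {w} → W₂ w → Adj w u → ¬ Adj w v
            only-one w∈ wu wv with another w∈
            ... | w' , w'∈ , ne = not-both w'∈ w∈ ne wu wv
            w₁≢w₂ : w₁ ≢ w₂
            w₁≢w₂ refl = only-one w₁∈ w₁u w₂v
            ¬uw₂ : ¬ Adj w₂ u
            ¬uw₂ a = only-one w₂∈ a w₂v
            ¬vw₁ : ¬ Adj w₁ v
            ¬vw₁ a = only-one w₁∈ w₁u a
            only₂ : ∀ {z} → W₂ z → z ≡ w₁ ⊎ z ≡ w₂
            only₂ {z} z∈ with z Finₚ.≟ w₁ | z Finₚ.≟ w₂
            ... | yes e | _ = inj₁ e
            ... | no _ | yes e = inj₂ e
            ... | no a | no b = ⊥-elim (nonsep-three c (all-nonsep (proj₂ some₁)) (mkThree z∈ w₁∈ w₂∈ a b w₁≢w₂))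
            lift : ∀ {t} x → (W₁ x → Cl (Adj t x)) → Cl (W₁ x → Adj t x)
            lift x f with W₁? x
            ... | yes x∈ = f x∈ >>= λ a → pure λ _ → a
            ... | no x∉ = pure λ x∈ → ⊥-elim (x∉ x∈)

      not-all-nonsep : ⊥
      not-all-nonsep with three₁
      ... | x₁ , x₂ , x₃ , t = run do
        tri ← TriangleSide.is-triangle c' missing₁ t
        uv ← link-sides c'
        λ k → k (Pinned.finish t (TriangleSide.Triangle.only tri) (TriangleSide.Triangle.cl tri) uv)

    -- Induction on the side of a cut

    record Smaller {W₁ : VSet} (s : V) : Set₁ where
      field
        {u' v'} : V
        X : Subset n
        {W₂'} : VSet
        cut : Cut u' v' (_∈ X) W₂'
        {a'} : V
        nonsep : NonSep cut a'
        X⊆ : ∀ {z} → z ∈ X → W₁ z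
        s∉ : s ∉ X

    -- A separating vertex s splits off the part of W₁ between u and s.
    shrink : ∀ {u v W₁ W₂} (c : Cut u v W₁ W₂) {a s} → NonSep c a → W₁ s → ¬ NonSep c s →
      ConnV (λ z → ¬ W₂ z × z ≢ s) a u → a ≢ s →
      Comprehension (λ z → W₁ z × z ≢ s × ConnV (λ r → ¬ W₂ r × r ≢ s) z u) → Smaller {W₁} s
    shrink {u} {v} {W₁} {W₂} c {a} {s} (a∈ , w , wv) s∈ ¬ns au a≢s ⟦ X , out , into ⟧ = record
      { X = X ; cut = cut ; nonsep = a∈X , walk ; X⊆ = proj₁ ∘ out ; s∉ = λ q → proj₁ (proj₂ (out q)) refl }
      where
      open CutFacts c
      a∈X : a ∈ X
      a∈X = into (a∈ , a≢s , au)
      -- The new far side contains `v`, the old `W₂` and the rest of `W₁`.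
      W₂' : VSet
      W₂' z = z ≢ u × z ≢ s × z ∉ X
      s≢v : s ≢ v
      s≢v refl = v∉₁ s∈
      cut : Cut u s (_∈ X) W₂'
      cut = record
        { u≢v = λ { refl → u∉₁ s∈ }
        ; part = λ z → part' z (z Finₚ.≟ u) (z Finₚ.≟ s) (z ∈? X)
        ; disj = λ p q → proj₂ (proj₂ q) p
        ; u∉₁ = λ q → u∉₁ (proj₁ (out q)) ; u∉₂ = λ q → proj₁ q refl
        ; v∉₁ = λ q → proj₁ (proj₂ (out q)) refl ; v∉₂ = λ q → proj₁ (proj₂ q) refl
        ; apart = apart' ; some₁ = a , a∈X
        ; some₂ = v , u≢v ∘ sym , s≢v ∘ sym , λ q → v∉₁ (proj₁ (out q)) }
        where
        part' : ∀ z → Dec (z ≡ u) → Dec (z ≡ s) → Dec (z ∈ X) → z ≡ u ⊎ z ≡ s ⊎ z ∈ X ⊎ W₂' z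
        part' z (yes e) _ _ = inj₁ e
        part' z (no _) (yes e) _ = inj₂ (inj₁ e)
        part' z (no _) (no _) (yes e) = inj₂ (inj₂ (inj₁ e))
        part' z (no p) (no q) (no r) = inj₂ (inj₂ (inj₂ (p , q , r)))
        apart' : ∀ {p q} → p ∈ X → W₂' q → ¬ Adj p q
        apart' {p} {q} p∈ (q≢u , q≢s , q∉) pq with out p∈
        ... | p∈₁ , p≢s , pu with not-2 (adj-1 p∈₁ pq)
        ...   | inj₁ (inj₁ e) = q≢u e
        -- An edge from `X` to `v` would complete a walk from `u` to `v` avoiding `s`.
        ...   | inj₁ (inj₂ refl) = ¬ns (s∈ , connV-trans (connV-sym pu) (connV-adj (disj p∈₁ , p≢s) (v∉₂ , q≢s) pq))
        ...   | inj₂ q∈ = q∉ (into (q∈ , q≢s , connV-trans (connV-adj (disj q∈ , q≢s) (disj p∈₁ , p≢s) (adj-sym pq)) pu))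
      -- The walk around `a` passes through `s`, since `s` separates `u` from `v`. Its initial part
      -- up to `s` stays within `X` and the new ends, so `a` is again non-separating.
      walk : ConnV (λ z → ¬ W₂' z × z ≢ a) u s
      walk with simplify w
      ... | w' , sw , sub , _ with s ∈ᵛ? w'
      ...   | no s∉ = ⊥-elim (¬ns (s∈ , w' , λ r∈ → proj₁ (wv (sub r∈)) , λ { refl → s∉ r∈ }))
      ...   | yes s∈w with split w' s∈w
      ...     | mkSplit x y refl = x , λ {r} r∈ → inner r∈ , proj₂ (wv (sub (∈ᵛ-⊕ˡ x y r∈)))
        where
        sxy = simple-⊕⁻ x y sw
        inner : ∀ {r} → r ∈ᵛ x → ¬ W₂' r
        inner {r} r∈ (r≢u , r≢s , r∉) with not-2 (proj₁ (wv (sub (∈ᵛ-⊕ˡ x y r∈))))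
        ... | inj₁ (inj₁ e) = r≢u e
        ... | inj₁ (inj₂ refl) = r≢s (proj₂ (proj₂ sxy) r∈ (end∈ y))
        ... | inj₂ r∈₁ with split x r∈
        ...   | mkSplit p q refl = r∉ (into (r∈₁ , r≢s , connV-sym (p , λ {z} z∈ →
                  proj₁ (wv (sub (∈ᵛ-⊕ˡ (p ⊕ q) y (∈ᵛ-⊕ˡ p q z∈)))) , λ { refl → r≢s (sym (proj₂ (proj₂ (simple-⊕⁻ p q (proj₁ sxy))) z∈ (end∈ q))) })))

    -- If some vertex of `W₁` does separate, the cut shrinks while `a` stays non-separating;
    -- otherwise `not-all-nonsep` applies. The subset `Y` bounds the side, because `W₁` is merely a
    -- predicate and has no size.
    no-nonsep : ∀ {u v W₁ W₂} (c : Cut u v W₁ W₂) {a} → ¬ NonSep c a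
    no-nonsep c ns = go (suc n) c Data.Fin.Subset.⊤ (λ _ → ∈⊤) (s≤s (∣p∣≤n Data.Fin.Subset.⊤)) ns
      where
      go : ∀ k {u v W₁ W₂} (c : Cut u v W₁ W₂) (Y : Subset n) → (∀ {z} → W₁ z → z ∈ Y) → ∣ Y ∣ < k → ∀ {a} → ¬ NonSep c a
      go (suc k) {u} {v} {W₁} {W₂} c Y W₁⊆ (s≤s lt) {a} ns = run (em {∃[ s ] (W₁ s × ¬ NonSep c s)} >>= λ
          { (no none) → fin-choice {P = λ x → W₁ x → NonSep c x} (λ x → each none x) >>= λ all → λ k → k (not-all-nonsep c (λ {x} → all x))
          -- From `a` one of the ends is reached without `s`; if it is `v`, the ends are exchanged.
          ; (yes (s , s∈ , ¬ns)) → attach {a} {s} (proj₁ ns) (λ { refl → ¬ns ns }) >>= λ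
            { (t , inj₁ refl , _ , conn) → comprehension _ >>= λ co → λ k → k (smaller s∈ (shrink c ns s∈ ¬ns (on-side (inj₁ refl) conn) (λ { refl → ¬ns ns }) co))
            ; (t , inj₂ refl , _ , conn) → comprehension _ >>= λ co → λ k → k (smaller s∈ (shrink (swap-ends c) (flip-nonsep c ns) s∈
                (¬ns ∘ flip-nonsep (swap-ends c)) (on-side (inj₂ refl) conn) (λ { refl → ¬ns ns }) co)) } })
        where
        open CutFacts c
        on-side : ∀ {t s p} → End t → ConnV (λ z → (W₁ z ⊎ z ≡ t) × z ≢ s) p t → ConnV (λ z → ¬ W₂ z × z ≢ s) p t
        on-side en = connV-mono λ { (inj₁ q , ne) → disj q , ne ; (inj₂ refl , ne) → end∉₂ en , ne }
        each : ¬ (∃[ s ] (W₁ s × ¬ NonSep c s)) → ∀ x → Cl (W₁ x → NonSep c x)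
        each none x with W₁? x
        ... | no x∉ = pure λ q → ⊥-elim (x∉ q)
        ... | yes x∈ = λ k → none (x , x∈ , λ ns → k λ _ → ns)
        smaller : ∀ {s} → W₁ s → Smaller {W₁} s → ⊥
        smaller s∈ sm = go k (Smaller.cut sm) (Smaller.X sm) (λ q → q)
          (ℕₚ.≤-trans (p⊂q⇒∣p∣<∣q∣ ((λ q → W₁⊆ (Smaller.X⊆ sm q)) , _ , W₁⊆ s∈ , Smaller.s∉ sm)) lt) (Smaller.nonsep sm)

    -- Cycle graphs

    IsCyclicOrder : ∀ k → (Fin (suc k) → V) → Set
    IsCyclicOrder k c = (∀ i j → c i ≡ c j → i ≡ j) × (∀ v → ∃[ i ] c i ≡ v) ×
      (∀ i j → (Adj (c i) (c j) → j ≡ next i ⊎ i ≡ next j) × (j ≡ next i ⊎ i ≡ next j → Adj (c i) (c j)))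

    isCyclicOrder? : ∀ k c → Dec (IsCyclicOrder k c)
    isCyclicOrder? k c =
      Finₚ.all? (λ i → Finₚ.all? λ j → (c i Finₚ.≟ c j) →-dec (i Finₚ.≟ j)) ×-dec
      (Finₚ.all? (λ v → Finₚ.any? λ i → c i Finₚ.≟ v) ×-dec
      Finₚ.all? (λ i → Finₚ.all? λ j → (adj? (c i) (c j) →-dec consecutive? i j) ×-dec (consecutive? i j →-dec adj? (c i) (c j))))
      where
      consecutive? : ∀ i j → Dec (j ≡ next i ⊎ i ≡ next j)
      consecutive? i j = (j Finₚ.≟ next i) ⊎-dec (i Finₚ.≟ next j)

    cyclic-resp : ∀ {k} {c c' : Fin (suc k) → V} → (∀ i → c i ≡ c' i) → IsCyclicOrder k c → IsCyclicOrder k c'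
    cyclic-resp {c = c} {c'} eq (inj , surj , adj) =
      (λ i j e → inj i j (trans (eq i) (trans e (sym (eq j))))) ,
      (λ v → let (i , e) = surj v in i , trans (sym (eq i)) e) ,
      λ i j → (λ a → proj₁ (adj i j) (subst (λ t → Adj t (c j)) (sym (eq i)) (subst (Adj (c' i)) (sym (eq j)) a))) ,
        λ e → subst (λ t → Adj t (c' j)) (eq i) (subst (Adj (c i)) (eq j) (proj₂ (adj i j) e))

    order⇒cycle : ∀ {k} (c : Fin (suc k) → V) → IsCyclicOrder k c → SiIsCycle G
    order⇒cycle {k} c (inj , surj , adj) = k , c , (λ {i} {j} → inj i j) , surj , λ i j → mk⇔ (proj₁ (adj i j)) (proj₂ (adj i j))

    cycle⇒order : (s : SiIsCycle G) → IsCyclicOrder (proj₁ s) (proj₁ (proj₂ s))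
    cycle⇒order (k , c , inj , surj , adj) = (λ i j → inj) , surj , λ i j → to (adj i j) , from (adj i j)

    -- A cyclic order is injective, so its length is at most n and only finitely many sequences,
    -- coded by `funToFin`, have to be searched.
    siIsCycle-stable : Cl (SiIsCycle G) → SiIsCycle G
    siIsCycle-stable cl = result (Finₚ.any? (λ (k : Fin n) → Finₚ.any? λ f → isCyclicOrder? (toℕ k) (decode k f)))
      where
      decode : (k : Fin n) → Fin (n ^ suc (toℕ k)) → Fin (suc (toℕ k)) → V
      decode k f = finToFun f
      Found : Set
      Found = ∃[ k ] ∃[ f ] IsCyclicOrder (toℕ k) (decode k f)
      find : ∀ k' (c : Fin (suc k') → V) → IsCyclicOrder k' c → (k : Fin n) → toℕ k ≡ k' → Found
      find _ c o k refl = k , funToFin c , cyclic-resp (λ i → sym (Finₚ.finToFun-funToFin c i)) o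
      found : SiIsCycle G → Found
      found s@(k , c , inj , _) = find k c (cycle⇒order s) (fromℕ< {k} (Finₚ.injective⇒≤ inj)) (Finₚ.toℕ-fromℕ< _)
      result : Dec Found → SiIsCycle G
      result (yes (k , f , o)) = order⇒cycle (decode k f) o
      result (no ¬f) = ⊥-elim (cl (¬f ∘ found))

    spanning-cycle : ∀ {C p q} → IsCycle G C → p ≢ q → (∀ z → VO C z) → (∀ {p q} → Adj p q → ∃[ g ] (g ∈ C × J g p q)) → SiIsCycle G
    spanning-cycle {C} {p} {q} (k , v , e , vi , ei , je , ce) p≢q all real = order⇒cycle v
        ((λ i j → vi) , surj , λ i j → fwd , bwd)
      where
      surj : ∀ z → ∃[ i ] v i ≡ z
      surj z with all z
      ... | g , g∈ , inc with to (ce g) g∈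
      ...   | i , refl with J-ends (je i) inc
      ...     | inj₁ eq = i , sym eq
      ...     | inj₂ eq = next i , sym eq
      fwd : ∀ {i j} → Adj (v i) (v j) → j ≡ next i ⊎ i ≡ next j
      fwd {i} {j} a with real a
      ... | g , g∈ , jg with to (ce g) g∈
      ...   | l , refl with J-ends (je l) (J-incˡ jg)
      ...     | inj₁ eq with vi eq
      ...       | refl = inj₁ (vi (J-unique jg (je l)))
      fwd {i} {j} a | g , g∈ , jg | l , refl | inj₂ eq with vi eq
      ...       | refl = inj₂ (cong next (vi (sym (J-unique jg (J-sym (je l))))))
      moves : ∀ i → i ≢ next i
      moves i eq = p≢q (trans (sym (proj₂ (surj p))) (trans (cong v (one k i eq _ _)) (proj₂ (surj q))))
        where
        one : ∀ k (i : Fin (suc k)) → i ≡ next i → (x y : Fin (suc k)) → x ≡ y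
        one zero _ _ zero zero = refl
        one (suc k) zero eq x y with trans eq (next-inject₁ {suc k} zero)
        ... | ()
        one (suc k) (suc i) eq x y with trans (sym (prev-next (suc i))) (cong prev (sym eq))
        ... | eq' = ⊥-elim (ℕₚ.m≢1+m+n (toℕ i) (trans (sym (Finₚ.toℕ-inject₁ i)) (trans (cong toℕ (sym eq')) (cong suc (sym (ℕₚ.+-identityʳ _))))))
      next-adj : ∀ i → Adj (v i) (v (next i))
      next-adj i = (λ eq → moves i (vi eq)) , e i , je i
      bwd : ∀ {i j} → j ≡ next i ⊎ i ≡ next j → Adj (v i) (v j)
      bwd {i} (inj₁ refl) = next-adj i
      bwd {j = j} (inj₂ refl) = adj-sym (next-adj j)

    module _ {u v W₁ W₂} (c : Cut u v W₁ W₂) where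
      open CutFacts c

      ends-nonadjacent : ¬ Adj u v
      ends-nonadjacent uv with some₁
      ... | a , a∈ = no-nonsep c (a∈ , connV-adj (u∉₂ , λ { refl → u∉₁ a∈ }) (v∉₂ , λ { refl → v∉₁ a∈ }) uv)

      -- A vertex of the side off the walk would be non-separating.
      covers : ∀ (w : Walk u v) → (∀ {r} → r ∈ᵛ w → ¬ W₂ r) → ∀ {z} → ¬ W₂ z → z ∈ᵛ w
      covers w wv {z} ¬2 with not-2 ¬2
      ... | inj₁ (inj₁ refl) = start∈ w
      ... | inj₁ (inj₂ refl) = end∈ w
      ... | inj₂ z∈ with z ∈ᵛ? w
      ...   | yes q = q
      ...   | no z∉ = ⊥-elim (no-nonsep c (z∈ , w , λ r∈ → wv r∈ , λ { refl → z∉ r∈ }))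

      -- An edge `pq` would be a shortcut around any vertex strictly between `p` and `q`, making
      -- that vertex non-separating.
      consecutive : ∀ {p q} (x : Walk u p) (y : Walk p q) (z : Walk q v) → Simple (x ⊕ (y ⊕ z)) →
        (∀ {r} → r ∈ᵛ x ⊕ (y ⊕ z) → ¬ W₂ r) → Adj p q → ∃[ g ] (g ∈ᵉ y × J g p q)
      consecutive {p} {q} x y z sw wv (p≢q , f , j) = one-edge y p≢q sy inner
        where
        s₁ = simple-⊕⁻ x (y ⊕ z) sw
        s₂ = simple-⊕⁻ y z (proj₁ (proj₂ s₁))
        sy : Simple y
        sy = proj₁ s₂
        inner : ∀ {r} → r ∈ᵛ y → r ≡ p ⊎ r ≡ q
        inner {r} r∈ with r Finₚ.≟ p | r Finₚ.≟ q
        ... | yes e | _ = inj₁ e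
        ... | no _ | yes e = inj₂ e
        ... | no r≢p | no r≢q = ⊥-elim (no-nonsep c (r∈₁ (not-2 (wv (∈ᵛ-⊕ʳ x (y ⊕ z) (∈ᵛ-⊕ˡ y z r∈)))) , x ⊕ cons f j z , around))
          where
          r∉x : ¬ r ∈ᵛ x
          r∉x q∈ = r≢p (proj₂ (proj₂ s₁) q∈ (∈ᵛ-⊕ˡ y z r∈))
          r∉z : ¬ r ∈ᵛ z
          r∉z q∈ = r≢q (proj₂ (proj₂ s₂) r∈ q∈)
          r∈₁ : End r ⊎ W₁ r → W₁ r
          r∈₁ (inj₂ a) = a
          r∈₁ (inj₁ (inj₁ refl)) = ⊥-elim (r∉x (start∈ x))
          r∈₁ (inj₁ (inj₂ refl)) = ⊥-elim (r∉z (end∈ z))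
          around : ∀ {t} → t ∈ᵛ x ⊕ cons f j z → ¬ W₂ t × t ≢ r
          around t∈ with ∈ᵛ-⊕⁻ x (cons f j z) t∈
          ... | inj₁ a = wv (∈ᵛ-⊕ˡ x (y ⊕ z) a) , λ { refl → r∉x a }
          ... | inj₂ (inj₁ refl) = wv (∈ᵛ-⊕ˡ x (y ⊕ z) (end∈ x)) , r≢p ∘ sym
          ... | inj₂ (inj₂ a) = wv (∈ᵛ-⊕ʳ x (y ⊕ z) (∈ᵛ-⊕ʳ y z a)) , λ { refl → r∉z a }

      side-edge : ∀ (w : Walk u v) → Simple w → (∀ {r} → r ∈ᵛ w → ¬ W₂ r) → ∀ {p q} → ¬ W₂ p → ¬ W₂ q → Adj p q →
        ∃[ g ] (g ∈ᵉ w × J g p q)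
      side-edge w sw wv ¬p ¬q pq with split w (covers w wv ¬p)
      ... | mkSplit x y refl with ∈ᵛ-⊕⁻ x y (covers w wv ¬q)
      ...   | inj₂ q∈ with split y q∈
      ...     | mkSplit y₁ y₂ refl with consecutive x y₁ y₂ sw wv pq
      ...       | g , g∈ , j = g , ∈ᵉ-⊕ʳ x _ (∈ᵉ-⊕ˡ y₁ y₂ g∈) , j
      side-edge w sw wv ¬p ¬q pq | mkSplit x y refl | inj₁ q∈ with split x q∈
      ...     | mkSplit x₁ x₂ refl with consecutive x₁ x₂ y (subst Simple (assoc x₁ x₂ y) sw)
                  (λ {r} r∈ → wv (subst (r ∈ᵛ_) (sym (assoc x₁ x₂ y)) r∈)) (adj-sym pq)
        where
        assoc : ∀ {a b c d} (x : Walk a b) (y : Walk b c) (z : Walk c d) → (x ⊕ y) ⊕ z ≡ x ⊕ (y ⊕ z)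
        assoc nil y z = refl
        assoc (cons e j x) y z = cong (cons e j) (assoc x y z)
      ...       | g , g∈ , j = g , ∈ᵉ-⊕ˡ (x₁ ⊕ x₂) y (∈ᵉ-⊕ʳ x₁ x₂ g∈) , J-sym j

    cut⇒cycle : ∀ {u v W₁ W₂} → Cut u v W₁ W₂ → Cl (SiIsCycle G)
    cut⇒cycle {u} {v} {W₁} {W₂} c = do
        (w , wv) ← link-sides c
        (w' , wv') ← link-sides c'
        pure (build w wv w' wv')
      where
      open CutFacts c
      c' = swap-sides c
      build : (w : Walk u v) → (∀ {r} → r ∈ᵛ w → ¬ W₂ r) → (w' : Walk u v) → (∀ {r} → r ∈ᵛ w' → ¬ W₁ r) → SiIsCycle G
      build w wv w' wv' with simplify w | simplify w'
      ... | x , sx , xw , _ | y , sy , yw , _ = spanning-cycle (two-walks-cycle {C = C} x y u≢v sx sy meet dis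
              (λ g∈ → ⊎-map (∈es⁻ x) (∈es⁻ y) (x∈p∪q⁻ (es x) (es y) g∈)) (λ q → x∈p∪q⁺ (⊎-map (∈es⁺ x) (∈es⁺ y) q))) u≢v all real
        where
        C = es x ∪ es y
        xv : ∀ {r} → r ∈ᵛ x → ¬ W₂ r
        xv q = wv (xw q)
        yv : ∀ {r} → r ∈ᵛ y → ¬ W₁ r
        yv q = wv' (yw q)
        meet : ∀ {p} → p ∈ᵛ x → p ∈ᵛ y → p ≡ u ⊎ p ≡ v
        meet a b with not-2 (xv a)
        ... | inj₁ en = en
        ... | inj₂ q = ⊥-elim (yv b q)
        dis : ∀ {g} → g ∈ᵉ x → g ∈ᵉ y → ⊥
        dis {g} a b with ∈ᵉ-joins x sx a
        ... | r , s , j , r∈ , s∈ , r≢s = ends (meet r∈ (∈ᵉ-ends y b (J-incˡ j))) (meet s∈ (∈ᵉ-ends y b (J-incʳ j)))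
          where
          ends : r ≡ u ⊎ r ≡ v → s ≡ u ⊎ s ≡ v → ⊥
          ends (inj₁ refl) (inj₁ refl) = r≢s refl
          ends (inj₂ refl) (inj₂ refl) = r≢s refl
          ends (inj₁ refl) (inj₂ refl) = ends-nonadjacent c (r≢s , g , j)
          ends (inj₂ refl) (inj₁ refl) = ends-nonadjacent c (r≢s ∘ sym , g , J-sym j)
        all : ∀ z → VO C z
        all z with W₁? z
        ... | yes z∈ = let (g , g∈ , i) = vertex-edge x u≢v (covers c x xv (disj z∈)) in g , x∈p∪q⁺ (inj₁ (∈es⁺ x g∈)) , i
        ... | no z∉ = let (g , g∈ , i) = vertex-edge y u≢v (covers c' y yv z∉) in g , x∈p∪q⁺ (inj₂ (∈es⁺ y g∈)) , i
        real : ∀ {p q} → Adj p q → ∃[ g ] (g ∈ C × J g p q)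
        real {p} {q} pq with W₁? p | W₁? q
        ... | no ¬p | no ¬q = let (g , g∈ , j) = side-edge c' y sy yv ¬p ¬q pq in g , x∈p∪q⁺ (inj₂ (∈es⁺ y g∈)) , j
        ... | yes p∈ | _ = let (g , g∈ , j) = side-edge c x sx xv (disj p∈) (adj-1 p∈ pq) pq in g , x∈p∪q⁺ (inj₁ (∈es⁺ x g∈)) , j
        ... | no _ | yes q∈ = let (g , g∈ , j) = side-edge c x sx xv (adj-1 q∈ (adj-sym pq)) (disj q∈) pq in g , x∈p∪q⁺ (inj₁ (∈es⁺ x g∈)) , j

    disconnecting⇒cut : ∀ {a b p q} → a ≢ b → Off a b p → Off a b q → ¬ ConnV (Off a b) p q →
      Cl (Σ (Subset n) λ W → Cut a b (_∈ W) (λ z → z ≢ a × z ≢ b × z ∉ W))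
    disconnecting⇒cut {a} {b} {p} {q} a≢b offp offq ¬conn = do
        co ← comprehension (ConnV (Off a b) p)
        pure (build co)
      where
      build : Comprehension (ConnV (Off a b) p) → Σ (Subset n) λ W → Cut a b (_∈ W) (λ z → z ≢ a × z ≢ b × z ∉ W)
      build ⟦ W , out , into ⟧ = W , record
        { u≢v = a≢b ; part = λ z → part (z Finₚ.≟ a) (z Finₚ.≟ b) (z ∈? W) ; disj = λ x y → proj₂ (proj₂ y) x
        ; u∉₁ = λ x → proj₁ (off x) refl ; u∉₂ = λ x → proj₁ x refl
        ; v∉₁ = λ x → proj₂ (off x) refl ; v∉₂ = λ x → proj₁ (proj₂ x) refl
        ; apart = λ x (y≢a , y≢b , y∉) xy → y∉ (into (connV-trans (out x) (connV-adj (off x) (y≢a , y≢b) xy)))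
        ; some₁ = p , into (connV-refl offp) ; some₂ = q , proj₁ offq , proj₂ offq , ¬conn ∘ out }
        where
        off : ∀ {z} → z ∈ W → Off a b z
        off z∈ = let (w , wv) = out z∈ in wv (end∈ w)
        part : ∀ {z} → Dec (z ≡ a) → Dec (z ≡ b) → Dec (z ∈ W) → z ≡ a ⊎ z ≡ b ⊎ z ∈ W ⊎ (z ≢ a × z ≢ b × z ∉ W)
        part (yes e) _ _ = inj₁ e
        part (no _) (yes e) _ = inj₂ (inj₁ e)
        part (no _) (no _) (yes e) = inj₂ (inj₂ (inj₁ e))
        part (no x) (no y) (no z) = inj₂ (inj₂ (inj₂ (x , y , z)))

    Disconnecting : Set
    Disconnecting = ∃[ a ] ∃[ b ] ∃[ p ] ∃[ q ] (a ≢ b × Off a b p × Off a b q × ¬ ConnV (Off a b) p q)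

    no-disconnecting : ¬ Disconnecting → ∀ {a b} → Conn₂ a b
    no-disconnecting none {a} {b} {p} {q} offp offq with a Finₚ.≟ b
    ... | no a≢b = λ ¬conn → none (a , b , p , q , a≢b , offp , offq , ¬conn)
    ... | yes refl = conn₁ (proj₁ offp) (proj₁ offq) >>= λ cn → pure (connV-mono (λ x → x , x) cn)

    -- Forbidden configurations of non-edges

    NonEdge : V → V → Set
    NonEdge p q = p ≢ q × ¬ Adj p q

    -- Pairwise intersecting edges form a star or a triangle. So without these three patterns the
    -- non-edges form a path of length at most two.
    Disjoint₂ Triangle₂ Claw₂ : Set
    Disjoint₂ = ∃[ p ] ∃[ q ] ∃[ r ] ∃[ s ] (NonEdge p q × NonEdge r s × p ≢ r × p ≢ s × q ≢ r × q ≢ s)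
    Triangle₂ = ∃[ p ] ∃[ q ] ∃[ r ] (NonEdge p q × NonEdge p r × NonEdge q r)
    Claw₂ = ∃[ b ] ∃[ p ] ∃[ q ] ∃[ r ] (NonEdge b p × NonEdge b q × NonEdge b r × p ≢ q × p ≢ r × q ≢ r)

    module Impossible (conn₂ : ∀ {a b} → Conn₂ a b) where
      open NoCut conn₂

      with-min : ∀ {p q} → NonEdge p q → (∀ mc → Minimal.size mc ≤ 3 → ⊥) → ⊥
      with-min (ne , ¬a) small = run do
        mc ← min-cycle {λ _ → ⊤} (λ bal → unb ne ¬a (balV-mono (λ _ → tt) bal))
        λ k → k ([ small mc , (λ 4≤ → WithMinimal.Large.large-impossible mc 4≤) ]′ (ℕₚ.≤-<-connex (Minimal.size mc) 3))

      no-disjoint : ¬ Disjoint₂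
      no-disjoint (p , q , r , s , pq , rs , a , b , c , d) = with-min pq λ mc ≤3 →
        SmallCycle.no-disjoint mc ≤3 (proj₁ pq) (proj₁ rs) a b c d (proj₂ pq) (proj₂ rs)

      no-triangle : ¬ Triangle₂
      no-triangle (p , q , r , pq , pr , qr) = with-min pq λ mc ≤3 →
        SmallCycle.no-triangle mc ≤3 (proj₁ pq) (proj₁ pr) (proj₁ qr) (proj₂ pq) (proj₂ pr) (proj₂ qr)

      no-claw : ¬ Claw₂
      no-claw (b , p , q , r , bp , bq , br , x , y , z) = with-min bp λ mc ≤3 →
        SmallCycle.Claw.no-claw mc ≤3 (proj₁ bp) (proj₁ bq) (proj₁ br) x y z (proj₂ bp) (proj₂ bq) (proj₂ br)

    -- Lifted-graphic matroids

    next-closed : ∀ {k} (P : Fin (suc k) → Set) {i} → P i → (∀ i → P i → P (next i)) → ∀ j → P j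
    next-closed {k} P {i} p step = <-weakInduction P
      (subst P (next-fromℕ k) (step _ (<-weakInduction-startingFrom P p up {fromℕ k} (subst (toℕ i ≤_) (sym (Finₚ.toℕ-fromℕ k)) (ℕₚ.≤-pred (Finₚ.toℕ<n i))))))
      up
      where
      up : ∀ j → P (inject₁ j) → P (suc j)
      up j q = subst P (next-inject₁ j) (step _ q)

    order-next : ∀ {k} {c : Fin (suc k) → V} → IsCyclicOrder k c → IsCyclicOrder k (c ∘ next)
    order-next {c = c} (inj , surj , adj) =
      (λ i j e → next-injective (inj _ _ e)) ,
      (λ v → let (i , e) = surj v in prev i , trans (cong c (next-prev i)) e) ,
      λ i j → (λ a → ⊎-map next-injective next-injective (proj₁ (adj _ _) a)) , λ e → proj₂ (adj _ _) (⊎-map (cong next) (cong next) e)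

    order-from : ∀ {k} (c : Fin (suc k) → V) → IsCyclicOrder k c → ∀ i →
      Σ (Fin (suc k) → V) λ c' → IsCyclicOrder k c' × c' zero ≡ c i × c' (next zero) ≡ c (next i)
    order-from {k} c o i = go (toℕ i) c o i refl
      where
      go : ∀ t (c : Fin (suc k) → V) → IsCyclicOrder k c → ∀ i → toℕ i ≡ t →
        Σ (Fin (suc k) → V) λ c' → IsCyclicOrder k c' × c' zero ≡ c i × c' (next zero) ≡ c (next i)
      go zero c o zero _ = c , o , refl , refl
      go (suc t) c o (suc i) eq with go t (c ∘ next) (order-next o) (inject₁ i) (trans (Finₚ.toℕ-inject₁ i) (ℕₚ.suc-injective eq))
      ... | c' , o' , e₀ , e₁ = c' , o' , trans e₀ (cong c (next-inject₁ i)) , trans e₁ (cong (c ∘ next) (next-inject₁ i))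

    -- Going round, there is a vertex of `C` whose successor is not in `C`. Both neighbours of that
    -- vertex on `C` must then be its predecessor, so `C` is a loop or a 2-cycle.
    short-cycle : ∀ {k} {c : Fin (suc k) → V} → IsCyclicOrder k c → ∀ {C z} → IsCycle G C → ¬ VO C z →
      ∃[ i ] (∀ {p} → VO C p → p ≡ c i ⊎ p ≡ c (next i))
    short-cycle {k} {c} (inj , surj , adj) {C} {z} cyc z∉ with Finₚ.any? (λ i → vo? C (c i) ×-dec ¬? (vo? C (c (next i))))
    ... | no none = ⊥-elim (z∉ (subst (VO C) (proj₂ (surj z)) (next-closed (λ i → VO C (c i)) {proj₁ (surj p)} (subst (VO C) (sym (proj₂ (surj p))) p∈)
            (λ i q → decidable-stable (vo? C (c (next i))) λ ¬q → none (i , q , ¬q)) (proj₁ (surj z)))))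
      where
      g = proj₁ (isCycle-nonempty cyc)
      p = proj₁ (G g)
      p∈ : VO C p
      p∈ = g , proj₂ (isCycle-nonempty cyc) , inj₁ refl
    ... | yes (i , i∈ , i∉) = prev i , λ {p} p∈ → shape (local-shape cyc i∈) p∈
      where
      before : ∀ {y} → VO C y → Adj (c i) y → y ≡ c (prev i)
      before {y} y∈ a with surj y
      ... | j , refl with proj₁ (adj i j) a
      ...   | inj₁ refl = ⊥-elim (i∉ y∈)
      ...   | inj₂ refl = cong c (sym (prev-next j))
      here' : ∀ {p} → p ≡ c i → p ≡ c (next (prev i))
      here' e = trans e (cong c (sym (next-prev i)))
      shape : LocalShape C (c i) → ∀ {p} → VO C p → p ≡ c (prev i) ⊎ p ≡ c (next (prev i))
      shape (loop only) p∈ = inj₂ (here' (only p∈))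
      shape (digon y e ne e∈ j only) p∈ with only p∈
      ... | inj₁ q = inj₂ (here' q)
      ... | inj₂ refl = inj₁ (before p∈ (ne , e , j))
      shape (bend y y' e e' n₁ n₂ n₃ e∈ j e'∈ j') p∈ =
        ⊥-elim (n₃ (trans (before (e , e∈ , J-incʳ j) (n₁ , e , j)) (sym (before (e' , e'∈ , J-incʳ j') (n₂ , e' , j')))))

    -- C₁ lives on the first two vertices; the third vertex and the last one separate it from the
    -- remaining arc, which contains another cycle of F.
    module Arc {k : ℕ} {c : Fin (suc (suc (suc (suc (suc (suc (suc k))))))) → V} (o : IsCyclicOrder _ c)
      {C₁ : Subset m} (f₁ : F C₁) (C₁⊆ : ∀ {p} → VO C₁ p → p ≡ c zero ⊎ p ≡ c (suc zero)) where

      private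
        N : ℕ
        N = suc (suc (suc (suc (suc (suc k)))))
        I : Set
        I = Fin (suc N)
        pattern i₀ = zero
        pattern i₁ = suc zero
        pattern i₂ = suc (suc zero)
        pattern i₃ = suc (suc (suc zero))
        pattern i₄ = suc (suc (suc (suc zero)))
        pattern i₅ = suc (suc (suc (suc (suc zero))))

        end : I
        end = fromℕ N

        inj : ∀ {i j} → c i ≡ c j → i ≡ j
        inj {i} {j} = proj₁ o i j

        adj⁻ : ∀ {i j} → Adj (c i) (c j) → j ≡ next i ⊎ i ≡ next j
        adj⁻ {i} {j} = proj₁ (proj₂ (proj₂ o) i j)

        adj-next : ∀ {i j} → j ≡ next i → Adj (c i) (c j)
        adj-next {i} {j} e = proj₂ (proj₂ (proj₂ o) i j) (inj₁ e)

        neighbours : ∀ {i j} → Adj (c i) (c j) → j ≡ next i ⊎ j ≡ prev i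
        neighbours a = ⊎-map (λ q → q) (λ { refl → sym (prev-next _) }) (adj⁻ a)

        step : ∀ (i : Fin N) → next (inject₁ i) ≡ suc i
        step = next-inject₁

        u v : V
        u = c end
        v = c i₂

        u≢v : u ≢ v
        u≢v e with inj {end} {i₂} e
        ... | ()

        ¬uv : ¬ Adj u v
        ¬uv a = [ first-end , last-end ]′ (neighbours {end} {i₂} a)
          where
          first-end : i₂ ≢ next end
          first-end e with trans e (next-fromℕ N)
          ... | ()
          last-end : i₂ ≢ prev end
          last-end e with trans (sym (step (suc (suc zero)))) (trans (cong next e) (next-prev end))
          ... | ()

      open NonAdjacent u≢v ¬uv renaming (Off to Offᵤ) using (EH; all-F; NoL)

      private
        off : ∀ {i} → i ≢ end → i ≢ i₂ → Offᵤ (c i)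
        off a b = (λ e → a (inj e)) , λ e → b (inj e)

        off₀ : Offᵤ (c i₀)
        off₀ = off (λ ()) (λ ())
        off₁ : Offᵤ (c i₁)
        off₁ = off (λ ()) (λ ())

        Range : I → Set
        Range i = 3 ≤ toℕ i × toℕ i < N

        off-range : ∀ {i} → Range i → Offᵤ (c i)
        off-range (a , b) = off (λ { refl → ℕₚ.<-irrefl (Finₚ.toℕ-fromℕ N) b }) (λ { refl → ℕₚ.<⇒≱ (s≤s (s≤s (s≤s z≤n))) a })

        range₃ : Range i₃
        range₃ = s≤s (s≤s (s≤s z≤n)) , s≤s (s≤s (s≤s (s≤s z≤n)))
        range₄ : Range i₄
        range₄ = s≤s (s≤s (s≤s z≤n)) , s≤s (s≤s (s≤s (s≤s (s≤s z≤n))))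
        range₅ : Range i₅
        range₅ = s≤s (s≤s (s≤s z≤n)) , s≤s (s≤s (s≤s (s≤s (s≤s (s≤s z≤n)))))

        arc : ∀ i → Range i → ConnV Offᵤ (c i₃) (c i)
        arc = <-weakInduction (λ i → Range i → ConnV Offᵤ (c i₃) (c i)) (λ { (() , _) }) up
          where
          up : ∀ (i : Fin N) → (Range (inject₁ i) → ConnV Offᵤ (c i₃) (c (inject₁ i))) → Range (suc i) → ConnV Offᵤ (c i₃) (c (suc i))
          up zero ih (s≤s () , _)
          up (suc zero) ih (s≤s (s≤s ()) , _)
          up (suc (suc zero)) ih r = connV-refl (off-range r)
          up i@(suc (suc (suc _))) ih r@(_ , lt) = connV-trans (ih r') (connV-adj (off-range r') (off-range r) (adj-next (sym (step i))))
            where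
            r' : Range (inject₁ i)
            r' = s≤s (s≤s (s≤s z≤n)) , subst (_< N) (sym (Finₚ.toℕ-inject₁ i)) (ℕₚ.<-trans (ℕₚ.n<1+n _) lt)

        where-is : ∀ i → Offᵤ (c i) → (i ≡ i₀ ⊎ i ≡ i₁) ⊎ Range i
        where-is i₀ _ = inj₁ (inj₁ refl)
        where-is i₁ _ = inj₁ (inj₂ refl)
        where-is i₂ o = ⊥-elim (proj₂ o refl)
        where-is i@(suc (suc (suc _))) o = inj₂ (s≤s (s≤s (s≤s z≤n)) , ℕₚ.≤∧≢⇒< (ℕₚ.≤-pred (Finₚ.toℕ<n i))
          λ e → proj₁ o (cong c (Finₚ.toℕ-injective (trans e (sym (Finₚ.toℕ-fromℕ N))))))

        First : VSet
        First p = p ≡ c i₀ ⊎ p ≡ c i₁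

        first-closed : ∀ {p q} → Connects EH p q → First p → First q
        first-closed (w , a) = go w a
          where
          onward : ∀ {i j} → First (c i) → Offᵤ (c j) → Adj (c i) (c j) → First (c j)
          onward {i} {j} (inj₁ e) oj a with inj e
          ... | refl with neighbours a
          ...   | inj₁ q = inj₂ (cong c (trans q (step zero)))
          ...   | inj₂ q = ⊥-elim (proj₁ oj (cong c q))
          onward {i} {j} (inj₂ e) oj a with inj e
          ... | refl with neighbours a
          ...   | inj₁ q = ⊥-elim (proj₂ oj (cong c (trans q (step (suc zero)))))
          ...   | inj₂ q = inj₁ (cong c q)
          go : ∀ {p q} (w : Walk p q) → (∀ {g} → g ∈ᵉ w → EH g) → First p → First q
          go nil a fp = fp
          go (cons {p} {y} e j w) a fp with p Finₚ.≟ y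
          ... | yes refl = go w (a ∘ inj₂) fp
          ... | no ne with proj₁ (proj₂ o) p | proj₁ (proj₂ o) y
          ...   | ip , refl | iy , refl = go w (a ∘ inj₂) (onward fp (inV-end (a (inj₁ refl)) (J-incʳ j)) (ne , e , j))

        range-not-first : ∀ {i} → Range i → ¬ First (c i)
        range-not-first (a , _) (inj₁ e) with inj e
        range-not-first (() , _) (inj₁ e) | refl
        range-not-first (a , _) (inj₂ e) with inj e
        range-not-first (s≤s () , _) (inj₂ e) | refl

        record Second : Set where
          field
            K : Subset m
            cyc : IsCycle G K
            ¬b : ¬ B K
            inR : ∀ {p} → VO K p → ∃[ i ] (p ≡ c i × Range i)

        -- Index 4 has only the neighbours 3 and 5, and with at least seven vertices all three lie
        -- strictly between the two deleted ones. If every pair formed with a neighbour were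
        -- balanced, there would be a third neighbour.
        second : Cl Second
        second k = none λ {r} a → balV-stable λ ¬bal → ¬bal λ {K} cyc sub → decidable-stable (balanced? cyc) λ ¬b →
            k record { K = K ; cyc = cyc ; ¬b = ¬b ; inR = λ { (g , g∈ , i) → place a (inV-end (sub g∈) i) } }
          where
          near : ∀ {j} → Adj (c i₄) (c j) → j ≡ i₃ ⊎ j ≡ i₅
          near a with neighbours a
          ... | inj₁ e = inj₂ (trans e (step (suc (suc (suc (suc zero))))))
          ... | inj₂ e = inj₁ e
          place : ∀ {r p} → Adj (c i₄) r → p ≡ c i₄ ⊎ p ≡ r → ∃[ i ] (p ≡ c i × Range i)
          place a (inj₁ e) = i₄ , e , range₄
          place {r} a (inj₂ refl) with proj₁ (proj₂ o) r
          ... | j , refl with near a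
          ...   | inj₁ refl = i₃ , refl , range₃
          ...   | inj₂ refl = i₅ , refl , range₅
          none : ¬ (∀ {r} → Adj (c i₄) r → BalV (λ z → z ≡ c i₄ ⊎ z ≡ r))
          none all with neighbour-of {c i₄} {c i₃} {c i₅} all
          ... | r , a , r≢₃ , r≢₅ with proj₁ (proj₂ o) r
          ...   | j , refl with near a
          ...     | inj₁ refl = r≢₃ refl
          ...     | inj₂ refl = r≢₅ refl

        vertex-first : ∃[ q ] (VO C₁ q × First q)
        vertex-first with isCycle-nonempty (F-cycle f₁)
        ... | g , g∈ = proj₁ (G g) , (g , g∈ , inj₁ refl) , C₁⊆ (g , g∈ , inj₁ refl)

        first-conn : ∀ {p q} → First p → First q → ConnV Offᵤ p q
        first-conn (inj₁ refl) (inj₁ refl) = connV-refl off₀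
        first-conn (inj₂ refl) (inj₂ refl) = connV-refl off₁
        first-conn (inj₁ refl) (inj₂ refl) = connV-adj off₀ off₁ (adj-next (sym (step zero)))
        first-conn (inj₂ refl) (inj₁ refl) = connV-sym (connV-adj off₀ off₁ (adj-next (sym (step zero))))

        first-off : ∀ {p} → First p → Offᵤ p
        first-off (inj₁ refl) = off₀
        first-off (inj₂ refl) = off₁

      arc-impossible : ⊥
      arc-impossible = run (second >>= λ s k → k (go s))
        where
        go : Second → ⊥
        go s = all-F (λ {p} offp → pure (spread offp)) noL
          where
          open Second s
          in-off : ∀ {p} → VO K p → Offᵤ p
          in-off p∈ with inR p∈
          ... | i , refl , r = off-range r
          -- A cycle of L avoiding the two deleted vertices meets `C₁`. If `K` is in F it meets `K`
          -- too, although the two arcs are not connected; and if `K` is in L it would have to meet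
          -- `C₁` itself.
          noL : NoL
          noL {D} l sub with LF-meet _ _ l f₁
          ... | x , x∈ , x∈₁ with cover K cyc
          ...   | inj₁ b = ¬b b
          ...   | inj₂ (inj₁ lK) with LF-meet _ _ lK f₁
          ...     | y , y∈ , y∈₁ with inR y∈
          ...       | i , refl , r = range-not-first r (C₁⊆ y∈₁)
          noL {D} l sub | x , x∈ , x∈₁ | inj₂ (inj₂ fK) with LF-meet _ _ l fK
          ...     | y , y∈ , y∈K with inR y∈K
          ...       | i , refl , r = range-not-first r (first-closed (connects-mono sub (cycle-connects (L-cycle l) x∈ y∈)) (C₁⊆ x∈₁))
          spread : ∀ {p} → Offᵤ p → ∃[ C ] ∃[ q ] (IsCycle G C × ¬ B C × (∀ {g} → g ∈ C → EH g) × VO C q × Connects EH p q)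
          spread {p} offp with proj₁ (proj₂ o) p
          ... | i , refl with where-is i offp
          ...   | inj₁ fi = let (q , q∈ , fq) = vertex-first in
                  C₁ , q , F-cycle f₁ , F⇒¬B f₁ , (λ g∈ → cycle-inV (λ x → first-off (C₁⊆ x)) g∈) , q∈ ,
                  connV-edges (first-conn (⊎-map (cong c) (cong c) fi) fq)
          ...   | inj₂ r with isCycle-nonempty cyc
          ...     | g , g∈ with inR (g , g∈ , inj₁ refl)
          ...       | j , eq , rj = K , proj₁ (G g) , cyc , ¬b , (λ h∈ → cycle-inV in-off h∈) , (g , g∈ , inj₁ refl) ,
                      connV-edges (connV-trans (connV-sym (arc i r)) (subst (ConnV Offᵤ (c i₃)) (sym eq) (arc j rj)))

    no-disjoint-F : SiIsCycle G → ∀ {C₁ C₂} → F C₁ → F C₂ → ¬ VertexDisjoint G C₁ C₂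
    no-disjoint-F s@(k , c , _) {C₁} {C₂} f₁ f₂ d = from-order k c (cycle⇒order s)
      where
      from-order : ∀ k (c : Fin (suc k) → V) → IsCyclicOrder k c → ⊥
      from-order k c o with isCycle-nonempty (F-cycle f₂)
      ... | g , g∈ with short-cycle o (F-cycle f₁) (λ z∈ → d (proj₁ (G g)) z∈ (g , g∈ , inj₁ refl))
      ...   | i , C₁⊆ with order-from c o i
      ...     | c' , o' , e₀ , e₁ = large k c' o' big (λ p∈ → ⊎-map (λ e → trans e (sym e₀)) (λ e → trans e (sym e₁)) (C₁⊆ p∈))
        where
        big : 6 < suc k
        big = ℕₚ.≤-trans 6<n (Finₚ.injective⇒≤ {f = λ z → proj₁ (proj₁ (proj₂ o) z)}
          λ {x} {y} e → trans (sym (proj₂ (proj₁ (proj₂ o) x))) (trans (cong c e) (proj₂ (proj₁ (proj₂ o) y))))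
        large : ∀ k (c : Fin (suc k) → V) → IsCyclicOrder k c → 6 < suc k → (∀ {p} → VO C₁ p → p ≡ c zero ⊎ p ≡ c (next zero)) → ⊥
        large k c o (s≤s 6≤k) sub with ℕₚ.m≤n⇒∃[o]m+o≡n 6≤k
        ... | k' , refl = Arc.arc-impossible o f₁ (λ p∈ → ⊎-map (λ q → q) (λ e → trans e (cong c (next-inject₁ zero))) (sub p∈))

    -- The identity is an isomorphism. The two circuit systems differ only in pairs of disjoint
    -- unbalanced cycles: two of F do not occur, and one of each kind would meet.
    lifted : SiIsCycle G → LiftedGraphic Circ
    lifted s = n , m , G , B , record { B-cycles = λ X b → B-cycle b ; theta = IsQuasiBiased.theta quasiBiased } ,
        ↔-id E , λ D → mk⇔ (λ x → subst Circ (sym (tabulate∘lookup D)) (into x)) (λ x → out (subst Circ (tabulate∘lookup D) x))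
      where
      unbalanced : ∀ {C} → IsCycle G C → ¬ B C → L C ⊎ F C
      unbalanced cyc ¬b with cover _ cyc
      ... | inj₁ b = ⊥-elim (¬b b)
      ... | inj₂ q = q
      both-L : ∀ {C₁ C₂} → VertexDisjoint G C₁ C₂ → L C₁ ⊎ F C₁ → L C₂ ⊎ F C₂ → L C₁ × L C₂
      both-L d (inj₁ l₁) (inj₁ l₂) = l₁ , l₂
      both-L d (inj₁ l₁) (inj₂ f₂) = let (z , a , b) = LF-meet _ _ l₁ f₂ in ⊥-elim (d z a b)
      both-L d (inj₂ f₁) (inj₁ l₂) = let (z , a , b) = LF-meet _ _ l₂ f₁ in ⊥-elim (d z b a)
      both-L d (inj₂ f₁) (inj₂ f₂) = ⊥-elim (no-disjoint-F s f₁ f₂ d)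
      into : ∀ {D} → LiftCircuit G B D → Circ D
      into (inj₁ b) = inj₁ b
      into (inj₂ (inj₁ t)) = inj₂ (inj₁ t)
      into (inj₂ (inj₂ (inj₁ t))) = inj₂ (inj₂ (inj₁ t))
      into (inj₂ (inj₂ (inj₂ (inj₁ (C₁ , C₂ , (c₁ , ¬b₁) , (c₂ , ¬b₂) , d , eq))))) =
        let (l₁ , l₂) = both-L d (unbalanced c₁ ¬b₁) (unbalanced c₂ ¬b₂) in inj₂ (inj₂ (inj₂ (inj₁ (C₁ , C₂ , l₁ , l₂ , d , eq))))
      out : ∀ {D} → Circ D → LiftCircuit G B D
      out (inj₁ b) = inj₁ b
      out (inj₂ (inj₁ t)) = inj₂ (inj₁ t)
      out (inj₂ (inj₂ (inj₁ t))) = inj₂ (inj₂ (inj₁ t))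
      out (inj₂ (inj₂ (inj₂ (inj₁ (C₁ , C₂ , l₁ , l₂ , d , eq))))) =
        inj₂ (inj₂ (inj₂ (inj₁ (C₁ , C₂ , (L-cycle l₁ , L⇒¬B l₁) , (L-cycle l₂ , L⇒¬B l₂) , d , eq))))
      out (inj₂ (inj₂ (inj₂ (inj₂ (_ , _ , _ , _ , _ , _ , f₁ , f₂ , d , _))))) = ⊥-elim (no-disjoint-F s f₁ f₂ d)

    -- From few non-edges to the conclusion

    nonEdge? : ∀ p q → Dec (NonEdge p q)
    nonEdge? p q = ¬? (p Finₚ.≟ q) ×-dec ¬? (adj? p q)

    nonEdge-sym : ∀ {p q} → NonEdge p q → NonEdge q p
    nonEdge-sym (ne , ¬a) = ne ∘ sym , ¬a ∘ adj-sym

    module _ (¬disj : ¬ Disjoint₂) (¬tri : ¬ Triangle₂) (¬claw : ¬ Claw₂) where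

      private
        adjacent : ∀ {p q} → p ≢ q → ¬ NonEdge p q → Adj p q
        adjacent {p} {q} ne ¬n = decidable-stable (adj? p q) λ ¬a → ¬n (ne , ¬a)

        two-missing : ∀ {a b c} → NonEdge a b → NonEdge b c → a ≢ c → SiCompleteMinusShortPath G
        two-missing {a} {b} {c} ab bc a≢c = 2 , ℕₚ.≤-refl , p , p-inj , λ x y → mk⇔ (λ xy → proj₁ xy , λ { (i , e) → onto xy i e }) back
          where
          p : Fin 3 → V
          p zero = a
          p (suc zero) = b
          p (suc (suc zero)) = c
          p-inj : ∀ {i j} → p i ≡ p j → i ≡ j
          p-inj {zero} {zero} _ = refl
          p-inj {zero} {suc zero} e = ⊥-elim (proj₁ ab e)
          p-inj {zero} {suc (suc zero)} e = ⊥-elim (a≢c e)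
          p-inj {suc zero} {zero} e = ⊥-elim (proj₁ ab (sym e))
          p-inj {suc zero} {suc zero} _ = refl
          p-inj {suc zero} {suc (suc zero)} e = ⊥-elim (proj₁ bc e)
          p-inj {suc (suc zero)} {zero} e = ⊥-elim (a≢c (sym e))
          p-inj {suc (suc zero)} {suc zero} e = ⊥-elim (proj₁ bc (sym e))
          p-inj {suc (suc zero)} {suc (suc zero)} _ = refl
          onto : ∀ {x y} → Adj x y → (i : Fin 2) → ¬ PairEq x y (p (inject₁ i)) (p (suc i))
          onto xy zero (inj₁ (refl , refl)) = proj₂ ab xy
          onto xy zero (inj₂ (refl , refl)) = proj₂ ab (adj-sym xy)
          onto xy (suc zero) (inj₁ (refl , refl)) = proj₂ bc xy
          onto xy (suc zero) (inj₂ (refl , refl)) = proj₂ bc (adj-sym xy)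
          at-b : ∀ {y} → NonEdge b y → y ≡ a ⊎ y ≡ c
          at-b {y} by with y Finₚ.≟ a | y Finₚ.≟ c
          ... | yes e | _ = inj₁ e
          ... | no _ | yes e = inj₂ e
          ... | no y≢a | no y≢c = ⊥-elim (¬claw (b , a , c , y , nonEdge-sym ab , bc , by , a≢c , y≢a ∘ sym , y≢c ∘ sym))
          missing : ∀ {x y} → NonEdge x y → ∃[ i ] PairEq x y (p (inject₁ i)) (p (suc i))
          missing {x} {y} xy with x Finₚ.≟ b | y Finₚ.≟ b
          ... | yes refl | _ = [ (λ e → zero , inj₂ (refl , e)) , (λ e → suc zero , inj₁ (refl , e)) ]′ (at-b xy)
          ... | no _ | yes refl = [ (λ e → zero , inj₁ (e , refl)) , (λ e → suc zero , inj₂ (e , refl)) ]′ (at-b (nonEdge-sym xy))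
          ... | no x≢b | no y≢b with x Finₚ.≟ a | y Finₚ.≟ a
          ...   | no x≢a | no y≢a = ⊥-elim (¬disj (x , y , a , b , xy , ab , x≢a , x≢b , y≢a , y≢b))
          ...   | yes refl | _ with y Finₚ.≟ c
          ...     | yes refl = ⊥-elim (¬tri (a , b , c , ab , xy , bc))
          ...     | no y≢c = ⊥-elim (¬disj (a , y , b , c , xy , bc , x≢b , a≢c , y≢b , y≢c))
          missing {x} {y} xy | no x≢b | no y≢b | no x≢a | yes refl with x Finₚ.≟ c
          ...     | yes refl = ⊥-elim (¬tri (a , b , c , ab , nonEdge-sym xy , bc))
          ...     | no x≢c = ⊥-elim (¬disj (x , a , b , c , xy , bc , x≢b , x≢c , y≢b , a≢c))
          back : ∀ {x y} → x ≢ y × ¬ (∃[ i ] PairEq x y (p (inject₁ i)) (p (suc i))) → Adj x y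
          back (ne , ¬m) = adjacent ne (¬m ∘ missing)

        one-missing : ∀ {a b} → NonEdge a b → ¬ (∃[ c ] (c ≢ a × c ≢ b × (NonEdge a c ⊎ NonEdge b c))) → SiCompleteMinusShortPath G
        one-missing {a} {b} ab none = 1 , s≤s z≤n , p , p-inj , λ x y → mk⇔ (λ xy → proj₁ xy , λ { (zero , e) → onto xy e }) back
          where
          p : Fin 2 → V
          p zero = a
          p (suc zero) = b
          p-inj : ∀ {i j} → p i ≡ p j → i ≡ j
          p-inj {zero} {zero} _ = refl
          p-inj {zero} {suc zero} e = ⊥-elim (proj₁ ab e)
          p-inj {suc zero} {zero} e = ⊥-elim (proj₁ ab (sym e))
          p-inj {suc zero} {suc zero} _ = refl
          onto : ∀ {x y} → Adj x y → ¬ PairEq x y a b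
          onto xy (inj₁ (refl , refl)) = proj₂ ab xy
          onto xy (inj₂ (refl , refl)) = proj₂ ab (adj-sym xy)
          missing : ∀ {x y} → NonEdge x y → PairEq x y a b
          missing {x} {y} xy with x Finₚ.≟ a | x Finₚ.≟ b | y Finₚ.≟ a | y Finₚ.≟ b
          ... | yes e | _ | _ | yes e' = inj₁ (e , e')
          ... | _ | yes e | yes e' | _ = inj₂ (e , e')
          ... | yes refl | _ | no y≢a | no y≢b = ⊥-elim (none (y , y≢a , y≢b , inj₁ xy))
          ... | no _ | yes refl | no y≢a | no y≢b = ⊥-elim (none (y , y≢a , y≢b , inj₂ xy))
          ... | no x≢a | no x≢b | yes refl | _ = ⊥-elim (none (x , x≢a , x≢b , inj₁ (nonEdge-sym xy)))
          ... | no x≢a | no x≢b | no _ | yes refl = ⊥-elim (none (x , x≢a , x≢b , inj₂ (nonEdge-sym xy)))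
          ... | no x≢a | no x≢b | no y≢a | no y≢b = ⊥-elim (¬disj (x , y , a , b , xy , ab , x≢a , x≢b , y≢a , y≢b))
          ... | yes refl | no _ | yes refl | _ = ⊥-elim (proj₁ xy refl)
          ... | no _ | yes refl | no _ | yes refl = ⊥-elim (proj₁ xy refl)
          back : ∀ {x y} → x ≢ y × ¬ (∃[ i ] PairEq x y (p (inject₁ i)) (p (suc i))) → Adj x y
          back (ne , ¬m) = adjacent ne λ n → ¬m (zero , missing n)

        none-missing : ¬ (∃[ a ] ∃[ b ] NonEdge a b) → SiCompleteMinusShortPath G
        none-missing none = 0 , z≤n , (λ _ → proj₁ (fresh [] (ℕₚ.≤-trans (s≤s z≤n) 6<n))) , (λ { {zero} {zero} _ → refl }) ,
          λ x y → mk⇔ (λ xy → proj₁ xy , λ { (() , _) }) λ (ne , _) → adjacent ne λ n → none (x , y , n)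
          where open import Data.List using ([])

      complete-minus-short-path : SiCompleteMinusShortPath G
      complete-minus-short-path with Finₚ.any? (λ a → Finₚ.any? λ b → nonEdge? a b)
      ... | no none = none-missing none
      ... | yes (a , b , ab) with Finₚ.any? (λ c → ¬? (c Finₚ.≟ a) ×-dec (¬? (c Finₚ.≟ b) ×-dec (nonEdge? a c ⊎-dec nonEdge? b c)))
      ...   | no none = one-missing ab none
      ...   | yes (c , c≢a , c≢b , inj₁ ac) = two-missing (nonEdge-sym ab) ac (c≢b ∘ sym)
      ...   | yes (c , c≢a , c≢b , inj₂ bc) = two-missing ab bc (c≢a ∘ sym)

    Bad : Set
    Bad = Disjoint₂ ⊎ Triangle₂ ⊎ Claw₂

    bad? : Dec Bad
    bad? = disjoint? ⊎-dec (triangle? ⊎-dec claw?)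
      where
      _≢?_ : ∀ (p q : V) → Dec (p ≢ q)
      p ≢? q = ¬? (p Finₚ.≟ q)
      disjoint? : Dec Disjoint₂
      disjoint? = Finₚ.any? λ p → Finₚ.any? λ q → Finₚ.any? λ r → Finₚ.any? λ s →
        nonEdge? p q ×-dec (nonEdge? r s ×-dec ((p ≢? r) ×-dec ((p ≢? s) ×-dec ((q ≢? r) ×-dec (q ≢? s)))))
      triangle? : Dec Triangle₂
      triangle? = Finₚ.any? λ p → Finₚ.any? λ q → Finₚ.any? λ r → nonEdge? p q ×-dec (nonEdge? p r ×-dec nonEdge? q r)
      claw? : Dec Claw₂
      claw? = Finₚ.any? λ b → Finₚ.any? λ p → Finₚ.any? λ q → Finₚ.any? λ r →
        nonEdge? b p ×-dec (nonEdge? b q ×-dec (nonEdge? b r ×-dec ((p ≢? q) ×-dec ((p ≢? r) ×-dec (q ≢? r)))))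

    -- Whether a 2-vertex cut exists is known only classically; stability of the conclusion makes
    -- the case split harmless.
    bad⇒cycle : Bad → SiIsCycle G
    bad⇒cycle bad = siIsCycle-stable (em {Disconnecting} >>= λ where
      (yes (a , b , p , q , a≢b , offp , offq , ¬conn)) → disconnecting⇒cut a≢b offp offq ¬conn >>= λ (W , c) → cut⇒cycle c
      (no none) _ → impossible (no-disconnecting none) bad)
      where
      impossible : (∀ {a b} → Conn₂ a b) → Bad → ⊥
      impossible conn₂ = [ no-disjoint , [ no-triangle , no-claw ]′ ]′
        where open Impossible conn₂

    -- The configurations in `Bad` are finite data and can be searched for, so the disjunction is
    -- decided on them.
    cycle-or-complete : (SiIsCycle G × LiftedGraphic Circ) ⊎ SiCompleteMinusShortPath G
    cycle-or-complete with bad?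
    ... | yes bad = inj₁ (bad⇒cycle bad , lifted (bad⇒cycle bad))
    ... | no ¬bad = inj₂ (complete-minus-short-path (¬bad ∘ inj₁) (¬bad ∘ inj₂ ∘ inj₁) (¬bad ∘ inj₂ ∘ inj₂))

theorem1p3 : ∀ {n m} (G : Graph n m) (B L F : Subset m → Set) →
    IsQuasiBiased G B L F →
    6 < n →
    (∀ v → ∃[ w ] (w ≢ v × Path G v w)) →
    ThreeConnected (MCircuit G B L F) →
    Unbreakable (MCircuit G B L F) →
    (SiIsCycle G × LiftedGraphic (MCircuit G B L F)) ⊎ SiCompleteMinusShortPath G
theorem1p3 G B L F qb 6<n component three unbreakable = Graphs.Matroid.cycle-or-complete G B L F
  record { quasiBiased = qb ; 6<n = 6<n ; component = component ; three = three ; unbreakable = unbreakable }
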